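{- Let $\mathcal{A}^{\mathrm{bd}}$ be the type $D$ cluster algebra with boundary frozen variables of a once-punctured polygon, let $\Sigma=\Sigma_T$ be a seed corresponding to a tagged triangulation $T$, let $\gamma$ be a tagged arc, and let $N$ be the Newton polytope of $x_\gamma$ written as a Laurent polynomial in $\Sigma$. Then: (1) if $\gamma$ is plain and $T\neq T^p$, then $N$ is empty if and only if $\gamma$ intersects no arc of $T$ more than once; (2) if $\gamma$ is plain and $T=T^p$, then $N$ is empty if and only if $\gamma$ intersects no arc of $T^\circ$ more than once; (3) if $\gamma$ is notched, then $N$ is empty.
   Context: A once-punctured polygon has marked points its vertices and one interior puncture. Ordinary arcs are non-self-intersecting curves up to isotopy between marked points (not cutting out an unpunctured monogon or bigon); a radius has one endpoint at the puncture. Tagged arcs are ordinary arcs with distinct endpoints tagged plain, and radii tagged notched (written $\rho^{\bowtie}$). Two tagged arcs are compatible if their underlying ordinary arcs do not cross, and, if their underlying arcs are distinct radii, they have the same tagging; tagged triangulations are maximal sets of pairwise compatible tagged arcs. The type $D$ cluster algebra with boundary frozen variables (Fomin–Shapiro–Thurston) has cluster variables $x_\gamma$ indexed by tagged arcs, seeds $\Sigma_T$ indexed by tagged triangulations $T$, and one frozen variable per boundary segment. $T^p$ denotes the tagged triangulation obtained from $T$ by switching the tagging of every radius; $T=T^p$ exactly when $T$ contains both $\rho$ and $\rho^{\bowtie}$ for some radius $\rho$, and in that case $T^\circ$ denotes the ideal triangulation obtained by replacing $\rho^{\bowtie}$ with the loop based at the endpoint of $\rho$ enclosing $\rho$. "Intersects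 an arc more than once" refers to the minimal number of crossings of the underlying ordinary arcs up to isotopy. The Newton polytope of a Laurent polynomial is the convex hull of its exponent vectors with nonzero coefficient; it is empty if every lattice point in it is a vertex. -}

module Defs where

open import Data.Bool using (Bool; true; false; _∧_; _∨_; if_then_else_; not)
open import Data.Nat as ℕ using (ℕ; zero; suc; _≤_; _<ᵇ_; _≤ᵇ_; _≡ᵇ_)
open import Data.Integer as ℤ using (ℤ; +_; -[1+_])
open import Data.Rational as ℚ using (ℚ; 0ℚ; 1ℚ)
open import Data.Fin as Fin using (Fin; splitAt; _↑ˡ_; _↑ʳ_)
open import Data.List as List using (List; []; _∷_; map; concatMap; foldr; foldl; upTo; allFin; length; filter; lookup; tabulate; _++_)
open import Data.Bool.ListAction using (any; all)
open import Data.List.Membership.Propositional using (_∈_)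
open import Data.List.Relation.Unary.All using (All)
open import Data.List.Relation.Unary.Unique.Propositional using (Unique)
open import Data.Vec as Vec using (Vec)
import Data.Vec.Properties as VecP
open import Data.Product using (Σ; ∃; _×_; _,_; proj₁; proj₂)
open import Data.Sum using (_⊎_; inj₁; inj₂; [_,_]′)
open import Relation.Nullary using (¬_; Dec; yes; no; does)
open import Relation.Binary.PropositionalEquality using (_≡_; _≢_; refl)
open import Function.Bundles using (_⇔_)

-- Once-punctured n-gon.  Vertices are 0,…,n-1 (counterclockwise).
-- Universal-cover model: the puncture is a cusp at ∞ of the upper half
-- plane, the lifts of vertex i are the integers i + t·n, and the deck
-- transformation is x ↦ x + n.  A non-radius ordinary arc is the class
-- of a geodesic between integers u < v; it is written  iv (u mod n) (v-u).
--   iv i 1       : boundary segment from i to i+1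
--   iv i k, 2≤k<n: ordinary arc from i to i+k (mod n), cutting off the
--                  unpunctured region bounded by the boundary path
--                  i, i+1, …, i+k
--   iv i n       : loop based at i enclosing the puncture
--   rad i        : radius from vertex i to the puncture

data OArc : Set where
  iv  : ℕ → ℕ → OArc
  rad : ℕ → OArc

data Tag : Set where
  plain notched : Tag

-- tagged arcs: plain non-radius arcs with distinct endpoints, radii with a tag
data TArc : Set where
  tiv  : ℕ → ℕ → TArc
  trad : ℕ → Tag → TArc

ValidT : ℕ → TArc → Set
ValidT n (tiv i k) = (suc i ≤ n) × (2 ≤ k) × (suc k ≤ n)
ValidT n (trad i t) = suc i ≤ n

tagEq : Tag → Tag → Bool
tagEq plain plain = true
tagEq notched notched = true
tagEq _ _ = false

oEq : OArc → OArc → Bool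
oEq (iv i k) (iv j l) = (i ≡ᵇ j) ∧ (k ≡ᵇ l)
oEq (rad i) (rad j) = i ≡ᵇ j
oEq _ _ = false

tEq : TArc → TArc → Bool
tEq (tiv i k) (tiv j l) = (i ≡ᵇ j) ∧ (k ≡ᵇ l)
tEq (trad i s) (trad j t) = (i ≡ᵇ j) ∧ tagEq s t
tEq _ _ = false

memT : TArc → List TArc → Bool
memT γ = any (tEq γ)

memO : OArc → List OArc → Bool
memO x = any (oEq x)

und : TArc → OArc
und (tiv i k) = iv i k
und (trad i _) = rad i

IsPlain : TArc → Set
IsPlain (tiv _ _) = Data.Unit.⊤ where import Data.Unit
IsPlain (trad _ plain) = Data.Unit.⊤ where import Data.Unit
IsPlain (trad _ notched) = Data.Empty.⊥ where import Data.Empty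

IsNotched : TArc → Set
IsNotched (trad _ notched) = Data.Unit.⊤ where import Data.Unit
IsNotched _ = Data.Empty.⊥ where import Data.Empty

-- Minimal number of crossings of ordinary arcs (interiors), computed in
-- the universal cover: the number of lifts of β whose interior crosses a
-- fixed lift of α.  Geodesic lifts realise minimal position.  For vertices
-- i,j < n and lengths ≤ n only the translates t ∈ {-1,0,1} can cross,
-- so the count over these t is the full count.

private
  bit : Bool → ℕ
  bit true = 1
  bit false = 0

  infix 4 _<ᶻ_
  _<ᶻ_ : ℤ → ℤ → Bool
  x <ᶻ y = does (x ℤ.<? y)

  shifts : List ℤ
  shifts = -[1+ 0 ] ∷ + 0 ∷ + 1 ∷ []

  sumℕ : List ℕ → ℕ
  sumℕ = foldr ℕ._+_ 0

interleave : ℤ → ℤ → ℤ → ℤ → Bool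
interleave a b c d = ((a <ᶻ c) ∧ (c <ᶻ b) ∧ (b <ᶻ d)) ∨ ((c <ᶻ a) ∧ (a <ᶻ d) ∧ (d <ᶻ b))

crossO : ℕ → OArc → OArc → ℕ
crossO n (iv i k) (iv j l) =
  sumℕ (map (λ t → bit (interleave (+ i) (+ (i ℕ.+ k))
                                   (+ j ℤ.+ t ℤ.* + n) (+ (j ℕ.+ l) ℤ.+ t ℤ.* + n))) shifts)
crossO n (iv i k) (rad j) =
  sumℕ (map (λ t → bit ((+ i <ᶻ (+ j ℤ.+ t ℤ.* + n)) ∧ ((+ j ℤ.+ t ℤ.* + n) <ᶻ + (i ℕ.+ k)))) shifts)
crossO n (rad j) (iv i k) = crossO n (iv i k) (rad j)
crossO n (rad _) (rad _) = 0

DistinctRadii : TArc → TArc → Set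
DistinctRadii (trad i _) (trad j _) = i ≢ j
DistinctRadii _ _ = Data.Empty.⊥ where import Data.Empty

tagOf : TArc → Tag
tagOf (tiv _ _) = plain
tagOf (trad _ t) = t

Compatible : ℕ → TArc → TArc → Set
Compatible n α β = (crossO n (und α) (und β) ≡ 0)
                 × (DistinctRadii α β → tagOf α ≡ tagOf β)

record IsTaggedTriangulation (n : ℕ) (T : List TArc) : Set where
  field
    valid      : All (ValidT n) T
    distinct   : Unique T
    compatible : ∀ {α β} → α ∈ T → β ∈ T → Compatible n α β
    maximal    : ∀ γ → ValidT n γ → (∀ {α} → α ∈ T → Compatible n γ α) → γ ∈ T

switch : TArc → TArc
switch (tiv i k) = tiv i k
switch (trad i plain) = trad i notched
switch (trad i notched) = trad i plain

_ᵖ : List TArc → List TArc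
T ᵖ = map switch T

SelfDual : List TArc → Set
SelfDual T = ∀ γ → (γ ∈ T ⇔ γ ∈ (T ᵖ))

-- T° (for T = T^p): replace ρ^⋈ by the loop at the endpoint of ρ enclosing ρ
circArc : ℕ → TArc → OArc
circArc n (tiv i k) = iv i k
circArc n (trad i plain) = rad i
circArc n (trad i notched) = iv i n

Tcirc : ℕ → List TArc → List OArc
Tcirc n T = map (circArc n) T

-- Exchange matrix B(T) (Fomin–Shapiro–Thurston), with boundary rows.
-- B(T) := B(T°) if T = T^p; otherwise B of the ideal triangulation obtained
-- by forgetting the tags (all radii of T have the same tag).

hasBoth : List TArc → Bool
hasBoth T = any (λ { (trad i notched) → memT (trad i plain) T ; _ → false }) T

idealArc : ℕ → List TArc → TArc → OArc
idealArc n T γ = if hasBoth T then circArc n γ else und γ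

-- π_T : the radius of a self-folded triangle is sent to its loop
πT : ℕ → List OArc → OArc → OArc
πT n I (rad i) = if memO (iv i n) I then iv i n else rad i
πT n I x = x

private
  red : ℕ → ℕ → ℕ
  red n u = if u <ᵇ n then u else u ℕ.∸ n

  side : ℕ → ℕ → ℕ → OArc
  side n u v = iv (red n u) (v ℕ.∸ u)

  present : ℕ → List OArc → OArc → Bool
  present n I (iv i k) = (k ≡ᵇ 1) ∨ memO (iv i k) I
  present n I (rad i) = memO (rad i) I

  allPresent : ℕ → List OArc → List OArc → Bool
  allPresent n I xs = all (present n I) xs

-- non-self-folded triangles of the ideal triangulation I (plus boundary),
-- each listed once (lift with smallest finite vertex in [0,n)), sides in
-- the cyclic order induced by the orientation of the boundary ℝ ∪ {∞}
triangles : ℕ → List OArc → List (OArc × OArc × OArc)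
triangles n I = finite ++ infinite
  where
  finite = concatMap (λ a → concatMap (λ b → concatMap (λ c →
      let s = (side n a b , side n b c , side n a c) in
      if (a <ᵇ b) ∧ (b <ᵇ c) ∧ (c ≤ᵇ a ℕ.+ n)
         ∧ allPresent n I (side n a b ∷ side n b c ∷ side n a c ∷ [])
      then s ∷ [] else []) (upTo (n ℕ.+ n))) (upTo (n ℕ.+ n))) (upTo n)
  infinite = concatMap (λ a → concatMap (λ b →
      let s = (side n a b , rad (red n b) , rad a) in
      if (a <ᵇ b) ∧ (b <ᵇ a ℕ.+ n)
         ∧ allPresent n I (side n a b ∷ rad (red n b) ∷ rad a ∷ [])
      then s ∷ [] else []) (upTo (n ℕ.+ n))) (upTo n)

private
  ind : Bool → ℤ
  ind true = + 1
  ind false = + 0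

  sumℤ : List ℤ → ℤ
  sumℤ = foldr ℤ._+_ (+ 0)

adj : OArc × OArc × OArc → OArc → OArc → ℤ
adj (s₁ , s₂ , s₃) x y =
  sumℤ (map (λ p → ind (oEq (proj₁ p) x ∧ oEq (proj₂ p) y) ℤ.- ind (oEq (proj₁ p) y ∧ oEq (proj₂ p) x))
            ((s₁ , s₂) ∷ (s₂ , s₃) ∷ (s₃ , s₁) ∷ []))

bEntry : ℕ → List OArc → OArc → OArc → ℤ
bEntry n I x y = sumℤ (map (λ Δ → adj Δ (πT n I x) (πT n I y)) (triangles n I))

exchangeMatrix : (n : ℕ) (T : List TArc) → Fin (length T ℕ.+ n) → Fin (length T) → ℤ
exchangeMatrix n T i j =
  bEntry n I ([ (λ p → I′ p) , (λ s → iv (Fin.toℕ s) 1) ]′ (splitAt (length T) i)) (I′ j)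
  where
  I′ : Fin (length T) → OArc
  I′ p = idealArc n T (lookup T p)
  I : List OArc
  I = map (idealArc n T) T

LPoly : ℕ → Set
LPoly m = List (ℤ × Vec ℤ m)

coeff : ∀ {m} → LPoly m → Vec ℤ m → ℤ
coeff L e = foldr ℤ._+_ (+ 0) (map proj₁ (filter (λ t → VecP.≡-dec ℤ._≟_ (proj₂ t) e) L))

_≃_ : ∀ {m} → LPoly m → LPoly m → Set
P ≃ Q = ∀ e → coeff P e ≡ coeff Q e

_+L_ : ∀ {m} → LPoly m → LPoly m → LPoly m
_+L_ = _++_

_*L_ : ∀ {m} → LPoly m → LPoly m → LPoly m
P *L Q = concatMap (λ s → map (λ t → (proj₁ s ℤ.* proj₁ t , Vec.zipWith ℤ._+_ (proj₂ s) (proj₂ t))) Q) P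

oneL : ∀ {m} → LPoly m
oneL = (+ 1 , Vec.replicate _ (+ 0)) ∷ []

varL : ∀ {m} → Fin m → LPoly m
varL i = (+ 1 , Vec.tabulate (λ j → if does (i Fin.≟ j) then + 1 else + 0)) ∷ []

Frac : ℕ → Set
Frac m = LPoly m × LPoly m

fmul : ∀ {m} → Frac m → Frac m → Frac m
fmul (a , b) (c , d) = (a *L c , b *L d)

fadd : ∀ {m} → Frac m → Frac m → Frac m
fadd (a , b) (c , d) = ((a *L d) +L (c *L b) , b *L d)

finv : ∀ {m} → Frac m → Frac m
finv (a , b) = (b , a)

fone : ∀ {m} → Frac m
fone = (oneL , oneL)

fpow : ∀ {m} → Frac m → ℕ → Frac m
fpow f zero = fone
fpow f (suc k) = fmul f (fpow f k)

pos : ℤ → ℕ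
pos (+ k) = k
pos -[1+ _ ] = 0

record Seed (r f : ℕ) : Set where
  field
    B : Fin (r ℕ.+ f) → Fin r → ℤ
    X : Fin r → Frac (r ℕ.+ f)

mutate : ∀ {r f} → Seed r f → Fin r → Seed r f
mutate {r} {f} s k = record { B = B′ ; X = X′ }
  where
  open Seed s
  kr : Fin (r ℕ.+ f)
  kr = k ↑ˡ f
  Y : Fin (r ℕ.+ f) → Frac (r ℕ.+ f)
  Y i = [ X , (λ j → (varL (r ↑ʳ j) , oneL)) ]′ (splitAt r i)
  prodF : List (Frac (r ℕ.+ f)) → Frac (r ℕ.+ f)
  prodF = foldr fmul fone
  P₊ P₋ : Frac (r ℕ.+ f)
  P₊ = prodF (map (λ i → fpow (Y i) (pos (B i k))) (allFin _))
  P₋ = prodF (map (λ i → fpow (Y i) (pos (ℤ.- B i k))) (allFin _))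
  X′ : Fin r → Frac (r ℕ.+ f)
  X′ j = if does (j Fin.≟ k) then fmul (fadd P₊ P₋) (finv (X k)) else X j
  B′ : Fin (r ℕ.+ f) → Fin r → ℤ
  B′ i j = if does (i Fin.≟ kr) ∨ does (j Fin.≟ k) then ℤ.- B i j
           else B i j ℤ.+ (+ pos (B i k) ℤ.* + pos (B kr j))
                      ℤ.- (+ pos (ℤ.- B i k) ℤ.* + pos (ℤ.- B kr j))

initialSeed : (n : ℕ) (T : List TArc) → Seed (length T) n
initialSeed n T = record { B = exchangeMatrix n T ; X = λ k → (varL (k ↑ˡ n) , oneL) }

mutateAlong : ∀ {r f} → Seed r f → List (Fin r) → Seed r f
mutateAlong = foldl mutate

record FlipStep (n : ℕ) {r : ℕ} (T : Fin r → TArc) (p : Fin r) (T′ : Fin r → TArc) : Set where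
  field
    changed : T′ p ≢ T p
    others  : ∀ q → q ≢ p → T′ q ≡ T q
    triang  : IsTaggedTriangulation n (tabulate T′)

data FlipPath (n : ℕ) {r : ℕ} : (Fin r → TArc) → List (Fin r) → (Fin r → TArc) → Set where
  done : ∀ {T} → FlipPath n T [] T
  step : ∀ {T T₁ T₂ p ps} → FlipStep n T p T₁ → FlipPath n T₁ ps T₂ → FlipPath n T (p ∷ ps) T₂

-- Newton polytopes (points with rational coordinates; N is a rational
-- polytope, so this loses nothing)

toQ : ∀ {m} → Vec ℤ m → Vec ℚ m
toQ = Vec.map (λ z → z ℚ./ 1)

Supp : ∀ {m} → LPoly m → Vec ℤ m → Set
Supp L e = coeff L e ≢ + 0

combo : ∀ {m} → List (ℚ × Vec ℤ m) → Vec ℚ m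
combo = foldr (λ w acc → Vec.zipWith ℚ._+_ (Vec.map (proj₁ w ℚ.*_) (toQ (proj₂ w))) acc) (Vec.replicate _ 0ℚ)

InHull : ∀ {m} → (Vec ℤ m → Set) → Vec ℚ m → Set
InHull {m} S x = ∃ λ (ws : List (ℚ × Vec ℤ m)) →
  All (λ w → (0ℚ ℚ.≤ proj₁ w) × S (proj₂ w)) ws
  × foldr ℚ._+_ 0ℚ (map proj₁ ws) ≡ 1ℚ
  × combo ws ≡ x

IsVertex : ∀ {m} → (Vec ℤ m → Set) → Vec ℚ m → Set
IsVertex {m} S x = InHull S x ×
  ¬ (Σ (Vec ℚ m) λ y → Σ (Vec ℚ m) λ z → Σ ℚ λ t →
       InHull S y × InHull S z × y ≢ z × (0ℚ ℚ.< t) × (t ℚ.< 1ℚ)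
       × x ≡ Vec.zipWith ℚ._+_ (Vec.map (t ℚ.*_) y) (Vec.map ((1ℚ ℚ.- t) ℚ.*_) z))

NewtonEmpty : ∀ {m} → LPoly m → Set
NewtonEmpty L = ∀ p → InHull (Supp L) (toQ p) → IsVertex (Supp L) (toQ p)

IsLaurentExpansion : ∀ {m} → LPoly m → Frac m → Set
IsLaurentExpansion L (N , D) = (L *L D) ≃ N

{-# OPTIONS --safe #-}

-- Lift the punctured polygon to the universal cover and realise an initial ideal triangulation by vectors V u in a
-- rank-two module over Laurent polynomials, with V (u + n) = V u + c · x u · V ∞.  The arc [u , w] then has value
-- det (V u) (V w), a radius of the tag of the initial radii has value x u, and one of the other tag c · x u.  Flips are
-- rotations of the tree of triangles, the Plücker relation is the exchange relation, so these values are the cluster variables.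
-- If some radius base z satisfies w − n ≤ z ≤ u, then the value of [u , w] is built by operations which split the support
-- into two consecutive levels of a linear functional, and the Newton polytope is empty; every arc is then crossed at most
-- once.  Otherwise the side [s , t] of the triangle at the puncture above u is crossed twice, and the expansion across
-- that triangle has two monomials whose midpoint is a lattice point.

module Submission where

-- The invariant along a flip path is that the numerator is the λ-length times the denominator and
-- that both have positive coefficients; positive factors can be cancelled, which finally identifies
-- the Laurent expansion. The two tags correspond to two conjugate horocycles at the puncture: their
-- scales multiply to `c`, the horocyclic length of a full turn, and so the loop around a radius is
-- the product of its two tagged versions. The linear functionals count arcs of the initial
-- triangulation by the vertex at which they start. When the apex `u` of a triangle over `[e , f]`
-- is expanded, only the factor `[u , f]` starts at `u`, so the two summands lie in adjacent
-- degrees, provided that nothing else in them starts at `u`. To keep this proviso, the recursion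
-- always expands the end point that hangs deeper in the tree. The condition on `z` keeps it away
-- from the loop `[u , u + n]` at a vertex without radius, whose value is `c` times a square.

open import Defs

-- Polynomial identities in commutative rings

module RingIdentities where
 open import Level using (0ℓ)
 open import Algebra.Bundles using (CommutativeRing)
 open import Data.Integer as ℤ using (ℤ; 0ℤ; 1ℤ)
 open import Data.Maybe using (Maybe; just; nothing)
 open import Relation.Nullary using (yes; no)
 open import Relation.Binary.PropositionalEquality using () renaming (refl to ≡-refl)

 -- The ring solver works with integer coefficients, which have to be mapped into `R`. The same
 -- identities then serve the rationals in the convexity arguments and Laurent polynomials in the
 -- computations with λ-lengths.
 record IntHom (R : CommutativeRing 0ℓ 0ℓ) : Set where
   open CommutativeRing R
   field
     φ : ℤ → Carrier
     φ-+ : ∀ a b → φ (a ℤ.+ b) ≈ φ a + φ b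
     φ-* : ∀ a b → φ (a ℤ.* b) ≈ φ a * φ b
     φ-neg : ∀ a → φ (ℤ.- a) ≈ - φ a
     φ-0 : φ 0ℤ ≈ 0#
     φ-1 : φ 1ℤ ≈ 1#

 module IntRingIdentities (R : CommutativeRing 0ℓ 0ℓ) (hom : IntHom R) where
   open CommutativeRing R
   open IntHom hom
   open import Algebra.Solver.Ring.AlmostCommutativeRing using (fromCommutativeRing; _-Raw-AlmostCommutative⟶_)

   private
     morphism : ℤ.+-*-rawRing -Raw-AlmostCommutative⟶ fromCommutativeRing R
     morphism = record { ⟦_⟧ = φ ; +-homo = φ-+ ; *-homo = φ-* ; -‿homo = φ-neg ; 0-homo = φ-0 ; 1-homo = φ-1 }

     _coeff≟_ : ∀ a b → Maybe (φ a ≈ φ b)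
     a coeff≟ b with a ℤ.≟ b
     ... | yes ≡-refl = just refl
     ... | no _ = nothing

   open import Algebra.Solver.Ring ℤ.+-*-rawRing (fromCommutativeRing R) morphism _coeff≟_ using (solve; _:=_; _:+_; _:*_; :-_; con)

   dotQ-+ : ∀ a x x′ u v → a * (x + x′) + (u + v) ≈ a * x + u + (a * x′ + v)
   dotQ-+ = solve 5 (λ a x x′ u v → a :* (x :+ x′) :+ (u :+ v) := a :* x :+ u :+ (a :* x′ :+ v)) refl
   dotQ-* : ∀ a c x u → a * (c * x) + c * u ≈ c * (a * x + u)
   dotQ-* = solve 4 (λ a c x u → a :* (c :* x) :+ c :* u := c :* (a :* x :+ u)) refl
   affine-step : ∀ c h k a s → c * (h + k) + (a + k * s) ≈ (c * h + a) + k * (c + s)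
   affine-step = solve 5 (λ c h k a s → c :* (h :+ k) :+ (a :+ k :* s) := (c :* h :+ a) :+ k :* (c :+ s)) refl
   complement-step : ∀ c g o s a → c * (o + - g) + (s + - a) ≈ (c * o + s) + - (c * g + a)
   complement-step = solve 5 (λ c g o s a → c :* (o :+ :- g) :+ (s :+ :- a) := (c :* o :+ s) :+ :- (c :* g :+ a)) refl
   convex-shift : ∀ t s y z k → t * (y + k) + s * (z + k) ≈ (t * y + s * z) + (t + s) * k
   convex-shift = solve 5 (λ t s y z k → t :* (y :+ k) :+ s :* (z :+ k) := (t :* y :+ s :* z) :+ (t :+ s) :* k) refl
   convex-complement : ∀ t s o y z → t * (o + - y) + s * (o + - z) ≈ (t + s) * o + - (t * y + s * z)
   convex-complement = solve 5 (λ t s o y z → t :* (o :+ :- y) :+ s :* (o :+ :- z) := (t :+ s) :* o :+ :- (t :* y :+ s :* z)) refl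
   add-complement : ∀ j k → j + (k + - j) ≈ k
   add-complement = solve 2 (λ j k → j :+ (k :+ :- j) := k) refl
   add-cancel : ∀ x s → x + s + - s ≈ x
   add-cancel = solve 2 (λ x s → x :+ s :+ :- s := x) refl
   shift-step : ∀ c k x y s → c * (x + s) + (y + k * s) ≈ (c * x + y) + (c + k) * s
   shift-step = solve 5 (λ c k x y s → c :* (x :+ s) :+ (y :+ k :* s) := (c :* x :+ y) :+ (c :+ k) :* s) refl

   -- Here and below `x , a` and `y , b` are coordinates of vectors and `x * b + - (a * y)` is their
   -- determinant. `D-lin₁` and `D-lin₂` are its linearity at the apex of a triangle, `D-per` its
   -- invariance under the unipotent deck transformation.
   D-lin₂ : ∀ x a k p q y b y′ b′ → x * (k * (p * b + q * b′)) + - (a * (k * (p * y + q * y′))) ≈ k * (p * (x * b + - (a * y)) + q * (x * b′ + - (a * y′)))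
   D-lin₂ = solve 9 (λ x a k p q y b y′ b′ → x :* (k :* (p :* b :+ q :* b′)) :+ :- (a :* (k :* (p :* y :+ q :* y′))) := k :* (p :* (x :* b :+ :- (a :* y)) :+ q :* (x :* b′ :+ :- (a :* y′)))) refl
   D-lin₁ : ∀ y b k p q x a x′ a′ → k * (p * x + q * x′) * b + - (k * (p * a + q * a′) * y) ≈ k * (p * (x * b + - (a * y)) + q * (x′ * b + - (a′ * y)))
   D-lin₁ = solve 9 (λ y b k p q x a x′ a′ → k :* (p :* x :+ q :* x′) :* b :+ :- (k :* (p :* a :+ q :* a′) :* y) := k :* (p :* (x :* b :+ :- (a :* y)) :+ q :* (x′ :* b :+ :- (a′ :* y)))) refl
   D-self : ∀ x a → x * a + - (a * x) ≈ 0#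
   D-self x a = trans (solve 2 (λ x a → x :* a :+ :- (a :* x) := con 0ℤ) refl x a) φ-0
   D-base : ∀ x y s s′ → x * (s′ * y) + - (s * x * y) ≈ x * y * (s′ + - s)
   D-base = solve 4 (λ x y s s′ → x :* (s′ :* y) :+ :- (s :* x :* y) := x :* y :* (s′ :+ :- s)) refl
   D-scale : ∀ c k p q x y → c * (k * (p * x + q * y)) ≈ k * (p * (c * x) + q * (c * y))
   D-scale = solve 6 (λ c k p q x y → c :* (k :* (p :* x :+ q :* y)) := k :* (p :* (c :* x) :+ q :* (c :* y))) refl
   D-per : ∀ c x a y b → x * (b + c * y) + - ((a + c * x) * y) ≈ x * b + - (a * y)
   D-per = solve 5 (λ c x a y b → x :* (b :+ c :* y) :+ :- ((a :+ c :* x) :* y) := x :* b :+ :- (a :* y)) refl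
   per-step : ∀ c k p q x a x′ a′ → k * (p * (a + c * x) + q * (a′ + c * x′)) ≈ k * (p * a + q * a′) + c * (k * (p * x + q * x′))
   per-step = solve 8 (λ c k p q x a x′ a′ → k :* (p :* (a :+ c :* x) :+ q :* (a′ :+ c :* x′)) := k :* (p :* a :+ q :* a′) :+ c :* (k :* (p :* x :+ q :* x′))) refl
   plücker : ∀ x₁ a₁ x₂ a₂ x₃ a₃ x₄ a₄ →
     (x₁ * a₃ + - (a₁ * x₃)) * (x₂ * a₄ + - (a₂ * x₄)) ≈
     (x₁ * a₂ + - (a₁ * x₂)) * (x₃ * a₄ + - (a₃ * x₄)) + (x₁ * a₄ + - (a₁ * x₄)) * (x₂ * a₃ + - (a₂ * x₃))
   plücker = solve 8 (λ x₁ a₁ x₂ a₂ x₃ a₃ x₄ a₄ →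
     (x₁ :* a₃ :+ :- (a₁ :* x₃)) :* (x₂ :* a₄ :+ :- (a₂ :* x₄)) :=
     (x₁ :* a₂ :+ :- (a₁ :* x₂)) :* (x₃ :* a₄ :+ :- (a₃ :* x₄)) :+ (x₁ :* a₄ :+ :- (a₁ :* x₄)) :* (x₂ :* a₃ :+ :- (a₂ :* x₃))) refl
   digon : ∀ c x a y b → (x * b + - (a * y)) + (y * (a + c * x) + - (b * x)) ≈ c * x * y
   digon = solve 5 (λ c x a y b → (x :* b :+ :- (a :* y)) :+ (y :* (a :+ c :* x) :+ :- (b :* x)) := c :* x :* y) refl
   neg-front : ∀ x y → - y ≈ - (x + y) + x
   neg-front = solve 2 (λ x y → :- y := :- (x :+ y) :+ x) refl
   cancelˡ : ∀ x y z → x + y ≈ x + z → y ≈ z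
   cancelˡ x y z h = trans (solve 2 (λ x y → y := (x :+ y) :+ :- x) refl x y) (trans (+-cong h refl) (solve 2 (λ x z → (x :+ z) :+ :- x := z) refl x z))
   add-cancel′ : ∀ x s → x + s + - x ≈ s
   add-cancel′ = solve 2 (λ x s → x :+ s :+ :- x := s) refl
   side-cancel : ∀ m₁ m₂ m₃ i₂ i₃ z → z ≈ 0# → m₂ * i₂ ≈ 1# → m₃ * i₃ ≈ 1# → m₃ * m₂ * (m₁ * (i₃ * i₂) + z) ≈ m₁
   side-cancel m₁ m₂ m₃ i₂ i₃ z hz h₂ h₃ = trans (*-cong refl (trans (+-cong refl hz) (+-identityʳ _)))
     (trans (solve 5 (λ m₁ m₂ m₃ i₂ i₃ → m₃ :* m₂ :* (m₁ :* (i₃ :* i₂)) := m₁ :* ((m₃ :* i₃) :* (m₂ :* i₂))) refl m₁ m₂ m₃ i₂ i₃)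
       (trans (*-cong refl (trans (*-cong h₃ h₂) (*-identityˡ 1#))) (*-identityʳ m₁)))
   apexʳ-cancel : ∀ m i p q → m * i ≈ 1# → i * (p * 0# + q * m) ≈ q
   apexʳ-cancel m i p q h = trans (*-cong refl (trans (+-cong (zeroʳ p) refl) (+-identityˡ _)))
     (trans (solve 3 (λ i q m → i :* (q :* m) := q :* (m :* i)) refl i q m) (trans (*-cong refl h) (*-identityʳ q)))
   apexˡ-cancel : ∀ m i p q → m * i ≈ 1# → i * (p * m + q * 0#) ≈ p
   apexˡ-cancel m i p q h = trans (*-cong refl (trans (+-cong refl (zeroʳ q)) (+-identityʳ _)))
     (trans (solve 3 (λ i q m → i :* (q :* m) := q :* (m :* i)) refl i p m) (trans (*-cong refl h) (*-identityʳ p)))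
   three-term : ∀ xs as xt at xu au → (xs * at + - (as * xt)) * xu ≈ (xu * at + - (au * xt)) * xs + (xs * au + - (as * xu)) * xt
   three-term = solve 6 (λ xs as xt at xu au → (xs :* at :+ :- (as :* xt)) :* xu := (xu :* at :+ :- (au :* xt)) :* xs :+ (xs :* au :+ :- (as :* xu)) :* xt) refl
   straighten : ∀ xs as xt at xu au xv av → (xv * at + - (av * xt)) * (xs * au + - (as * xu)) ≈
     (xu * at + - (au * xt)) * (xs * av + - (as * xv)) + (xv * au + - (av * xu)) * (xs * at + - (as * xt))
   straighten = solve 8 (λ xs as xt at xu au xv av → (xv :* at :+ :- (av :* xt)) :* (xs :* au :+ :- (as :* xu)) :=
     (xu :* at :+ :- (au :* xt)) :* (xs :* av :+ :- (as :* xv)) :+ (xv :* au :+ :- (av :* xu)) :* (xs :* at :+ :- (as :* xt))) refl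
   -- The left side is `c * (xu * xv)` minus the determinant `p` of the vectors at `v` and `u`.
   -- Expanding `xu` and `xv` in `xs` and `xt` yields the mixed terms `A * B′` and `B * A′`; by the
   -- last hypothesis `p` is `A′ * B + - (A * B′)` divided by `β`, so subtracting it trades `B * A′`
   -- for a second `A * B′` and leaves no negative term.
   wrap-identity : ∀ c c′ β bi xs si xt ti A A′ B B′ xu au xv av → β * bi ≈ 1# → xs * si ≈ 1# → xt * ti ≈ 1# →
     c ≈ β * (si * ti) + c′ → β * xu ≈ A * xs + B * xt → β * xv ≈ A′ * xs + B′ * xt → A′ * B ≈ A * B′ + (xv * au + - (av * xu)) * β →
     xu * (av + c * xv) + - (au * xv) ≈
     c′ * ((bi * (A * xs + B * xt)) * (bi * (A′ * xs + B′ * xt))) + bi * (A * A′ * (xs * ti) + B * B′ * (xt * si) + A * B′ + A * B′)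
   wrap-identity c c′ β bi xs si xt ti A A′ B B′ xu au xv av hβ hs ht hc hu hv hp = begin
     xu * (av + c * xv) + - (au * xv)
       ≈⟨ solve 5 (λ c xu au xv av → xu :* (av :+ c :* xv) :+ :- (au :* xv) := c :* (xu :* xv) :+ :- (xv :* au :+ :- (av :* xu))) refl c xu au xv av ⟩
     c * (xu * xv) + - p  ≈⟨ +-cong (*-cong hc refl) refl ⟩
     (β * (si * ti) + c′) * (xu * xv) + - p
       ≈⟨ solve 5 (λ k c′ xu xv p → (k :+ c′) :* (xu :* xv) :+ :- p := c′ :* (xu :* xv) :+ (k :* (xu :* xv) :+ :- p)) refl (β * (si * ti)) c′ xu xv p ⟩
     c′ * (xu * xv) + (β * (si * ti) * (xu * xv) + - p)
       ≈⟨ +-cong (*-cong refl (*-cong (inv xu hu) (inv xv hv))) (trans (+-cong first (-‿cong second)) collect) ⟩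
     c′ * ((bi * (A * xs + B * xt)) * (bi * (A′ * xs + B′ * xt))) + bi * (A * A′ * (xs * ti) + B * B′ * (xt * si) + A * B′ + A * B′) ∎
     where
     open import Relation.Binary.Reasoning.Setoid setoid
     p = xv * au + - (av * xu)
     inv : ∀ x {y} → β * x ≈ y → x ≈ bi * y
     inv x {y} h = trans (sym (*-identityˡ x)) (trans (*-cong (trans (sym hβ) (*-comm β bi)) refl) (trans (*-assoc bi β x) (*-cong refl h)))
     first : β * (si * ti) * (xu * xv) ≈ bi * (A * A′ * (xs * ti) + B * B′ * (xt * si) + A * B′ + B * A′)
     first = begin
       β * (si * ti) * (xu * xv)  ≈⟨ *-cong (*-cong β≈ refl) refl ⟩
       bi * (β * β) * (si * ti) * (xu * xv)
         ≈⟨ solve 6 (λ bi β si ti xu xv → bi :* (β :* β) :* (si :* ti) :* (xu :* xv) := bi :* ((si :* ti) :* ((β :* xu) :* (β :* xv)))) refl bi β si ti xu xv ⟩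
       bi * ((si * ti) * ((β * xu) * (β * xv)))  ≈⟨ *-cong refl (*-cong refl (*-cong hu hv)) ⟩
       bi * ((si * ti) * ((A * xs + B * xt) * (A′ * xs + B′ * xt)))
         ≈⟨ *-cong refl (solve 8 (λ si ti xs xt A A′ B B′ → (si :* ti) :* ((A :* xs :+ B :* xt) :* (A′ :* xs :+ B′ :* xt)) :=
              A :* A′ :* (xs :* ti) :* (xs :* si) :+ B :* B′ :* (xt :* si) :* (xt :* ti) :+ A :* B′ :* ((xs :* si) :* (xt :* ti)) :+ B :* A′ :* ((xs :* si) :* (xt :* ti))) refl si ti xs xt A A′ B B′) ⟩
       bi * (A * A′ * (xs * ti) * (xs * si) + B * B′ * (xt * si) * (xt * ti) + A * B′ * ((xs * si) * (xt * ti)) + B * A′ * ((xs * si) * (xt * ti)))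
         ≈⟨ *-cong refl (+-cong (+-cong (+-cong (one hs) (one ht)) (one st)) (one st)) ⟩
       bi * (A * A′ * (xs * ti) + B * B′ * (xt * si) + A * B′ + B * A′) ∎
       where
       β≈ : β ≈ bi * (β * β)
       β≈ = trans (sym (*-identityˡ β)) (trans (*-cong (trans (sym hβ) (*-comm β bi)) refl) (*-assoc bi β β))
       one : ∀ {x y} → y ≈ 1# → x * y ≈ x
       one h = trans (*-cong refl h) (*-identityʳ _)
       st : (xs * si) * (xt * ti) ≈ 1#
       st = trans (*-cong hs ht) (*-identityˡ 1#)
     second : p ≈ bi * (A′ * B + - (A * B′))
     second = inv p (trans (trans (*-comm β p) (solve 2 (λ k q → q := k :+ q :+ :- k) refl (A * B′) (p * β))) (+-cong (sym hp) refl))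
     collect : bi * (A * A′ * (xs * ti) + B * B′ * (xt * si) + A * B′ + B * A′) + - (bi * (A′ * B + - (A * B′))) ≈
       bi * (A * A′ * (xs * ti) + B * B′ * (xt * si) + A * B′ + A * B′)
     collect = solve 7 (λ bi y z A A′ B B′ → bi :* (y :+ z :+ A :* B′ :+ B :* A′) :+ :- (bi :* (A′ :* B :+ :- (A :* B′))) := bi :* (y :+ z :+ A :* B′ :+ A :* B′)) refl
       bi (A * A′ * (xs * ti)) (B * B′ * (xt * si)) A A′ B B′

import Data.Nat as ℕ
import Data.Nat.Properties as ℕP
import Data.Integer as ℤ
import Data.Fin as Fin
import Data.Fin.Properties as FinP
open import Data.Product using (Σ; ∃; ∃₂; _×_; _,_; proj₁; proj₂)
open import Data.Sum using (_⊎_; inj₁; inj₂; [_,_]′)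
open import Data.Empty using (⊥; ⊥-elim)
open import Data.Unit using (⊤; tt)
open import Relation.Nullary using (¬_; Dec; yes; no; does)
open import Relation.Nullary.Decidable using (dec-true; dec-false)
open import Relation.Binary.PropositionalEquality using (_≡_; _≢_; refl; sym; trans; cong; cong₂; subst; subst₂; module ≡-Reasoning)
open import Algebra.Bundles using (CommutativeRing)

-- Linear inequalities over the integers

module IntegerInequalities where
 open import Data.Nat using (ℕ)
 open import Data.Integer using (ℤ; +_; -[1+_]; _+_; _*_; _-_; -_; _≤_; _<_; 0ℤ; 1ℤ)
 open import Data.Integer.Properties
 open import Data.List using ([]; _∷_)
 open import Data.Integer.Tactic.RingSolver using (solve; solve-∀)

 infixl 5 _⊕_
 _⊕_ : ∀ {a b c d} → a ≤ b → c ≤ d → a + c ≤ b + d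
 _⊕_ = +-mono-≤

 s≤ : ∀ {a b} → a < b → 1ℤ + a ≤ b
 s≤ = i<j⇒suc[i]≤j

 -- Linear arithmetic by certificate: hypotheses are added with `_⊕_`, strict ones after `s≤`, and
 -- the ring solver checks that the left side of the sum exceeds the right side by the positive
 -- constant `suc k`. With `by<` or `by≤` the negated goal joins the hypotheses.
 absurd≤ : ∀ {a b} k → a ≤ b → a ≡ b + + (ℕ.suc k) → ⊥
 absurd≤ {a} {b} k le refl = <-irrefl refl (<-≤-trans (i<i+1 b k) le)
   where
   i<i+1 : ∀ b k → b < b + + (ℕ.suc k)
   i<i+1 b k = subst (_< b + + (ℕ.suc k)) (+-identityʳ b) (+-monoʳ-< b (Data.Integer.+<+ (ℕ.s≤s ℕ.z≤n)))

 by< : ∀ {a b} → (b ≤ a → ⊥) → a < b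
 by< f = ≰⇒> f

 by≤ : ∀ {a b} → (b < a → ⊥) → a ≤ b
 by≤ f = ≮⇒≥ f

 ≡⇒≤ : ∀ {a b : ℤ} → a ≡ b → a ≤ b
 ≡⇒≤ = ≤-reflexive

 n<1+n : ∀ (a : ℤ) → a < 1ℤ + a
 n<1+n a = by< λ h → absurd≤ 0 h (solve (a ∷ []))

 -- Lifts of one arc differ by multiples of `n`; this is how two lifts less than a period apart are
 -- shown to coincide.
 mult-small : ∀ {n : ℕ} (s d : ℤ) → d ≡ s * + n → d < + n → - + n < d → s ≡ 0ℤ
 mult-small (+ 0) d eq a b = refl
 mult-small {n} (+ ℕ.suc m) d refl a b = ⊥-elim (<-irrefl refl (<-≤-trans a (subst (_≤ + ℕ.suc m * + n) (*-identityˡ (+ n)) (*-monoʳ-≤-nonNeg (+ n) {1ℤ} {+ ℕ.suc m} (Data.Integer.+≤+ (ℕ.s≤s ℕ.z≤n))))))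
 mult-small {n} -[1+ m ] d refl a b = ⊥-elim (<-irrefl refl (<-≤-trans b (subst (-[1+ m ] * + n ≤_) (-1*i≡-i (+ n)) (*-monoʳ-≤-nonNeg (+ n) { -[1+ m ]} { -[1+ 0 ]} (Data.Integer.-≤- ℕ.z≤n)))))

 cancelʳ : ∀ {a b} (c : ℤ) → a + c ≡ b + c → a ≡ b
 cancelʳ {a} {b} c e = trans (p a c) (trans (cong (_- c) e) (sym (p b c)))
   where
   p : ∀ a c → a ≡ a + c - c
   p = solve-∀

 -- To derive c ≡ d from a ≡ b, check the polynomial identity c − d = a − b in the form c + b = d + a.
 lin≡ : ∀ {a b c d : ℤ} → a ≡ b → c + b ≡ d + a → c ≡ d
 lin≡ {a} refl e = cancelʳ a e

-- The ring of Laurent polynomials and its gradings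

module LaurentPolynomials where
 open import Level using (0ℓ)
 open import Data.Bool using (true; false; if_then_else_)
 open import Data.Nat using (ℕ; zero; suc)
 open import Data.Integer using (ℤ; +_; _+_; _*_; -_; _<_; 0ℤ; 1ℤ)
 open import Data.Integer.Properties as ℤP
 open import Data.Integer.Tactic.RingSolver using (solve-∀)
 open import Data.Fin using (Fin; zero; suc)
 open import Data.List as List using (List; []; _∷_; map; _++_)
 open import Data.List.Membership.Propositional using (_∈_)
 open import Data.List.Membership.Propositional.Properties using (∈-++⁺ˡ; ∈-++⁺ʳ; ∈-++⁻; ∈-map⁺)
 open import Data.List.Relation.Unary.Any using (here; there)
 open import Data.List.Relation.Unary.All as All using (All; []; _∷_)
 import Data.List.Relation.Unary.All.Properties as AllP
 open import Data.Vec as Vec using (Vec; []; _∷_)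
 import Data.Vec.Properties as VecP

 +ʳ : ∀ (a : ℤ) {b c} → b ≡ c → a + b ≡ a + c
 +ʳ a refl = refl

 Mon : ℕ → Set
 Mon = Vec ℤ

 infixl 6 _⊞_
 _⊞_ : ∀ {m} → Mon m → Mon m → Mon m
 _⊞_ = Vec.zipWith _+_

 ⊟_ : ∀ {m} → Mon m → Mon m
 ⊟_ = Vec.map -_

 𝟘 : ∀ {m} → Mon m
 𝟘 = Vec.replicate _ 0ℤ

 ⊞-assoc : ∀ {m} (x y z : Mon m) → x ⊞ y ⊞ z ≡ x ⊞ (y ⊞ z)
 ⊞-assoc = VecP.zipWith-assoc ℤP.+-assoc

 ⊞-comm : ∀ {m} (x y : Mon m) → x ⊞ y ≡ y ⊞ x
 ⊞-comm = VecP.zipWith-comm ℤP.+-comm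

 ⊞-identityˡ : ∀ {m} (x : Mon m) → 𝟘 ⊞ x ≡ x
 ⊞-identityˡ = VecP.zipWith-identityˡ ℤP.+-identityˡ

 ⊞-identityʳ : ∀ {m} (x : Mon m) → x ⊞ 𝟘 ≡ x
 ⊞-identityʳ = VecP.zipWith-identityʳ ℤP.+-identityʳ

 ⊞-inverseʳ : ∀ {m} (x : Mon m) → x ⊞ (⊟ x) ≡ 𝟘
 ⊞-inverseʳ = VecP.zipWith-inverseʳ ℤP.+-inverseʳ

 ⊞-cancelʳ : ∀ {m} (x y z : Mon m) → x ⊞ z ≡ y ⊞ z → x ≡ y
 ⊞-cancelʳ x y z eq = begin
   x               ≡⟨ ⊞-identityʳ x ⟨
   x ⊞ 𝟘           ≡⟨ cong (x ⊞_) (⊞-inverseʳ z) ⟨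
   x ⊞ (z ⊞ (⊟ z)) ≡⟨ ⊞-assoc x z (⊟ z) ⟨
   x ⊞ z ⊞ (⊟ z)   ≡⟨ cong (_⊞ (⊟ z)) eq ⟩
   y ⊞ z ⊞ (⊟ z)   ≡⟨ ⊞-assoc y z (⊟ z) ⟩
   y ⊞ (z ⊞ (⊟ z)) ≡⟨ cong (y ⊞_) (⊞-inverseʳ z) ⟩
   y ⊞ 𝟘           ≡⟨ ⊞-identityʳ y ⟩
   y               ∎
   where open ≡-Reasoning

 ⊟-⊞ : ∀ {m} (x y : Mon m) → x ⊞ (⊟ y) ⊞ y ≡ x
 ⊟-⊞ x y = ⊞-cancelʳ (x ⊞ (⊟ y) ⊞ y) x (⊟ y) (trans (⊞-assoc _ y (⊟ y))
   (trans (cong (x ⊞ (⊟ y) ⊞_) (⊞-inverseʳ y)) (⊞-identityʳ _)))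

 _≟ᵐ_ : ∀ {m} (x y : Mon m) → Dec (x ≡ y)
 _≟ᵐ_ = VecP.≡-dec ℤ._≟_

 δ : ∀ {m} → Mon m → Mon m → ℤ
 δ e x = if does (x ≟ᵐ e) then 1ℤ else 0ℤ

 δ-refl : ∀ {m} (e : Mon m) → δ e e ≡ 1ℤ
 δ-refl e rewrite dec-true (e ≟ᵐ e) refl = refl

 δ-≢ : ∀ {m} {e x : Mon m} → x ≢ e → δ e x ≡ 0ℤ
 δ-≢ {e = e} {x} ne rewrite dec-false (x ≟ᵐ e) ne = refl

 δ-shift : ∀ {m} (e s t : Mon m) → δ e (s ⊞ t) ≡ δ (e ⊞ (⊟ t)) s
 δ-shift e s t with s ≟ᵐ (e ⊞ (⊟ t))
 ... | yes refl = trans (cong (δ e) (⊟-⊞ e t)) (δ-refl e)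
 ... | no ne = δ-≢ λ eq → ne (⊞-cancelʳ _ _ t (trans eq (sym (⊟-⊞ e t))))

 -- A term list is used as a measure on exponents, with `coeff` as the integral of `δ`. Products
 -- become double integrals, so commutativity is an exchange of summations and no normal form of
 -- lists is required.
 ev : ∀ {m} → LPoly m → (Mon m → ℤ) → ℤ
 ev [] φ = 0ℤ
 ev (t ∷ P) φ = proj₁ t * φ (proj₂ t) + ev P φ

 coeff-ev : ∀ {m} (P : LPoly m) e → coeff P e ≡ ev P (δ e)
 coeff-ev [] e = refl
 coeff-ev ((c , x) ∷ P) e with does (x ≟ᵐ e)
 ... | true = cong₂ _+_ (sym (ℤP.*-identityʳ c)) (coeff-ev P e)
 ... | false = trans (coeff-ev P e) (sym (trans (cong (_+ ev P (δ e)) (ℤP.*-zeroʳ c)) (ℤP.+-identityˡ _)))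

 module _ {m : ℕ} where

   ev-cong∈ : ∀ (P : LPoly m) {φ ψ} → All (λ t → φ (proj₂ t) ≡ ψ (proj₂ t)) P → ev P φ ≡ ev P ψ
   ev-cong∈ [] [] = refl
   ev-cong∈ (t ∷ P) (h ∷ hs) = cong₂ _+_ (cong (proj₁ t *_) h) (ev-cong∈ P hs)

   ev-cong : ∀ (P : LPoly m) {φ ψ} → (∀ x → φ x ≡ ψ x) → ev P φ ≡ ev P ψ
   ev-cong P h = ev-cong∈ P (All.universal (λ t → h (proj₂ t)) P)

   ev-++ : ∀ (P Q : LPoly m) φ → ev (P ++ Q) φ ≡ ev P φ + ev Q φ
   ev-++ [] Q φ = sym (ℤP.+-identityˡ _)
   ev-++ (t ∷ P) Q φ = trans (+ʳ (proj₁ t * φ (proj₂ t)) (ev-++ P Q φ)) (sym (ℤP.+-assoc (proj₁ t * φ (proj₂ t)) (ev P φ) (ev Q φ)))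

   ev-scale : ∀ (P : LPoly m) c φ → ev P (λ x → c * φ x) ≡ c * ev P φ
   ev-scale [] c φ = sym (ℤP.*-zeroʳ c)
   ev-scale (t ∷ P) c φ = trans (+ʳ (proj₁ t * (c * φ (proj₂ t))) (ev-scale P c φ)) (lem (proj₁ t) c (φ (proj₂ t)) (ev P φ))
     where
     lem : ∀ a c x y → a * (c * x) + c * y ≡ c * (a * x + y)
     lem = solve-∀

   ev-0 : ∀ (P : LPoly m) → ev P (λ _ → 0ℤ) ≡ 0ℤ
   ev-0 [] = refl
   ev-0 (t ∷ P) = trans (cong₂ _+_ (ℤP.*-zeroʳ (proj₁ t)) (ev-0 P)) refl

   ev-+ : ∀ (P : LPoly m) φ ψ → ev P (λ x → φ x + ψ x) ≡ ev P φ + ev P ψ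
   ev-+ [] φ ψ = refl
   ev-+ (t ∷ P) φ ψ = trans (+ʳ (proj₁ t * (φ (proj₂ t) + ψ (proj₂ t))) (ev-+ P φ ψ)) (lem (proj₁ t) (φ (proj₂ t)) (ψ (proj₂ t)) (ev P φ) (ev P ψ))
     where
     lem : ∀ a x y u v → a * (x + y) + (u + v) ≡ a * x + u + (a * y + v)
     lem = solve-∀

   ev-swap : ∀ (P Q : LPoly m) (f : Mon m → Mon m → ℤ) →
     ev P (λ s → ev Q (λ t → f s t)) ≡ ev Q (λ t → ev P (λ s → f s t))
   ev-swap [] Q f = sym (ev-0 Q)
   ev-swap (p ∷ P) Q f = begin
     proj₁ p * ev Q (f (proj₂ p)) + ev P (λ s → ev Q (f s))
       ≡⟨ cong₂ _+_ (ev-scale Q (proj₁ p) (f (proj₂ p))) (sym (ev-swap P Q f)) ⟨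
     ev Q (λ t → proj₁ p * f (proj₂ p) t) + ev Q (λ t → ev P (λ s → f s t))
       ≡⟨ ev-+ Q _ _ ⟨
     ev Q (λ t → proj₁ p * f (proj₂ p) t + ev P (λ s → f s t)) ∎
     where open ≡-Reasoning

   ev-* : ∀ (P Q : LPoly m) φ → ev (P *L Q) φ ≡ ev P (λ s → ev Q (λ t → φ (s ⊞ t)))
   ev-* [] Q φ = refl
   ev-* (p ∷ P) Q φ = trans (ev-++ (map _ Q) (P *L Q) φ) (cong₂ _+_ (lem Q) (ev-* P Q φ))
     where
     lem : ∀ Q → ev (map (λ t → (proj₁ p * proj₁ t , proj₂ p ⊞ proj₂ t)) Q) φ
                 ≡ proj₁ p * ev Q (λ t → φ (proj₂ p ⊞ t))
     lem [] = sym (ℤP.*-zeroʳ (proj₁ p))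
     lem (t ∷ Q) = trans (+ʳ (proj₁ p * proj₁ t * φ (proj₂ p ⊞ proj₂ t)) (lem Q)) (ar (proj₁ p) (proj₁ t) (φ (proj₂ p ⊞ proj₂ t)) (ev Q (λ t → φ (proj₂ p ⊞ t))))
       where
       ar : ∀ a b x y → a * b * x + a * y ≡ a * (b * x + y)
       ar = solve-∀

   coeff-* : ∀ (P Q : LPoly m) e → coeff (P *L Q) e ≡ ev P (λ s → coeff Q (e ⊞ (⊟ s)))
   coeff-* P Q e = trans (coeff-ev (P *L Q) e) (trans (ev-* P Q (δ e))
     (ev-cong P λ s → trans (ev-cong Q λ t → trans (cong (δ e) (⊞-comm s t)) (δ-shift e t s)) (sym (coeff-ev Q _))))

   coeff-+ : ∀ (P Q : LPoly m) e → coeff (P +L Q) e ≡ coeff P e + coeff Q e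
   coeff-+ P Q e = trans (coeff-ev (P ++ Q) e) (trans (ev-++ P Q (δ e)) (sym (cong₂ _+_ (coeff-ev P e) (coeff-ev Q e))))

   negL : LPoly m → LPoly m
   negL = map λ t → - proj₁ t , proj₂ t

   coeff-neg : ∀ (P : LPoly m) e → coeff (negL P) e ≡ - coeff P e
   coeff-neg P e = trans (coeff-ev (negL P) e) (trans (lem P) (sym (cong -_ (coeff-ev P e))))
     where
     ar : ∀ a x y → - a * x + - y ≡ - (a * x + y)
     ar = solve-∀
     lem : ∀ P → ev (negL P) (δ e) ≡ - ev P (δ e)
     lem [] = refl
     lem (t ∷ P) = trans (+ʳ (- proj₁ t * δ e (proj₂ t)) (lem P)) (ar (proj₁ t) (δ e (proj₂ t)) (ev P (δ e)))

   ≃-refl : {P : LPoly m} → P ≃ P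
   ≃-refl e = refl

   ≃-sym : {P Q : LPoly m} → P ≃ Q → Q ≃ P
   ≃-sym h e = sym (h e)

   ≃-trans : {P Q R : LPoly m} → P ≃ Q → Q ≃ R → P ≃ R
   ≃-trans h k e = trans (h e) (k e)

   ≃-reflexive : {P Q : LPoly m} → P ≡ Q → P ≃ Q
   ≃-reflexive refl e = refl

   +L-cong : {P P′ Q Q′ : LPoly m} → P ≃ P′ → Q ≃ Q′ → (P +L Q) ≃ (P′ +L Q′)
   +L-cong {P} {P′} {Q} {Q′} h k e = trans (coeff-+ P Q e) (trans (cong₂ _+_ (h e) (k e)) (sym (coeff-+ P′ Q′ e)))

   +L-comm : (P Q : LPoly m) → (P +L Q) ≃ (Q +L P)
   +L-comm P Q e = trans (coeff-+ P Q e) (trans (ℤP.+-comm (coeff P e) (coeff Q e)) (sym (coeff-+ Q P e)))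

   *L-comm : (P Q : LPoly m) → (P *L Q) ≃ (Q *L P)
   *L-comm P Q e = begin
     coeff (P *L Q) e                       ≡⟨ coeff-ev (P *L Q) e ⟩
     ev (P *L Q) (δ e)                      ≡⟨ ev-* P Q (δ e) ⟩
     ev P (λ s → ev Q (λ t → δ e (s ⊞ t)))  ≡⟨ ev-swap P Q _ ⟩
     ev Q (λ t → ev P (λ s → δ e (s ⊞ t)))  ≡⟨ ev-cong Q (λ t → ev-cong P (λ s → cong (δ e) (⊞-comm s t))) ⟩
     ev Q (λ t → ev P (λ s → δ e (t ⊞ s)))  ≡⟨ ev-* Q P (δ e) ⟨
     ev (Q *L P) (δ e)                      ≡⟨ coeff-ev (Q *L P) e ⟨
     coeff (Q *L P) e                       ∎
     where open ≡-Reasoning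

   *L-congʳ : (P : LPoly m) {Q Q′ : LPoly m} → Q ≃ Q′ → (P *L Q) ≃ (P *L Q′)
   *L-congʳ P {Q} {Q′} h e = trans (coeff-* P Q e) (trans (ev-cong P (λ s → h _)) (sym (coeff-* P Q′ e)))

   *L-cong : {P P′ Q Q′ : LPoly m} → P ≃ P′ → Q ≃ Q′ → (P *L Q) ≃ (P′ *L Q′)
   *L-cong {P} {P′} {Q} {Q′} h k = ≃-trans {P *L Q} {P *L Q′} {P′ *L Q′} (*L-congʳ P {Q} {Q′} k)
     (≃-trans {P *L Q′} {Q′ *L P} {P′ *L Q′} (*L-comm P Q′)
       (≃-trans {Q′ *L P} {Q′ *L P′} {P′ *L Q′} (*L-congʳ Q′ {P} {P′} h) (*L-comm Q′ P′)))

   *L-assoc : (P Q R : LPoly m) → ((P *L Q) *L R) ≃ (P *L (Q *L R))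
   *L-assoc P Q R e = begin
     coeff ((P *L Q) *L R) e   ≡⟨ coeff-ev ((P *L Q) *L R) e ⟩
     ev ((P *L Q) *L R) (δ e)  ≡⟨ ev-* (P *L Q) R (δ e) ⟩
     ev (P *L Q) (λ x → ev R (λ u → δ e (x ⊞ u)))  ≡⟨ ev-* P Q _ ⟩
     ev P (λ s → ev Q (λ t → ev R (λ u → δ e (s ⊞ t ⊞ u))))
       ≡⟨ ev-cong P (λ s → trans (ev-cong Q (λ t → ev-cong R (λ u → cong (δ e) (⊞-assoc s t u)))) (sym (ev-* Q R _))) ⟩
     ev P (λ s → ev (Q *L R) (λ x → δ e (s ⊞ x)))  ≡⟨ ev-* P (Q *L R) (δ e) ⟨
     ev (P *L (Q *L R)) (δ e)  ≡⟨ coeff-ev (P *L (Q *L R)) e ⟨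
     coeff (P *L (Q *L R)) e   ∎
     where open ≡-Reasoning

   *L-identityˡ : (P : LPoly m) → (oneL *L P) ≃ P
   *L-identityˡ P e = trans (coeff-ev (oneL *L P) e) (trans (ev-* oneL P (δ e))
     (trans (ℤP.+-identityʳ _) (trans (ℤP.*-identityˡ _)
       (trans (ev-cong P (λ t → cong (δ e) (⊞-identityˡ t))) (sym (coeff-ev P e))))))

   *L-distribʳ : (P Q R : LPoly m) → ((Q +L R) *L P) ≃ ((Q *L P) +L (R *L P))
   *L-distribʳ P Q R e = trans (coeff-* (Q +L R) P e) (trans (ev-++ Q R _)
     (sym (trans (coeff-+ (Q *L P) (R *L P) e) (cong₂ _+_ (coeff-* Q P e) (coeff-* R P e)))))

   *L-distribˡ : (P Q R : LPoly m) → (P *L (Q +L R)) ≃ ((P *L Q) +L (P *L R))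
   *L-distribˡ P Q R e = trans (*L-comm P (Q +L R) e) (trans (*L-distribʳ P Q R e)
     (+L-cong {Q *L P} {P *L Q} {R *L P} {P *L R} (*L-comm Q P) (*L-comm R P) e))

 LRing : ℕ → CommutativeRing 0ℓ 0ℓ
 LRing m = record
   { Carrier = LPoly m ; _≈_ = _≃_ ; _+_ = _+L_ ; _*_ = _*L_ ; -_ = negL ; 0# = [] ; 1# = oneL
   ; isCommutativeRing = record
     { isRing = record
       { +-isAbelianGroup = record
         { isGroup = record
           { isMonoid = record
             { isSemigroup = record
               { isMagma = record
                 { isEquivalence = record
                   { refl = λ {P} → ≃-refl {m} {P} ; sym = λ {P} {Q} → ≃-sym {m} {P} {Q}
                   ; trans = λ {P} {Q} {R} → ≃-trans {m} {P} {Q} {R} }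
                 ; ∙-cong = λ {P} {P′} {Q} {Q′} → +L-cong {m} {P} {P′} {Q} {Q′} }
               ; assoc = λ P Q R → ≃-reflexive (LP.++-assoc P Q R) }
             ; identity = (λ P → ≃-refl {m} {P}) , λ P → ≃-reflexive (LP.++-identityʳ P) }
           ; inverse = (λ P e → trans (coeff-+ (negL P) P e) (trans (cong (_+ coeff P e) (coeff-neg P e)) (ℤP.+-inverseˡ (coeff P e))))
                     , λ P e → trans (coeff-+ P (negL P) e) (trans (+ʳ (coeff P e) (coeff-neg P e)) (ℤP.+-inverseʳ (coeff P e)))
           ; ⁻¹-cong = λ {P} {Q} h e → trans (coeff-neg P e) (trans (cong -_ (h e)) (sym (coeff-neg Q e))) }
         ; comm = +L-comm }
       ; *-cong = λ {P} {P′} {Q} {Q′} → *L-cong {m} {P} {P′} {Q} {Q′}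
       ; *-assoc = *L-assoc
       ; *-identity = *L-identityˡ , λ P e → trans (*L-comm P oneL e) (*L-identityˡ P e)
       ; distrib = *L-distribˡ , *L-distribʳ }
     ; *-comm = *L-comm } }
   where import Data.List.Properties as LP

 mono : ∀ {m} → Mon m → LPoly m
 mono e = (1ℤ , e) ∷ []

 unit : ∀ {m} → Fin m → Mon m
 unit i = Vec.tabulate (λ j → if does (i Fin.≟ j) then 1ℤ else 0ℤ)

 -- Linear functionals on exponents; Hom is checked on the terms as written, so it needs no cancellation argument.

 dot : ∀ {m} → Vec ℤ m → Mon m → ℤ
 dot [] [] = 0ℤ
 dot (a ∷ w) (x ∷ e) = a * x + dot w e

 dot-⊞ : ∀ {m} (w : Vec ℤ m) s t → dot w (s ⊞ t) ≡ dot w s + dot w t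
 dot-⊞ [] [] [] = refl
 dot-⊞ (a ∷ w) (x ∷ s) (y ∷ t) = trans (+ʳ (a * (x + y)) (dot-⊞ w s t)) (lem a x y (dot w s) (dot w t))
   where
   lem : ∀ a x y u v → a * (x + y) + (u + v) ≡ a * x + u + (a * y + v)
   lem = solve-∀

 dot-𝟘 : ∀ {m} (w : Vec ℤ m) → dot w 𝟘 ≡ 0ℤ
 dot-𝟘 [] = refl
 dot-𝟘 (a ∷ w) = cong₂ _+_ (ℤP.*-zeroʳ a) (dot-𝟘 w)

 dot-⊟ : ∀ {m} (w : Vec ℤ m) s → dot w (⊟ s) ≡ - dot w s
 dot-⊟ w s = begin
   dot w (⊟ s)                        ≡⟨ lem (dot w s) (dot w (⊟ s)) ⟩
   dot w s + dot w (⊟ s) + - dot w s  ≡⟨ cong (_+ - dot w s) (trans (sym (dot-⊞ w s (⊟ s))) (trans (cong (dot w) (⊞-inverseʳ s)) (dot-𝟘 w))) ⟩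
   0ℤ + - dot w s                     ≡⟨ ℤP.+-identityˡ _ ⟩
   - dot w s                          ∎
   where
   open ≡-Reasoning
   lem : ∀ a b → b ≡ a + b + - a
   lem = solve-∀

 dot-unit : ∀ {m} (w : Vec ℤ m) i → dot w (unit i) ≡ Vec.lookup w i
 dot-unit (a ∷ w) zero = trans (cong₂ _+_ (ℤP.*-identityʳ a) (trans (cong (dot w) (lem _)) (dot-𝟘 w))) (ℤP.+-identityʳ a)
   where
   lem : ∀ m → Vec.tabulate {n = m} (λ _ → 0ℤ) ≡ 𝟘
   lem zero = refl
   lem (suc m) = cong (0ℤ ∷_) (lem m)
 dot-unit (a ∷ w) (suc i) = trans (cong₂ _+_ (ℤP.*-zeroʳ a) (trans (cong (dot w) (VecP.tabulate-cong (λ j → refl))) (dot-unit w i))) (ℤP.+-identityˡ _)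

 Hom : ∀ {m} → Vec ℤ m → ℤ → LPoly m → Set
 Hom w k P = All (λ t → dot w (proj₂ t) ≡ k) P

 All-* : ∀ {m} {A B C : ℤ × Mon m → Set} (P Q : LPoly m) →
   (∀ s t → A s → B t → C (proj₁ s * proj₁ t , proj₂ s ⊞ proj₂ t)) → All A P → All B Q → All C (P *L Q)
 All-* [] Q f [] hq = []
 All-* (s ∷ P) Q f (h ∷ hp) hq = AllP.++⁺ (AllP.map⁺ (All.map (λ {t} b → f s t h b) hq)) (All-* P Q f hp hq)

 module _ {m : ℕ} {w : Vec ℤ m} where

   Hom-* : ∀ {k l P Q} → Hom w k P → Hom w l Q → Hom w (k + l) (P *L Q)
   Hom-* {P = P} {Q} hp hq = All-* P Q (λ s t a b → trans (dot-⊞ w (proj₂ s) (proj₂ t)) (cong₂ _+_ a b)) hp hq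

   Hom-+ : ∀ {k P Q} → Hom w k P → Hom w k Q → Hom w k (P +L Q)
   Hom-+ = AllP.++⁺

   Hom-neg : ∀ {k P} → Hom w k P → Hom w k (negL P)
   Hom-neg hp = AllP.map⁺ hp

 coeff-none : ∀ {m} (P : LPoly m) e → All (λ t → proj₂ t ≢ e) P → coeff P e ≡ 0ℤ
 coeff-none P e h = trans (coeff-ev P e) (trans (ev-cong∈ P (All.map δ-≢ h)) (ev-0 P))

 -- Terms may cancel, so the support can be smaller than the set of listed exponents; `PosC-supp`
 -- gives the converse inclusion for positive coefficients.
 supp-∈ : ∀ {m} (P : LPoly m) e → Supp P e → ∃ λ c → (c , e) ∈ P
 supp-∈ P e s = go P λ h → s (coeff-none P e h)
   where
   go : ∀ P → ¬ All (λ t → proj₂ t ≢ e) P → ∃ λ c → (c , e) ∈ P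
   go [] h = ⊥-elim (h [])
   go ((c , x) ∷ P) h with x ≟ᵐ e
   ... | yes refl = c , here refl
   ... | no ne with go P (λ a → h (ne ∷ a))
   ...   | c′ , i = c′ , there i

 Hom-supp : ∀ {m} {w : Vec ℤ m} {k} {P : LPoly m} → Hom w k P → ∀ {e} → Supp P e → dot w e ≡ k
 Hom-supp {P = P} h {e} s = All.lookup h (proj₂ (supp-∈ P e s))

 -- Lists with positive coefficients, where no cancellation can occur.

 PosC : ∀ {m} → LPoly m → Set
 PosC = All λ t → 0ℤ < proj₁ t

 PosL : ∀ {m} → LPoly m → Set
 PosL P = PosC P × ∃ (_∈ P)

 pos*pos : ∀ {a b} → 0ℤ < a → 0ℤ < b → 0ℤ < a * b
 pos*pos {+ suc a} {+ suc b} _ _ = ℤ.+<+ (ℕ.s≤s ℕ.z≤n)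
 pos*pos {+ zero} (ℤ.+<+ ())
 pos*pos {+ suc a} {+ zero} _ (ℤ.+<+ ())

 ∈-* : ∀ {m} {P Q : LPoly m} {s t} → s ∈ P → t ∈ Q → (proj₁ s * proj₁ t , proj₂ s ⊞ proj₂ t) ∈ (P *L Q)
 ∈-* (here refl) j = ∈-++⁺ˡ (∈-map⁺ _ j)
 ∈-* {P = p ∷ P} {Q} (there i) j = ∈-++⁺ʳ (map _ Q) (∈-* i j)

 ∈-*⁻ : ∀ {m} (P Q : LPoly m) {u} → u ∈ (P *L Q) → ∃ λ s → ∃ λ t → s ∈ P × t ∈ Q × proj₂ u ≡ proj₂ s ⊞ proj₂ t
 ∈-*⁻ (p ∷ P) Q i with ∈-++⁻ (map _ Q) i
 ... | inj₂ j with ∈-*⁻ P Q j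
 ...   | s , t , a , b , eq = s , t , there a , b , eq
 ∈-*⁻ (p ∷ P) Q i | inj₁ j with ∈-map⁻ _ j
   where open import Data.List.Membership.Propositional.Properties using (∈-map⁻)
 ... | t , b , refl = p , t , here refl , b , refl

 PosC-* : ∀ {m} {P Q : LPoly m} → PosC P → PosC Q → PosC (P *L Q)
 PosC-* {P = P} {Q} = All-* P Q λ s t → pos*pos

 PosL-* : ∀ {m} {P Q : LPoly m} → PosL P → PosL Q → PosL (P *L Q)
 PosL-* (p , _ , i) (q , _ , j) = PosC-* p q , _ , ∈-* i j

 PosL-+ : ∀ {m} {P Q : LPoly m} → PosL P → PosC Q → PosL (P +L Q)
 PosL-+ (p , _ , i) q = AllP.++⁺ p q , _ , ∈-++⁺ˡ i

 PosL-mono : ∀ {m} (e : Mon m) → PosL (mono e)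
 PosL-mono e = (ℤ.+<+ (ℕ.s≤s ℕ.z≤n) ∷ []) , _ , here refl

 ev-δ-≥0 : ∀ {m} {P : LPoly m} e → PosC P → 0ℤ ℤ.≤ ev P (δ e)
 ev-δ-≥0 e [] = ℤP.≤-refl
 ev-δ-≥0 {P = (c , x) ∷ P} e (h ∷ hs) with does (x ≟ᵐ e)
 ... | true = ℤP.+-mono-≤ (subst (0ℤ ℤ.≤_) (sym (ℤP.*-identityʳ c)) (ℤP.<⇒≤ h)) (ev-δ-≥0 {P = P} e hs)
 ... | false = ℤP.+-mono-≤ (subst (0ℤ ℤ.≤_) (sym (ℤP.*-zeroʳ c)) ℤP.≤-refl) (ev-δ-≥0 {P = P} e hs)

 coeff-pos : ∀ {m} {P : LPoly m} {c e} → PosC P → (c , e) ∈ P → 0ℤ < coeff P e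
 coeff-pos {P = P} {e = e} h i = subst (0ℤ <_) (sym (coeff-ev P e)) (go h i)
   where
   go : ∀ {P c} → PosC P → (c , e) ∈ P → 0ℤ < ev P (δ e)
   go {(c , x) ∷ P} (h ∷ hs) (here refl) =
     ℤP.+-mono-<-≤ (subst (0ℤ <_) (trans (sym (ℤP.*-identityʳ c)) (cong (c *_) (sym (δ-refl e)))) h) (ev-δ-≥0 {P = P} e hs)
   go {(c , x) ∷ P} (h ∷ hs) (there i) = ℤP.+-mono-≤-< (lem (δ01 x)) (go hs i)
     where
     δ01 : ∀ x → δ e x ≡ 0ℤ ⊎ δ e x ≡ 1ℤ
     δ01 x with does (x ≟ᵐ e)
     ... | true = inj₂ refl
     ... | false = inj₁ refl
     lem : δ e x ≡ 0ℤ ⊎ δ e x ≡ 1ℤ → 0ℤ ℤ.≤ c * δ e x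
     lem (inj₁ z) rewrite z = subst (0ℤ ℤ.≤_) (sym (ℤP.*-zeroʳ c)) ℤP.≤-refl
     lem (inj₂ o) rewrite o = subst (0ℤ ℤ.≤_) (sym (ℤP.*-identityʳ c)) (ℤP.<⇒≤ h)

 PosC-supp : ∀ {m} {P : LPoly m} {c e} → PosC P → (c , e) ∈ P → Supp P e
 PosC-supp {P = P} {e = e} h i eq = ℤP.<-irrefl (sym eq) (coeff-pos {P = P} h i)

-- Cancelling positive factors

module Cancellation where
 open LaurentPolynomials
 open import Data.Nat using (ℕ)
 open import Data.Integer using (ℤ; +_; _+_; _*_; -_; _<_; 0ℤ)
 open import Data.Integer.Properties as ℤP
 open import Data.List as List using (List; []; _∷_; map)
 open import Data.List.Membership.Propositional using (_∈_)
 open import Data.List.Membership.Propositional.Properties using (∈-map⁺)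
 open import Data.List.Relation.Unary.Any using (here; there)
 open import Data.List.Relation.Unary.All as All using (All; []; _∷_)
 open import Data.Vec using ([]; _∷_)
 open import Relation.Binary.Definitions using (tri<; tri≈; tri>)

 infix 4 _<ˡ_
 _<ˡ_ : ∀ {m} → Mon m → Mon m → Set
 [] <ˡ [] = ⊥
 (x ∷ xs) <ˡ (y ∷ ys) = x < y ⊎ (x ≡ y × xs <ˡ ys)

 <ˡ-trans : ∀ {m} {x y z : Mon m} → x <ˡ y → y <ˡ z → x <ˡ z
 <ˡ-trans {x = _ ∷ _} {_ ∷ _} {_ ∷ _} (inj₁ a) (inj₁ b) = inj₁ (ℤP.<-trans a b)
 <ˡ-trans {x = _ ∷ _} {_ ∷ _} {_ ∷ _} (inj₁ a) (inj₂ (refl , _)) = inj₁ a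
 <ˡ-trans {x = _ ∷ _} {_ ∷ _} {_ ∷ _} (inj₂ (refl , _)) (inj₁ b) = inj₁ b
 <ˡ-trans {x = _ ∷ _} {_ ∷ _} {_ ∷ _} (inj₂ (refl , a)) (inj₂ (refl , b)) = inj₂ (refl , <ˡ-trans a b)
 <ˡ-trans {x = []} {[]} () _

 <ˡ-irrefl : ∀ {m} {x : Mon m} → ¬ (x <ˡ x)
 <ˡ-irrefl {x = _ ∷ _} (inj₁ a) = ℤP.<-irrefl refl a
 <ˡ-irrefl {x = _ ∷ _} (inj₂ (_ , a)) = <ˡ-irrefl a

 <ˡ-cmp : ∀ {m} (x y : Mon m) → x <ˡ y ⊎ x ≡ y ⊎ y <ˡ x
 <ˡ-cmp [] [] = inj₂ (inj₁ refl)
 <ˡ-cmp (x ∷ xs) (y ∷ ys) with ℤP.<-cmp x y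
 ... | tri< a _ _ = inj₁ (inj₁ a)
 ... | tri> _ _ c = inj₂ (inj₂ (inj₁ c))
 ... | tri≈ _ refl _ with <ˡ-cmp xs ys
 ...   | inj₁ a = inj₁ (inj₂ (refl , a))
 ...   | inj₂ (inj₁ refl) = inj₂ (inj₁ refl)
 ...   | inj₂ (inj₂ c) = inj₂ (inj₂ (inj₂ (refl , c)))

 <ˡ-⊞ : ∀ {m} {x y : Mon m} (z : Mon m) → x <ˡ y → x ⊞ z <ˡ y ⊞ z
 <ˡ-⊞ {x = []} {[]} _ ()
 <ˡ-⊞ {x = x ∷ _} {y ∷ _} (z ∷ _) (inj₁ a) = inj₁ (ℤP.+-monoˡ-< z a)
 <ˡ-⊞ {x = _ ∷ _} {_ ∷ _} (_ ∷ zs) (inj₂ (refl , a)) = inj₂ (refl , <ˡ-⊞ zs a)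

 max-of : ∀ {m} {A : Mon m → Set} (A? : ∀ e → Dec (A e)) (es : List (Mon m)) →
   All (λ e → ¬ A e) es ⊎ ∃ λ e → A e × e ∈ es × All (λ e′ → A e′ → ¬ (e <ˡ e′)) es
 max-of A? [] = inj₁ []
 max-of A? (e ∷ es) with A? e | max-of A? es
 ... | no na | inj₁ none = inj₁ (na ∷ none)
 ... | no na | inj₂ (f , a , i , h) = inj₂ (f , a , there i , (λ a′ → ⊥-elim (na a′)) ∷ h)
 ... | yes a | inj₁ none = inj₂ (e , a , here refl , (λ _ → <ˡ-irrefl) ∷ All.map (λ na a′ → ⊥-elim (na a′)) none)
 ... | yes a | inj₂ (f , b , i , h) with <ˡ-cmp e f
 ...   | inj₁ e<f = inj₂ (f , b , there i , (λ _ f<e → <ˡ-irrefl (<ˡ-trans e<f f<e)) ∷ h)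
 ...   | inj₂ (inj₁ refl) = inj₂ (f , b , there i , (λ _ → <ˡ-irrefl) ∷ h)
 ...   | inj₂ (inj₂ f<e) = inj₂ (e , a , here refl , (λ _ → <ˡ-irrefl) ∷ All.map (λ k a′ e<e′ → k a′ (<ˡ-trans f<e e<e′)) h)

 module _ {m : ℕ} where

   -- The lexicographically largest exponents of D and of h cannot cancel in the product.
   PosL-regular : (D h : LPoly m) → PosL D → (h *L D) ≃ [] → h ≃ []
   PosL-regular D h (pd , (c₀ , x₀) , i₀) z e
     with max-of {A = λ e → coeff h e ≢ 0ℤ} (λ e → ¬?′ (coeff h e ℤ.≟ 0ℤ)) (map proj₂ h)
        | max-of {A = λ e → e ∈ map proj₂ D} (λ e → _ ∈? _) (map proj₂ D)
     where
     ¬?′ : ∀ {A : Set} → Dec A → Dec (¬ A)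
     ¬?′ (yes a) = no λ n → n a
     ¬?′ (no n) = yes n
     open import Data.List.Membership.DecPropositional _≟ᵐ_ using (_∈?_)
   ... | inj₁ none | _ with coeff h e ℤ.≟ 0ℤ
   ...   | yes eq = eq
   ...   | no ne = ⊥-elim (All.lookup none (∈-map⁺ proj₂ (proj₂ (supp-∈ h e ne))) ne)
   PosL-regular D h (pd , (c₀ , x₀) , i₀) z e | inj₂ _ | inj₁ none = ⊥-elim (All.lookup none (∈-map⁺ proj₂ i₀) (∈-map⁺ proj₂ i₀))
   PosL-regular D h (pd , (c₀ , x₀) , i₀) z e | inj₂ (f , nf , _ , hf) | inj₂ (d , d∈ , _ , hd) = ⊥-elim (contra eq)
     where
     open import Data.List.Membership.Propositional.Properties using (∈-map⁻)
     big : ∀ {e′} → f <ˡ e′ → coeff h e′ ≡ 0ℤ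
     big {e′} lt with coeff h e′ ℤ.≟ 0ℤ
     ... | yes eq = eq
     ... | no ne = ⊥-elim (All.lookup hf (∈-map⁺ proj₂ (proj₂ (supp-∈ h e′ ne))) ne lt)
     -- An exponent `x` of `D` below `d` would have to be paired with an exponent of `h` above `f`,
     -- where `h` vanishes; only `x = d` contributes at `d ⊞ f`.
     stp : ∀ x → x ∈ map proj₂ D → coeff h ((d ⊞ f) ⊞ (⊟ x)) ≡ coeff h f * δ d x
     stp x x∈ with <ˡ-cmp d x
     ... | inj₁ lt = ⊥-elim (All.lookup hd x∈ x∈ lt)
     ... | inj₂ (inj₁ refl) = trans (cong (coeff h) lem) (sym (trans (cong (coeff h f *_) (δ-refl d)) (ℤP.*-identityʳ _)))
       where
       lem : (d ⊞ f) ⊞ (⊟ d) ≡ f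
       lem = trans (cong (_⊞ (⊟ d)) (⊞-comm d f)) (trans (⊞-assoc f d (⊟ d)) (trans (cong (f ⊞_) (⊞-inverseʳ d)) (⊞-identityʳ f)))
     ... | inj₂ (inj₂ x<d) = trans (big lt) (sym (trans (cong (coeff h f *_) (δ-≢ {e = d} {x} λ { refl → <ˡ-irrefl x<d })) (ℤP.*-zeroʳ (coeff h f))))
       where
       lt : f <ˡ (d ⊞ f) ⊞ (⊟ x)
       lt = subst (_<ˡ (d ⊞ f) ⊞ (⊟ x)) (trans (cong (_⊞ (⊟ x)) (⊞-comm x f)) (trans (⊞-assoc f x (⊟ x)) (trans (cong (f ⊞_) (⊞-inverseʳ x)) (⊞-identityʳ f))))
         (<ˡ-⊞ (⊟ x) (<ˡ-⊞ f x<d))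
     eq : coeff h f * coeff D d ≡ 0ℤ
     eq = begin
       coeff h f * coeff D d              ≡⟨ cong (coeff h f *_) (coeff-ev D d) ⟩
       coeff h f * ev D (δ d)             ≡⟨ ev-scale D (coeff h f) (δ d) ⟨
       ev D (λ x → coeff h f * δ d x)     ≡⟨ ev-cong∈ D (All.tabulate λ {t} t∈ → stp (proj₂ t) (∈-map⁺ proj₂ t∈)) ⟨
       ev D (λ x → coeff h ((d ⊞ f) ⊞ (⊟ x))) ≡⟨ coeff-* D h (d ⊞ f) ⟨
       coeff (D *L h) (d ⊞ f)             ≡⟨ *L-comm D h (d ⊞ f) ⟩
       coeff (h *L D) (d ⊞ f)             ≡⟨ z (d ⊞ f) ⟩
       0ℤ                                 ∎
       where open ≡-Reasoning
     contra : coeff h f * coeff D d ≡ 0ℤ → ⊥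
     contra eq with ℤP.i*j≡0⇒i≡0∨j≡0 (coeff h f) eq | ∈-map⁻ proj₂ d∈
     ... | inj₁ a | _ = nf a
     ... | inj₂ b | t , t∈ , refl = PosC-supp {P = D} pd t∈ b

   PosL-cancel : (D P Q : LPoly m) → PosL D → (P *L D) ≃ (Q *L D) → P ≃ Q
   PosL-cancel D P Q pd h e = ℤP.i-j≡0⇒i≡j (coeff P e) (coeff Q e)
     (trans (sym (trans (coeff-+ P (negL Q) e) (+ʳ (coeff P e) (coeff-neg Q e))))
       (PosL-regular D (P +L negL Q) pd diff e))
     where
     diff : ((P +L negL Q) *L D) ≃ []
     diff e = begin
       coeff ((P +L negL Q) *L D) e            ≡⟨ *L-distribʳ D P (negL Q) e ⟩
       coeff ((P *L D) +L (negL Q *L D)) e     ≡⟨ coeff-+ (P *L D) (negL Q *L D) e ⟩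
       coeff (P *L D) e + coeff (negL Q *L D) e ≡⟨ cong₂ _+_ (h e) (neg*) ⟩
       coeff (Q *L D) e + - coeff (Q *L D) e   ≡⟨ ℤP.+-inverseʳ (coeff (Q *L D) e) ⟩
       0ℤ ∎
       where
       open ≡-Reasoning
       neg* : coeff (negL Q *L D) e ≡ - coeff (Q *L D) e
       neg* = begin
         coeff (negL Q *L D) e  ≡⟨ *L-comm (negL Q) D e ⟩
         coeff (D *L negL Q) e  ≡⟨ coeff-* D (negL Q) e ⟩
         ev D (λ s → coeff (negL Q) (e ⊞ (⊟ s))) ≡⟨ ev-cong D (λ s → trans (coeff-neg Q _) (sym (ℤP.-1*i≡-i _))) ⟩
         ev D (λ s → ℤ.-1ℤ * coeff Q (e ⊞ (⊟ s))) ≡⟨ ev-scale D ℤ.-1ℤ (λ s → coeff Q (e ⊞ (⊟ s))) ⟩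
         ℤ.-1ℤ * ev D (λ s → coeff Q (e ⊞ (⊟ s))) ≡⟨ cong (ℤ.-1ℤ *_) (coeff-* D Q e) ⟨
         ℤ.-1ℤ * coeff (D *L Q) e ≡⟨ ℤP.-1*i≡-i _ ⟩
         - coeff (D *L Q) e ≡⟨ cong -_ (*L-comm D Q e) ⟩
         - coeff (Q *L D) e ∎

-- Convex hulls and lattice points

module NewtonPolytopes where
 open LaurentPolynomials
 open import Data.Nat using (ℕ; suc)
 open import Data.Integer using (ℤ; 0ℤ; 1ℤ)
 import Data.Integer.Properties as ℤP
 open import Data.Integer.Tactic.RingSolver using (solve-∀)
 open import Data.Rational as ℚ using (ℚ; 0ℚ; 1ℚ; ½; _+_; _*_; -_; _≤_; _<_; toℚᵘ)
 import Data.Rational.Properties as ℚP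
 open import Data.Rational.Unnormalised as ℚᵘ using (mkℚᵘ; *≡*; *≤*)
 import Data.Rational.Unnormalised.Properties as ℚᵘP
 open RingIdentities
 open import Algebra.Properties.Group ℚP.+-0-group using (⁻¹-involutive)
 open import Data.List using (List; []; _∷_; map; foldr)
 open import Data.List.Relation.Unary.All as All using (All; []; _∷_)
 open import Data.Vec as Vec using (Vec; []; _∷_)
 import Data.Vec.Properties as VecP

 ι : ℤ → ℚ
 ι z = z ℚ./ 1

 toℚᵘ-ι : ∀ z → toℚᵘ (ι z) ℚᵘ.≃ mkℚᵘ z 0
 toℚᵘ-ι z = ℚP.toℚᵘ-fromℚᵘ (mkℚᵘ z 0)

 ι-+ : ∀ a b → ι (a ℤ.+ b) ≡ ι a + ι b
 ι-+ a b = ℚP.toℚᵘ-injective (begin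
   toℚᵘ (ι (a ℤ.+ b))           ≈⟨ toℚᵘ-ι (a ℤ.+ b) ⟩
   mkℚᵘ (a ℤ.+ b) 0             ≈⟨ *≡* (ar a b) ⟩
   mkℚᵘ a 0 ℚᵘ.+ mkℚᵘ b 0       ≈⟨ ℚᵘP.+-cong (toℚᵘ-ι a) (toℚᵘ-ι b) ⟨
   toℚᵘ (ι a) ℚᵘ.+ toℚᵘ (ι b)   ≈⟨ ℚP.toℚᵘ-homo-+ (ι a) (ι b) ⟨
   toℚᵘ (ι a + ι b)             ∎)
   where
   open ℚᵘP.≃-Reasoning
   ar : ∀ a b → (a ℤ.+ b) ℤ.* 1ℤ ≡ (a ℤ.* 1ℤ ℤ.+ b ℤ.* 1ℤ) ℤ.* 1ℤ
   ar = solve-∀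

 ι-* : ∀ a b → ι (a ℤ.* b) ≡ ι a * ι b
 ι-* a b = ℚP.toℚᵘ-injective (begin
   toℚᵘ (ι (a ℤ.* b))           ≈⟨ toℚᵘ-ι (a ℤ.* b) ⟩
   mkℚᵘ (a ℤ.* b) 0             ≈⟨ *≡* refl ⟩
   mkℚᵘ a 0 ℚᵘ.* mkℚᵘ b 0       ≈⟨ ℚᵘP.*-cong (toℚᵘ-ι a) (toℚᵘ-ι b) ⟨
   toℚᵘ (ι a) ℚᵘ.* toℚᵘ (ι b)   ≈⟨ ℚP.toℚᵘ-homo-* (ι a) (ι b) ⟨
   toℚᵘ (ι a * ι b)             ∎)
   where open ℚᵘP.≃-Reasoning

 ι-neg : ∀ k → ι (ℤ.- k) ≡ - ι k
 ι-neg (ℤ.+ 0) = refl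
 ι-neg (ℤ.+ suc n) = refl
 ι-neg (ℤ.-[1+ n ]) = sym (⁻¹-involutive _)

 ι-hom : IntHom ℚP.+-*-commutativeRing
 ι-hom = record { φ = ι ; φ-+ = ι-+ ; φ-* = ι-* ; φ-neg = ι-neg ; φ-0 = refl ; φ-1 = refl }

 open IntRingIdentities ℚP.+-*-commutativeRing ι-hom

 ι-cancel-≤ : ∀ a b → ι a ≤ ι b → a ℤ.≤ b
 ι-cancel-≤ a b le = lem (ℚᵘP.≤-respˡ-≃ (toℚᵘ-ι a) (ℚᵘP.≤-respʳ-≃ (toℚᵘ-ι b) (ℚP.toℚᵘ-mono-≤ le)))
   where
   lem : mkℚᵘ a 0 ℚᵘ.≤ mkℚᵘ b 0 → a ℤ.≤ b
   lem (*≤* h) = subst₂ ℤ._≤_ (ℤP.*-identityʳ a) (ℤP.*-identityʳ b) h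

 ι-injective : ∀ {a b} → ι a ≡ ι b → a ≡ b
 ι-injective {a} {b} eq = ℤP.≤-antisym (ι-cancel-≤ a b (ℚP.≤-reflexive eq)) (ι-cancel-≤ b a (ℚP.≤-reflexive (sym eq)))

 0≤* : ∀ {a b} → 0ℚ ≤ a → 0ℚ ≤ b → 0ℚ ≤ a * b
 0≤* {a} {b} p q = ℚP.nonNegative⁻¹ (a * b)
   ⦃ ℚP.nonNeg*nonNeg⇒nonNeg a ⦃ ℚ.nonNegative p ⦄ b ⦃ ℚ.nonNegative q ⦄ ⦄

 0≤+ : ∀ {a b} → 0ℚ ≤ a → 0ℚ ≤ b → 0ℚ ≤ a + b
 0≤+ p q = ℚP.+-mono-≤ p q

 sum-zero : ∀ {a b} → 0ℚ ≤ a → 0ℚ ≤ b → a + b ≡ 0ℚ → a ≡ 0ℚ × b ≡ 0ℚ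
 sum-zero {a} {b} p q eq = a0 , trans (sym (ℚP.+-identityˡ b)) (trans (cong (_+ b) (sym a0)) eq)
   where
   a0 : a ≡ 0ℚ
   a0 = ℚP.≤-antisym (subst₂ _≤_ (ℚP.+-identityʳ a) eq (ℚP.+-monoʳ-≤ a q)) p

 *-zero-pos : ∀ {t a} → 0ℚ < t → t * a ≡ 0ℚ → a ≡ 0ℚ
 *-zero-pos {t} {a} p eq = ℚP.≤-antisym (le (ℚP.≤-reflexive (trans eq (sym (ℚP.*-zeroʳ t))))) (le (ℚP.≤-reflexive (trans (ℚP.*-zeroʳ t) (sym eq))))
   where
   le : ∀ {x y} → t * x ≤ t * y → x ≤ y
   le = ℚP.*-cancelˡ-≤-pos t ⦃ ℚ.positive p ⦄

 convex-zero : ∀ {t s a b} → 0ℚ < t → 0ℚ < s → 0ℚ ≤ a → 0ℚ ≤ b → t * a + s * b ≡ 0ℚ → a ≡ 0ℚ × b ≡ 0ℚ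
 convex-zero p q ha hb eq with sum-zero (0≤* (ℚP.<⇒≤ p) ha) (0≤* (ℚP.<⇒≤ q) hb) eq
 ... | x , y = *-zero-pos p x , *-zero-pos q y

 infixl 6 _⊕ᵛ_
 _⊕ᵛ_ : ∀ {m} → Vec ℚ m → Vec ℚ m → Vec ℚ m
 _⊕ᵛ_ = Vec.zipWith _+_

 infixr 7 _·ᵛ_
 _·ᵛ_ : ∀ {m} → ℚ → Vec ℚ m → Vec ℚ m
 c ·ᵛ y = Vec.map (c *_) y

 dotQ : ∀ {m} → Vec ℤ m → Vec ℚ m → ℚ
 dotQ [] [] = 0ℚ
 dotQ (a ∷ w) (x ∷ y) = ι a * x + dotQ w y

 dotQ-⊕ : ∀ {m} (w : Vec ℤ m) y z → dotQ w (y ⊕ᵛ z) ≡ dotQ w y + dotQ w z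
 dotQ-⊕ [] [] [] = refl
 dotQ-⊕ (a ∷ w) (x ∷ y) (x′ ∷ z) = trans (cong (ι a * (x + x′) +_) (dotQ-⊕ w y z))
   (dotQ-+ (ι a) x x′ (dotQ w y) (dotQ w z))

 dotQ-· : ∀ {m} (w : Vec ℤ m) c y → dotQ w (c ·ᵛ y) ≡ c * dotQ w y
 dotQ-· [] c [] = sym (ℚP.*-zeroʳ c)
 dotQ-· (a ∷ w) c (x ∷ y) = trans (cong (ι a * (c * x) +_) (dotQ-· w c y))
   (dotQ-* (ι a) c x (dotQ w y))

 dotQ-toQ : ∀ {m} (w : Vec ℤ m) e → dotQ w (toQ e) ≡ ι (dot w e)
 dotQ-toQ [] [] = refl
 dotQ-toQ (a ∷ w) (x ∷ e) = trans (cong₂ _+_ (sym (ι-* a x)) (dotQ-toQ w e)) (sym (ι-+ (a ℤ.* x) (dot w e)))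

 dotQ-0 : ∀ {m} (w : Vec ℤ m) → dotQ w (Vec.replicate _ 0ℚ) ≡ 0ℚ
 dotQ-0 [] = refl
 dotQ-0 (a ∷ w) = trans (cong₂ _+_ (ℚP.*-zeroʳ (ι a)) (dotQ-0 w)) (ℚP.+-identityˡ 0ℚ)

 wsum : ∀ {m} → List (ℚ × Mon m) → ℚ
 wsum ws = foldr _+_ 0ℚ (map proj₁ ws)

 H : ∀ {m} → (Mon m → ℤ) → List (ℚ × Mon m) → ℚ
 H g [] = 0ℚ
 H g (w ∷ ws) = proj₁ w * ι (g (proj₂ w)) + H g ws

 dotQ-combo : ∀ {m} (w : Vec ℤ m) ws → dotQ w (combo ws) ≡ H (dot w) ws
 dotQ-combo w [] = dotQ-0 w
 dotQ-combo w ((c , e) ∷ ws) = trans (dotQ-⊕ w (c ·ᵛ toQ e) (combo ws))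
   (cong₂ _+_ (trans (dotQ-· w c (toQ e)) (cong (c *_) (dotQ-toQ w e))) (dotQ-combo w ws))

 H-affine : ∀ {m} (g h : Mon m → ℤ) k → (∀ e → g e ≡ h e ℤ.+ k) → ∀ ws → H g ws ≡ H h ws + ι k * wsum ws
 H-affine g h k eq [] = sym (trans (ℚP.+-identityˡ _) (ℚP.*-zeroʳ (ι k)))
 H-affine g h k eq ((c , e) ∷ ws) = trans (cong₂ _+_ (cong (c *_) (trans (cong ι (eq e)) (ι-+ (h e) k))) (H-affine g h k eq ws))
   (affine-step c (ι (h e)) (ι k) (H h ws) (wsum ws))

 Wts : ∀ {m} → (Mon m → Set) → List (ℚ × Mon m) → Set
 Wts S = All (λ w → (0ℚ ≤ proj₁ w) × S (proj₂ w))

 H-≥0 : ∀ {m} {S : Mon m → Set} (g : Mon m → ℤ) → (∀ {e} → S e → g e ≡ 0ℤ ⊎ g e ≡ 1ℤ) → ∀ {ws} → Wts S ws → 0ℚ ≤ H g ws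
 H-≥0 g g01 [] = ℚP.≤-refl
 H-≥0 g g01 {(c , e) ∷ ws} ((p , s) ∷ hs) = 0≤+ (0≤* p (lem (g01 s))) (H-≥0 g g01 hs)
   where
   lem : g e ≡ 0ℤ ⊎ g e ≡ 1ℤ → 0ℚ ≤ ι (g e)
   lem (inj₁ eq) rewrite eq = ℚP.≤-refl
   lem (inj₂ eq) rewrite eq = ℚP.nonNegative⁻¹ 1ℚ

 ⊕-0· : ∀ {m} (e y : Vec ℚ m) → (0ℚ ·ᵛ e) ⊕ᵛ y ≡ y
 ⊕-0· [] [] = refl
 ⊕-0· (x ∷ e) (z ∷ y) = cong₂ _∷_ (trans (cong (_+ z) (ℚP.*-zeroˡ x)) (ℚP.+-identityˡ z)) (⊕-0· e y)

 -- A vanishing sum of nonnegative terms vanishes termwise, so every point with `g = 1` has weight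
 -- zero. Dropping these points leaves a combination supported on the face `g = 0`.
 restrict : ∀ {m} {S : Mon m → Set} (g : Mon m → ℤ) → (∀ {e} → S e → g e ≡ 0ℤ ⊎ g e ≡ 1ℤ) → ∀ ws → Wts S ws → H g ws ≡ 0ℚ →
   ∃ λ ws′ → Wts (λ e → S e × g e ≡ 0ℤ) ws′ × wsum ws′ ≡ wsum ws × combo ws′ ≡ combo ws
 restrict g g01 [] [] eq = [] , [] , refl , refl
 restrict g g01 ((c , e) ∷ ws) ((p , s) ∷ hs) eq with g01 s
 ... | inj₁ z = let hd = trans (sym (trans (cong (λ q → c * ι q + H g ws) z) (trans (cong (_+ H g ws) (ℚP.*-zeroʳ c)) (ℚP.+-identityˡ _)))) eq
                    ws′ , a , b , d = restrict g g01 ws hs hd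
                in (c , e) ∷ ws′ , (p , s , z) ∷ a , cong (c +_) b , cong ((c ·ᵛ toQ e) ⊕ᵛ_) d
 ... | inj₂ o with sum-zero p (H-≥0 g g01 hs) (trans (sym (cong (_+ H g ws) (trans (cong (λ q → c * ι q) o) (ℚP.*-identityʳ c)))) eq)
 ...   | refl , hd = let ws′ , a , b , d = restrict g g01 ws hs hd
                     in ws′ , a , trans b (sym (ℚP.+-identityˡ _)) , trans d (sym (⊕-0· (toQ e) (combo ws)))

 -- No lattice point is a proper convex combination of two points of the hull of S.
 SE : ∀ {m} → (Mon m → Set) → Set
 SE {m} S = ∀ (p : Mon m) (y z : Vec ℚ m) t s → InHull S y → InHull S z → 0ℚ < t → 0ℚ < s → t + s ≡ 1ℚ →
   toQ p ≡ (t ·ᵛ y) ⊕ᵛ (s ·ᵛ z) → y ≡ z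

 SE⇒NewtonEmpty : ∀ {m} (L : LPoly m) → SE (Supp L) → NewtonEmpty L
 SE⇒NewtonEmpty L se p h = h , λ { (y , z , t , hy , hz , ne , p0 , p1 , eq) →
   ne (se p y z t (1ℚ ℚ.- t) hy hz p0 (0<1- p1) (add-complement t 1ℚ) eq) }
   where
   0<1- : ∀ {t} → t < 1ℚ → 0ℚ < 1ℚ ℚ.- t
   0<1- {t} p = subst (_< 1ℚ ℚ.- t) (ℚP.+-inverseʳ t) (ℚP.+-monoˡ-< (- t) p)

 InHull-mono : ∀ {m} {S S′ : Mon m → Set} → (∀ {e} → S e → S′ e) → ∀ {y} → InHull S y → InHull S′ y
 InHull-mono f (ws , a , b , c) = ws , All.map (λ { (p , s) → p , f s }) a , b , c

 -- Faces of a support are sets of exponents that no polynomial has to have as its support.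
 -- Monotonicity lets the recursion enclose them in supports of summands.
 SE-mono : ∀ {m} {S S′ : Mon m → Set} → (∀ {e} → S e → S′ e) → SE S′ → SE S
 SE-mono f se p y z t s hy hz = se p y z t s (InHull-mono f hy) (InHull-mono f hz)

 between : ∀ j → 0ℤ ℤ.≤ j → j ℤ.≤ 1ℤ → j ≡ 0ℤ ⊎ j ≡ 1ℤ
 between (ℤ.+ 0) _ _ = inj₁ refl
 between (ℤ.+ 1) _ _ = inj₂ refl
 between (ℤ.+ suc (suc _)) _ (ℤ.+≤+ (ℕ.s≤s ()))
 between (ℤ.-[1+ _ ]) () _

 -- A lattice point of the hull has integral w-degree, hence lies on one of the two faces w = k, w = k + 1.
 SE-split : ∀ {m} {S : Mon m → Set} (w : Vec ℤ m) k → (∀ {e} → S e → dot w e ≡ k ⊎ dot w e ≡ 1ℤ ℤ.+ k) →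
   SE (λ e → S e × dot w e ≡ k) → SE (λ e → S e × dot w e ≡ 1ℤ ℤ.+ k) → SE S
 SE-split {m} {S} w k d01 se₀ se₁ p y z t s (wy , ay , by , cy) (wz , az , bz , cz) p0 p1 ts eq =
   go (between j (ι-cancel-≤ 0ℤ j j≥0) (ι-cancel-≤ j 1ℤ j≤1))
   where
   -- `g` moves the two levels to 0 and 1, and `h` is its complement. Both are nonnegative on `S`,
   -- so a hull point where one of them vanishes lies on the corresponding face.
   g h : Mon m → ℤ
   g e = dot w e ℤ.+ ℤ.- k
   h e = 1ℤ ℤ.+ ℤ.- g e
   j = g p
   ar1 : ∀ k → k ℤ.+ ℤ.- k ≡ 0ℤ
   ar1 = solve-∀
   ar2 : ∀ k → 1ℤ ℤ.+ k ℤ.+ ℤ.- k ≡ 1ℤ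
   ar2 = solve-∀
   ar3 : ∀ k d → d ≡ (d ℤ.+ ℤ.- k) ℤ.+ k
   ar3 = solve-∀
   g01 : ∀ {e} → S e → g e ≡ 0ℤ ⊎ g e ≡ 1ℤ
   g01 s with d01 s
   ... | inj₁ q = inj₁ (trans (cong (ℤ._+ ℤ.- k) q) (ar1 k))
   ... | inj₂ q = inj₂ (trans (cong (ℤ._+ ℤ.- k) q) (ar2 k))
   h01 : ∀ {e} → S e → h e ≡ 0ℤ ⊎ h e ≡ 1ℤ
   h01 s with g01 s
   ... | inj₁ q = inj₂ (cong (λ q → 1ℤ ℤ.+ ℤ.- q) q)
   ... | inj₂ q = inj₁ (cong (λ q → 1ℤ ℤ.+ ℤ.- q) q)
   dQ : ∀ ws → wsum ws ≡ 1ℚ → dotQ w (combo ws) ≡ H g ws + ι k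
   dQ ws b = trans (dotQ-combo w ws) (trans (H-affine (dot w) g k (λ e → ar3 k (dot w e)) ws)
     (cong (H g ws +_) (trans (cong (ι k *_) b) (ℚP.*-identityʳ (ι k)))))
   hG : ∀ ws → H h ws ≡ wsum ws + - H g ws
   hG [] = refl
   hG ((c , e) ∷ ws) = trans (cong₂ _+_ (cong (c *_) (trans (ι-+ 1ℤ (ℤ.- g e)) (cong (1ℚ +_) (ι-neg (g e))))) (hG ws))
       (trans (complement-step c (ι (g e)) 1ℚ (wsum ws) (H g ws)) (cong (λ q → (q + wsum ws) + - (c * ι (g e) + H g ws)) (ℚP.*-identityʳ c)))
   jk : ι (dot w p) ≡ (t * H g wy + s * H g wz) + ι k
   jk = trans (sym (dotQ-toQ w p)) (trans (cong (dotQ w) eq) (trans (dotQ-⊕ w _ _)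
       (trans (cong₂ _+_ (trans (dotQ-· w t y) (cong (t *_) (trans (cong (dotQ w) (sym cy)) (dQ wy by))))
                         (trans (dotQ-· w s z) (cong (s *_) (trans (cong (dotQ w) (sym cz)) (dQ wz bz)))))
         (trans (convex-shift t s (H g wy) (H g wz) (ι k)) (cong ((t * H g wy + s * H g wz) +_) (trans (cong (_* ι k) ts) (ℚP.*-identityˡ (ι k))))))))
   jeq : ι j ≡ t * H g wy + s * H g wz
   jeq = trans (ι-+ (dot w p) (ℤ.- k)) (trans (cong₂ _+_ jk (ι-neg k)) (add-cancel _ (ι k)))
   1-j : ι (1ℤ ℤ.+ ℤ.- j) ≡ t * H h wy + s * H h wz
   1-j = trans (ι-+ 1ℤ (ℤ.- j)) (trans (cong₂ _+_ (sym (trans (cong (_* 1ℚ) ts) (ℚP.*-identityˡ 1ℚ))) (trans (ι-neg j) (cong -_ jeq)))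
     (trans (sym (convex-complement t s 1ℚ (H g wy) (H g wz))) (cong₂ (λ a b → t * a + s * b) (hG′ wy by) (hG′ wz bz))))
     where
     hG′ : ∀ ws → wsum ws ≡ 1ℚ → 1ℚ + - H g ws ≡ H h ws
     hG′ ws b = sym (trans (hG ws) (cong (_+ - H g ws) b))
   gy = H-≥0 g g01 ay
   gz = H-≥0 g g01 az
   hy = H-≥0 h h01 ay
   hz = H-≥0 h h01 az
   j≥0 : ι 0ℤ ≤ ι j
   j≥0 = subst (0ℚ ≤_) (sym jeq) (0≤+ (0≤* (ℚP.<⇒≤ p0) gy) (0≤* (ℚP.<⇒≤ p1) gz))
   j≤1 : ι j ≤ ι 1ℤ
   j≤1 = subst₂ _≤_ (ℚP.+-identityʳ (ι j)) (trans (sym (ι-+ j (1ℤ ℤ.+ ℤ.- j))) (cong ι (ar4 j 1ℤ)))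
     (ℚP.+-monoʳ-≤ (ι j) (subst (0ℚ ≤_) (sym 1-j) (0≤+ (0≤* (ℚP.<⇒≤ p0) hy) (0≤* (ℚP.<⇒≤ p1) hz))))
     where
     ar4 : ∀ d k → d ℤ.+ (k ℤ.+ ℤ.- d) ≡ k
     ar4 = solve-∀
   undo₀ : ∀ {e} → g e ≡ 0ℤ → dot w e ≡ k
   undo₀ {e} q = trans (ar3 k (dot w e)) (trans (cong (ℤ._+ k) q) (ℤP.+-identityˡ k))
   undo₁ : ∀ {e} → h e ≡ 0ℤ → dot w e ≡ 1ℤ ℤ.+ k
   undo₁ {e} q = trans (ar5 k (dot w e)) (trans (cong (λ q → 1ℤ ℤ.+ k ℤ.+ ℤ.- q) q) (ℤP.+-identityʳ _))
     where
     ar5 : ∀ k d → d ≡ 1ℤ ℤ.+ k ℤ.+ ℤ.- (1ℤ ℤ.+ ℤ.- (d ℤ.+ ℤ.- k))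
     ar5 = solve-∀
   face : ∀ (f : Mon m → ℤ) c (f01 : ∀ {e} → S e → f e ≡ 0ℤ ⊎ f e ≡ 1ℤ) → (∀ {e} → f e ≡ 0ℤ → dot w e ≡ c) →
     ∀ x ws → Wts S ws → wsum ws ≡ 1ℚ → combo ws ≡ x → H f ws ≡ 0ℚ → InHull (λ e → S e × dot w e ≡ c) x
   face f c f01 undo x ws a b eq q =
     let rs , a′ , b′ , c′ = restrict f f01 ws a q
     in rs , All.map (λ { (u , s , q) → u , s , undo q }) a′ , trans b′ b , trans c′ eq
   go : j ≡ 0ℤ ⊎ j ≡ 1ℤ → y ≡ z
   -- The mean of `g` over `y` and `z`, with positive weights, is zero; so `g` vanishes at both, and
   -- both lie on the face of `p`.
   go (inj₁ q) = let zs = convex-zero p0 p1 gy gz (trans (sym jeq) (cong ι q)) in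
     se₀ p y z t s (face g k g01 undo₀ y wy ay by cy (proj₁ zs)) (face g k g01 undo₀ z wz az bz cz (proj₂ zs)) p0 p1 ts eq
   go (inj₂ q) = let zs = convex-zero p0 p1 hy hz (trans (sym 1-j) (cong (λ q → ι (1ℤ ℤ.+ ℤ.- q)) q)) in
     se₁ p y z t s (face h (1ℤ ℤ.+ k) h01 undo₁ y wy ay by cy (proj₁ zs)) (face h (1ℤ ℤ.+ k) h01 undo₁ z wz az bz cz (proj₂ zs)) p0 p1 ts eq

 SE-point : ∀ {m} {S : Mon m → Set} (e₀ : Mon m) → (∀ {e} → S e → e ≡ e₀) → SE S
 SE-point e₀ f p y z t s (wy , ay , by , refl) (wz , az , bz , refl) _ _ _ _ = trans (lem wy ay by) (sym (lem wz az bz))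
   where
   ar : ∀ {m} c s (x : Vec ℚ m) → (c ·ᵛ x) ⊕ᵛ (s ·ᵛ x) ≡ (c + s) ·ᵛ x
   ar c s [] = refl
   ar c s (x ∷ xs) = cong₂ _∷_ (sym (ℚP.*-distribʳ-+ x c s)) (ar c s xs)
   zr : ∀ {m} (x : Vec ℚ m) → Vec.replicate _ 0ℚ ≡ 0ℚ ·ᵛ x
   zr [] = refl
   zr (x ∷ xs) = cong₂ _∷_ (sym (ℚP.*-zeroˡ x)) (zr xs)
   go : ∀ ws → Wts _ ws → combo ws ≡ wsum ws ·ᵛ toQ e₀
   go [] [] = zr (toQ e₀)
   go ((c , e) ∷ ws) ((_ , s) ∷ hs) = trans (cong₂ (λ e r → (c ·ᵛ toQ e) ⊕ᵛ r) (f s) (go ws hs)) (ar c (wsum ws) (toQ e₀))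
   lem : ∀ ws → Wts _ ws → wsum ws ≡ 1ℚ → combo ws ≡ toQ e₀
   lem ws a b = trans (go ws a) (trans (cong (_·ᵛ toQ e₀) b) (one (toQ e₀)))
     where
     one : ∀ {m} (x : Vec ℚ m) → 1ℚ ·ᵛ x ≡ x
     one [] = refl
     one (x ∷ xs) = cong₂ _∷_ (ℚP.*-identityˡ x) (one xs)

 toQ-⊞ : ∀ {m} (x y : Mon m) → toQ (x ⊞ y) ≡ toQ x ⊕ᵛ toQ y
 toQ-⊞ [] [] = refl
 toQ-⊞ (x ∷ xs) (y ∷ ys) = cong₂ _∷_ (ι-+ x y) (toQ-⊞ xs ys)

 -- Serves multiplication by a monomial: translation by a lattice vector preserves the lattice and
 -- commutes with convex combinations.
 SE-shift : ∀ {m} {S : Mon m → Set} (s : Mon m) → SE S → SE (λ e → S (e ⊞ s))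
 SE-shift {m} {S} e₀ se p y z t s (wy , ay , by , refl) (wz , az , bz , refl) p0 p1 ts eq =
   cancel _ _ (toQ e₀) (trans (sym (moved wy by)) (trans main (moved wz bz)))
   where
   mv : List (ℚ × Mon m) → List (ℚ × Mon m)
   mv = map λ w → proj₁ w , proj₂ w ⊞ e₀
   ar : ∀ {m} c k (x y s : Vec ℚ m) → (c ·ᵛ (x ⊕ᵛ s)) ⊕ᵛ (y ⊕ᵛ (k ·ᵛ s)) ≡ ((c ·ᵛ x) ⊕ᵛ y) ⊕ᵛ ((c + k) ·ᵛ s)
   ar c k [] [] [] = refl
   ar c k (x ∷ xs) (y ∷ ys) (s ∷ ss) = cong₂ _∷_
     (shift-step c k x y s) (ar c k xs ys ss)
   zr : ∀ {m} (x : Vec ℚ m) → Vec.replicate _ 0ℚ ≡ Vec.replicate _ 0ℚ ⊕ᵛ (0ℚ ·ᵛ x)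
   zr [] = refl
   zr (x ∷ xs) = cong₂ _∷_ (sym (trans (ℚP.+-identityˡ _) (ℚP.*-zeroˡ x))) (zr xs)
   go : ∀ ws → combo (mv ws) ≡ combo ws ⊕ᵛ (wsum ws ·ᵛ toQ e₀)
   go [] = zr (toQ e₀)
   go ((c , e) ∷ ws) = trans (cong₂ (λ a b → (c ·ᵛ a) ⊕ᵛ b) (toQ-⊞ e e₀) (go ws)) (ar c (wsum ws) (toQ e) (combo ws) (toQ e₀))
   one : ∀ {m} (x : Vec ℚ m) → 1ℚ ·ᵛ x ≡ x
   one [] = refl
   one (x ∷ xs) = cong₂ _∷_ (ℚP.*-identityˡ x) (one xs)
   moved : ∀ ws → wsum ws ≡ 1ℚ → combo (mv ws) ≡ combo ws ⊕ᵛ toQ e₀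
   moved ws b = trans (go ws) (cong (combo ws ⊕ᵛ_) (trans (cong (_·ᵛ toQ e₀) b) (one (toQ e₀))))
   wsum-mv : ∀ ws → wsum (mv ws) ≡ wsum ws
   wsum-mv [] = refl
   wsum-mv (w ∷ ws) = cong (proj₁ w +_) (wsum-mv ws)
   all-mv : ∀ {ws} → Wts (λ e → S (e ⊞ e₀)) ws → Wts S (mv ws)
   all-mv [] = []
   all-mv (h ∷ hs) = h ∷ all-mv hs
   cancel : ∀ {m} (x y s : Vec ℚ m) → x ⊕ᵛ s ≡ y ⊕ᵛ s → x ≡ y
   cancel [] [] [] _ = refl
   cancel (x ∷ xs) (y ∷ ys) (s ∷ ss) eq = cong₂ _∷_ (trans (lem x s) (trans (cong (λ q → q + - s) (VecP.∷-injectiveˡ eq)) (sym (lem y s)))) (cancel xs ys ss (VecP.∷-injectiveʳ eq))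
     where
     lem : ∀ x s → x ≡ x + s + - s
     lem x s = sym (add-cancel x s)
   cv : ∀ {m} (y z u : Vec ℚ m) → ((t ·ᵛ y) ⊕ᵛ (s ·ᵛ z)) ⊕ᵛ u ≡ (t ·ᵛ (y ⊕ᵛ u)) ⊕ᵛ (s ·ᵛ (z ⊕ᵛ u))
   cv [] [] [] = refl
   cv (y ∷ ys) (z ∷ zs) (u ∷ us) = cong₂ _∷_
     (sym (trans (convex-shift t s y z u) (cong ((t * y + s * z) +_) (trans (cong (_* u) ts) (ℚP.*-identityˡ u))))) (cv ys zs us)
   main : combo (mv wy) ≡ combo (mv wz)
   main = se (p ⊞ e₀) _ _ t s (mv wy , all-mv ay , trans (wsum-mv wy) by , refl) (mv wz , all-mv az , trans (wsum-mv wz) bz , refl) p0 p1 ts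
     (trans (toQ-⊞ p e₀) (trans (cong (_⊕ᵛ toQ e₀) eq) (trans (cv (combo wy) (combo wz) (toQ e₀))
       (sym (cong₂ (λ a b → (t ·ᵛ a) ⊕ᵛ (s ·ᵛ b)) (moved wy by) (moved wz bz))))))

 toQ-injective : ∀ {m} {x y : Mon m} → toQ x ≡ toQ y → x ≡ y
 toQ-injective {x = []} {[]} _ = refl
 toQ-injective {x = x ∷ xs} {y ∷ ys} eq = cong₂ _∷_ (ι-injective (VecP.∷-injectiveˡ eq)) (toQ-injective (VecP.∷-injectiveʳ eq))

 midpoint-nonempty : ∀ {m} (L : LPoly m) {a b p : Mon m} → Supp L a → Supp L b → a ≢ b → p ⊞ p ≡ a ⊞ b → ¬ NewtonEmpty L
 midpoint-nonempty {m} L {a} {b} {p} sa sb ne mid empty =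
   proj₂ (empty p hull) (toQ a , toQ b , ½ , pt sa , pt sb , (λ q → ne (toQ-injective q)) , ℚP.positive⁻¹ ½ , half<1 , half)
   where
   half<1 : ½ < 1ℚ
   half<1 = ℚP.positive⁻¹ ½ ⟨+⟩ refl
     where
     _⟨+⟩_ : 0ℚ < ½ → ½ + ½ ≡ 1ℚ → ½ < 1ℚ
     h ⟨+⟩ e = subst₂ _<_ (ℚP.+-identityʳ ½) e (ℚP.+-monoʳ-< ½ h)
   one : ∀ {m} (x : Vec ℚ m) → (1ℚ ·ᵛ x) ⊕ᵛ Vec.replicate _ 0ℚ ≡ x
   one [] = refl
   one (x ∷ xs) = cong₂ _∷_ (trans (ℚP.+-identityʳ _) (ℚP.*-identityˡ x)) (one xs)
   pt : ∀ {e} → Supp L e → InHull (Supp L) (toQ e)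
   pt {e} s = (1ℚ , e) ∷ [] , (ℚP.nonNegative⁻¹ 1ℚ , s) ∷ [] , refl , one (toQ e)
   halves : ∀ {m} (p a b : Mon m) → p ⊞ p ≡ a ⊞ b → toQ p ≡ (½ ·ᵛ toQ a) ⊕ᵛ (½ ·ᵛ toQ b)
   halves [] [] [] _ = refl
   halves (p ∷ ps) (a ∷ as) (b ∷ bs) eq = cong₂ _∷_
     (trans (sym (trans (ℚP.*-distribˡ-+ ½ (ι p) (ι p)) (trans (sym (ℚP.*-distribʳ-+ (ι p) ½ ½)) (ℚP.*-identityˡ (ι p))))) (trans (cong (½ *_) (trans (sym (ι-+ p p)) (trans (cong ι (VecP.∷-injectiveˡ eq)) (ι-+ a b))))
       (ℚP.*-distribˡ-+ ½ (ι a) (ι b)))) (halves ps as bs (VecP.∷-injectiveʳ eq))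
   half : toQ p ≡ (½ ·ᵛ toQ a) ⊕ᵛ ((1ℚ ℚ.- ½) ·ᵛ toQ b)
   half = halves p a b mid
   zr : ∀ {m} (x : Vec ℚ m) → x ⊕ᵛ Vec.replicate _ 0ℚ ≡ x
   zr [] = refl
   zr (x ∷ xs) = cong₂ _∷_ (ℚP.+-identityʳ x) (zr xs)
   hull : InHull (Supp L) (toQ p)
   hull = (½ , a) ∷ (½ , b) ∷ [] , (ℚP.nonNegative⁻¹ ½ , sa) ∷ (ℚP.nonNegative⁻¹ ½ , sb) ∷ [] , refl
        , trans (cong ((½ ·ᵛ toQ a) ⊕ᵛ_) (zr (½ ·ᵛ toQ b))) (sym (halves p a b mid))

-- Newton polytopes of sums and monomial multiples

module LaurentNewtonPolytopes where
 open LaurentPolynomials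
 open NewtonPolytopes
 open RingIdentities
 open import Data.Nat using (ℕ)
 open import Data.Integer using (ℤ; _+_; _*_; -_; 0ℤ; 1ℤ)
 import Data.Integer.Properties as ℤP
 open import Data.List using (List; []; _∷_)
 open import Data.List.Relation.Unary.All using ([]; _∷_)
 open import Data.Vec using (Vec)

 constL : ∀ {m} → ℤ → LPoly m
 constL c = (c , 𝟘) ∷ []

 module _ (m : ℕ) where

   coeff-const : ∀ c (e : Mon m) → coeff (constL c) e ≡ c * δ e 𝟘
   coeff-const c e = trans (coeff-ev (constL {m} c) e) (ℤP.+-identityʳ _)

   LHom : IntHom (LRing m)
   LHom = record
     { φ = constL
     ; φ-+ = λ a b e → trans (coeff-const (a + b) e) (trans (ℤP.*-distribʳ-+ (δ e 𝟘) a b)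
         (sym (trans (coeff-+ (constL a) (constL b) e) (cong₂ _+_ (coeff-const a e) (coeff-const b e)))))
     ; φ-* = λ a b e → trans (coeff-const (a * b) e) (sym (trans (coeff-ev (constL {m} a *L constL b) e)
         (trans (ℤP.+-identityʳ _) (cong (λ z → a * b * δ e z) (⊞-identityˡ 𝟘)))))
     ; φ-neg = λ a e → trans (coeff-const (- a) e) (trans (sym (ℤP.neg-distribˡ-* a (δ e 𝟘))) (sym (trans (coeff-neg (constL {m} a) e) (cong -_ (coeff-const a e)))))
     ; φ-0 = λ e → coeff-const 0ℤ e
     ; φ-1 = λ e → refl }

 SE-≃ : ∀ {m} {P Q : LPoly m} → P ≃ Q → SE (Supp Q) → SE (Supp P)
 SE-≃ {P = P} {Q} h = SE-mono λ {e} s z → s (trans (h e) z)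

 SE-[] : ∀ {m} → SE {m} (Supp [])
 SE-[] = SE-point 𝟘 λ s → ⊥-elim (s refl)

 SE-mono* : ∀ {m} (k : Mon m) {P : LPoly m} → SE (Supp P) → SE (Supp (mono k *L P))
 SE-mono* k {P} se = SE-mono (λ {e} s z → s (trans (coeff-* (mono k) P e) (trans (ℤP.+-identityʳ _) (trans (ℤP.*-identityˡ _) z)))) (SE-shift (⊟ k) se)

 SE-monomial : ∀ {m} (k : Mon m) → SE (Supp (mono k))
 SE-monomial k = SE-point k λ {e} s → single e (supp-∈ (mono k) e s)
   where
   open import Data.List.Relation.Unary.Any using (here; there)
   open import Data.List.Membership.Propositional using (_∈_)
   open import Data.Product using (∃)
   single : ∀ e → ∃ (λ c → (c , e) ∈ mono k) → e ≡ k
   single e (_ , here refl) = refl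

 -- In adjacent degrees the summands share no exponent, so nothing cancels between them and each of
 -- the two faces lies in the support of one summand.
 SE-+ : ∀ {m} (w : Vec ℤ m) k {P Q : LPoly m} → Hom w k P → Hom w (1ℤ + k) Q → SE (Supp P) → SE (Supp Q) → SE (Supp (P +L Q))
 SE-+ w k {P} {Q} hp hq sp sq = SE-split w k which
   (SE-mono (λ { {e} (s , d) → fromP e s (λ b → k≢1+k (trans (sym d) (Hom-supp {w = w} {P = Q} hq b))) }) sp)
   (SE-mono (λ { {e} (s , d) → fromQ e s (λ a → k≢1+k (trans (sym (Hom-supp {w = w} {P = P} hp a)) d)) }) sq)
   where
   k≢1+k : k ≢ 1ℤ + k
   k≢1+k e = lem k e
     where
     open import Data.Integer.Tactic.RingSolver using (solve-∀)
     ar : ∀ k → 1ℤ + k + - k ≡ 1ℤ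
     ar = solve-∀
     lem : ∀ k → k ≢ 1ℤ + k
     lem k e with trans (sym (ℤP.+-inverseʳ k)) (trans (cong (_+ - k) e) (ar k))
     ... | ()
   fromP : ∀ e → Supp (P +L Q) e → ¬ Supp Q e → Supp P e
   fromP e s nq z with coeff Q e ℤ.≟ 0ℤ
   ... | yes q = s (trans (coeff-+ P Q e) (cong₂ _+_ z q))
   ... | no q = nq q
   fromQ : ∀ e → Supp (P +L Q) e → ¬ Supp P e → Supp Q e
   fromQ e s np z with coeff P e ℤ.≟ 0ℤ
   ... | yes p = s (trans (coeff-+ P Q e) (cong₂ _+_ p z))
   ... | no p = np p
   which : ∀ {e} → Supp (P +L Q) e → dot w e ≡ k ⊎ dot w e ≡ 1ℤ + k
   which {e} s with coeff P e ℤ.≟ 0ℤ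
   ... | no p = inj₁ (Hom-supp {w = w} {P = P} hp p)
   ... | yes p = inj₂ (Hom-supp {w = w} {P = Q} hq λ q → s (trans (coeff-+ P Q e) (cong₂ _+_ p q)))

 Hom-mono : ∀ {m} (w : Vec ℤ m) {e k} → dot w e ≡ k → Hom w k (mono e)
 Hom-mono w h = h ∷ []

 -- The recursion step: a vertex is a combination of the two ends of the arc above it.
 SE-comb : ∀ {m} (w : Vec ℤ m) {L P Q : LPoly m} (k p q : Mon m) → L ≃ (mono k *L ((mono p *L P) +L (mono q *L Q))) →
   dot w p ≡ 1ℤ → dot w q ≡ 0ℤ → Hom w 0ℤ P → Hom w 0ℤ Q → SE (Supp P) → SE (Supp Q) → SE (Supp L)
 SE-comb w {L} {P} {Q} k p q eq dp dq hp hq sp sq = SE-≃ {P = L} {mono k *L ((mono p *L P) +L (mono q *L Q))} eq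
   (SE-mono* k {(mono p *L P) +L (mono q *L Q)} (SE-≃ {P = (mono p *L P) +L (mono q *L Q)} {(mono q *L Q) +L (mono p *L P)} (+L-comm (mono p *L P) (mono q *L Q))
     (SE-+ w 0ℤ {mono q *L Q} {mono p *L P} (Hom-* {w = w} {P = mono q} {Q = Q} (Hom-mono w dq) hq) (Hom-* {w = w} {P = mono p} {Q = P} (Hom-mono w dp) hp) (SE-mono* q {Q} sq) (SE-mono* p {P} sp))))

-- Arcs in the universal cover

module UniversalCover where
 open IntegerInequalities
 open import Data.Nat using (ℕ; zero; suc)
 open import Data.Integer using (ℤ; +_; _+_; _*_; -_; _≤_; _<_; 1ℤ; ∣_∣)
 open import Data.Integer.Properties hiding (_≟_)
 open import Data.Integer.DivMod using (_%ℕ_; _/ℕ_; n%ℕd<d; a≡a%ℕn+[a/ℕn]*n)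
 open import Data.Integer.Tactic.RingSolver using (solve; solve-∀)
 open import Data.Fin using (Fin; zero; suc)
 open import Data.List using ([]; _∷_)
 open import Relation.Binary.Definitions using (tri<; tri≈; tri>)

 -- The cusp counts as the largest point. A radius is then an interval unbounded to the right, and
 -- most arguments treat it like any other arc.
 data Pt : Set where
   fin : ℤ → Pt
   ∞   : Pt

 infix 4 _≺_
 _≺_ : Pt → Pt → Set
 fin x ≺ fin y = x < y
 fin x ≺ ∞ = ⊤
 ∞ ≺ _ = ⊥

 ≺-trans : ∀ {x y z} → x ≺ y → y ≺ z → x ≺ z
 ≺-trans {fin x} {fin y} {fin z} p q = <-trans p q
 ≺-trans {fin x} {fin y} {∞} p q = tt
 ≺-trans {fin x} {∞} p ()

 data Cmp (x y : Pt) : Set where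
   lt : x ≺ y → Cmp x y
   eq : x ≡ y → Cmp x y
   gt : y ≺ x → Cmp x y

 ≺-cmp : ∀ x y → Cmp x y
 ≺-cmp (fin x) (fin y) with <-cmp x y
 ... | tri< a _ _ = lt a
 ... | tri≈ _ b _ = eq (cong fin b)
 ... | tri> _ _ c = gt c
 ≺-cmp (fin x) ∞ = lt tt
 ≺-cmp ∞ (fin y) = gt tt
 ≺-cmp ∞ ∞ = eq refl

 fin-injective : ∀ {x y} → fin x ≡ fin y → x ≡ y
 fin-injective refl = refl

 -- Two arcs of the universal cover cross, the first one starting further to the left.
 X : ℤ → Pt → ℤ → Pt → Set
 X u v u′ v′ = u < u′ × fin u′ ≺ v × v ≺ v′

 _≟ᵒ_ : (x y : OArc) → Dec (x ≡ y)
 iv i k ≟ᵒ iv j l with i ℕ.≟ j | k ℕ.≟ l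
 ... | yes refl | yes refl = yes refl
 ... | no ne | _ = no λ { refl → ne refl }
 ... | yes _ | no ne = no λ { refl → ne refl }
 iv _ _ ≟ᵒ rad _ = no λ ()
 rad _ ≟ᵒ iv _ _ = no λ ()
 rad i ≟ᵒ rad j with i ℕ.≟ j
 ... | yes refl = yes refl
 ... | no ne = no λ { refl → ne refl }

 argmax : ∀ m → .⦃ ℕ.NonZero m ⦄ → (f : Fin m → ℕ) → ∃ λ i → ∀ j → f j ℕ.≤ f i
 argmax (suc zero) f = zero , λ { zero → ℕP.≤-refl }
 argmax (suc (suc m)) f with argmax (suc m) (λ i → f (suc i))
 ... | i , h with ℕP.≤-total (f zero) (f (suc i))
 ...   | inj₁ le = suc i , λ { zero → le ; (suc j) → h j }
 ...   | inj₂ ge = zero , λ { zero → ℕP.≤-refl ; (suc j) → ℕP.≤-trans (h j) ge }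

 lenᵒ : OArc → ℕ
 lenᵒ (iv i k) = k
 lenᵒ (rad i) = 0

 module Cover (n : ℕ) (2≤n : 2 ℕ.≤ n) where

   N : ℤ
   N = + n

   instance
     n≢0 : ℕ.NonZero n
     n≢0 = ℕ.>-nonZero (ℕP.≤-trans (ℕ.s≤s ℕ.z≤n) 2≤n)

   2≤N : + 2 ≤ N
   2≤N = ℤ.+≤+ 2≤n

   sh : ℤ → Pt → Pt
   sh t (fin v) = fin (v + t * N)
   sh t ∞ = ∞

   -- A lift is a bare pair of end points, and this relation tells which arc it lifts. Crossing and
   -- nesting become inequalities between integers, and residues modulo `n` matter only when labels
   -- are compared.
   data On : OArc → ℤ → Pt → Set where
     on-iv  : ∀ {i k u v} t → u ≡ + i + t * N → v ≡ u + + k → On (iv i k) u (fin v)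
     on-rad : ∀ {i u} t → u ≡ + i + t * N → On (rad i) u ∞

   Small : OArc → Set
   Small (iv i k) = i ℕ.< n × 1 ℕ.≤ k × k ℕ.≤ n
   Small (rad i) = i ℕ.< n

   Shape : OArc → Set
   Shape (iv i k) = i ℕ.< n × 2 ℕ.≤ k × k ℕ.≤ n
   Shape (rad i) = i ℕ.< n

   Shape⇒Small : ∀ y → Shape y → Small y
   Shape⇒Small (iv i k) (a , b , c) = a , ℕP.≤-trans (ℕ.s≤s ℕ.z≤n) b , c
   Shape⇒Small (rad i) a = a

   on-shift : ∀ {y u v} t → On y u v → On y (u + t * N) (sh t v)
   on-shift t (on-iv {i} {k} s refl refl) = on-iv (s + t) (ar (+ i) s t N) (ar′ (+ i) s t N (+ k))
     where
     ar : ∀ i s t N → i + s * N + t * N ≡ i + (s + t) * N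
     ar = solve-∀
     ar′ : ∀ i s t N k → i + s * N + k + t * N ≡ i + s * N + t * N + k
     ar′ = solve-∀
   on-shift t (on-rad {i} s refl) = on-rad (s + t) (ar (+ i) s t N)
     where
     ar : ∀ i s t N → i + s * N + t * N ≡ i + (s + t) * N
     ar = solve-∀

   on-order : ∀ {y u v} → Small y → On y u v → fin u ≺ v
   on-order (_ , 1≤k , _) (on-iv {k = suc k} {u} t _ refl) = by< λ h → absurd≤ k h refl
   on-order _ (on-rad _ _) = tt

   on-len : ∀ {y u v} → Small y → On y u (fin v) → v ≤ u + N
   on-len (_ , _ , k≤n) (on-iv {u = u} t _ refl) = +-monoʳ-≤ u (ℤ.+≤+ k≤n)

   resid : ∀ {i j t t′} → i ℕ.< n → j ℕ.< n → + i + t * N ≡ + j + t′ * N → t ≡ t′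
   resid {i} {j} {t} {t′} i< j< e = sym (i-j≡0⇒i≡j t′ t (mult-small (t′ ℤ.- t) (+ i ℤ.- + j) (ar (+ i) (+ j) t t′ N e) up dn))
     where
     ar : ∀ i j t t′ N → i + t * N ≡ j + t′ * N → i ℤ.- j ≡ (t′ ℤ.- t) * N
     ar i j t t′ N e = lin≡ e (solve (i ∷ j ∷ t ∷ t′ ∷ N ∷ []))
     up : + i ℤ.- + j < + n
     up = ≤-<-trans (i≤j⇒i-k≤j (+ j) ≤-refl) (ℤ.+<+ i<)
     dn : - + n < + i ℤ.- + j
     dn = <-≤-trans (neg-mono-< (ℤ.+<+ j<)) (subst (_≤ + i ℤ.- + j) (+-identityˡ _) (+-monoˡ-≤ (- + j) (ℤ.+≤+ ℕ.z≤n)))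

   resid′ : ∀ {i j t t′} → i ℕ.< n → j ℕ.< n → + i + t * N ≡ + j + t′ * N → i ≡ j
   resid′ {i} {j} {t} {t′} i< j< e with resid {i} {j} {t} {t′} i< j< e
   ... | refl = +-injective (cancelʳ (t * N) e)

   on-unique : ∀ {y y′ u v} → Small y → Small y′ → On y u v → On y′ u v → y ≡ y′
   on-unique {iv i k} {iv j l} (a , _) (b , _) (on-iv {u = u} t e refl) (on-iv t′ e′ q) =
     cong₂ iv (resid′ {t = t} {t′} a b (trans (sym e) e′)) (+-injective (ar u (+ k) (+ l) q))
     where
     ar : ∀ u k l → u + k ≡ u + l → k ≡ l
     ar u k l e = lin≡ e (solve (u ∷ k ∷ l ∷ []))
   on-unique a b (on-rad t e) (on-rad t′ e′) = cong rad (resid′ {t = t} {t′} a b (trans (sym e) e′))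

   on-lift : ∀ {y u v u′ v′} → On y u v → On y u′ v′ → ∃ λ t → u′ ≡ u + t * N × v′ ≡ sh t v
   on-lift (on-iv {i} {k} t refl refl) (on-iv t′ refl refl) = t′ ℤ.- t , ar (+ i) t t′ N , cong fin (ar′ (+ i) t t′ N (+ k))
     where
     ar : ∀ i t t′ N → i + t′ * N ≡ i + t * N + (t′ ℤ.- t) * N
     ar = solve-∀
     ar′ : ∀ i t t′ N k → i + t′ * N + k ≡ i + t * N + k + (t′ ℤ.- t) * N
     ar′ = solve-∀
   on-lift (on-rad {i} t refl) (on-rad t′ refl) = t′ ℤ.- t , ar (+ i) t t′ N , refl
     where
     ar : ∀ i t t′ N → i + t′ * N ≡ i + t * N + (t′ ℤ.- t) * N
     ar = solve-∀

   cls : ℤ → Pt → OArc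
   cls u (fin v) = iv (u %ℕ n) ∣ v ℤ.- u ∣
   cls u ∞ = rad (u %ℕ n)

   +∣-∣ : ∀ {u v} → u ≤ v → v ≡ u + + ∣ v ℤ.- u ∣
   +∣-∣ {u} {v} le = lin≡ (sym (0≤i⇒+∣i∣≡i (i≤j⇒0≤j-i le))) (ar u v (+ ∣ v ℤ.- u ∣))
     where
     ar : ∀ u v w → v + w ≡ (u + w) + (v ℤ.- u)
     ar = solve-∀

   on-cls : ∀ {u v} → fin u ≺ v → On (cls u v) u v
   on-cls {u} {fin v} p = on-iv (u /ℕ n) (a≡a%ℕn+[a/ℕn]*n u n) (+∣-∣ (<⇒≤ p))
   on-cls {u} {∞} p = on-rad (u /ℕ n) (a≡a%ℕn+[a/ℕn]*n u n)

   abstract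
     nearest : ∀ z a → ∃ λ t → z + t * N ≤ a × a < z + t * N + N
     nearest z a = t , lo , hi
       where
       t : ℤ
       t = (a ℤ.- z) /ℕ n
       i : ℕ
       i = (a ℤ.- z) %ℕ n
       e : a ≡ z + t * N + + i
       e = ar a z (+ i) (t * N) (a≡a%ℕn+[a/ℕn]*n (a ℤ.- z) n)
         where
         ar : ∀ a z i w → a ℤ.- z ≡ i + w → a ≡ z + w + i
         ar a z i w h = lin≡ h (solve (a ∷ z ∷ i ∷ w ∷ []))
       lo : z + t * N ≤ a
       lo = subst (z + t * N ≤_) (sym e) (subst (_≤ z + t * N + + i) (+-identityʳ _) (+-monoʳ-≤ (z + t * N) (ℤ.+≤+ ℕ.z≤n)))
       hi : a < z + t * N + N
       hi = subst (_< z + t * N + N) (sym e) (+-monoʳ-< (z + t * N) (ℤ.+<+ (n%ℕd<d (a ℤ.- z) n)))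

   len-cls : ∀ {u v} → u < v → v ≤ u + N → Small (cls u (fin v))
   len-cls {u} {v} p q = n%ℕd<d u n , lower , upper
     where
     E = +∣-∣ (<⇒≤ p)
     lower : 1 ℕ.≤ ∣ v ℤ.- u ∣
     lower with ∣ v ℤ.- u ∣ | E
     ... | zero | refl = ⊥-elim (<-irrefl (sym (+-identityʳ u)) p)
     ... | suc _ | _ = ℕ.s≤s ℕ.z≤n
     upper : ∣ v ℤ.- u ∣ ℕ.≤ n
     upper = drop‿+≤+ (lem (+ ∣ v ℤ.- u ∣) E)
       where
       lem : ∀ k → v ≡ u + k → k ≤ N
       lem k refl = by≤ λ h → lem′ N h q
         where
         lem′ : ∀ N → N < k → u + k ≤ u + N → ⊥
         lem′ N h q = absurd≤ 0 (s≤ h ⊕ q) (solve (u ∷ k ∷ N ∷ []))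

   shape-cls : ∀ {u v} → 1ℤ + u < v → v ≤ u + N → Shape (cls u (fin v))
   shape-cls {u} {v} p q = n%ℕd<d u n , lower , proj₂ (proj₂ (len-cls (<-trans (n<1+n u) p) q))
     where
     E = +∣-∣ (<⇒≤ (<-trans (n<1+n u) p))
     lower : 2 ℕ.≤ ∣ v ℤ.- u ∣
     lower with ∣ v ℤ.- u ∣ | E
     ... | zero | refl = ⊥-elim (<-asym p (subst (_< 1ℤ + u) (sym (+-identityʳ u)) (n<1+n u)))
     ... | suc zero | refl = ⊥-elim (<-irrefl (+-comm 1ℤ u) p)
     ... | suc (suc _) | _ = ℕ.s≤s (ℕ.s≤s ℕ.z≤n)

-- Ideal triangulations and their tree of triangles

module IdealTriangulations where
 open IntegerInequalities
 open UniversalCover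
 open import Data.Nat using (ℕ; zero; suc)
 open import Data.Integer using (ℤ; +_; _+_; _*_; -_; _≤_; _<_; 0ℤ; 1ℤ; ∣_∣)
 open import Data.Integer.Properties hiding (_≟_)
 open import Data.Integer.DivMod using (_/ℕ_; n%ℕd<d; a≡a%ℕn+[a/ℕn]*n)
 open import Data.Integer.Tactic.RingSolver using (solve)
 open import Data.Fin using (Fin; zero; suc; _↑ˡ_; _↑ʳ_; toℕ; fromℕ<; splitAt)
 open import Data.List using ([]; _∷_)
 open import Relation.Binary.Definitions using (tri<; tri≈; tri>)

 module Triangulation (n : ℕ) (2≤n : 2 ℕ.≤ n) where
   open Cover n 2≤n

   -- The labels r ↑ʳ s are the boundary segments; O may contain one loop.
   record Ideal (r : ℕ) (O : Fin (r ℕ.+ n) → OArc) : Set where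
     field
       bnd   : ∀ s → O (r ↑ʳ s) ≡ iv (toℕ s) 1
       shape : ∀ q → Shape (O (q ↑ˡ n))
       O-inj : ∀ {ℓ ℓ′} → O ℓ ≡ O ℓ′ → ℓ ≡ ℓ′
       noX   : ∀ {ℓ ℓ′ u v u′ v′} → On (O ℓ) u v → On (O ℓ′) u′ v′ → ¬ X u v u′ v′
       maxi  : ∀ y → Shape y → ∀ {u v} → On y u v →
               (∀ {ℓ u′ v′} → On (O ℓ) u′ v′ → ¬ X u v u′ v′ × ¬ X u′ v′ u v) → ∃ λ q → O (q ↑ˡ n) ≡ y

   module Triangles {r : ℕ} {O : Fin (r ℕ.+ n) → OArc} (I : Ideal r O) where
     open Ideal I public

     Label : Set
     Label = Fin (r ℕ.+ n)

     data View : Label → Set where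
       arcˡ : ∀ q → View (q ↑ˡ n)
       bdyˡ : ∀ s → View (r ↑ʳ s)

     view : ∀ ℓ → View ℓ
     view ℓ with splitAt r ℓ in e
     ... | inj₁ q = subst View (FinP.splitAt⁻¹-↑ˡ {m = r} e) (arcˡ q)
     ... | inj₂ s = subst View (FinP.splitAt⁻¹-↑ʳ {m = r} e) (bdyˡ s)

     small : ∀ ℓ → Small (O ℓ)
     small ℓ with view ℓ
     ... | arcˡ q = Shape⇒Small _ (shape q)
     ... | bdyˡ s = subst Small (sym (bnd s)) (FinP.toℕ<n s , ℕP.≤-refl , ℕP.≤-trans (ℕ.s≤s ℕ.z≤n) 2≤n)

     Arc : ℤ → Pt → Set
     Arc u v = ∃ λ ℓ → On (O ℓ) u v

     arc-≺ : ∀ {u v} → Arc u v → fin u ≺ v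
     arc-≺ (ℓ , on) = on-order (small ℓ) on

     arc-len : ∀ {u v} → Arc u (fin v) → v ≤ u + N
     arc-len (ℓ , on) = on-len (small ℓ) on

     label-unique : ∀ {ℓ ℓ′ u v} → On (O ℓ) u v → On (O ℓ′) u v → ℓ ≡ ℓ′
     label-unique {ℓ} {ℓ′} on on′ = O-inj (on-unique (small ℓ) (small ℓ′) on on′)

     nx : ∀ {u v u′ v′} → Arc u v → Arc u′ v′ → ¬ X u v u′ v′
     nx (_ , on) (_ , on′) = noX on on′

     arc-sh : ∀ {u v} t → Arc u v → Arc (u + t * N) (sh t v)
     arc-sh t (ℓ , on) = ℓ , on-shift t on

     bdry : ∀ u → Arc u (fin (1ℤ + u))
     bdry u = r ↑ʳ fromℕ< (n%ℕd<d u n) , subst (λ y → On y u (fin (1ℤ + u))) (sym (trans (bnd _) (cong (λ i → iv i 1) (FinP.toℕ-fromℕ< (n%ℕd<d u n)))))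
       (on-iv (u /ℕ n) (a≡a%ℕn+[a/ℕn]*n u n) (+-comm 1ℤ u))

     present : ∀ {u v} → Shape (cls u v) → fin u ≺ v →
       (∀ {u′ v′} → Arc u′ v′ → ¬ X u v u′ v′ × ¬ X u′ v′ u v) → Arc u v
     present {u} {v} s p h with maxi (cls u v) s (on-cls p) (λ {ℓ} on → h (ℓ , on))
     ... | q , e = q ↑ˡ n , subst (λ y → On y u v) (sym e) (on-cls p)

     Small-cls : ∀ {u v} → Arc u v → Small (cls u v)
     Small-cls {u} {fin v} a = len-cls (arc-≺ a) (arc-len a)
     Small-cls {u} {∞} a = n%ℕd<d u n

     arc? : ∀ u v → fin u ≺ v → Dec (Arc u v)
     arc? u v p with FinP.any? (λ ℓ → O ℓ ≟ᵒ cls u v)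
     ... | yes (ℓ , e) = yes (ℓ , subst (λ y → On y u v) (sym e) (on-cls p))
     ... | no ne = no λ a → ne (proj₁ a , on-unique (small (proj₁ a)) (Small-cls a) (proj₂ a) (on-cls p))

     -- Vertices are listed in increasing order, which singles out `a₃` as the long side. An arc
     -- that is no boundary segment is the long side of one triangle (`inner`), and every arc is a
     -- short side of one (`parent`); this orders the triangles as a tree.
     record Tri (e u : ℤ) (f : Pt) : Set where
       constructor mkTri
       field
         e<u : e < u
         u≺f : fin u ≺ f
         a₁  : Arc e (fin u)
         a₂  : Arc u f
         a₃  : Arc e f

     tri-sh : ∀ {e u f} t → Tri e u f → Tri (e + t * N) (u + t * N) (sh t f)
     tri-sh t T = mkTri (+-monoˡ-< (t * N) e<u) (sh-≺ _ u≺f) (arc-sh t a₁) (arc-sh t a₂) (arc-sh t a₃)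
       where
       open Tri T
       sh-≺ : ∀ {u} f → fin u ≺ f → fin (u + t * N) ≺ sh t f
       sh-≺ (fin f) p = +-monoˡ-< (t * N) p
       sh-≺ ∞ p = tt

     u<u+k : ∀ (u : ℤ) k → 1 ℕ.≤ k → u < u + + k
     u<u+k u (suc k) _ = by< λ h → absurd≤ k h refl

     lastArc : ∀ a k₀ → 1 ℕ.≤ k₀ → ∃ λ k → 1 ℕ.≤ k × k ℕ.≤ k₀ × Arc a (fin (a + + k)) ×
       (∀ k′ → k ℕ.< k′ → k′ ℕ.≤ k₀ → ¬ Arc a (fin (a + + k′)))
     lastArc a (suc zero) _ = 1 , ℕP.≤-refl , ℕP.≤-refl , subst (λ z → Arc a (fin z)) (+-comm 1ℤ a) (bdry a) , λ k′ p q → ⊥-elim (ℕP.<⇒≱ p q)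
     lastArc a (suc (suc k₀)) _ with lastArc a (suc k₀) (ℕ.s≤s ℕ.z≤n) | arc? a (fin (a + + suc (suc k₀))) (u<u+k a _ (ℕ.s≤s ℕ.z≤n))
     ... | _ | yes arc = _ , ℕ.s≤s ℕ.z≤n , ℕP.≤-refl , arc , λ k′ p q → ⊥-elim (ℕP.<⇒≱ p q)
     ... | k , 1≤k , k≤ , arc , mx | no na = k , 1≤k , ℕP.m≤n⇒m≤1+n k≤ , arc , λ k′ p q → case k′ p (ℕP.m≤n⇒m<n∨m≡n q)
       where
       case : ∀ k′ → k ℕ.< k′ → k′ ℕ.< suc (suc k₀) ⊎ k′ ≡ suc (suc k₀) → ¬ Arc a (fin (a + + k′))
       case k′ p (inj₁ (ℕ.s≤s q)) = mx k′ p q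
       case k′ p (inj₂ refl) = na

     private
       -- `k₀` limits the search for the third vertex: a finite arc has length at most `n`, which
       -- suffices below a radius, and below a finite arc the search stops one short of its end.
       bound : ∀ {a c} → Arc a c → fin (1ℤ + a) ≺ c → ∃ λ k₀ → 1 ℕ.≤ k₀ ×
         (∀ k → k ℕ.≤ k₀ → fin (a + + k) ≺ c) × (∀ k → k ℕ.≤ n → fin (a + + k) ≺ c → k ℕ.≤ k₀)
       bound {a} {∞} _ _ = n , ℕP.≤-trans (ℕ.s≤s ℕ.z≤n) 2≤n , (λ _ _ → tt) , λ _ h _ → h
       bound {a} {fin c} (ℓ , on) p with O ℓ | on
       ... | iv i (suc (suc k)) | on-iv _ _ refl = suc k , ℕ.s≤s ℕ.z≤n
             , (λ k′ h → +-monoʳ-< a (ℤ.+<+ (ℕ.s≤s h)))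
             , λ k′ _ h → ℕ.s≤s⁻¹ (drop‿+<+ (ar a (+ k′) (+ suc (suc k)) h))
         where
         ar : ∀ a x y → a + x < a + y → x < y
         ar a x y h = by< λ g → absurd≤ 0 (s≤ h ⊕ g) (solve (a ∷ x ∷ y ∷ []))
       ... | iv i (suc zero) | on-iv _ _ refl = ⊥-elim (<-irrefl (+-comm 1ℤ a) p)
       ... | iv i zero | on-iv _ _ refl = ⊥-elim (<-asym p (subst (_< 1ℤ + a) (sym (+-identityʳ a)) (n<1+n a)))

     abstract
       -- The third vertex is the last b before c with [a,b] present: an arc crossing [b,c] would give a later one.
       inner : ∀ {a c} → Arc a c → fin (1ℤ + a) ≺ c → ∃ λ b → Tri a b c
       inner {a} {c} ac p with bound ac p
       ... | k₀ , 1≤k₀ , before , after with lastArc a k₀ 1≤k₀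
       ...   | k , 1≤k , k≤ , ab , mx = b , mkTri a<b (before k k≤) ab (second c refl) ac
         where
         b : ℤ
         b = a + + k
         a<b : a < b
         a<b = u<u+k a k 1≤k
         latest : ∀ {f} → fin b ≺ fin f → fin f ≺ c → ¬ Arc a (fin f)
         latest b<f f≺c (ℓ , on) with O ℓ | on | small ℓ
         ... | iv i k′ | on-iv t e refl | sm = mx k′ (drop‿+<+ (ar a (+ k) (+ k′) b<f)) (after k′ (proj₂ (proj₂ sm)) f≺c)
                                               (ℓ , on)
           where
           ar : ∀ a x y → a + x < a + y → x < y
           ar a x y h = by< λ g → absurd≤ 0 (s≤ h ⊕ g) (solve (a ∷ x ∷ y ∷ []))
         free : ∀ {e f} → Arc e f → ¬ X b c e f × ¬ X e f b c
         free {e} {f} ef = (λ { (p , q , r) → nx ac ef (<-trans a<b p , q , r) }) , left f ef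
           where
           left : ∀ f → Arc e f → ¬ X e f b c
           left ∞ ef (p , q , ())
           left (fin f) ef (p , q , r) with <-cmp e a
           ... | tri< e<a _ _ = nx ef ac (e<a , <-trans a<b q , r)
           ... | tri≈ _ refl _ = latest q r ef
           ... | tri> _ _ a<e = nx ab ef (a<e , p , q)
         second : ∀ c′ → c′ ≡ c → Arc b c
         second ∞ refl = present (n%ℕd<d b n) tt free
         second (fin c′) refl with <-cmp (1ℤ + b) c′
         ... | tri≈ _ refl _ = bdry b
         ... | tri> _ _ h = ⊥-elim (lem b c′ h (before k k≤))
           where
           lem : ∀ b c → c < 1ℤ + b → b < c → ⊥
           lem b c p q = absurd≤ 0 (s≤ p ⊕ s≤ q) (solve (b ∷ c ∷ []))
         ... | tri< h _ _ = present (shape-cls h (≤-trans (arc-len ac) (+-monoˡ-≤ N (<⇒≤ a<b)))) (before k k≤) free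

     Base : ℤ → Set
     Base u = Arc u ∞

     abstract
       -- The left endpoint of a longest arc lies under no arc, so it carries a radius.
       radius : ∃ Base
       radius with argmax (r ℕ.+ n) ⦃ ℕ.>-nonZero (ℕP.≤-trans (ℕP.≤-trans (ℕ.s≤s ℕ.z≤n) 2≤n) (ℕP.m≤n+m n r)) ⦄ (λ ℓ → lenᵒ (O ℓ))
       ... | j , mx with O j in ej
       ...   | rad i = + i + 0ℤ * N , j , subst (λ y → On y _ ∞) (sym ej) (on-rad 0ℤ refl)
       ...   | iv i k = u , present (n%ℕd<d u n) tt λ {e} {f} a → (λ { (_ , _ , ()) }) , left f a
         where
         u : ℤ
         u = + i + 0ℤ * N
         uv : Arc u (fin (u + + k))
         uv = j , subst (λ y → On y u (fin (u + + k))) (sym ej) (on-iv 0ℤ refl refl)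
         left : ∀ {e} f → Arc e f → ¬ X e f u ∞
         left ∞ a (_ , _ , ())
         left {e} (fin f) a@(ℓ , on) (p , q , _) = nx a uv (p , q , shorter (O ℓ) on (mx ℓ))
           where
           lem : ∀ e u k k′ → k′ ≤ k → e < u → u + k ≤ e + k′ → ⊥
           lem e u k k′ a b c = absurd≤ 0 (a ⊕ s≤ b ⊕ c) (solve (e ∷ u ∷ k ∷ k′ ∷ []))
           shorter : ∀ y → On y e (fin f) → lenᵒ y ℕ.≤ k → f < u + + k
           shorter (iv i′ k′) (on-iv _ _ refl) h = by< (lem e u (+ k) (+ k′) (ℤ.+≤+ h) p)

     baseBelow : ∀ a → ∃ λ e → Base e × e ≤ a
     baseBelow a with radius
     ... | z , b with nearest z a
     ...   | t , lo , _ = z + t * N , arc-sh t b , lo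

     -- The two consecutive radii around a vertex, together with the triangle they bound.
     slot′ : ∀ u → ∃₂ λ s t → Tri s t ∞ × s ≤ u × u < t
     slot′ u with baseBelow u
     -- Each triangle at the puncture moves the radius at least one step to the right, so the
     -- distance to `u` is enough fuel.
     ... | e , b , e≤u = go ∣ u ℤ.- e ∣ e b e≤u (≤-reflexive (+∣-∣ e≤u))
       where
       go : ∀ g e → Base e → e ≤ u → u ≤ e + + g → ∃₂ λ s t → Tri s t ∞ × s ≤ u × u < t
       go g e b e≤u fuel with inner b tt
       ... | d , T with <-cmp u d
       ...   | tri< u<d _ _ = e , d , T , e≤u , u<d
       go zero e b e≤u fuel | d , T | tri≈ _ refl _ = ⊥-elim (<-irrefl refl (<-≤-trans (Tri.e<u T) (subst (d ≤_) (+-identityʳ e) fuel)))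
       go zero e b e≤u fuel | d , T | tri> _ _ d<u = ⊥-elim (<-irrefl refl (<-≤-trans (<-trans (Tri.e<u T) d<u) (subst (u ≤_) (+-identityʳ e) fuel)))
       go (suc g) e b e≤u fuel | d , T | tri≈ _ u≡d _ = go g d (Tri.a₂ T) (≤-reflexive (sym u≡d)) (lem u d e (+ g) (Tri.e<u T) fuel)
         where
         lem : ∀ u d e g → e < d → u ≤ e + (1ℤ + g) → u ≤ d + g
         lem u d e g a b = by≤ λ h → absurd≤ 0 (s≤ a ⊕ b ⊕ s≤ h) (solve (u ∷ d ∷ e ∷ g ∷ []))
       go (suc g) e b e≤u fuel | d , T | tri> _ _ d<u = go g d (Tri.a₂ T) (<⇒≤ d<u) (lem u d e (+ g) (Tri.e<u T) fuel)
         where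
         lem : ∀ u d e g → e < d → u ≤ e + (1ℤ + g) → u ≤ d + g
         lem u d e g a b = by≤ λ h → absurd≤ 0 (s≤ a ⊕ b ⊕ s≤ h) (solve (u ∷ d ∷ e ∷ g ∷ []))

     abstract
       slot : ∀ u → ∃₂ λ s t → Tri s t ∞ × s ≤ u × u < t
       slot = slot′

     not-under : ∀ {u e f} → Base u → Arc e (fin f) → e < u → ¬ (u < f)
     not-under b a p q = nx a b (p , q , tt)

     private
       gap : ∀ {e a b} → e < a → a < b → 1ℤ + e < b
       gap {e} {a} {b} p q = by< λ h → absurd≤ 0 (s≤ p ⊕ s≤ q ⊕ h) (solve (e ∷ a ∷ b ∷ []))
       fuelˡ : ∀ {f d} e g → e < d → f ≤ e + (1ℤ + g) → f ≤ d + g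
       fuelˡ {f} {d} e g a b = by≤ λ h → absurd≤ 0 (s≤ a ⊕ b ⊕ s≤ h) (solve (f ∷ d ∷ e ∷ g ∷ []))
       fuelʳ : ∀ {f d} e g → d < f → f ≤ e + (1ℤ + g) → d ≤ e + g
       fuelʳ {f} {d} e g a b = by≤ λ h → absurd≤ 0 (s≤ a ⊕ b ⊕ s≤ h) (solve (f ∷ d ∷ e ∷ g ∷ []))
       fuel0 : ∀ {e f} → e < f → ¬ (f ≤ e + 0ℤ)
       fuel0 {e} {f} p q = <-irrefl refl (<-≤-trans p (subst (f ≤_) (+-identityʳ e) q))

     -- The triangle below which a vertex lies.
     data Parent (a : ℤ) (b : Pt) : Set where
       first  : ∀ {b′ c} → b ≡ fin b′ → Tri a b′ c → Parent a b
       second : ∀ {d} → Tri d a b → Parent a b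

     private
       -- Descent from an arc `[e , f]` that properly contains `[a , b]`. Its third vertex cannot
       -- lie strictly between `a` and `b`, as a side would cross `[a , b]`; hence `[a , b]` is a
       -- short side or lies in one, and the length of `[e , f]` drops.
       parentIn : ∀ {a b} → Arc a (fin b) → ∀ g e f → Arc e (fin f) → e ≤ a → b ≤ f → (e < a ⊎ b < f) → f ≤ e + + g → Parent a (fin b)
       parentIn {a} {b} ab zero e f ef p q _ fuel = ⊥-elim (fuel0 {e} {f} (≤-<-trans p (<-≤-trans (arc-≺ ab) q)) fuel)
       parentIn {a} {b} ab (suc g) e f ef p q st fuel with inner ef (room st)
         where
         room : e < a ⊎ b < f → 1ℤ + e < f
         room (inj₁ h) = gap h (<-≤-trans (arc-≺ ab) q)
         room (inj₂ h) = gap (≤-<-trans p (arc-≺ ab)) h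
       ... | d , T with <-cmp d a
       ...   | tri< h _ _ = parentIn ab g d f (Tri.a₂ T) (<⇒≤ h) q (inj₁ h) (fuelˡ e (+ g) (Tri.e<u T) fuel)
       ...   | tri≈ _ refl _ with <-cmp b f
       ...     | tri≈ _ refl _ = second T
       ...     | tri< h _ _ = parentIn ab g d f (Tri.a₂ T) ≤-refl q (inj₂ h) (fuelˡ e (+ g) (Tri.e<u T) fuel)
       ...     | tri> _ _ h = ⊥-elim (<⇒≱ h q)
       parentIn {a} {b} ab (suc g) e f ef p q st fuel | d , T | tri> _ _ a<d with <-cmp d b
       ... | tri< d<b _ _ = ⊥-elim (clash st)
         where
         clash : e < a ⊎ b < f → ⊥
         clash (inj₁ h) = nx (Tri.a₁ T) ab (h , a<d , d<b)
         clash (inj₂ h) = nx ab (Tri.a₂ T) (a<d , d<b , h)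
       ... | tri> _ _ b<d = parentIn ab g e d (Tri.a₁ T) p (<⇒≤ b<d) (inj₂ b<d) (fuelʳ e (+ g) (Tri.u≺f T) fuel)
       ... | tri≈ _ refl _ with <-cmp e a
       ...   | tri< h _ _ = parentIn ab g e d (Tri.a₁ T) p ≤-refl (inj₁ h) (fuelʳ e (+ g) (Tri.u≺f T) fuel)
       ...   | tri≈ _ refl _ = first refl T
       ...   | tri> _ _ h = ⊥-elim (<⇒≱ h p)

     private
      parent′ : ∀ {a b} → Arc a b → Parent a b
      -- A vertex with a radius lies under no arc, so the gap between consecutive radii that
      -- contains `a - 1` has to end at `a`.
      parent′ {a} {∞} ra with slot (a ℤ.- 1ℤ)
      ... | s , t , T , lo , hi with <-cmp a t
      ...   | tri< a<t _ _ = ⊥-elim (not-under ra (Tri.a₁ T) (lem a s lo) a<t)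
        where
        lem : ∀ a s → s ≤ a ℤ.- 1ℤ → s < a
        lem a s h = by< λ k → absurd≤ 0 (h ⊕ k) (solve (a ∷ s ∷ []))
      ...   | tri≈ _ refl _ = second T
      ...   | tri> _ _ t<a = ⊥-elim (lem a t t<a hi)
        where
        lem : ∀ a t → t < a → a ℤ.- 1ℤ < t → ⊥
        lem a t h k = absurd≤ 0 (s≤ h ⊕ s≤ k) (solve (a ∷ t ∷ []))
      parent′ {a} {fin b} ab with slot a
      ... | s , t , T , s≤a , a<t with <-cmp b t
      ...   | tri> _ _ t<b = ⊥-elim (not-under (Tri.a₂ T) ab a<t t<b)
      ...   | tri< b<t _ _ = parentIn ab _ s t (Tri.a₁ T) s≤a (<⇒≤ b<t) (inj₂ b<t) (≤-reflexive (+∣-∣ (<⇒≤ (Tri.e<u T))))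
      ...   | tri≈ _ refl _ with <-cmp s a
      ...     | tri≈ _ refl _ = first refl T
      ...     | tri< s<a _ _ = parentIn ab _ s t (Tri.a₁ T) s≤a ≤-refl (inj₁ s<a) (≤-reflexive (+∣-∣ (<⇒≤ (Tri.e<u T))))
      ...     | tri> _ _ h = ⊥-elim (<⇒≱ h s≤a)

     abstract
       parent : ∀ {a b} → Arc a b → Parent a b
       parent = parent′

     inner-unique : ∀ {a b b′ c} → Tri a b c → Tri a b′ c → b ≡ b′
     inner-unique {a} {b} {b′} T T′ with <-cmp b b′
     ... | tri< h _ _ = ⊥-elim (nx (Tri.a₁ T′) (Tri.a₂ T) (Tri.e<u T , h , Tri.u≺f T′))
     ... | tri≈ _ h _ = h
     ... | tri> _ _ h = ⊥-elim (nx (Tri.a₁ T) (Tri.a₂ T′) (Tri.e<u T′ , h , Tri.u≺f T))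

     first-unique : ∀ {a b c c′} → Tri a b c → Tri a b c′ → c ≡ c′
     first-unique {c = c} {c′} T T′ with ≺-cmp c c′
     ... | lt h = ⊥-elim (nx (Tri.a₃ T) (Tri.a₂ T′) (Tri.e<u T , Tri.u≺f T , h))
     ... | eq h = h
     ... | gt h = ⊥-elim (nx (Tri.a₃ T′) (Tri.a₂ T) (Tri.e<u T′ , Tri.u≺f T′ , h))

     second-unique : ∀ {e e′ u f} → Tri e u f → Tri e′ u f → e ≡ e′
     second-unique {e} {e′} T T′ with <-cmp e e′
     ... | tri< h _ _ = ⊥-elim (nx (Tri.a₁ T) (Tri.a₃ T′) (h , Tri.e<u T′ , Tri.u≺f T))
     ... | tri≈ _ h _ = h
     ... | tri> _ _ h = ⊥-elim (nx (Tri.a₁ T′) (Tri.a₃ T) (h , Tri.e<u T , Tri.u≺f T′))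

     -- Together with `first-unique` and `second-unique`: the triangle above an arc is unique, and
     -- so is the role of the arc in it.
     first-second : ∀ {d a b c} → Tri a b c → ¬ Tri d a (fin b)
     first-second T T′ = nx (Tri.a₃ T′) (Tri.a₃ T) (Tri.e<u T′ , Tri.e<u T , Tri.u≺f T)

     -- This makes the coordinates of a vertex independent of the way in which it is reached from
     -- the radii.
     apex-unique : ∀ {e e′ u f f′} → Tri e u (fin f) → Tri e′ u (fin f′) → e ≡ e′ × f ≡ f′
     apex-unique {e} {e′} {u} {f} {f′} T T′ with <-cmp e e′ | <-cmp f f′
     ... | tri< h _ _ | _ = ⊥-elim (nx (Tri.a₁ T) (Tri.a₃ T′) (h , Tri.e<u T′ , Tri.u≺f T′))
     ... | tri> _ _ h | _ = ⊥-elim (nx (Tri.a₁ T′) (Tri.a₃ T) (h , Tri.e<u T , Tri.u≺f T))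
     ... | tri≈ _ h _ | tri≈ _ k _ = h , k
     ... | tri≈ _ refl _ | tri< k _ _ = ⊥-elim (nx (Tri.a₃ T) (Tri.a₂ T′) (Tri.e<u T , Tri.u≺f T , k))
     ... | tri≈ _ refl _ | tri> _ _ k = ⊥-elim (nx (Tri.a₃ T′) (Tri.a₂ T) (Tri.e<u T′ , Tri.u≺f T′ , k))

-- Decorated vectors and λ-lengths

module DecoratedVectors where
 open IntegerInequalities
 open UniversalCover
 open IdealTriangulations
 open RingIdentities
 open import Level using (0ℓ)
 open import Data.Nat using (ℕ; zero; suc)
 open import Data.Integer using (ℤ; +_; -[1+_]; _+_; _*_; -_; _≤_; _<_; 0ℤ; 1ℤ; ∣_∣)
 open import Data.Integer.Properties hiding (_≟_)
 open import Data.Integer.Tactic.RingSolver using (solve; solve-∀)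
 open import Data.Fin using (Fin)
 open import Data.List using ([]; _∷_)
 open import Relation.Binary.Definitions using (tri<; tri≈; tri>)

 record LengthData : Set₁ where
   constructor lengths
   field
     n : ℕ
     2≤n : 2 ℕ.≤ n
     {r} : ℕ
     {O} : Fin (r ℕ.+ n) → OArc
     I : Triangulation.Ideal n 2≤n r O
     R : CommutativeRing 0ℓ 0ℓ
     hom : IntHom R
     M M⁻ : Fin (r ℕ.+ n) → CommutativeRing.Carrier R
     M-inv : ∀ ℓ → CommutativeRing._≈_ R (CommutativeRing._*_ R (M ℓ) (M⁻ ℓ)) (CommutativeRing.1# R)

 module LambdaLengths (Ω : LengthData) where
   open LengthData Ω


   open Cover n 2≤n
   open Triangulation n 2≤n hiding (Ideal)
   open Triangles I
   private module R = CommutativeRing R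
   open R using (Carrier; _≈_; 0#; 1#) renaming (_+_ to infixl 6 _⊹_; _*_ to infixl 7 _⋆_; -_ to infix 8 ⊖_)
   private module Id = IntRingIdentities R hom
   open import Relation.Binary.Reasoning.Setoid R.setoid

   -- A derivation records the triangles over a vertex up to the radii. Structural recursion on it
   -- is recursion up the tree and replaces a termination measure.
   data Vert : ℤ → Set where
     base : ∀ {u} → Base u → Vert u
     apex : ∀ {e u f} → Tri e u (fin f) → Vert e → Vert f → Vert u

   private
     gap : ∀ {e a b} → e < a → a < b → 1ℤ + e < b
     gap {e} {a} {b} p q = by< λ h → absurd≤ 0 (s≤ p ⊕ s≤ q ⊕ h) (solve (e ∷ a ∷ b ∷ []))
     fuelˡ : ∀ {f d} e g → e < d → f ≤ e + (1ℤ + g) → f ≤ d + g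
     fuelˡ {f} {d} e g a b = by≤ λ h → absurd≤ 0 (s≤ a ⊕ b ⊕ s≤ h) (solve (f ∷ d ∷ e ∷ g ∷ []))
     fuelʳ : ∀ {f d} e g → d < f → f ≤ e + (1ℤ + g) → d ≤ e + g
     fuelʳ {f} {d} e g a b = by≤ λ h → absurd≤ 0 (s≤ a ⊕ b ⊕ s≤ h) (solve (f ∷ d ∷ e ∷ g ∷ []))

     vertIn : ∀ {u} g e f → Arc e (fin f) → Vert e → Vert f → e < u → u < f → f ≤ e + + g → Vert u
     vertIn zero e f a ve vf p q fuel = ⊥-elim (<-irrefl refl (<-≤-trans (<-trans p q) (subst (f ≤_) (+-identityʳ e) fuel)))
     vertIn {u} (suc g) e f a ve vf p q fuel with inner a (gap p q)
     ... | d , T with <-cmp u d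
     ...   | tri< h _ _ = vertIn g e d (Tri.a₁ T) ve (apex T ve vf) p h (fuelʳ e (+ g) (Tri.u≺f T) fuel)
     ...   | tri≈ _ refl _ = apex T ve vf
     ...   | tri> _ _ h = vertIn g d f (Tri.a₂ T) (apex T ve vf) vf h q (fuelˡ e (+ g) (Tri.e<u T) fuel)

   abstract
     vert : ∀ u → Vert u
     vert u with slot u
     ... | s , t , T , s≤u , u<t with <-cmp s u
     ...   | tri< h _ _ = vertIn _ s t (Tri.a₁ T) (base (Tri.a₃ T)) (base (Tri.a₂ T)) h u<t (≤-reflexive (+∣-∣ (<⇒≤ (Tri.e<u T))))
     ...   | tri≈ _ refl _ = base (Tri.a₃ T)
     ...   | tri> _ _ h = ⊥-elim (<⇒≱ h s≤u)

   -- Horocyclic length of the boundary between the radius at z and the next one.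
   wtT : ∀ {z t} → Tri z t ∞ → Carrier
   wtT T = M (proj₁ (Tri.a₁ T)) ⋆ (M⁻ (proj₁ (Tri.a₃ T)) ⋆ M⁻ (proj₁ (Tri.a₂ T)))

   base? : ∀ z → Dec (Base z)
   base? z = arc? z ∞ tt

   same : ∀ {A : Set} (f : Label → A) {u v} (a a′ : Arc u v) → f (proj₁ a) ≡ f (proj₁ a′)
   same f a a′ = cong f (label-unique (proj₂ a) (proj₂ a′))

   wtT-unique : ∀ {z t t′} (T : Tri z t ∞) (T′ : Tri z t′ ∞) → wtT T ≡ wtT T′
   wtT-unique T T′ with inner-unique T T′
   ... | refl = cong₂ _⋆_ (same M (Tri.a₁ T) (Tri.a₁ T′)) (cong₂ _⋆_ (same M⁻ (Tri.a₃ T) (Tri.a₃ T′)) (same M⁻ (Tri.a₂ T) (Tri.a₂ T′)))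

   wt : ℤ → Carrier
   wt z with base? z
   ... | yes b = wtT (proj₂ (inner b tt))
   ... | no _ = 0#

   wt-base : ∀ {z t} (T : Tri z t ∞) → wt z ≡ wtT T
   wt-base {z} T with base? z
   ... | yes b = wtT-unique (proj₂ (inner b tt)) T
   ... | no nb = ⊥-elim (nb (Tri.a₃ T))

   wt-other : ∀ {z} → ¬ Base z → wt z ≡ 0#
   wt-other {z} nb with base? z
   ... | yes b = ⊥-elim (nb b)
   ... | no _ = refl

   unshift : ∀ {u v} t → Arc (u + t * N) (sh t v) → Arc u v
   unshift {u} {v} t a = subst₂ Arc (ar u t N) (shsh v) (arc-sh (- t) a)
     where
     ar : ∀ u t N → u + t * N + - t * N ≡ u
     ar = solve-∀
     shsh : ∀ v → sh (- t) (sh t v) ≡ v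
     shsh (fin v) = cong fin (ar v t N)
     shsh ∞ = refl

   wt-per : ∀ z → wt (z + 1ℤ * N) ≡ wt z
   wt-per z = go (base? z)
     where
     go : Dec (Base z) → wt (z + 1ℤ * N) ≡ wt z
     go (yes b) = trans (wt-base (tri-sh 1ℤ (proj₂ (inner b tt)))) (sym (wt-base (proj₂ (inner b tt))))
     go (no nb) = trans (wt-other λ b → nb (unshift {v = ∞} 1ℤ b)) (sym (wt-other nb))

   sumW : ℤ → ℕ → Carrier
   sumW s zero = 0#
   sumW s (suc k) = sumW s k ⊹ wt (s + + k)

   sumW-front : ∀ s k → sumW s (suc k) ≈ wt s ⊹ sumW (1ℤ + s) k
   sumW-front s zero = begin
     0# ⊹ wt (s + 0ℤ)  ≡⟨ cong (λ z → 0# ⊹ wt z) (+-identityʳ s) ⟩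
     0# ⊹ wt s         ≈⟨ R.+-comm 0# (wt s) ⟩
     wt s ⊹ 0#         ∎
   sumW-front s (suc k) = begin
     sumW s (suc k) ⊹ wt (s + + suc k)               ≈⟨ R.+-cong (sumW-front s k) (R.reflexive (cong wt (ar s (+ k)))) ⟩
     (wt s ⊹ sumW (1ℤ + s) k) ⊹ wt (1ℤ + s + + k)   ≈⟨ R.+-assoc _ _ _ ⟩
     wt s ⊹ sumW (1ℤ + s) (suc k)                    ∎
     where
     ar : ∀ s k → s + (1ℤ + k) ≡ 1ℤ + s + k
     ar = solve-∀

   -- Horocyclic coordinate of the vertex u, measured from the vertex 0.
   rr : ℤ → Carrier
   rr (+ k) = sumW 0ℤ k
   rr -[1+ k ] = ⊖ sumW -[1+ k ] (suc k)

   rr-step : ∀ u → rr (1ℤ + u) ≈ rr u ⊹ wt u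
   rr-step (+ k) = R.refl
   rr-step -[1+ zero ] = R.sym (begin
     ⊖ (0# ⊹ wt -[1+ 0 ]) ⊹ wt -[1+ 0 ]  ≈⟨ R.+-cong (R.-‿cong (R.+-identityˡ _)) R.refl ⟩
     ⊖ wt -[1+ 0 ] ⊹ wt -[1+ 0 ]         ≈⟨ R.-‿inverseˡ _ ⟩
     0#                                  ∎)
   rr-step -[1+ suc k ] = begin
     ⊖ sumW -[1+ k ] (suc k)  ≈⟨ Id.neg-front (wt -[1+ suc k ]) (sumW -[1+ k ] (suc k)) ⟩
     ⊖ (wt -[1+ suc k ] ⊹ sumW -[1+ k ] (suc k)) ⊹ wt -[1+ suc k ]
       ≈⟨ R.+-cong (R.-‿cong (R.sym (sumW-front -[1+ suc k ] (suc k)))) R.refl ⟩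
     ⊖ sumW -[1+ suc k ] (suc (suc k)) ⊹ wt -[1+ suc k ] ∎

   rr-+ : ∀ u k → rr (u + + k) ≈ rr u ⊹ sumW u k
   rr-+ u zero = R.trans (R.reflexive (cong rr (+-identityʳ u))) (R.sym (R.+-identityʳ (rr u)))
   rr-+ u (suc k) = begin
     rr (u + + suc k)                    ≡⟨ cong rr (ar u (+ k)) ⟩
     rr (1ℤ + (u + + k))                 ≈⟨ rr-step (u + + k) ⟩
     rr (u + + k) ⊹ wt (u + + k)         ≈⟨ R.+-cong (rr-+ u k) R.refl ⟩
     rr u ⊹ sumW u k ⊹ wt (u + + k)      ≈⟨ R.+-assoc _ _ _ ⟩
     rr u ⊹ sumW u (suc k)               ∎
     where
     ar : ∀ u k → u + (1ℤ + k) ≡ 1ℤ + (u + k)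
     ar = solve-∀

   c : Carrier
   c = sumW 0ℤ n

   -- Prepending the weight at `u` to the one side and appending the equal weight at `u + N` to the
   -- other gives the same `n + 1` weights. Hence `c` is the length of a full turn from any starting
   -- vertex.
   sumW-rot : ∀ u → sumW (1ℤ + u) n ≈ sumW u n
   sumW-rot u = Id.cancelˡ (wt u) _ _ (begin
     wt u ⊹ sumW (1ℤ + u) n   ≈⟨ sumW-front u n ⟨
     sumW u n ⊹ wt (u + N)    ≡⟨ cong (sumW u n ⊹_) (trans (cong (λ z → wt (u + z)) (sym (*-identityˡ N))) (wt-per u)) ⟩
     sumW u n ⊹ wt u          ≈⟨ R.+-comm _ _ ⟩
     wt u ⊹ sumW u n          ∎)

   sumW-c : ∀ u → sumW u n ≈ c
   sumW-c (+ zero) = R.refl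
   sumW-c (+ suc k) = R.trans (sumW-rot (+ k)) (sumW-c (+ k))
   sumW-c -[1+ zero ] = R.sym (sumW-rot -[1+ 0 ])
   sumW-c -[1+ suc k ] = R.trans (R.sym (sumW-rot -[1+ suc k ])) (sumW-c -[1+ k ])

   rr-per : ∀ u → rr (u + 1ℤ * N) ≈ rr u ⊹ c
   rr-per u = begin
     rr (u + 1ℤ * N)   ≡⟨ cong (λ z → rr (u + z)) (*-identityˡ N) ⟩
     rr (u + N)        ≈⟨ rr-+ u n ⟩
     rr u ⊹ sumW u n   ≈⟨ R.+-cong R.refl (sumW-c u) ⟩
     rr u ⊹ c          ∎

   -- The Ptolemy relation solved for the apex: the three vectors of a triangle in rank two are
   -- dependent, with coefficients given by the opposite sides.
   combine : ∀ {e u f} → Tri e u f → Carrier → Carrier → Carrier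
   combine T y z = M⁻ (proj₁ (Tri.a₃ T)) ⋆ (M (proj₁ (Tri.a₂ T)) ⋆ y ⊹ M (proj₁ (Tri.a₁ T)) ⋆ z)

   combine-≈ : ∀ {e u f} (T : Tri e u f) {y y′ z z′} → y ≈ y′ → z ≈ z′ → combine T y z ≈ combine T y′ z′
   combine-≈ T p q = R.*-cong R.refl (R.+-cong (R.*-cong R.refl p) (R.*-cong R.refl q))

   combine-unique : ∀ {e u f} (T T′ : Tri e u f) {y y′ z z′} → y ≡ y′ → z ≡ z′ → combine T y z ≡ combine T′ y′ z′
   combine-unique T T′ refl refl = cong₂ _⋆_ (same M⁻ (Tri.a₃ T) (Tri.a₃ T′))
     (cong₂ _⊹_ (cong (_⋆ _) (same M (Tri.a₂ T) (Tri.a₂ T′))) (cong (_⋆ _) (same M (Tri.a₁ T) (Tri.a₁ T′))))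

   -- The two coordinates of the decorated vector. `xd` is the λ-length to the puncture; at a vertex
   -- with a radius, `ad` is `xd` times the horocyclic coordinate.
   xd ad : ∀ {u} → Vert u → Carrier
   xd (base b) = M (proj₁ b)
   xd (apex T de df) = combine T (xd de) (xd df)
   ad {u} (base b) = rr u ⋆ M (proj₁ b)
   ad (apex T de df) = combine T (ad de) (ad df)

   -- The length of the arc under which the vertex hangs, that is, its height in the tree. A vertex
   -- with a radius gets `1 + N`, more than any finite arc, so that heights strictly increase along
   -- a derivation.
   len : ∀ {u} → Vert u → ℤ
   len (base _) = 1ℤ + N
   len (apex {e} {u} {f} _ _ _) = f ℤ.- e

   base-apex : ∀ {e u f} → Base u → ¬ Tri e u (fin f)
   base-apex b T = not-under b (Tri.a₃ T) (Tri.e<u T) (Tri.u≺f T)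

   -- Triangles over a vertex are unique by `apex-unique`. Periodicity follows from this by
   -- comparing the derivation at `u + N` with the translated one.
   irr : ∀ {u} (d d′ : Vert u) → xd d ≡ xd d′ × ad d ≡ ad d′ × len d ≡ len d′
   irr {u} (base b) (base b′) = same M b b′ , cong (rr u ⋆_) (same M b b′) , refl
   irr (base b) (apex T _ _) = ⊥-elim (base-apex b T)
   irr (apex T _ _) (base b) = ⊥-elim (base-apex b T)
   irr (apex T de df) (apex T′ de′ df′) with apex-unique T T′
   ... | refl , refl with irr de de′ | irr df df′
   ...   | p , q , _ | p′ , q′ , _ = combine-unique T T′ p p′ , combine-unique T T′ q q′ , refl

   vsh : ∀ {u} t → Vert u → Vert (u + t * N)
   vsh t (base b) = base (arc-sh t b)
   vsh t (apex T de df) = apex (tri-sh t T) (vsh t de) (vsh t df)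

   len-vsh : ∀ {u} t (d : Vert u) → len (vsh t d) ≡ len d
   len-vsh t (base b) = refl
   len-vsh t (apex {e} {u} {f} T de df) = ar f e t N
     where
     ar : ∀ f e t N → f + t * N ℤ.- (e + t * N) ≡ f ℤ.- e
     ar = solve-∀

   xd-vsh : ∀ {u} t (d : Vert u) → xd (vsh t d) ≡ xd d
   xd-vsh t (base b) = refl
   xd-vsh t (apex T de df) = cong₂ (combine T) (xd-vsh t de) (xd-vsh t df)

   ad-vsh : ∀ {u} (d : Vert u) → ad (vsh 1ℤ d) ≈ ad d ⊹ c ⋆ xd d
   ad-vsh {u} (base b) = R.trans (R.*-cong (rr-per u) R.refl) (R.distribʳ _ _ _)
   ad-vsh (apex T de df) = R.trans (combine-≈ T (ad-vsh de) (ad-vsh df)) (Id.per-step c _ _ _ (xd de) (ad de) (xd df) (ad df))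

   xV aV : ℤ → Carrier
   xV u = xd (vert u)
   aV u = ad (vert u)

   xV-per : ∀ u → xV (u + 1ℤ * N) ≡ xV u
   xV-per u = trans (proj₁ (irr (vert (u + 1ℤ * N)) (vsh 1ℤ (vert u)))) (xd-vsh 1ℤ (vert u))

   aV-per : ∀ u → aV (u + 1ℤ * N) ≈ aV u ⊹ c ⋆ xV u
   aV-per u = R.trans (R.reflexive (proj₁ (proj₂ (irr (vert (u + 1ℤ * N)) (vsh 1ℤ (vert u)))))) (ad-vsh (vert u))

   Dt : Carrier → Carrier → Carrier → Carrier → Carrier
   Dt x a y b = x ⋆ b ⊹ ⊖ (a ⋆ y)

   Dt-≈ : ∀ {x x′ a a′ y y′ b b′} → x ≈ x′ → a ≈ a′ → y ≈ y′ → b ≈ b′ → Dt x a y b ≈ Dt x′ a′ y′ b′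
   Dt-≈ p q s t = R.+-cong (R.*-cong p t) (R.-‿cong (R.*-cong q s))

   -- λ-lengths; κ scales the vector at the puncture (κ = 1 for one tagging of the radii, κ = c for the other).
   P : Carrier → ℤ → Pt → Carrier
   P κ u (fin v) = Dt (xV u) (aV u) (xV v) (aV v)
   P κ u ∞ = Dt (xV u) (aV u) 0# κ

   P-∞ : ∀ κ u → P κ u ∞ ≈ κ ⋆ xV u
   P-∞ κ u = begin
     xV u ⋆ κ ⊹ ⊖ (aV u ⋆ 0#)  ≈⟨ R.+-cong (R.*-comm _ _) (R.-‿cong (R.zeroʳ _)) ⟩
     κ ⋆ xV u ⊹ ⊖ 0#           ≈⟨ R.+-cong R.refl -0≈0 ⟩
     κ ⋆ xV u ⊹ 0#             ≈⟨ R.+-identityʳ _ ⟩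
     κ ⋆ xV u                  ∎
     where
     -0≈0 : ⊖ 0# ≈ 0#
     -0≈0 = R.trans (R.sym (R.+-identityʳ _)) (R.-‿inverseˡ 0#)

   ptolemy : ∀ κ a b c d → P κ a (fin c) ⋆ P κ b d ≈ P κ a (fin b) ⋆ P κ c d ⊹ P κ a d ⋆ P κ b (fin c)
   ptolemy κ a b c (fin d) = Id.plücker (xV a) (aV a) (xV b) (aV b) (xV c) (aV c) (xV d) (aV d)
   ptolemy κ a b c ∞ = Id.plücker (xV a) (aV a) (xV b) (aV b) (xV c) (aV c) 0# κ

   P-self : ∀ κ u → P κ u (fin u) ≈ 0#
   P-self κ u = Id.D-self (xV u) (aV u)

   xV-apex : ∀ {e u f} (T : Tri e u (fin f)) → xV u ≡ combine T (xV e) (xV f)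
   xV-apex {e} {u} {f} T = proj₁ (irr (vert u) (apex T (vert e) (vert f)))

   aV-apex : ∀ {e u f} (T : Tri e u (fin f)) → aV u ≡ combine T (aV e) (aV f)
   aV-apex {e} {u} {f} T = proj₁ (proj₂ (irr (vert u) (apex T (vert e) (vert f))))

   xV-base : ∀ {u} (b : Base u) → xV u ≡ M (proj₁ b)
   xV-base {u} b = proj₁ (irr (vert u) (base b))

   aV-base : ∀ {u} (b : Base u) → aV u ≡ rr u ⋆ M (proj₁ b)
   aV-base {u} b = proj₁ (proj₂ (irr (vert u) (base b)))

   P-apexʳ : ∀ κ {e u f} (T : Tri e u (fin f)) w → P κ w (fin u) ≈ combine T (P κ w (fin e)) (P κ w (fin f))
   P-apexʳ κ {e} {u} {f} T w = R.trans (Dt-≈ R.refl R.refl (R.reflexive (xV-apex T)) (R.reflexive (aV-apex T)))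
     (Id.D-lin₂ (xV w) (aV w) _ _ _ (xV e) (aV e) (xV f) (aV f))

   P-apexˡ : ∀ κ {e u f} (T : Tri e u (fin f)) w → P κ u (fin w) ≈ combine T (P κ e (fin w)) (P κ f (fin w))
   P-apexˡ κ {e} {u} {f} T w = R.trans (Dt-≈ (R.reflexive (xV-apex T)) (R.reflexive (aV-apex T)) R.refl R.refl)
     (Id.D-lin₁ (xV w) (aV w) _ _ _ (xV e) (aV e) (xV f) (aV f))

   sumW-gap : ∀ z k → (∀ y → z ≤ y → y < z + + k → ¬ Base y) → sumW z k ≈ 0#
   sumW-gap z zero h = R.refl
   sumW-gap z (suc k) h = R.trans (R.+-cong (sumW-gap z k λ y p q → h y p (<-trans q lt′))
     (R.reflexive (wt-other (h (z + + k) (subst (_≤ z + + k) (+-identityʳ z) (+-monoʳ-≤ z (ℤ.+≤+ ℕ.z≤n))) lt′)))) (R.+-identityʳ 0#)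
     where
     lt′ : z + + k < z + + suc k
     lt′ = +-monoʳ-< z (ℤ.+<+ (ℕ.s≤s ℕP.≤-refl))

   P-bases : ∀ κ {u w} (b : Base u) (b′ : Base w) k → w ≡ u + + k → P κ u (fin w) ≈ M (proj₁ b) ⋆ M (proj₁ b′) ⋆ sumW u k
   P-bases κ {u} {w} b b′ k refl = begin
     P κ u (fin w)  ≈⟨ Dt-≈ (R.reflexive (xV-base b)) (R.reflexive (aV-base b)) (R.reflexive (xV-base b′)) (R.reflexive (aV-base b′)) ⟩
     Dt (M (proj₁ b)) (rr u ⋆ M (proj₁ b)) (M (proj₁ b′)) (rr w ⋆ M (proj₁ b′))  ≈⟨ Id.D-base _ _ _ _ ⟩
     M (proj₁ b) ⋆ M (proj₁ b′) ⋆ (rr w ⊹ ⊖ rr u)  ≈⟨ R.*-cong R.refl (R.+-cong (rr-+ u k) R.refl) ⟩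
     M (proj₁ b) ⋆ M (proj₁ b′) ⋆ (rr u ⊹ sumW u k ⊹ ⊖ rr u)  ≈⟨ R.*-cong R.refl (Id.add-cancel′ (rr u) (sumW u k)) ⟩
     M (proj₁ b) ⋆ M (proj₁ b′) ⋆ sumW u k ∎

   -- Between consecutive radii only the weight at `s` contributes, and `wtT` is defined so that the
   -- two radii cancel against it and leave the third side.
   P-side : ∀ κ {s t} (T : Tri s t ∞) → P κ s (fin t) ≈ M (proj₁ (Tri.a₁ T))
   P-side κ {s} {t} T = go ∣ t ℤ.- s ∣ (+∣-∣ (<⇒≤ (Tri.e<u T)))
     where
     m₁ = M (proj₁ (Tri.a₁ T))
     m₂ = M (proj₁ (Tri.a₂ T))
     m₃ = M (proj₁ (Tri.a₃ T))
     go : ∀ k → t ≡ s + + k → P κ s (fin t) ≈ m₁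
     go zero e = ⊥-elim (<-irrefl refl (subst (s <_) (trans e (+-identityʳ s)) (Tri.e<u T)))
     go (suc k) e = begin
       P κ s (fin t)                  ≈⟨ P-bases κ (Tri.a₃ T) (Tri.a₂ T) (suc k) e ⟩
       m₃ ⋆ m₂ ⋆ sumW s (suc k)       ≈⟨ R.*-cong R.refl (sumW-front s k) ⟩
       m₃ ⋆ m₂ ⋆ (wt s ⊹ sumW (1ℤ + s) k)
         ≈⟨ R.*-cong R.refl (R.+-cong (R.reflexive (wt-base T)) (sumW-gap (1ℤ + s) k λ y p q b → not-under b (Tri.a₁ T)
              (<-≤-trans (n<1+n s) p) (subst (y <_) (trans (ar s (+ k)) (sym e)) q))) ⟩
       m₃ ⋆ m₂ ⋆ (wtT T ⊹ 0#)         ≈⟨ Id.side-cancel m₁ m₂ m₃ _ _ 0# R.refl (M-inv (proj₁ (Tri.a₂ T))) (M-inv (proj₁ (Tri.a₃ T))) ⟩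
       m₁                             ∎
       where
       ar : ∀ s k → 1ℤ + s + k ≡ s + (1ℤ + k)
       ar = solve-∀

   -- By descent from the enclosing triangle, whose long side is at least one longer.
   P-finite : ∀ κ g {u v} (a : Arc u (fin v)) → u + N < v + + g → P κ u (fin v) ≈ M (proj₁ a)
   P-finite κ zero {u} {v} a h = ⊥-elim (<⇒≱ (subst (u + N <_) (+-identityʳ v) h) (arc-len a))
   P-finite κ (suc g) {u} {v} a h with parent a
   ... | first {c = ∞} refl T = R.trans (P-side κ T) (R.reflexive (same M (Tri.a₁ T) a))
   ... | first {c = fin w} refl T = begin
     P κ u (fin v)                                  ≈⟨ P-apexʳ κ T u ⟩
     combine T (P κ u (fin u)) (P κ u (fin w))      ≈⟨ combine-≈ T (P-self κ u) (P-finite κ g (Tri.a₃ T) (lem u v w N (+ g) (Tri.u≺f T) h)) ⟩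
     combine T 0# (M (proj₁ (Tri.a₃ T)))            ≈⟨ Id.apexʳ-cancel _ _ _ _ (M-inv (proj₁ (Tri.a₃ T))) ⟩
     M (proj₁ (Tri.a₁ T))                           ≡⟨ same M (Tri.a₁ T) a ⟩
     M (proj₁ a)                                    ∎
     where
     lem : ∀ u v w N g → v < w → u + N < v + (1ℤ + g) → u + N < w + g
     lem u v w N g p q = by< λ k → absurd≤ 0 (s≤ p ⊕ s≤ q ⊕ k) (solve (u ∷ v ∷ w ∷ N ∷ g ∷ []))
   ... | second {d = d} T = begin
     P κ u (fin v)                                  ≈⟨ P-apexˡ κ T v ⟩
     combine T (P κ d (fin v)) (P κ v (fin v))      ≈⟨ combine-≈ T (P-finite κ g (Tri.a₃ T) (lem u v d N (+ g) (Tri.e<u T) h)) (P-self κ v) ⟩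
     combine T (M (proj₁ (Tri.a₃ T))) 0#            ≈⟨ Id.apexˡ-cancel _ _ _ _ (M-inv (proj₁ (Tri.a₃ T))) ⟩
     M (proj₁ (Tri.a₂ T))                           ≡⟨ same M (Tri.a₂ T) a ⟩
     M (proj₁ a)                                    ∎
     where
     lem : ∀ u v d N g → d < u → u + N < v + (1ℤ + g) → d + N < v + g
     lem u v d N g p q = by< λ k → absurd≤ 0 (s≤ p ⊕ s≤ q ⊕ k) (solve (u ∷ v ∷ d ∷ N ∷ g ∷ []))

   P-arc : ∀ κ {u v} (a : Arc u (fin v)) → P κ u (fin v) ≈ M (proj₁ a)
   P-arc κ {u} {v} a = P-finite κ n a (+-monoˡ-< N (arc-≺ a))

   P-per₁ : ∀ κ u v → P κ (u + 1ℤ * N) (sh 1ℤ v) ≈ P κ u v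
   P-per₁ κ u (fin v) = R.trans (Dt-≈ (R.reflexive (xV-per u)) (aV-per u) (R.reflexive (xV-per v)) (aV-per v)) (Id.D-per c (xV u) (aV u) (xV v) (aV v))
   P-per₁ κ u ∞ = R.trans (P-∞ κ _) (R.trans (R.*-cong R.refl (R.reflexive (xV-per u))) (R.sym (P-∞ κ u)))

   private
     P-per⁺ : ∀ κ t u v → P κ (u + + t * N) (sh (+ t) v) ≈ P κ u v
     P-per⁺ κ zero u v = R.reflexive (cong₂ (P κ) (+-identityʳ u) (sh0 v))
       where
       sh0 : ∀ v → sh 0ℤ v ≡ v
       sh0 (fin v) = cong fin (+-identityʳ v)
       sh0 ∞ = refl
     P-per⁺ κ (suc t) u v = R.trans (R.reflexive (cong₂ (P κ) (ar u (+ t) N) (shs v)))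
       (R.trans (P-per₁ κ (u + + t * N) (sh (+ t) v)) (P-per⁺ κ t u v))
       where
       ar : ∀ u t N → u + (1ℤ + t) * N ≡ u + t * N + 1ℤ * N
       ar = solve-∀
       shs : ∀ v → sh (+ suc t) v ≡ sh 1ℤ (sh (+ t) v)
       shs (fin v) = cong fin (ar v (+ t) N)
       shs ∞ = refl

   P-per : ∀ κ t u v → P κ (u + t * N) (sh t v) ≈ P κ u v
   P-per κ (+ t) u v = P-per⁺ κ t u v
   P-per κ -[1+ t ] u v = R.trans (R.sym (P-per⁺ κ (suc t) (u + -[1+ t ] * N) (sh -[1+ t ] v))) (R.reflexive (cong₂ (P κ) (ar u (+ suc t) N) (shs v)))
     where
     ar : ∀ u t N → u + - t * N + t * N ≡ u
     ar = solve-∀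
     shs : ∀ v → sh (+ suc t) (sh -[1+ t ] v) ≡ v
     shs (fin v) = cong fin (ar v (+ suc t) N)
     shs ∞ = refl

   -- The exchange relation for two radii of opposite tags in a digon around the puncture. For
   -- `b = a` one side degenerates and the other is the loop.
   P-digon : ∀ κ a b → P κ a (fin b) ⊹ P κ b (fin (a + 1ℤ * N)) ≈ c ⋆ xV a ⋆ xV b
   P-digon κ a b = R.trans (R.+-cong R.refl (Dt-≈ R.refl R.refl (R.reflexive (xV-per a)) (aV-per a))) (Id.digon c (xV a) (aV a) (xV b) (aV b))

   -- An arc [u, v + N] with s < v < u < t runs around the puncture; in the basis V s, V t of the strip its
   -- λ-length is a sum of products of λ-lengths inside the strip, with a coefficient 2 in the middle.
   module Wrap (κ : Carrier) {s t : ℤ} (T : Tri s t ∞) (u v : ℤ) where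
     β = M (proj₁ (Tri.a₁ T))
     β⁻ = M⁻ (proj₁ (Tri.a₁ T))
     xₛ = M (proj₁ (Tri.a₃ T))
     xₛ⁻ = M⁻ (proj₁ (Tri.a₃ T))
     xₜ = M (proj₁ (Tri.a₂ T))
     xₜ⁻ = M⁻ (proj₁ (Tri.a₂ T))
     A = P κ u (fin t)
     A′ = P κ v (fin t)
     B = P κ s (fin u)
     B′ = P κ s (fin v)
     c′ = sumW (1ℤ + s) (ℕ.pred n)
     xᵘ = β⁻ ⋆ (A ⋆ xₛ ⊹ B ⋆ xₜ)
     xᵛ = β⁻ ⋆ (A′ ⋆ xₛ ⊹ B′ ⋆ xₜ)

     straighten : A′ ⋆ B ≈ A ⋆ B′ ⊹ P κ v (fin u) ⋆ β
     straighten = R.trans (Id.straighten (xV s) (aV s) (xV t) (aV t) (xV u) (aV u) (xV v) (aV v))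
       (R.+-cong R.refl (R.*-cong R.refl (P-side κ T)))

     private
       three : ∀ u → β ⋆ xV u ≈ P κ u (fin t) ⋆ xₛ ⊹ P κ s (fin u) ⋆ xₜ
       three u = begin
         β ⋆ xV u                   ≈⟨ R.*-cong (P-side κ T) R.refl ⟨
         P κ s (fin t) ⋆ xV u       ≈⟨ Id.three-term (xV s) (aV s) (xV t) (aV t) (xV u) (aV u) ⟩
         P κ u (fin t) ⋆ xV s ⊹ P κ s (fin u) ⋆ xV t
           ≈⟨ R.+-cong (R.*-cong R.refl (R.reflexive (xV-base (Tri.a₃ T)))) (R.*-cong R.refl (R.reflexive (xV-base (Tri.a₂ T)))) ⟩
         P κ u (fin t) ⋆ xₛ ⊹ P κ s (fin u) ⋆ xₜ ∎
       -- The weight of the strip itself is split off from the full turn; the rest `c′` is a sum of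
       -- positive terms and stays untouched.
       c-split : c ≈ β ⋆ (xₛ⁻ ⋆ xₜ⁻) ⊹ c′
       c-split = begin
         c                         ≈⟨ sumW-c s ⟨
         sumW s n                  ≡⟨ cong (sumW s) (sym (ℕP.suc-pred n)) ⟩
         sumW s (suc (ℕ.pred n))   ≈⟨ sumW-front s (ℕ.pred n) ⟩
         wt s ⊹ c′                 ≡⟨ cong (_⊹ c′) (wt-base T) ⟩
         wtT T ⊹ c′                ∎

     wrap : P κ u (fin (v + 1ℤ * N)) ≈ c′ ⋆ (xᵘ ⋆ xᵛ) ⊹ β⁻ ⋆ (A ⋆ A′ ⋆ (xₛ ⋆ xₜ⁻) ⊹ B ⋆ B′ ⋆ (xₜ ⋆ xₛ⁻) ⊹ A ⋆ B′ ⊹ A ⋆ B′)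
     wrap = R.trans (Dt-≈ R.refl R.refl (R.reflexive (xV-per v)) (aV-per v))
       (Id.wrap-identity c c′ β β⁻ xₛ xₛ⁻ xₜ xₜ⁻ A A′ B B′ (xV u) (aV u) (xV v) (aV v)
         (M-inv (proj₁ (Tri.a₁ T))) (M-inv (proj₁ (Tri.a₃ T))) (M-inv (proj₁ (Tri.a₂ T))) c-split (three u) (three v) straighten)

     wrap′ : ∀ {A₁ A₁′ B₁ B₁′} → A ≈ A₁ → A′ ≈ A₁′ → B ≈ B₁ → B′ ≈ B₁′ → P κ u (fin (v + 1ℤ * N)) ≈
       c′ ⋆ ((β⁻ ⋆ (A₁ ⋆ xₛ ⊹ B₁ ⋆ xₜ)) ⋆ (β⁻ ⋆ (A₁′ ⋆ xₛ ⊹ B₁′ ⋆ xₜ))) ⊹ β⁻ ⋆ (A₁ ⋆ A₁′ ⋆ (xₛ ⋆ xₜ⁻) ⊹ B₁ ⋆ B₁′ ⋆ (xₜ ⋆ xₛ⁻) ⊹ A₁ ⋆ B₁′ ⊹ A₁ ⋆ B₁′)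
     wrap′ hA hA′ hB hB′ = R.trans wrap (R.+-cong
       (R.*-cong R.refl (R.*-cong (R.*-cong R.refl (R.+-cong (R.*-cong hA R.refl) (R.*-cong hB R.refl))) (R.*-cong R.refl (R.+-cong (R.*-cong hA′ R.refl) (R.*-cong hB′ R.refl)))))
       (R.*-cong R.refl (R.+-cong (R.+-cong (R.+-cong (R.*-cong (R.*-cong hA hA′) R.refl) (R.*-cong (R.*-cong hB hB′) R.refl)) (R.*-cong hA hB′)) (R.*-cong hA hB′))))

-- Laurent expansions: empty and nonempty Newton polytopes

module LaurentExpansions where
 open IntegerInequalities
 open UniversalCover hiding (lt; gt; eq)
 open IdealTriangulations
 open LaurentPolynomials
 open NewtonPolytopes
 open LaurentNewtonPolytopes
 open DecoratedVectors
 open import Data.Bool using (if_then_else_)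
 open import Data.Nat using (ℕ; zero; suc)
 open import Data.Integer using (ℤ; +_; -[1+_]; _+_; _*_; -_; _≤_; _<_; 0ℤ; 1ℤ; ∣_∣)
 open import Data.Integer.Properties hiding (_≟_)
 open import Data.Integer.DivMod using (_%ℕ_; _/ℕ_; n%ℕd<d; a≡a%ℕn+[a/ℕn]*n)
 open import Data.Integer.Tactic.RingSolver using (solve; solve-∀)
 open import Data.Fin using (Fin)
 open import Data.List using ([]; _∷_)
 open import Data.List.Relation.Unary.All as All using (All)
 open import Data.List.Membership.Propositional using (_∈_)
 open import Data.List.Membership.Propositional.Properties using (∈-++⁺ˡ; ∈-++⁺ʳ)
 open import Data.List.Relation.Unary.Any using (here)
 import Data.List.Relation.Unary.All.Properties as AllP
 open import Data.Vec as V using (Vec)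
 import Data.Vec.Properties as VecP
 open RingIdentities
 open import Relation.Binary.Definitions using (tri<; tri≈; tri>)

 -- In a triangle with apex `w` over `[e , f]` only the side `[w , f]` starts at `w`, so this degree
 -- separates the two terms of `combine`. Radii have degree zero, so the weight at `z` has degree
 -- one at `z`, contributed by the arc to the next radius.
 leftDeg : ℕ → OArc → ℤ
 leftDeg i (iv j k) = if does (i ℕ.≟ j) then 1ℤ else 0ℤ
 leftDeg i (rad j) = 0ℤ

 -- Arcs are only required to be monomials, because a loop will be the product of two variables; the
 -- vectors `W i` must recover `leftDeg i` from exponents.
 record Grading : Set where
   constructor grading
   field
     n : ℕ
     2≤n : 2 ℕ.≤ n
     {r} : ℕ
     {O} : Fin (r ℕ.+ n) → OArc
     I : Triangulation.Ideal n 2≤n r O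
     mon : Fin (r ℕ.+ n) → Mon (r ℕ.+ n)
     W : ℕ → Vec ℤ (r ℕ.+ n)
     dot-W : ∀ i ℓ → dot (W i) (mon ℓ) ≡ leftDeg i (O ℓ)

 module LaurentExpansion (Ω : Grading) where
   open Grading Ω


   open Cover n 2≤n
   open Triangulation n 2≤n hiding (Ideal)
   open Triangles I

   mono-inv : ∀ ℓ → (mono (mon ℓ) *L mono (⊟ mon ℓ)) ≃ oneL
   mono-inv ℓ = ≃-reflexive (cong mono (⊞-inverseʳ (mon ℓ)))

   private
     lengthData : LengthData
     lengthData = lengths n 2≤n I (LRing (r ℕ.+ n)) (LHom (r ℕ.+ n)) (λ ℓ → mono (mon ℓ)) (λ ℓ → mono (⊟ mon ℓ)) mono-inv

   open LambdaLengths lengthData public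

   R : Set
   R = LPoly (r ℕ.+ n)

   Cong : ℤ → ℤ → Set
   Cong u w = ∃ λ t → u ≡ w + t * N

   private
     resd : ∀ {i} w {u} t → u ≡ + i + t * N → w %ℕ n ≡ i → Cong u w
     resd w t refl refl = t ℤ.- w /ℕ n , lin≡ (sym (a≡a%ℕn+[a/ℕn]*n w n)) (ar (+ (w %ℕ n)) t N w (w /ℕ n))
       where
       ar : ∀ i t N w q → i + t * N + w ≡ w + (t ℤ.- q) * N + (i + q * N)
       ar = solve-∀
     resd′ : ∀ {i} w {u} t → i ℕ.< n → u ≡ + i + t * N → Cong u w → w %ℕ n ≡ i
     resd′ {i} w {u} t i< e (s , e′) = resid′ {t = w /ℕ n + s} {t} (n%ℕd<d w n) i<
       (trans (ar (+ (w %ℕ n)) (w /ℕ n) s N) (trans (cong (_+ s * N) (sym (a≡a%ℕn+[a/ℕn]*n w n))) (trans (sym e′) e)))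
       where
       ar : ∀ i q s N → i + (q + s) * N ≡ i + q * N + s * N
       ar = solve-∀

   deg-no : ∀ {ℓ u v} w → On (O ℓ) u v → ¬ Cong u w → dot (W (w %ℕ n)) (mon ℓ) ≡ 0ℤ
   deg-no {ℓ} w on nc = trans (dot-W (w %ℕ n) ℓ) (go (O ℓ) on nc)
     where
     go : ∀ y {u v} → On y u v → ¬ Cong u w → leftDeg (w %ℕ n) y ≡ 0ℤ
     go (rad _) _ _ = refl
     go (iv i k) (on-iv t e _) nc = cong (if_then 1ℤ else 0ℤ) (dec-false (w %ℕ n ℕ.≟ i) λ q → nc (resd w t e q))
   deg-yes : ∀ {ℓ u v} w → On (O ℓ) u (fin v) → Cong u w → dot (W (w %ℕ n)) (mon ℓ) ≡ 1ℤ
   deg-yes {ℓ} w on cg = trans (dot-W (w %ℕ n) ℓ) (go (O ℓ) (small ℓ) on cg)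
     where
     go : ∀ y {u v} → Small y → On y u (fin v) → Cong u w → leftDeg (w %ℕ n) y ≡ 1ℤ
     go (iv i k) (i< , _) (on-iv t e _) cg = cong (if_then 1ℤ else 0ℤ) (dec-true (w %ℕ n ℕ.≟ i) (resd′ w t i< e cg))
   deg-∞ : ∀ {ℓ u} i → On (O ℓ) u ∞ → dot (W i) (mon ℓ) ≡ 0ℤ
   deg-∞ {ℓ} i on = trans (dot-W i ℓ) (go (O ℓ) on)
     where
     go : ∀ y {u} → On y u ∞ → leftDeg i y ≡ 0ℤ
     go (rad _) _ = refl

   Good : ℤ → ℤ → Set
   Good u w = ∃ λ z → Base z × w ≤ z + N × z ≤ u

   Cong-sym : ∀ {u w} → Cong u w → Cong w u
   Cong-sym {u} {w} (t , refl) = - t , ar w t N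
     where
     ar : ∀ w t N → w ≡ w + t * N + - t * N
     ar = solve-∀

   Cong-base : ∀ {u w} → Cong u w → Base w → Base u
   Cong-base (t , refl) b = arc-sh t b

   Cong-near : ∀ {u w} → Cong w u → u ≤ w → w ≤ u + N → w ≡ u ⊎ w ≡ u + N
   Cong-near {u} {w} (t , e) p q = go (<-cmp w (u + N))
     where
     ar : ∀ u w x N → w ≡ u + x → w < u + N → x < N
     ar u w x N e h = by< λ k → absurd≤ 0 (s≤ h ⊕ k ⊕ ≡⇒≤ (sym e)) (solve (u ∷ w ∷ x ∷ N ∷ []))
     ar′ : ∀ u w x N → w ≡ u + x → u ≤ w → 0ℤ < N → - N < x
     ar′ u w x N e h g = by< λ k → absurd≤ 0 (h ⊕ k ⊕ s≤ g ⊕ ≡⇒≤ e) (solve (u ∷ w ∷ x ∷ N ∷ []))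
     go : _ → w ≡ u ⊎ w ≡ u + N
     go (tri≈ _ h _) = inj₂ h
     go (tri> _ _ h) = ⊥-elim (<⇒≱ h q)
     go (tri< h _ _) = inj₁ (trans e (trans (cong (λ z → u + z * N) t≡0) (+-identityʳ u)))
       where
       t≡0 : t ≡ 0ℤ
       t≡0 = mult-small {n} t (t * N) refl (ar u w (t * N) N e h) (ar′ u w (t * N) N e p (<-≤-trans (ℤ.+<+ (ℕ.s≤s ℕ.z≤n)) 2≤N))

   len-cong : ∀ {u w} (du : Vert u) (dw : Vert w) → Cong u w → len du ≡ len dw
   len-cong du dw (t , refl) = trans (proj₂ (proj₂ (irr du (vsh t dw)))) (len-vsh t dw)

   -- If the triangle above `e` ended before `f`, its long side would cross `[e , f]`; so that side
   -- properly contains `[e , f]`. The same holds at `f` by `lenʳ`.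
   lenˡ : ∀ {e u f} → Tri e u (fin f) → (de : Vert e) → f ℤ.- e < len de
   lenˡ {e} {u} {f} T (base b) = ar f e N (arc-len (Tri.a₃ T))
     where
     ar : ∀ f e N → f ≤ e + N → f ℤ.- e < 1ℤ + N
     ar f e N h = by< λ k → absurd≤ 0 (h ⊕ k) (solve (f ∷ e ∷ N ∷ []))
   lenˡ {e} {u} {f} T (apex {e′} {_} {f′} T′ _ _) with <-cmp f′ f
   ... | tri< h _ _ = ⊥-elim (nx (Tri.a₃ T′) (Tri.a₃ T) (Tri.e<u T′ , Tri.u≺f T′ , h))
   ... | tri≈ _ refl _ = ar f e e′ (Tri.e<u T′)
     where
     ar : ∀ f e e′ → e′ < e → f ℤ.- e < f ℤ.- e′
     ar f e e′ h = by< λ k → absurd≤ 0 (s≤ h ⊕ k) (solve (f ∷ e ∷ e′ ∷ []))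
   ... | tri> _ _ h = ar f f′ e e′ (Tri.e<u T′) h
     where
     ar : ∀ f f′ e e′ → e′ < e → f < f′ → f ℤ.- e < f′ ℤ.- e′
     ar f f′ e e′ h g = by< λ k → absurd≤ 1 (s≤ h ⊕ s≤ g ⊕ k) (solve (f ∷ f′ ∷ e ∷ e′ ∷ []))

   lenʳ : ∀ {e u f} → Tri e u (fin f) → (df : Vert f) → f ℤ.- e < len df
   lenʳ {e} {u} {f} T (base b) = ar f e N (arc-len (Tri.a₃ T))
     where
     ar : ∀ f e N → f ≤ e + N → f ℤ.- e < 1ℤ + N
     ar f e N h = by< λ k → absurd≤ 0 (h ⊕ k) (solve (f ∷ e ∷ N ∷ []))
   lenʳ {e} {u} {f} T (apex {e′} {_} {f′} T′ _ _) with <-cmp e e′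
   ... | tri< h _ _ = ⊥-elim (nx (Tri.a₃ T) (Tri.a₃ T′) (h , Tri.e<u T′ , Tri.u≺f T′))
   ... | tri≈ _ refl _ = ar f e f′ (Tri.u≺f T′)
     where
     ar : ∀ f e f′ → f < f′ → f ℤ.- e < f′ ℤ.- e
     ar f e f′ h = by< λ k → absurd≤ 0 (s≤ h ⊕ k) (solve (f ∷ e ∷ f′ ∷ []))
   ... | tri> _ _ h = ar f f′ e e′ h (Tri.u≺f T′)
     where
     ar : ∀ f f′ e e′ → e′ < e → f < f′ → f ℤ.- e < f′ ℤ.- e′
     ar f f′ e e′ h g = by< λ k → absurd≤ 1 (s≤ h ⊕ s≤ g ⊕ k) (solve (f ∷ f′ ∷ e ∷ e′ ∷ []))

   -- Any other vertex under `[e , f]` lies under one of the short sides of the triangle, hence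
   -- hangs below an arc no longer than that side.
   inside : ∀ {e w f v} → Tri e w (fin f) → e < v → v < f → v ≢ w → (dv : Vert v) → len dv < f ℤ.- e
   inside T p q ne (base b) = ⊥-elim (not-under b (Tri.a₃ T) p q)
   inside {e} {w} {f} {v} T p q ne (apex {e′} {_} {f′} T′ _ _) with <-cmp v w
   ... | tri≈ _ h _ = ⊥-elim (ne h)
   ... | tri< v<w _ _ = ar e e′ f f′ w (by≤ λ h → nx (Tri.a₁ T′) (Tri.a₁ T) (h , p , v<w)) (by≤ λ h → nx (Tri.a₁ T) (Tri.a₂ T′) (p , v<w , h)) (Tri.u≺f T)
     where
     ar : ∀ e e′ f f′ w → e ≤ e′ → f′ ≤ w → w < f → f′ ℤ.- e′ < f ℤ.- e
     ar e e′ f f′ w a b g = by< λ k → absurd≤ 0 (a ⊕ b ⊕ s≤ g ⊕ k) (solve (e ∷ e′ ∷ f ∷ f′ ∷ w ∷ []))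
   ... | tri> _ _ w<v = ar e e′ f f′ w (by≤ λ h → nx (Tri.a₁ T′) (Tri.a₂ T) (h , w<v , q)) (by≤ λ h → nx (Tri.a₂ T) (Tri.a₂ T′) (w<v , q , h)) (Tri.e<u T)
     where
     ar : ∀ e e′ f f′ w → w ≤ e′ → f′ ≤ f → e < w → f′ ℤ.- e′ < f ℤ.- e
     ar e e′ f f′ w a b g = by< λ k → absurd≤ 0 (a ⊕ b ⊕ s≤ g ⊕ k) (solve (e ∷ e′ ∷ f ∷ f′ ∷ w ∷ []))

   Hom-wt : ∀ i z {k} → (∀ {t} (T : Tri z t ∞) → dot (W i) (mon (proj₁ (Tri.a₁ T))) ≡ k) → Hom (W i) k (wt z)
   Hom-wt i z {k} h = go (base? z)
     where
     go : Dec (Base z) → Hom (W i) k (wt z)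
     go (no nb) = subst (Hom (W i) k) (sym (wt-other nb)) All.[]
     go (yes b) = subst (Hom (W i) k) (sym (wt-base T)) (Hom-mono (W i) (trans (dot-⊞ (W i) m₁ ((⊟ m₃) ⊞ (⊟ m₂)))
         (trans (cong₂ _+_ (h T) (trans (dot-⊞ (W i) (⊟ m₃) (⊟ m₂)) (cong₂ _+_ (z′ m₃ (deg-∞ i (proj₂ (Tri.a₃ T)))) (z′ m₂ (deg-∞ i (proj₂ (Tri.a₂ T))))))) (+-identityʳ k))))
       where
       T = proj₂ (inner b tt)
       m₁ = mon (proj₁ (Tri.a₁ T))
       m₂ = mon (proj₁ (Tri.a₂ T))
       m₃ = mon (proj₁ (Tri.a₃ T))
       z′ : ∀ m → dot (W i) m ≡ 0ℤ → dot (W i) (⊟ m) ≡ 0ℤ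
       z′ m e = trans (dot-⊟ (W i) m) (cong -_ e)

   Hom-sumW : ∀ i k s l → (∀ z → s ≤ z → z < s + + l → Hom (W i) k (wt z)) → Hom (W i) k (sumW s l)
   Hom-sumW i k s zero h = All.[]
   Hom-sumW i k s (suc l) h = Hom-+ {w = W i} {P = sumW s l} {wt (s + + l)} (Hom-sumW i k s l λ z p q → h z p (<-trans q l<))
     (h (s + + l) (subst (_≤ s + + l) (+-identityʳ s) (+-monoʳ-≤ s (ℤ.+≤+ ℕ.z≤n))) l<)
     where
     l< : s + + l < s + + suc l
     l< = +-monoʳ-< s (ℤ.+<+ (ℕ.s≤s ℕP.≤-refl))

   Hom-combine : ∀ i {e u f} (T : Tri e u (fin f)) {y z k a} → dot (W i) (mon (proj₁ (Tri.a₂ T))) ≡ 0ℤ →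
     dot (W i) (mon (proj₁ (Tri.a₁ T))) ≡ a → dot (W i) (mon (proj₁ (Tri.a₃ T))) ≡ a → Hom (W i) (a + k) y → Hom (W i) k z → Hom (W i) k (combine T y z)
   Hom-combine i T {y} {z} {k} {a} d₂ d₁ d₃ hy hz = subst (λ q → Hom (W i) q (combine T y z)) (ar a k)
     (Hom-* {w = W i} {P = mono (⊟ m₃)} {(mono m₂ *L y) +L (mono m₁ *L z)} (Hom-mono (W i) (trans (dot-⊟ (W i) m₃) (cong -_ d₃)))
       (Hom-+ {w = W i} {P = mono m₂ *L y} {mono m₁ *L z} (subst (λ q → Hom (W i) q (mono m₂ *L y)) (+-identityˡ (a + k)) (Hom-* {w = W i} {P = mono m₂} {y} (Hom-mono (W i) d₂) hy))
         (Hom-* {w = W i} {P = mono m₁} {z} (Hom-mono (W i) d₁) hz)))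
     where
     m₁ = mon (proj₁ (Tri.a₁ T))
     m₂ = mon (proj₁ (Tri.a₂ T))
     m₃ = mon (proj₁ (Tri.a₃ T))
     ar : ∀ a k → - a + (a + k) ≡ k
     ar = solve-∀

   Hom-rr : ∀ {w} → ¬ Base w → ∀ u → Hom (W (w %ℕ n)) 0ℤ (rr u)
   Hom-rr {w} nb u = go u
     where
     z : ∀ z → Hom (W (w %ℕ n)) 0ℤ (wt z)
     z z = Hom-wt (w %ℕ n) z λ T → deg-no w (proj₂ (Tri.a₁ T)) λ cg → nb (Cong-base (Cong-sym cg) (Tri.a₃ T))
     go : ∀ u → Hom (W (w %ℕ n)) 0ℤ (rr u)
     go (+ k) = Hom-sumW (w %ℕ n) 0ℤ 0ℤ k λ y _ _ → z y
     go -[1+ k ] = Hom-neg {w = W (w %ℕ n)} {P = sumW -[1+ k ] (suc k)} (Hom-sumW (w %ℕ n) 0ℤ -[1+ k ] (suc k) λ y _ _ → z y)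

   -- The vector at u involves no arc starting at w unless w lies above u.
   Hom-V : ∀ {w} → ¬ Base w → (dw : Vert w) → ∀ {u} (du : Vert u) → len dw ≤ len du → ¬ Cong u w →
     Hom (W (w %ℕ n)) 0ℤ (xd du) × Hom (W (w %ℕ n)) 0ℤ (ad du)
   Hom-V {w} nb dw {u} (base b) le nc = x , Hom-* {w = W (w %ℕ n)} {P = rr u} {mono (mon (proj₁ b))} (Hom-rr nb u) x
     where
     x = Hom-mono (W (w %ℕ n)) (deg-∞ (w %ℕ n) (proj₂ b))
   Hom-V {w} nb dw {u} (apex {e} {_} {f} T de df) le nc = cmb (proj₁ he) (proj₁ hf) , cmb (proj₂ he) (proj₂ hf)
     where
     up : ∀ {v} (dv : Vert v) → f ℤ.- e < len dv → ¬ Cong v w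
     up dv h cg = <-irrefl (sym (len-cong dv dw cg)) (≤-<-trans le h)
     he = Hom-V nb dw de (<⇒≤ (≤-<-trans le (lenˡ T de))) (up de (lenˡ T de))
     hf = Hom-V nb dw df (<⇒≤ (≤-<-trans le (lenʳ T df))) (up df (lenʳ T df))
     cmb : ∀ {y z} → Hom (W (w %ℕ n)) 0ℤ y → Hom (W (w %ℕ n)) 0ℤ z → Hom (W (w %ℕ n)) 0ℤ (combine T y z)
     cmb = Hom-combine (w %ℕ n) T (deg-no w (proj₂ (Tri.a₂ T)) nc) (deg-no w (proj₂ (Tri.a₁ T)) (up de (lenˡ T de))) (deg-no w (proj₂ (Tri.a₃ T)) (up de (lenˡ T de)))

   wtExp : ∀ {z t} → Tri z t ∞ → Mon (r ℕ.+ n)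
   wtExp T = mon (proj₁ (Tri.a₁ T)) ⊞ ((⊟ mon (proj₁ (Tri.a₃ T))) ⊞ (⊟ mon (proj₁ (Tri.a₂ T))))

   -- Within a full turn no vertex of the polygon is repeated, so the last weight is the only one
   -- that contains an arc starting at `z`. It lies one level above the sum of the others.
   SE-sumW : ∀ s k → k ℕ.≤ n → SE (Supp (sumW s k))
   SE-sumW s zero _ = SE-[]
   SE-sumW s (suc k) k≤ = go (base? z)
     where
     z = s + + k
     rest : SE (Supp (sumW s k))
     rest = SE-sumW s k (ℕP.<⇒≤ k≤)
     ar : ∀ s k N y → s ≤ y → k < N → s + k ≤ y + N
     ar s k N y p q = by≤ λ h → absurd≤ 1 (p ⊕ s≤ q ⊕ s≤ h) (solve (s ∷ k ∷ N ∷ y ∷ []))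
     ar′ : ∀ s k N y → s ≤ y → k < N → s + k ≢ y + N
     ar′ s k N y p q e = absurd≤ 0 (p ⊕ s≤ q ⊕ ≡⇒≤ (sym e)) (solve (s ∷ k ∷ N ∷ y ∷ []))
     earlier : ∀ y → s ≤ y → y < z → ¬ Cong y z
     earlier y p q cg with Cong-near (Cong-sym cg) (<⇒≤ q) (ar s (+ k) N y p (ℤ.+<+ k≤))
     ... | inj₁ e = <-irrefl (sym e) q
     ... | inj₂ e = ar′ s (+ k) N y p (ℤ.+<+ k≤) e
     go : Dec (Base z) → SE (Supp (sumW s (suc k)))
     go (no nb) = subst (λ q → SE (Supp (sumW s k +L q))) (sym (wt-other nb)) (SE-≃ {P = sumW s k +L []} {sumW s k} (CommutativeRing.+-identityʳ (LRing (r ℕ.+ n)) (sumW s k)) rest)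
     go (yes b) = SE-+ (W (z %ℕ n)) 0ℤ {sumW s k} {wt z}
       (Hom-sumW (z %ℕ n) 0ℤ s k λ y p q → Hom-wt (z %ℕ n) y λ T → deg-no z (proj₂ (Tri.a₁ T)) (earlier y p q))
       (Hom-wt (z %ℕ n) z λ T → deg-yes z (proj₂ (Tri.a₁ T)) (0ℤ , sym (+-identityʳ z))) rest
       (subst (λ q → SE (Supp q)) (sym (wt-base (proj₂ (inner b tt)))) (SE-monomial (wtExp (proj₂ (inner b tt)))))

   private
     Hom-P : ∀ {w} → ¬ Base w → (dw : Vert w) → ∀ {u v} (du : Vert u) (dv : Vert v) → len dw ≤ len du → ¬ Cong u w → len dw ≤ len dv → ¬ Cong v w →
       Hom (W (w %ℕ n)) 0ℤ (P oneL u (fin v))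
     Hom-P {w} nb dw {u} {v} du dv lu cu lv cv = Hom-+ {w = W (w %ℕ n)} {P = xV u *L aV v} {negL (aV u *L xV v)}
         (Hom-* {w = W (w %ℕ n)} {P = xV u} {aV v} (proj₁ hu) (proj₂ hv))
         (Hom-neg {w = W (w %ℕ n)} {P = aV u *L xV v} (Hom-* {w = W (w %ℕ n)} {P = aV u} {xV v} (proj₂ hu) (proj₁ hv)))
       where
       hu = Hom-V nb dw (vert u) (subst (len dw ≤_) (proj₂ (proj₂ (irr du (vert u)))) lu) cu
       hv = Hom-V nb dw (vert v) (subst (len dw ≤_) (proj₂ (proj₂ (irr dv (vert v)))) lv) cv

     above : ∀ {e u f v} (T : Tri e u (fin f)) (du : Vert u) (dv : Vert v) → len du ≡ f ℤ.- e → f ℤ.- e < len dv → len du ≤ len dv × ¬ Cong v u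
     above T du dv e h = subst (_≤ len dv) (sym e) (<⇒≤ h) , λ cg → <-irrefl (sym (trans (len-cong dv du cg) e)) h

     degrees : ∀ {e u f} (T : Tri e u (fin f)) (de : Vert e) (df : Vert f) →
       dot (W (u %ℕ n)) (mon (proj₁ (Tri.a₂ T))) ≡ 1ℤ × dot (W (u %ℕ n)) (mon (proj₁ (Tri.a₁ T))) ≡ 0ℤ
     degrees {e} {u} {f} T de df = deg-yes u (proj₂ (Tri.a₂ T)) (0ℤ , sym (+-identityʳ u))
       , deg-no u (proj₂ (Tri.a₁ T)) (proj₂ (above T (apex T de df) de refl (lenˡ T de)))

   -- The length condition says that `w` hangs at least as deep as `u`. Then no arc starting at `w`
   -- enters the vectors at `u`, `e` and `f`, and the factor `[w , f]` alone separates the two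
   -- terms.
   SE-apexʳ : ∀ {e w f u} (T : Tri e w (fin f)) (de : Vert e) (df : Vert f) (du : Vert u) → f ℤ.- e ≤ len du → ¬ Cong u w →
     SE (Supp (P oneL u (fin e))) → SE (Supp (P oneL u (fin f))) → SE (Supp (P oneL u (fin w)))
   SE-apexʳ {e} {w} {f} {u} T de df du le nc se sf = SE-comb (W (w %ℕ n)) {P oneL u (fin w)} {P oneL u (fin e)} {P oneL u (fin f)} (⊟ mon (proj₁ (Tri.a₃ T))) (mon (proj₁ (Tri.a₂ T))) (mon (proj₁ (Tri.a₁ T))) (P-apexʳ oneL T u)
     (proj₁ (degrees T de df)) (proj₂ (degrees T de df))
     (Hom-P nb dw du de le nc (proj₁ ae) (proj₂ ae)) (Hom-P nb dw du df le nc (proj₁ af) (proj₂ af)) se sf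
     where
     dw = apex T de df
     nb : ¬ Base w
     nb b = base-apex b T
     ae = above T dw de refl (lenˡ T de)
     af = above T dw df refl (lenʳ T df)

   SE-apexˡ : ∀ {e u f w} (T : Tri e u (fin f)) (de : Vert e) (df : Vert f) (dw : Vert w) → f ℤ.- e ≤ len dw → ¬ Cong w u →
     SE (Supp (P oneL e (fin w))) → SE (Supp (P oneL f (fin w))) → SE (Supp (P oneL u (fin w)))
   SE-apexˡ {e} {u} {f} {w} T de df dw le nc se sf = SE-comb (W (u %ℕ n)) {P oneL u (fin w)} {P oneL e (fin w)} {P oneL f (fin w)} (⊟ mon (proj₁ (Tri.a₃ T))) (mon (proj₁ (Tri.a₂ T))) (mon (proj₁ (Tri.a₁ T))) (P-apexˡ oneL T w)
     (proj₁ (degrees T de df)) (proj₂ (degrees T de df))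
     (Hom-P nb du de dw (proj₁ ae) (proj₂ ae) le nc) (Hom-P nb du df dw (proj₁ af) (proj₂ af) le nc) se sf
     where
     du = apex T de df
     nb : ¬ Base u
     nb b = base-apex b T
     ae = above T du de refl (lenˡ T de)
     af = above T du df refl (lenʳ T df)

   private
     <≢ : ∀ {a b : ℤ} → a < b → b ≢ a
     <≢ h e = <-irrefl (sym e) h

     strictly : ∀ {u w} → u ≤ w → ¬ Cong u w → u < w
     strictly {u} {w} p nc with <-cmp u w
     ... | tri< h _ _ = h
     ... | tri≈ _ e _ = ⊥-elim (nc (0ℤ , trans e (sym (+-identityʳ w))))
     ... | tri> _ _ h = ⊥-elim (<⇒≱ h p)

     strictly′ : ∀ {u w} → w ≤ u + N → ¬ Cong u w → w < u + N
     strictly′ {u} {w} p nc with <-cmp w (u + N)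
     ... | tri< h _ _ = h
     ... | tri≈ _ e _ = ⊥-elim (nc (- 1ℤ , ar u w N e))
       where
       ar : ∀ u w N → w ≡ u + N → u ≡ w + - 1ℤ * N
       ar u w N e = lin≡ (sym e) (solve (u ∷ w ∷ N ∷ []))
     ... | tri> _ _ h = ⊥-elim (<⇒≱ h p)

     -- If `u` or its translate `u + N` were strictly inside `[e , f]`, it would hang deeper than
     -- `w`, against the length condition. Likewise `[e , f]` cannot pass over the radius at
     -- `z + N`.
     rangeʳ : ∀ {e w f u} (T : Tri e w (fin f)) (du : Vert u) → f ℤ.- e ≤ len du → ¬ Cong u w → u ≤ w → w ≤ u + N → Good u w →
       (u ≤ e × e ≤ u + N × Good u e) × (u ≤ f × f ≤ u + N × Good u f)
     rangeʳ {e} {w} {f} {u} T du le nc p q (z , b , g₁ , g₂) =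
       (u≤e , <⇒≤ (<-≤-trans (Tri.e<u T) q) , z , b , <⇒≤ (<-≤-trans (Tri.e<u T) g₁) , g₂) ,
       (<⇒≤ (≤-<-trans p (Tri.u≺f T)) , f≤ , z , b , by≤ f≤z , g₂)
       where
       u≤e : u ≤ e
       u≤e = by≤ λ h → <⇒≱ (inside T h (<-trans (strictly p nc) (Tri.u≺f T)) (λ eq → <-irrefl eq (strictly p nc)) du) le
       du⁺ : Vert (u + 1ℤ * N)
       du⁺ = vsh 1ℤ du
       f≤ : f ≤ u + N
       f≤ = by≤ λ h → <⇒≱ (subst (_< f ℤ.- e) (len-vsh 1ℤ du) (inside T
           (subst (e <_) (sym (eqN u)) (<-trans (Tri.e<u T) (strictly′ q nc))) (subst (_< f) (sym (eqN u)) h)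
           (λ eq → <-irrefl (sym (trans (sym (eqN u)) eq)) (strictly′ q nc)) du⁺)) le
         where
         eqN : ∀ u → u + 1ℤ * N ≡ u + N
         eqN u = cong (λ x → u + x) (*-identityˡ N)
       f≤z : ¬ (z + N < f)
       f≤z h = not-under (subst Base (cong (λ x → z + x) (*-identityˡ N)) (arc-sh 1ℤ b)) (Tri.a₃ T) (<-≤-trans (Tri.e<u T) g₁) h

     rangeˡ : ∀ {e u f w} (T : Tri e u (fin f)) (dw : Vert w) → f ℤ.- e ≤ len dw → ¬ Cong u w → u ≤ w → w ≤ u + N → Good u w →
       (e ≤ w × w ≤ e + N × Good e w) × (f ≤ w × w ≤ f + N × Good f w)
     rangeˡ {e} {u} {f} {w} T dw le nc p q (z , b , g₁ , g₂) =
       (<⇒≤ (<-≤-trans (Tri.e<u T) p) , w≤ , z , b , g₁ , by≤ z≤e) ,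
       (f≤w , ≤-trans q (+-monoˡ-≤ N (<⇒≤ (Tri.u≺f T))) , z , b , g₁ , ≤-trans g₂ (<⇒≤ (Tri.u≺f T)))
       where
       f≤w : f ≤ w
       f≤w = by≤ λ h → <⇒≱ (inside T (<-trans (Tri.e<u T) (strictly p nc)) h (<≢ (strictly p nc)) dw) le
       eqN : ∀ w → w + - 1ℤ * N ≡ w ℤ.- N
       eqN w = cong (λ x → w + x) (-1*i≡-i N)
       ar₁ : ∀ e w N → e + N < w → e < w ℤ.- N
       ar₁ e w N h = by< λ k → absurd≤ 0 (s≤ h ⊕ k) (solve (e ∷ w ∷ N ∷ []))
       ar₂ : ∀ u w N → w < u + N → w ℤ.- N < u
       ar₂ u w N h = by< λ k → absurd≤ 0 (s≤ h ⊕ k) (solve (u ∷ w ∷ N ∷ []))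
       w-N<u : w ℤ.- N < u
       w-N<u = ar₂ u w N (strictly′ q nc)
       w≤ : w ≤ e + N
       w≤ = by≤ λ h → <⇒≱ (subst (_< f ℤ.- e) (len-vsh (- 1ℤ) dw) (inside T
           (subst (e <_) (sym (eqN w)) (ar₁ e w N h)) (subst (_< f) (sym (eqN w)) (<-trans w-N<u (Tri.u≺f T)))
           (λ eq → <-irrefl (trans (sym (eqN w)) eq) w-N<u) (vsh (- 1ℤ) dw))) le
       z≤e : ¬ (e < z)
       z≤e h = not-under b (Tri.a₃ T) h (≤-<-trans g₂ (Tri.u≺f T))

   Rec : ℤ → ℤ → Set
   Rec u w = u ≤ w → w ≤ u + N → Good u w → SE (Supp (P oneL u (fin w)))

   private
     stepʳ : ∀ {e w f u} (T : Tri e w (fin f)) (de : Vert e) (df : Vert f) (du : Vert u) → f ℤ.- e ≤ len du → ¬ Cong u w → Rec u e → Rec u f → Rec u w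
     stepʳ T de df du le nc re rf p q g = let (p₁ , q₁ , g₁) , (p₂ , q₂ , g₂) = rangeʳ T du le nc p q g in
       SE-apexʳ T de df du le nc (re p₁ q₁ g₁) (rf p₂ q₂ g₂)

     stepˡ : ∀ {e u f w} (T : Tri e u (fin f)) (de : Vert e) (df : Vert f) (dw : Vert w) → f ℤ.- e ≤ len dw → ¬ Cong u w → Rec e w → Rec f w → Rec u w
     stepˡ T de df dw le nc re rf p q g = let (p₁ , q₁ , g₁) , (p₂ , q₂ , g₂) = rangeˡ T dw le nc p q g in
       SE-apexˡ T de df dw le (λ cg → nc (Cong-sym cg)) (re p₁ q₁ g₁) (rf p₂ q₂ g₂)

     len≤ : ∀ {e u f} → Tri e u (fin f) → f ℤ.- e ≤ 1ℤ + N
     len≤ {e} {u} {f} T = ar e f N (arc-len (Tri.a₃ T))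
       where
       ar : ∀ e f N → f ≤ e + N → f ℤ.- e ≤ 1ℤ + N
       ar e f N h = by≤ λ k → absurd≤ 1 (h ⊕ s≤ k) (solve (e ∷ f ∷ N ∷ []))

     step-both : ∀ {e u f e′ w f′} (T : Tri e u (fin f)) (de : Vert e) (df : Vert f) (T′ : Tri e′ w (fin f′)) (de′ : Vert e′) (df′ : Vert f′) →
       Rec u e′ → Rec u f′ → Rec e w → Rec f w → Rec u w
     step-both {e} {u} {f} {e′} {w} {f′} T de df T′ de′ df′ r₁ r₂ r₃ r₄ p q g@(z , b , g₁ , g₂) = go (<-cmp u w) (<-cmp w (u + N))
       where
       go : _ → _ → SE (Supp (P oneL u (fin w)))
       go (tri≈ _ h _) _ = subst (λ w → SE (Supp (P oneL u (fin w)))) h (SE-≃ {P = P oneL u (fin u)} {[]} (P-self oneL u) SE-[])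
       go (tri> _ _ h) _ = ⊥-elim (<⇒≱ h p)
       go (tri< _ _ _) (tri> _ _ h) = ⊥-elim (<⇒≱ h q)
       -- At `w = u + N` the two bounds force `z = u`, but the apex `u` carries no radius. This is
       -- the one place where the square of `xV u` would arise.
       go (tri< _ _ _) (tri≈ _ h _) = ⊥-elim (base-apex (subst Base (≤-antisym g₂ (ar u w z N h g₁)) b) T)
         where
         ar : ∀ u w z N → w ≡ u + N → w ≤ z + N → u ≤ z
         ar u w z N e h = by≤ λ k → absurd≤ 0 (≡⇒≤ (sym e) ⊕ h ⊕ s≤ k) (solve (u ∷ w ∷ z ∷ N ∷ []))
       -- The end point under the shorter arc hangs deeper and is the one expanded.
       go (tri< u<w _ _) (tri< w<u+N _ _) with ≤-total (f ℤ.- e) (f′ ℤ.- e′)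
       ... | inj₁ le = stepˡ T de df (apex T′ de′ df′) le nc r₃ r₄ p q g
         where
         nc : ¬ Cong u w
         nc cg with Cong-near (Cong-sym cg) p q
         ... | inj₁ h = <-irrefl (sym h) u<w
         ... | inj₂ h = <-irrefl h w<u+N
       ... | inj₂ ge = stepʳ T′ de′ df′ (apex T de df) ge nc r₁ r₂ p q g
         where
         nc : ¬ Cong u w
         nc cg with Cong-near (Cong-sym cg) p q
         ... | inj₁ h = <-irrefl (sym h) u<w
         ... | inj₂ h = <-irrefl h w<u+N

     step-base : ∀ {u w} → Base u → Base w → Rec u w
     step-base {u} {w} b b′ p q g = SE-≃ {P = P oneL u (fin w)} {mono (mon (proj₁ b) ⊞ mon (proj₁ b′)) *L sumW u k} (P-bases oneL b b′ k e)
         (SE-mono* (mon (proj₁ b) ⊞ mon (proj₁ b′)) {sumW u k} (SE-sumW u k (drop‿+≤+ (ar u w (+ k) N e q))))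
       where
       k = ∣ w ℤ.- u ∣
       e = +∣-∣ p
       ar : ∀ u w k N → w ≡ u + k → w ≤ u + N → k ≤ N
       ar u w k N e h = by≤ λ g → absurd≤ 0 (≡⇒≤ (sym e) ⊕ h ⊕ s≤ g) (solve (u ∷ w ∷ k ∷ N ∷ []))

   SE-P : ∀ {u w} → Vert u → Vert w → Rec u w
   SE-P (base b) (base b′) = step-base b b′
   SE-P du@(base b) (apex T de df) = stepʳ T de df du (len≤ T) (λ cg → base-apex (Cong-base (Cong-sym cg) b) T) (SE-P du de) (SE-P du df)
   SE-P (apex T de df) dw@(base b) = stepˡ T de df dw (len≤ T) (λ cg → base-apex (Cong-base cg b) T) (SE-P de dw) (SE-P df dw)
   SE-P du@(apex T de df) dw@(apex T′ de′ df′) = step-both T de df T′ de′ df′ (SE-P du de′) (SE-P du df′) (SE-P de dw) (SE-P df dw)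

   -- Radii: K = 1 for the tagging of the initial triangulation, K = c for the other one.
   SE-x : ∀ K → (∀ {w} → ¬ Base w → Hom (W (w %ℕ n)) 0ℤ K) → SE (Supp K) → ∀ {u} (d : Vert u) → SE (Supp (K *L xd d))
   SE-x K hK sK (base b) = SE-≃ {P = K *L mono (mon (proj₁ b))} {mono (mon (proj₁ b)) *L K} (*L-comm K (mono (mon (proj₁ b)))) (SE-mono* (mon (proj₁ b)) {K} sK)
   SE-x K hK sK {u} (apex T de df) = SE-comb (W (u %ℕ n)) {K *L combine T (xd de) (xd df)} {K *L xd de} {K *L xd df} (⊟ mon (proj₁ (Tri.a₃ T))) (mon (proj₁ (Tri.a₂ T))) (mon (proj₁ (Tri.a₁ T)))
       (IntRingIdentities.D-scale (LRing (r ℕ.+ n)) (LHom (r ℕ.+ n)) K (mono (⊟ mon (proj₁ (Tri.a₃ T)))) (mono (mon (proj₁ (Tri.a₂ T)))) (mono (mon (proj₁ (Tri.a₁ T)))) (xd de) (xd df))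
       (proj₁ (degrees T de df)) (proj₂ (degrees T de df))
       (hx de (lenˡ T de)) (hx df (lenʳ T df)) (SE-x K hK sK de) (SE-x K hK sK df)
     where
     nb : ¬ Base u
     nb b = base-apex b T
     hx : ∀ {v} (d : Vert v) → _ < len d → Hom (W (u %ℕ n)) 0ℤ (K *L xd d)
     hx d h = let a = above T (apex T de df) d refl h in Hom-* {w = W (u %ℕ n)} {P = K} {xd d} (hK nb) (proj₁ (Hom-V nb (apex T de df) d (proj₁ a) (proj₂ a)))

   SE-xV : ∀ u → SE (Supp (oneL *L xV u))
   SE-xV u = SE-x oneL (λ {w} _ → Hom-mono (W (w %ℕ n)) (dot-𝟘 (W (w %ℕ n)))) (SE-monomial 𝟘) (vert u)

   SE-cxV : ∀ u → SE (Supp (c *L xV u))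
   SE-cxV u = SE-x c (λ nb → Hom-rr nb N) (SE-sumW 0ℤ n ℕP.≤-refl) (vert u)

   -- Multiplicatively: the square of `a b′ / β` is the product of `a a′ s / (β t)` and
   -- `b b′ t / (β s)` as soon as `a′ b = a b′`.
   vec-mid : ∀ {m} (β a a′ b b′ s t : Mon m) → a′ ⊞ b ≡ a ⊞ b′ →
     (β ⊞ (a ⊞ b′)) ⊞ (β ⊞ (a ⊞ b′)) ≡ (β ⊞ ((a ⊞ a′) ⊞ (s ⊞ (⊟ t)))) ⊞ (β ⊞ ((b ⊞ b′) ⊞ (t ⊞ (⊟ s))))
   vec-mid V.[] V.[] V.[] V.[] V.[] V.[] V.[] _ = refl
   vec-mid (β V.∷ βs) (a V.∷ as) (a′ V.∷ as′) (b V.∷ bs) (b′ V.∷ bs′) (s V.∷ ss) (t V.∷ ts) e =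
     cong₂ V._∷_ (ar β a a′ b b′ s t (VecP.∷-injectiveˡ e)) (vec-mid βs as as′ bs bs′ ss ts (VecP.∷-injectiveʳ e))
     where
     ar : ∀ β a a′ b b′ s t → a′ + b ≡ a + b′ → (β + (a + b′)) + (β + (a + b′)) ≡ (β + ((a + a′) + (s + - t))) + (β + ((b + b′) + (t + - s)))
     ar β a a′ b b′ s t e = lin≡ (sym e) (solve (β ∷ a ∷ a′ ∷ b ∷ b′ ∷ s ∷ t ∷ []))

   module Strip {s t : ℤ} (S : Tri s t ∞) where

     private
       bs = Tri.a₃ S
       bt = Tri.a₂ S
       t≤s+N : t ≤ s + N
       t≤s+N = arc-len (Tri.a₁ S)

     -- Inside the strip a λ-length `[u , w]` has degree one in the arcs starting at `s` if `u = s`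
     -- and degree zero otherwise. This will separate two of the monomials.
     deg : ℤ → ℤ
     deg u = if does (u ℤ.≟ s) then 1ℤ else 0ℤ

     deg-≢ : ∀ {u} → u ≢ s → deg u ≡ 0ℤ
     deg-≢ {u} h = cong (if_then 1ℤ else 0ℤ) (dec-false (u ℤ.≟ s) h)

     deg-s : deg s ≡ 1ℤ
     deg-s = cong (if_then 1ℤ else 0ℤ) (dec-true (s ℤ.≟ s) refl)

     deg-arc : ∀ {e f} (a : Arc e (fin f)) → s ≤ e → e < t → dot (W (s %ℕ n)) (mon (proj₁ a)) ≡ deg e
     deg-arc {e} (ℓ , on) p q with e ℤ.≟ s
     ... | yes refl = deg-yes s on (0ℤ , sym (+-identityʳ s))
     ... | no ne = deg-no s on λ cg → clash (Cong-near cg p (<⇒≤ (<-≤-trans q t≤s+N)))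
       where
       clash : e ≡ s ⊎ e ≡ s + N → ⊥
       clash (inj₁ h) = ne h
       clash (inj₂ h) = <-irrefl h (<-≤-trans q t≤s+N)

     base-in : ∀ {u} → Base u → s ≤ u → u ≤ t → u ≡ s ⊎ u ≡ t
     base-in {u} b p q with <-cmp u s | <-cmp u t
     ... | tri≈ _ h _ | _ = inj₁ h
     ... | _ | tri≈ _ h _ = inj₂ h
     ... | tri< h _ _ | _ = ⊥-elim (<⇒≱ h p)
     ... | _ | tri> _ _ h = ⊥-elim (<⇒≱ h q)
     ... | tri> _ _ h | tri< k _ _ = ⊥-elim (not-under b (Tri.a₁ S) h k)

     -- A positive representative, homogeneous for the degree counting arcs that start at s.
     record PosHom (u w : ℤ) : Set where
       constructor posHom
       field
         Q   : R
         P≃Q : P oneL u (fin w) ≃ Q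
         posQ : PosC Q
         ne  : u < w → ∃ (_∈ Q)
         hom : Hom (W (s %ℕ n)) (deg u) Q

     private
       i = s %ℕ n

       combine-pos : ∀ {e u f} (T : Tri e u (fin f)) {y z} → PosC y → PosC z → PosC (combine T y z)
       combine-pos T {y} {z} py pz = PosC-* {P = mono (⊟ mon (proj₁ (Tri.a₃ T)))} {(mono (mon (proj₁ (Tri.a₂ T))) *L y) +L (mono (mon (proj₁ (Tri.a₁ T))) *L z)} (proj₁ (PosL-mono (⊟ mon (proj₁ (Tri.a₃ T)))))
         (AllP.++⁺ (PosC-* {P = mono (mon (proj₁ (Tri.a₂ T)))} {y} (proj₁ (PosL-mono (mon (proj₁ (Tri.a₂ T))))) py) (PosC-* {P = mono (mon (proj₁ (Tri.a₁ T)))} {z} (proj₁ (PosL-mono (mon (proj₁ (Tri.a₁ T))))) pz))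

       combine-ne₂ : ∀ {e u f} (T : Tri e u (fin f)) {y z} → ∃ (_∈ z) → ∃ (_∈ combine T y z)
       combine-ne₂ T {y} {z} (q , i) = _ , ∈-* {P = mono (⊟ mon (proj₁ (Tri.a₃ T)))} {(mono (mon (proj₁ (Tri.a₂ T))) *L y) +L (mono (mon (proj₁ (Tri.a₁ T))) *L z)} (here refl) (∈-++⁺ʳ (mono (mon (proj₁ (Tri.a₂ T))) *L y) (∈-* {P = mono (mon (proj₁ (Tri.a₁ T)))} {z} (here refl) i))

       combine-ne₁ : ∀ {e u f} (T : Tri e u (fin f)) {y z} → ∃ (_∈ y) → ∃ (_∈ combine T y z)
       combine-ne₁ T {y} {z} (q , i) = _ , ∈-* {P = mono (⊟ mon (proj₁ (Tri.a₃ T)))} {(mono (mon (proj₁ (Tri.a₂ T))) *L y) +L (mono (mon (proj₁ (Tri.a₁ T))) *L z)} (here refl) (∈-++⁺ˡ (∈-* {P = mono (mon (proj₁ (Tri.a₂ T)))} {y} (here refl) i))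

       PH : ℤ → ℤ → Set
       PH u w = s ≤ u → u ≤ w → w ≤ t → PosHom u w

       within : ∀ {e u f} → Tri e u (fin f) → s ≤ u → u ≤ t → s ≤ e × f ≤ t × s < u × u < t
       within {e} {u} {f} T p q = by≤ (λ h → not-under bs (Tri.a₃ T) h (<-trans s<u (Tri.u≺f T))) , by≤ (λ h → not-under bt (Tri.a₃ T) (<-trans (Tri.e<u T) u<t) h) , s<u , u<t
         where
         nb : ∀ {z} → Base z → u ≢ z
         nb b refl = base-apex b T
         s<u : s < u
         s<u with <-cmp s u
         ... | tri< h _ _ = h
         ... | tri≈ _ h _ = ⊥-elim (nb bs (sym h))
         ... | tri> _ _ h = ⊥-elim (<⇒≱ h p)
         u<t : u < t
         u<t with <-cmp u t
         ... | tri< h _ _ = h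
         ... | tri≈ _ h _ = ⊥-elim (nb bt h)
         ... | tri> _ _ h = ⊥-elim (<⇒≱ h q)

       degs : ∀ {e u f} (T : Tri e u (fin f)) → s ≤ u → u ≤ t →
         dot (W i) (mon (proj₁ (Tri.a₂ T))) ≡ 0ℤ × dot (W i) (mon (proj₁ (Tri.a₁ T))) ≡ deg e × dot (W i) (mon (proj₁ (Tri.a₃ T))) ≡ deg e
       degs T p q = let s≤e , f≤t , s<u , u<t = within T p q in
         trans (deg-arc (Tri.a₂ T) p u<t) (deg-≢ λ h → <-irrefl (sym h) s<u)
         , deg-arc (Tri.a₁ T) s≤e (<-trans (Tri.e<u T) u<t) , deg-arc (Tri.a₃ T) s≤e (<-trans (Tri.e<u T) u<t)

       -- The value at equal ends is zero, represented by the empty list.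
       zero-or : ∀ {u w} → PH u w → s ≤ u → u ≤ w → w ≤ t → ∀ k → (u < w → deg u ≡ k) →
         ∃ λ Q → P oneL u (fin w) ≃ Q × PosC Q × (u < w → ∃ (_∈ Q)) × Hom (W i) k Q
       zero-or {u} {w} ph p q q′ k h with <-cmp u w
       ... | tri< lt _ _ = let posHom Q e po ne ho = ph p q q′ in Q , e , po , ne , subst (λ k → Hom (W i) k Q) (h lt) ho
       ... | tri≈ _ refl _ = [] , P-self oneL u , All.[] , (λ lt → ⊥-elim (<-irrefl refl lt)) , All.[]
       ... | tri> _ _ gt = ⊥-elim (<⇒≱ gt q)

       -- The recursion used for emptiness again, with the same choice of the deeper end point, but
       -- carrying positivity and one degree. Between two consecutive radii no periodicity
       -- interferes.
       ph-stepʳ : ∀ {e w f u} (T : Tri e w (fin f)) (du : Vert u) → f ℤ.- e ≤ len du → u < w → PH u e → PH u f → PH u w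
       ph-stepʳ {e} {w} {f} {u} T du le u<w re rf p q q′ =
         let s≤e , f≤t , s<w , w<t = within T (≤-trans p q) q′
             d₂ , d₁ , d₃ = degs T (≤-trans p q) q′
             u<f = <-trans u<w (Tri.u≺f T)
             u≤e = by≤ λ h → <⇒≱ (inside T h u<f (λ eq → <-irrefl eq u<w) du) le
             Qe , ee , pe , _ , he = zero-or re p u≤e (<⇒≤ (<-trans (Tri.e<u T) w<t)) (deg e + deg u)
               (λ u<e → sym (trans (cong (_+ deg u) (deg-≢ λ h → <-irrefl (sym h) (≤-<-trans p u<e))) (+-identityˡ (deg u))))
             posHom Qf ef pf nf hf = rf p (<⇒≤ u<f) f≤t
         in posHom (combine T Qe Qf) (≃-trans {P = P oneL u (fin w)} {combine T (P oneL u (fin e)) (P oneL u (fin f))} {combine T Qe Qf} (P-apexʳ oneL T u)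
              (combine-≈ T {P oneL u (fin e)} {Qe} {P oneL u (fin f)} {Qf} ee ef)) (combine-pos T {Qe} {Qf} pe pf) (λ _ → combine-ne₂ T {Qe} {Qf} (nf u<f))
              (Hom-combine i T {Qe} {Qf} d₂ d₁ d₃ he hf)

       ph-stepˡ : ∀ {e u f w} (T : Tri e u (fin f)) (dw : Vert w) → f ℤ.- e ≤ len dw → u < w → PH e w → PH f w → PH u w
       ph-stepˡ {e} {u} {f} {w} T dw le u<w re rf p q q′ =
         let s≤e , f≤t , s<u , u<t = within T p (≤-trans q q′)
             d₂ , d₁ , d₃ = degs T p (≤-trans q q′)
             e<w = <-trans (Tri.e<u T) u<w
             f≤w = by≤ λ h → <⇒≱ (inside T e<w h (<≢ u<w) dw) le
             du0 = deg-≢ λ h → <-irrefl (sym h) s<u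
             posHom Qe ee pe ne he = re s≤e (<⇒≤ e<w) q′
             Qf , ef , pf , _ , hf = zero-or rf (<⇒≤ (<-trans s<u (Tri.u≺f T))) f≤w q′ (deg u)
               (λ _ → trans (deg-≢ λ h → <-irrefl (sym h) (<-trans s<u (Tri.u≺f T))) (sym du0))
         in posHom (combine T Qe Qf) (≃-trans {P = P oneL u (fin w)} {combine T (P oneL e (fin w)) (P oneL f (fin w))} {combine T Qe Qf} (P-apexˡ oneL T w)
              (combine-≈ T {P oneL e (fin w)} {Qe} {P oneL f (fin w)} {Qf} ee ef)) (combine-pos T {Qe} {Qf} pe pf) (λ _ → combine-ne₁ T {Qe} {Qf} (ne e<w))
              (Hom-combine i T {Qe} {Qf} d₂ d₁ d₃ (subst (λ k → Hom (W i) k Qe) (sym (trans (cong (λ z → deg e + z) du0) (+-identityʳ (deg e)))) he) hf)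

       ph-base : ∀ {u w} → Base u → Base w → u < w → PH u w
       ph-base {u} {w} b b′ u<w p q q′ with base-in b p (≤-trans q q′) | base-in b′ (≤-trans p q) q′
       ... | inj₁ refl | inj₂ refl = posHom (mono (mon (proj₁ (Tri.a₁ S)))) (P-side oneL S) (proj₁ (PosL-mono (mon (proj₁ (Tri.a₁ S))))) (λ _ → proj₂ (PosL-mono (mon (proj₁ (Tri.a₁ S)))))
                                       (Hom-mono (W i) (deg-arc (Tri.a₁ S) ≤-refl (Tri.e<u S)))
       ... | inj₁ refl | inj₁ refl = ⊥-elim (<-irrefl refl u<w)
       ... | inj₂ refl | inj₂ refl = ⊥-elim (<-irrefl refl u<w)
       ... | inj₂ refl | inj₁ refl = ⊥-elim (<-asym u<w (Tri.e<u S))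

       ph-any : ∀ {u w} → (u < w → PH u w) → PH u w
       ph-any {u} {w} h p q q′ with <-cmp u w
       ... | tri< lt _ _ = h lt p q q′
       ... | tri≈ _ refl _ = posHom [] (P-self oneL u) All.[] (λ lt → ⊥-elim (<-irrefl refl lt)) All.[]
       ... | tri> _ _ gt = ⊥-elim (<⇒≱ gt q)

       ph-both : ∀ {e u f e′ w f′} (T : Tri e u (fin f)) (de : Vert e) (df : Vert f) (T′ : Tri e′ w (fin f′)) (de′ : Vert e′) (df′ : Vert f′) →
         PH u e′ → PH u f′ → PH e w → PH f w → u < w → PH u w
       ph-both {e} {u} {f} {e′} {w} {f′} T de df T′ de′ df′ r₁ r₂ r₃ r₄ lt with ≤-total (f ℤ.- e) (f′ ℤ.- e′)
       ... | inj₁ le = ph-stepˡ T (apex T′ de′ df′) le lt r₃ r₄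
       ... | inj₂ ge = ph-stepʳ T′ (apex T de df) ge lt r₁ r₂

       posP : ∀ {u w} → Vert u → Vert w → PH u w
       posP (base b) (base b′) = ph-any (ph-base b b′)
       posP du@(base b) (apex T de df) = ph-any λ lt → ph-stepʳ T du (len≤ T) lt (posP du de) (posP du df)
       posP (apex T de df) dw@(base b) = ph-any λ lt → ph-stepˡ T dw (len≤ T) lt (posP de dw) (posP df dw)
       posP du@(apex T de df) dw@(apex T′ de′ df′) = ph-any (ph-both T de df T′ de′ df′ (posP du de′) (posP du df′) (posP de dw) (posP df dw))

       posW : ∀ z k → PosC (sumW z k)
       posW z zero = All.[]
       posW z (suc k) = AllP.++⁺ (posW z k) (one (base? (z + + k)))
         where
         one : ∀ {y} → Dec (Base y) → PosC (wt y)
         one (yes b) = subst PosC (sym (wt-base (proj₂ (inner b tt)))) (proj₁ (PosL-mono (wtExp (proj₂ (inner b tt)))))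
         one (no nb) = subst PosC (sym (wt-other nb)) All.[]

     ph : ∀ {u w} → s ≤ u → u ≤ w → w ≤ t → PosHom u w
     ph {u} {w} = posP (vert u) (vert w)

     -- Monomials a′b = ab′ exist by positivity of straighten; then ab′/β is the midpoint of two other terms.
     nonempty : ∀ {u v} → s < v → v < u → u < t → ¬ NewtonEmpty (P oneL u (fin (v + 1ℤ * N)))
     nonempty {u} {v} s<v v<u u<t = midpoint-nonempty (P oneL u (fin (v + 1ℤ * N))) supp₁ supp₃ distinct (vec-mid (⊟ mβ) (proj₂ a) (proj₂ a′) (proj₂ b) (proj₂ b′) mₛ mₜ mid)
       where
       open Wrap oneL S u v
       s<u = <-trans s<v v<u
       v<t = <-trans v<u u<t
       module PA = PosHom (ph (<⇒≤ s<u) (<⇒≤ u<t) ≤-refl)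
       module PA′ = PosHom (ph (<⇒≤ s<v) (<⇒≤ v<t) ≤-refl)
       module PB = PosHom (ph ≤-refl (<⇒≤ s<u) (<⇒≤ u<t))
       module PB′ = PosHom (ph ≤-refl (<⇒≤ s<v) (<⇒≤ v<t))
       module PP = PosHom (ph (<⇒≤ s<v) (<⇒≤ v<u) (<⇒≤ u<t))
       mβ = mon (proj₁ (Tri.a₁ S))
       mₛ = mon (proj₁ bs)
       mₜ = mon (proj₁ bt)
       a = proj₁ (PA.ne u<t)
       b′ = proj₁ (PB′.ne s<v)
       a∈ = proj₂ (PA.ne u<t)
       b′∈ = proj₂ (PB′.ne s<v)
       eqn : (PA′.Q *L PB.Q) ≃ ((PA.Q *L PB′.Q) +L (PP.Q *L β))
       eqn = ≃-trans {P = PA′.Q *L PB.Q} {A′ *L B} {(PA.Q *L PB′.Q) +L (PP.Q *L β)}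
         (≃-sym {P = A′ *L B} {PA′.Q *L PB.Q} (*L-cong {P = A′} {PA′.Q} {B} {PB.Q} PA′.P≃Q PB.P≃Q))
         (≃-trans {P = A′ *L B} {(A *L B′) +L (P oneL v (fin u) *L β)} {(PA.Q *L PB′.Q) +L (PP.Q *L β)} straighten
           (+L-cong {P = A *L B′} {PA.Q *L PB′.Q} {P oneL v (fin u) *L β} {PP.Q *L β} (*L-cong {P = A} {PA.Q} {B′} {PB′.Q} PA.P≃Q PB′.P≃Q) (*L-cong {P = P oneL v (fin u)} {PP.Q} {β} {β} PP.P≃Q (≃-refl {P = β}))))
       found = ∈-*⁻ PA′.Q PB.Q (proj₂ (supp-∈ (PA′.Q *L PB.Q) (proj₂ a ⊞ proj₂ b′) λ z →
         PosC-supp {P = (PA.Q *L PB′.Q) +L (PP.Q *L β)} (AllP.++⁺ (PosC-* {P = PA.Q} {PB′.Q} PA.posQ PB′.posQ) (PosC-* {P = PP.Q} {β} PP.posQ (proj₁ (PosL-mono mβ))))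
           (∈-++⁺ˡ (∈-* {P = PA.Q} {PB′.Q} a∈ b′∈)) (trans (sym (eqn (proj₂ a ⊞ proj₂ b′))) z)))
       a′ = proj₁ found
       b = proj₁ (proj₂ found)
       a′∈ = proj₁ (proj₂ (proj₂ found))
       b∈ = proj₁ (proj₂ (proj₂ (proj₂ found)))
       mid : proj₂ a′ ⊞ proj₂ b ≡ proj₂ a ⊞ proj₂ b′
       mid = sym (proj₂ (proj₂ (proj₂ (proj₂ found))))
       q₁ q₂ q₃ qx : R
       q₁ = (PA.Q *L PA′.Q) *L (xₛ *L xₜ⁻)
       q₂ = (PB.Q *L PB′.Q) *L (xₜ *L xₛ⁻)
       q₃ = PA.Q *L PB′.Q
       qx = c′ *L ((β⁻ *L ((PA.Q *L xₛ) +L (PB.Q *L xₜ))) *L (β⁻ *L ((PA′.Q *L xₛ) +L (PB′.Q *L xₜ))))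
       total : R
       total = qx +L (β⁻ *L (((q₁ +L q₂) +L q₃) +L q₃))
       rep : P oneL u (fin (v + 1ℤ * N)) ≃ total
       rep = wrap′ {PA.Q} {PA′.Q} {PB.Q} {PB′.Q} PA.P≃Q PA′.P≃Q PB.P≃Q PB′.P≃Q
       mp : ∀ e → PosC (mono e)
       mp e = proj₁ (PosL-mono e)
       p₃ : PosC q₃
       p₃ = PosC-* {P = PA.Q} {PB′.Q} PA.posQ PB′.posQ
       totalPos : PosC total
       totalPos = AllP.++⁺ (PosC-* {P = c′} (posW (1ℤ + s) (ℕ.pred n)) (PosC-* {P = β⁻ *L ((PA.Q *L xₛ) +L (PB.Q *L xₜ))}
           (PosC-* {P = β⁻} {(PA.Q *L xₛ) +L (PB.Q *L xₜ)} (mp (⊟ mβ)) (AllP.++⁺ (PosC-* {P = PA.Q} {xₛ} PA.posQ (mp mₛ)) (PosC-* {P = PB.Q} {xₜ} PB.posQ (mp mₜ))))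
           (PosC-* {P = β⁻} {(PA′.Q *L xₛ) +L (PB′.Q *L xₜ)} (mp (⊟ mβ)) (AllP.++⁺ (PosC-* {P = PA′.Q} {xₛ} PA′.posQ (mp mₛ)) (PosC-* {P = PB′.Q} {xₜ} PB′.posQ (mp mₜ))))))
         (PosC-* {P = β⁻} {((q₁ +L q₂) +L q₃) +L q₃} (mp (⊟ mβ)) (AllP.++⁺ (AllP.++⁺ (AllP.++⁺
           (PosC-* {P = PA.Q *L PA′.Q} {xₛ *L xₜ⁻} (PosC-* {P = PA.Q} {PA′.Q} PA.posQ PA′.posQ) (mp (mₛ ⊞ (⊟ mₜ))))
           (PosC-* {P = PB.Q *L PB′.Q} {xₜ *L xₛ⁻} (PosC-* {P = PB.Q} {PB′.Q} PB.posQ PB′.posQ) (mp (mₜ ⊞ (⊟ mₛ))))) p₃) p₃))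
       e₁ e₃ : Mon (r ℕ.+ n)
       e₁ = (⊟ mβ) ⊞ ((proj₂ a ⊞ proj₂ a′) ⊞ (mₛ ⊞ (⊟ mₜ)))
       e₃ = (⊟ mβ) ⊞ ((proj₂ b ⊞ proj₂ b′) ⊞ (mₜ ⊞ (⊟ mₛ)))
       inTotal : ∀ {k e} → (k , e) ∈ (((q₁ +L q₂) +L q₃) +L q₃) → Supp (P oneL u (fin (v + 1ℤ * N))) ((⊟ mβ) ⊞ e)
       inTotal {k} {e} i z = PosC-supp {P = total} totalPos (∈-++⁺ʳ qx (∈-* {P = β⁻} {((q₁ +L q₂) +L q₃) +L q₃} (here refl) i)) (trans (sym (rep ((⊟ mβ) ⊞ e))) z)
       supp₁ : Supp (P oneL u (fin (v + 1ℤ * N))) e₁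
       supp₁ = inTotal (∈-++⁺ˡ (∈-++⁺ˡ (∈-++⁺ˡ (∈-* {P = PA.Q *L PA′.Q} {xₛ *L xₜ⁻} (∈-* {P = PA.Q} {PA′.Q} a∈ a′∈) (here refl)))))
       supp₃ : Supp (P oneL u (fin (v + 1ℤ * N))) e₃
       supp₃ = inTotal (∈-++⁺ˡ (∈-++⁺ˡ (∈-++⁺ʳ q₁ (∈-* {P = PB.Q *L PB′.Q} {xₜ *L xₛ⁻} (∈-* {P = PB.Q} {PB′.Q} b∈ b′∈) (here refl)))))
       w = W (s %ℕ n)
       dotE : ∀ x y p q → dot w ((⊟ mβ) ⊞ ((x ⊞ y) ⊞ (p ⊞ (⊟ q)))) ≡ - dot w mβ + ((dot w x + dot w y) + (dot w p + - dot w q))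
       dotE x y p q = trans (dot-⊞ w (⊟ mβ) _) (cong₂ _+_ (dot-⊟ w mβ) (trans (dot-⊞ w (x ⊞ y) _) (cong₂ _+_ (dot-⊞ w x y) (trans (dot-⊞ w p (⊟ q)) (cong (λ z → dot w p + z) (dot-⊟ w q))))))
       dₛ : dot w mₛ ≡ 0ℤ
       dₛ = deg-∞ (s %ℕ n) (proj₂ bs)
       dₜ : dot w mₜ ≡ 0ℤ
       dₜ = deg-∞ (s %ℕ n) (proj₂ bt)
       da : dot w (proj₂ a) ≡ 0ℤ
       da = trans (All.lookup PA.hom a∈) (deg-≢ λ h → <-irrefl (sym h) s<u)
       da′ : dot w (proj₂ a′) ≡ 0ℤ
       da′ = trans (All.lookup PA′.hom a′∈) (deg-≢ λ h → <-irrefl (sym h) s<v)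
       db : dot w (proj₂ b) ≡ 1ℤ
       db = trans (All.lookup PB.hom b∈) deg-s
       db′ : dot w (proj₂ b′) ≡ 1ℤ
       db′ = trans (All.lookup PB′.hom b′∈) deg-s
       sums : ∀ x y p q {X Y P′ Q′ : ℤ} → dot w x ≡ X → dot w y ≡ Y → dot w p ≡ P′ → dot w q ≡ Q′ →
         dot w ((⊟ mβ) ⊞ ((x ⊞ y) ⊞ (p ⊞ (⊟ q)))) ≡ - dot w mβ + ((X + Y) + (P′ + - Q′))
       sums x y p q refl refl refl refl = dotE x y p q
       -- Counting arcs that start at `s`, the factors `a` and `a′` have degree 0, the factors `b`
       -- and `b′` degree 1, and radii degree 0. So the degrees of `e₁` and `e₃` differ by 2.
       distinct : e₁ ≢ e₃
       distinct h = ar (dot w mβ) (trans (sym (sums (proj₂ a) (proj₂ a′) mₛ mₜ da da′ dₛ dₜ)) (trans (cong (dot w) h) (sums (proj₂ b) (proj₂ b′) mₜ mₛ db db′ dₜ dₛ)))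
         where
         ar : ∀ k → ¬ (- k + 0ℤ ≡ - k + + 2)
         ar k e = absurd≤ 1 (≡⇒≤ (sym e)) (solve (k ∷ []))

-- Crossing numbers as crossings of lifts

module Crossings where
 open IntegerInequalities
 open UniversalCover
 open import Data.Bool using (Bool; true; false; _∧_; _∨_)
 open import Data.Bool.Properties using (∨-zeroʳ)
 open import Data.Nat using (ℕ; suc)
 open import Data.Integer using (ℤ; +_; -[1+_]; _+_; _*_; -_; _≤_; _<_; 0ℤ; 1ℤ)
 open import Data.Integer.Properties hiding (_≟_)
 open import Data.Integer.Tactic.RingSolver using (solve; solve-∀)
 open import Data.List using ([]; _∷_)

 does-true : ∀ {A : Set} (d : Dec A) → does d ≡ true → A
 does-true (yes a) _ = a

 ∧-split : ∀ {a b} → a ∧ b ≡ true → a ≡ true × b ≡ true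
 ∧-split {true} {true} _ = refl , refl

 ∨-split : ∀ {a b} → a ∨ b ≡ true → a ≡ true ⊎ b ≡ true
 ∨-split {true} _ = inj₁ refl
 ∨-split {false} h = inj₂ h

 Inter : ℤ → ℤ → ℤ → ℤ → Set
 Inter a b c d = (a < c × c < b × b < d) ⊎ (c < a × a < d × d < b)

 interleave-sound : ∀ a b c d → interleave a b c d ≡ true → Inter a b c d
 interleave-sound a b c d h with ∨-split h
 ... | inj₁ p = let x , yz = ∧-split p; y , z = ∧-split yz in inj₁ (does-true (a ℤ.<? c) x , does-true (c ℤ.<? b) y , does-true (b ℤ.<? d) z)
 ... | inj₂ p = let x , yz = ∧-split p; y , z = ∧-split yz in inj₂ (does-true (c ℤ.<? a) x , does-true (a ℤ.<? d) y , does-true (d ℤ.<? b) z)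

 interleave-complete : ∀ a b c d → Inter a b c d → interleave a b c d ≡ true
 interleave-complete a b c d (inj₁ (x , y , z)) rewrite dec-true (a ℤ.<? c) x | dec-true (c ℤ.<? b) y | dec-true (b ℤ.<? d) z = refl
 interleave-complete a b c d (inj₂ (x , y , z)) rewrite dec-true (c ℤ.<? a) x | dec-true (a ℤ.<? d) y | dec-true (d ℤ.<? b) z = ∨-zeroʳ _

 count3 : Bool → Bool → Bool → ℕ
 count3 true true true = 3
 count3 true true false = 2
 count3 true false true = 2
 count3 true false false = 1
 count3 false true true = 2
 count3 false true false = 1
 count3 false false true = 1
 count3 false false false = 0

 count3-zero : ∀ x y z → x ≢ true → y ≢ true → z ≢ true → count3 x y z ≡ 0
 count3-zero false false false _ _ _ = refl
 count3-zero true _ _ p _ _ = ⊥-elim (p refl)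
 count3-zero false true _ _ p _ = ⊥-elim (p refl)
 count3-zero false false true _ _ p = ⊥-elim (p refl)

 count3-≤1 : ∀ x y z → ¬ (x ≡ true × y ≡ true) → ¬ (x ≡ true × z ≡ true) → ¬ (y ≡ true × z ≡ true) → count3 x y z ℕ.≤ 1
 count3-≤1 true true z p _ _ = ⊥-elim (p (refl , refl))
 count3-≤1 true false true _ q _ = ⊥-elim (q (refl , refl))
 count3-≤1 true false false _ _ _ = ℕ.s≤s ℕ.z≤n
 count3-≤1 false true true _ _ s = ⊥-elim (s (refl , refl))
 count3-≤1 false true false _ _ _ = ℕ.s≤s ℕ.z≤n
 count3-≤1 false false true _ _ _ = ℕ.s≤s ℕ.z≤n
 count3-≤1 false false false _ _ _ = ℕ.z≤n

 lo : OArc → ℤ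
 lo (iv i k) = + i
 lo (rad i) = + i

 hi : OArc → Pt
 hi (iv i k) = fin (+ (i ℕ.+ k))
 hi (rad i) = ∞

 module CrossingNumber (n : ℕ) (2≤n : 2 ℕ.≤ n) where
   open Cover n 2≤n

   on-lo : ∀ {y u v} → On y u v → ∃ λ t → u ≡ lo y + t * N × v ≡ sh t (hi y)
   on-lo (on-iv {i} {k} t refl refl) = t , refl , cong fin (ar (+ i) (+ k) t N)
     where
     ar : ∀ i k t N → i + t * N + k ≡ i + k + t * N
     ar = solve-∀
   on-lo (on-rad t refl) = t , refl , refl

   lo-on : ∀ y t → On y (lo y + t * N) (sh t (hi y))
   lo-on (iv i k) t = on-iv t refl (ar (+ i) (+ k) t N)
     where
     ar : ∀ i k t N → i + k + t * N ≡ i + t * N + k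
     ar = solve-∀
   lo-on (rad i) t = on-rad t refl

   lo-on₀ : ∀ y → On y (lo y) (hi y)
   lo-on₀ y = subst₂ (On y) (+-identityʳ (lo y)) (sh0 (hi y)) (lo-on y 0ℤ)
     where
     sh0 : ∀ v → sh 0ℤ v ≡ v
     sh0 (fin v) = cong fin (+-identityʳ v)
     sh0 ∞ = refl

   ≺-sh : ∀ t {x y} → x ≺ y → sh t x ≺ sh t y
   ≺-sh t {fin x} {fin y} p = +-monoˡ-< (t * N) p
   ≺-sh t {fin x} {∞} p = tt

   X-sh : ∀ t {u v u′ v′} → X u v u′ v′ → X (u + t * N) (sh t v) (u′ + t * N) (sh t v′)
   X-sh t {u} {v} {u′} {v′} (p , q , r) = +-monoˡ-< (t * N) p , ≺-sh t {fin u′} {v} q , ≺-sh t {v} {v′} r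

   Crosses : ℤ → Pt → ℤ → Pt → Set
   Crosses u v u′ v′ = X u v u′ v′ ⊎ X u′ v′ u v

   Crosses-sh : ∀ t {u v u′ v′} → Crosses u v u′ v′ → Crosses (u + t * N) (sh t v) (u′ + t * N) (sh t v′)
   Crosses-sh t (inj₁ x) = inj₁ (X-sh t x)
   Crosses-sh t (inj₂ x) = inj₂ (X-sh t x)

   CrossL : OArc → OArc → ℤ → Set
   CrossL α β t = Crosses (lo α) (hi α) (lo β + t * N) (sh t (hi β))

   crossesL : ∀ {α β u v u′ v′} → On α u v → On β u′ v′ → Crosses u v u′ v′ → ∃ λ t → CrossL α β t
   crossesL {α} {β} a b x with on-lo a | on-lo b
   ... | s , refl , refl | s′ , refl , refl = s′ ℤ.- s , subst₂ (λ p q → Crosses (lo α) (hi α) p q) (ar′ (lo β) s s′ N) (shsh′ (hi β))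
         (subst₂ (λ p q → Crosses p q (lo β + s′ * N + - s * N) (sh (- s) (sh s′ (hi β)))) (ar (lo α) s N) (shsh (hi α)) (Crosses-sh (- s) x))
     where
     ar : ∀ u t N → u + t * N + - t * N ≡ u
     ar = solve-∀
     ar′ : ∀ u s s′ N → u + s′ * N + - s * N ≡ u + (s′ ℤ.- s) * N
     ar′ = solve-∀
     shsh : ∀ v → sh (- s) (sh s v) ≡ v
     shsh (fin v) = cong fin (ar v s N)
     shsh ∞ = refl
     shsh′ : ∀ v → sh (- s) (sh s′ v) ≡ sh (s′ ℤ.- s) v
     shsh′ (fin v) = cong fin (ar′ v s s′ N)
     shsh′ ∞ = refl

   cr : ℕ → ℕ → OArc → ℤ → Bool
   cr i k (iv j l) t = interleave (+ i) (+ (i ℕ.+ k)) (+ j + t * N) (+ (j ℕ.+ l) + t * N)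
   cr i k (rad j) t = does (+ i ℤ.<? + j + t * N) ∧ does (+ j + t * N ℤ.<? + (i ℕ.+ k))

   cr-sound : ∀ i k β t → cr i k β t ≡ true → CrossL (iv i k) β t
   cr-sound i k (iv j l) t h = interleave-sound _ _ _ _ h
   cr-sound i k (rad j) t h = let p , q = ∧-split h in inj₁ (does-true (+ i ℤ.<? _) p , does-true (_ ℤ.<? + (i ℕ.+ k)) q , tt)

   cr-complete : ∀ i k β t → CrossL (iv i k) β t → cr i k β t ≡ true
   cr-complete i k (iv j l) t h = interleave-complete _ _ _ _ h
   cr-complete i k (rad j) t (inj₁ (p , q , _)) rewrite dec-true (+ i ℤ.<? + j + t * N) p | dec-true (+ j + t * N ℤ.<? + (i ℕ.+ k)) q = refl
   cr-complete i k (rad j) t (inj₂ (_ , _ , ()))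

   crossO-count : ∀ i k β → crossO n (iv i k) β ≡ count3 (cr i k β -[1+ 0 ]) (cr i k β 0ℤ) (cr i k β 1ℤ)
   crossO-count i k (iv j l) with interleave (+ i) (+ (i ℕ.+ k)) (+ j + -[1+ 0 ] * N) (+ (j ℕ.+ l) + -[1+ 0 ] * N)
     | interleave (+ i) (+ (i ℕ.+ k)) (+ j + 0ℤ * N) (+ (j ℕ.+ l) + 0ℤ * N) | interleave (+ i) (+ (i ℕ.+ k)) (+ j + 1ℤ * N) (+ (j ℕ.+ l) + 1ℤ * N)
   ... | true | true | true = refl
   ... | true | true | false = refl
   ... | true | false | true = refl
   ... | true | false | false = refl
   ... | false | true | true = refl
   ... | false | true | false = refl
   ... | false | false | true = refl
   ... | false | false | false = refl
   crossO-count i k (rad j) with does (+ i ℤ.<? + j + -[1+ 0 ] * N) ∧ does (+ j + -[1+ 0 ] * N ℤ.<? + (i ℕ.+ k))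
     | does (+ i ℤ.<? + j + 0ℤ * N) ∧ does (+ j + 0ℤ * N ℤ.<? + (i ℕ.+ k)) | does (+ i ℤ.<? + j + 1ℤ * N) ∧ does (+ j + 1ℤ * N ℤ.<? + (i ℕ.+ k))
   ... | true | true | true = refl
   ... | true | true | false = refl
   ... | true | false | true = refl
   ... | true | false | false = refl
   ... | false | true | true = refl
   ... | false | true | false = refl
   ... | false | false | true = refl
   ... | false | false | false = refl

   data Near : ℤ → Set where
     near₋ : Near -[1+ 0 ]
     near₀ : Near 0ℤ
     near₁ : Near 1ℤ

   mult-near : ∀ t → t * N < N + N → - (N + N) < t * N → Near t
   mult-near (+ 0) _ _ = near₀
   mult-near (+ 1) _ _ = near₁
   mult-near (+ suc (suc m)) p _ = ⊥-elim (<⇒≱ p (subst (_≤ + suc (suc m) * N) (ar N) (*-monoʳ-≤-nonNeg N {+ 2} {+ suc (suc m)} (ℤ.+≤+ (ℕ.s≤s (ℕ.s≤s ℕ.z≤n))))))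
     where
     ar : ∀ N → + 2 * N ≡ N + N
     ar = solve-∀
   mult-near -[1+ 0 ] _ _ = near₋
   mult-near -[1+ suc m ] _ p = ⊥-elim (<⇒≱ p (subst (-[1+ suc m ] * N ≤_) (ar N) (*-monoʳ-≤-nonNeg N { -[1+ suc m ]} { -[1+ 1 ]} (ℤ.-≤- (ℕ.s≤s ℕ.z≤n)))))
     where
     ar : ∀ N → -[1+ 1 ] * N ≡ - (N + N)
     ar = solve-∀

   crossL-near : ∀ {i k β t} → Small (iv i k) → Small β → CrossL (iv i k) β t → Near t
   crossL-near {i} {k} {iv j l} {t} (i< , _ , k≤) (j< , _ , l≤) (inj₁ (p , q , _)) =
     mult-near t (ar₁ (+ i) (+ k) (+ j) (t * N) N (ℤ.+≤+ ℕ.z≤n) (ℤ.+<+ i<) (ℤ.+≤+ k≤) q) (ar₂ (+ i) (+ j) (t * N) N (ℤ.+≤+ ℕ.z≤n) (ℤ.+<+ j<) (<-≤-trans (ℤ.+<+ (ℕ.s≤s ℕ.z≤n)) 2≤N) p)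
     where
     ar₁ : ∀ i k j x N → 0ℤ ≤ j → i < N → k ≤ N → j + x < i + k → x < N + N
     ar₁ i k j x N a b c h = by< λ g → absurd≤ 1 (a ⊕ s≤ b ⊕ c ⊕ s≤ h ⊕ g) (solve (i ∷ k ∷ j ∷ x ∷ N ∷ []))
     ar₂ : ∀ i j x N → 0ℤ ≤ i → j < N → 0ℤ < N → i < j + x → - (N + N) < x
     ar₂ i j x N a b c h = by< λ g → absurd≤ 2 (a ⊕ s≤ b ⊕ s≤ c ⊕ s≤ h ⊕ g) (solve (i ∷ j ∷ x ∷ N ∷ []))
   crossL-near {i} {k} {iv j l} {t} (i< , _ , k≤) (j< , _ , l≤) (inj₂ (p , q , _)) =
     mult-near t (ar₁ (+ i) (+ j) (t * N) N (ℤ.+≤+ ℕ.z≤n) (ℤ.+<+ i<) (<-≤-trans (ℤ.+<+ (ℕ.s≤s ℕ.z≤n)) 2≤N) p) (ar₂ (+ i) (+ j) (+ l) (t * N) N (ℤ.+≤+ ℕ.z≤n) (ℤ.+<+ j<) (ℤ.+≤+ l≤) q)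
     where
     ar₁ : ∀ i j x N → 0ℤ ≤ j → i < N → 0ℤ < N → j + x < i → x < N + N
     ar₁ i j x N a b c h = by< λ g → absurd≤ 2 (a ⊕ s≤ b ⊕ s≤ c ⊕ s≤ h ⊕ g) (solve (i ∷ j ∷ x ∷ N ∷ []))
     ar₂ : ∀ i j l x N → 0ℤ ≤ i → j < N → l ≤ N → i < j + l + x → - (N + N) < x
     ar₂ i j l x N a b c h = by< λ g → absurd≤ 1 (a ⊕ s≤ b ⊕ c ⊕ s≤ h ⊕ g) (solve (i ∷ j ∷ l ∷ x ∷ N ∷ []))
   crossL-near {i} {k} {rad j} {t} (i< , _ , k≤) j< (inj₁ (p , q , _)) =
     mult-near t (ar₁ (+ i) (+ k) (+ j) (t * N) N (ℤ.+≤+ ℕ.z≤n) (ℤ.+<+ i<) (ℤ.+≤+ k≤) q) (ar₂ (+ i) (+ j) (t * N) N (ℤ.+≤+ ℕ.z≤n) (ℤ.+<+ j<) (<-≤-trans (ℤ.+<+ (ℕ.s≤s ℕ.z≤n)) 2≤N) p)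
     where
     ar₁ : ∀ i k j x N → 0ℤ ≤ j → i < N → k ≤ N → j + x < i + k → x < N + N
     ar₁ i k j x N a b c h = by< λ g → absurd≤ 1 (a ⊕ s≤ b ⊕ c ⊕ s≤ h ⊕ g) (solve (i ∷ k ∷ j ∷ x ∷ N ∷ []))
     ar₂ : ∀ i j x N → 0ℤ ≤ i → j < N → 0ℤ < N → i < j + x → - (N + N) < x
     ar₂ i j x N a b c h = by< λ g → absurd≤ 2 (a ⊕ s≤ b ⊕ s≤ c ⊕ s≤ h ⊕ g) (solve (i ∷ j ∷ x ∷ N ∷ []))
   crossL-near {β = rad j} _ _ (inj₂ (_ , _ , ()))

   private
     count-true : ∀ {f : ℤ → Bool} {t} → Near t → f t ≡ true → count3 (f -[1+ 0 ]) (f 0ℤ) (f 1ℤ) ≢ 0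
     count-true {f} near₋ e rewrite e = go (f 0ℤ) (f 1ℤ)
       where
       go : ∀ y z → count3 true y z ≢ 0
       go true true ()
       go true false ()
       go false true ()
       go false false ()
     count-true {f} near₀ e rewrite e = go (f -[1+ 0 ]) (f 1ℤ)
       where
       go : ∀ y z → count3 y true z ≢ 0
       go true true ()
       go true false ()
       go false true ()
       go false false ()
     count-true {f} near₁ e rewrite e = go (f -[1+ 0 ]) (f 0ℤ)
       where
       go : ∀ y z → count3 y z true ≢ 0
       go true true ()
       go true false ()
       go false true ()
       go false false ()

     c₁₂ : ∀ x → ¬ (count3 true true x ℕ.≤ 1)
     c₁₂ true (ℕ.s≤s ())
     c₁₂ false (ℕ.s≤s ())
     c₁₃ : ∀ x → ¬ (count3 true x true ℕ.≤ 1)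
     c₁₃ true (ℕ.s≤s ())
     c₁₃ false (ℕ.s≤s ())
     c₂₃ : ∀ x → ¬ (count3 x true true ℕ.≤ 1)
     c₂₃ true (ℕ.s≤s ())
     c₂₃ false (ℕ.s≤s ())

     count-two : ∀ {f : ℤ → Bool} {s t} → Near s → Near t → s ≢ t → f s ≡ true → f t ≡ true → ¬ (count3 (f -[1+ 0 ]) (f 0ℤ) (f 1ℤ) ℕ.≤ 1)
     count-two near₋ near₋ ne = ⊥-elim (ne refl)
     count-two near₀ near₀ ne = ⊥-elim (ne refl)
     count-two near₁ near₁ ne = ⊥-elim (ne refl)
     count-two {f} near₋ near₀ _ e e′ rewrite e | e′ = c₁₂ (f 1ℤ)
     count-two {f} near₀ near₋ _ e e′ rewrite e | e′ = c₁₂ (f 1ℤ)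
     count-two {f} near₋ near₁ _ e e′ rewrite e | e′ = c₁₃ (f 0ℤ)
     count-two {f} near₁ near₋ _ e e′ rewrite e | e′ = c₁₃ (f 0ℤ)
     count-two {f} near₀ near₁ _ e e′ rewrite e | e′ = c₂₃ (f -[1+ 0 ])
     count-two {f} near₁ near₀ _ e e′ rewrite e | e′ = c₂₃ (f -[1+ 0 ])

   crossO-zero : ∀ {i k β} → (∀ t → ¬ CrossL (iv i k) β t) → crossO n (iv i k) β ≡ 0
   crossO-zero {i} {k} {β} h = trans (crossO-count i k β) (count3-zero _ _ _ (no₁ _) (no₁ _) (no₁ _))
     where
     no₁ : ∀ t → cr i k β t ≢ true
     no₁ t e = h t (cr-sound i k β t e)

   crossO-nonzero : ∀ {i k β t} → Small (iv i k) → Small β → CrossL (iv i k) β t → crossO n (iv i k) β ≢ 0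
   crossO-nonzero {i} {k} {β} {t} s s′ x e = count-true {cr i k β} (crossL-near {t = t} s s′ x) (cr-complete i k β t x) (trans (sym (crossO-count i k β)) e)

   crossO-≤1 : ∀ {i k β} → (∀ s t → s ≢ t → CrossL (iv i k) β s → CrossL (iv i k) β t → ⊥) → crossO n (iv i k) β ℕ.≤ 1
   crossO-≤1 {i} {k} {β} h = subst (ℕ._≤ 1) (sym (crossO-count i k β)) (count3-≤1 _ _ _ (two _ _ λ ()) (two _ _ λ ()) (two _ _ λ ()))
     where
     two : ∀ s t → s ≢ t → ¬ (cr i k β s ≡ true × cr i k β t ≡ true)
     two s t ne (p , q) = h s t ne (cr-sound i k β s p) (cr-sound i k β t q)

   crossO-≥2 : ∀ {i k β s t} → Small (iv i k) → Small β → s ≢ t → CrossL (iv i k) β s → CrossL (iv i k) β t → ¬ (crossO n (iv i k) β ℕ.≤ 1)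
   crossO-≥2 {i} {k} {β} {s} {t} sm sm′ ne x y le = count-two {cr i k β} (crossL-near {t = s} sm sm′ x) (crossL-near {t = t} sm sm′ y) ne
     (cr-complete i k β s x) (cr-complete i k β t y) (subst (ℕ._≤ 1) (crossO-count i k β) le)

   private
     flip : ∀ {u v u′ v′} → Crosses u v u′ v′ → Crosses u′ v′ u v
     flip (inj₁ x) = inj₂ x
     flip (inj₂ x) = inj₁ x

   -- Crossing lifts exist exactly when the crossing number is nonzero.
   cross-lifts : ∀ {α β u v u′ v′} → Small α → Small β → On α u v → On β u′ v′ → Crosses u v u′ v′ → crossO n α β ≢ 0
   cross-lifts {iv i k} {β} s s′ a b x = let t , y = crossesL a b x in crossO-nonzero {t = t} s s′ y
   cross-lifts {rad j} {iv i k} s s′ a b x = let t , y = crossesL b a (flip x) in crossO-nonzero {β = rad j} {t} s′ s y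
   cross-lifts {rad i} {rad j} s s′ (on-rad _ _) (on-rad _ _) (inj₁ (_ , _ , ()))
   cross-lifts {rad i} {rad j} s s′ (on-rad _ _) (on-rad _ _) (inj₂ (_ , _ , ()))

   no-cross-lifts : ∀ {α β u v} → On α u v → (∀ {u′ v′} → On β u′ v′ → ¬ Crosses u v u′ v′) → crossO n α β ≡ 0
   no-cross-lifts {iv i k} {β} {u} {v} a h = crossO-zero λ t x → move t x
     where
     move : ∀ t → ¬ CrossL (iv i k) β t
     move t x with on-lo a
     ... | s , refl , refl = h (on-shift s (lo-on β t)) (Crosses-sh s x)
   no-cross-lifts {rad j} {iv i k} {u} {v} a h = crossO-zero {β = rad j} λ t x → move t x
     where
     move : ∀ t → ¬ CrossL (iv i k) (rad j) t
     move t x with on-lo a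
     ... | s , refl , refl = h (on-shift (s ℤ.- t) (lo-on₀ (iv i k))) (subst (λ z → Crosses z ∞ (+ i + (s ℤ.- t) * N) (sh (s ℤ.- t) (fin (+ (i ℕ.+ k))))) (ar (+ j) s t N) (Crosses-sh (s ℤ.- t) (flip x)))
       where
       ar : ∀ j s t N → j + t * N + (s ℤ.- t) * N ≡ j + s * N
       ar = solve-∀
   no-cross-lifts {rad i} {rad j} a h = refl

-- From tagged to ideal triangulations

module TaggedTriangulations where
 open IntegerInequalities
 open UniversalCover hiding (lt; gt; eq)
 open IdealTriangulations
 open Crossings
 open import Data.Nat using (ℕ; zero; suc)
 open import Data.Integer using (ℤ; +_; _+_; _*_; -_; _≤_; _<_; 0ℤ; 1ℤ)
 open import Data.Integer.Properties hiding (_≟_)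
 open import Data.Integer.Tactic.RingSolver using (solve; solve-∀)
 open import Data.Fin using (Fin; _↑ˡ_; _↑ʳ_; toℕ; splitAt)
 open import Data.List using (List; []; _∷_; tabulate; lookup)
 open import Data.List.Membership.Propositional.Properties using (∈-tabulate⁺; ∈-tabulate⁻; ∈-lookup)
 import Data.List.Relation.Unary.All as All
 import Data.List.Relation.Unary.Any as Any
 import Data.List.Relation.Unary.Any.Properties as AnyP
 import Data.List.Relation.Unary.AllPairs as AllPairs

 opp : Tag → Tag
 opp plain = notched
 opp notched = plain

 opp-opp : ∀ τ → opp (opp τ) ≡ τ
 opp-opp plain = refl
 opp-opp notched = refl

 opp-≢ : ∀ τ → opp τ ≢ τ
 opp-≢ plain ()
 opp-≢ notched ()

 tag-cases : ∀ τ σ → σ ≡ τ ⊎ σ ≡ opp τ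
 tag-cases plain plain = inj₁ refl
 tag-cases plain notched = inj₂ refl
 tag-cases notched plain = inj₂ refl
 tag-cases notched notched = inj₁ refl

 trad-injective : ∀ {i j s t} → trad i s ≡ trad j t → i ≡ j × s ≡ t
 trad-injective refl = refl , refl

 _≟ᵗ_ : (x y : TArc) → Dec (x ≡ y)
 tiv i k ≟ᵗ tiv j l with i ℕ.≟ j | k ℕ.≟ l
 ... | yes refl | yes refl = yes refl
 ... | no ne | _ = no λ { refl → ne refl }
 ... | yes _ | no ne = no λ { refl → ne refl }
 tiv _ _ ≟ᵗ trad _ _ = no λ ()
 trad _ _ ≟ᵗ tiv _ _ = no λ ()
 trad i s ≟ᵗ trad j t with i ℕ.≟ j | tag-cases t s
 ... | yes refl | inj₁ refl = yes refl
 ... | yes refl | inj₂ refl = no λ e → opp-≢ t (proj₂ (trad-injective e))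
 ... | no ne | _ = no λ { refl → ne refl }

 -- A family instead of a list, since seeds and flips refer to arcs by position.
 record Triang (n : ℕ) {r : ℕ} (T : Fin r → TArc) : Set where
   field
     validT  : ∀ q → ValidT n (T q)
     T-inj   : ∀ {q q′} → T q ≡ T q′ → q ≡ q′
     compat  : ∀ q q′ → Compatible n (T q) (T q′)
     maximal : ∀ γ → ValidT n γ → (∀ q → Compatible n γ (T q)) → ∃ λ q → T q ≡ γ

 unique-lookup : ∀ {A : Set} (xs : List A) → AllPairs.AllPairs _≢_ xs → ∀ i j → lookup xs i ≡ lookup xs j → i ≡ j
 unique-lookup (x ∷ xs) (p AllPairs.∷ ps) Fin.zero Fin.zero e = refl
 unique-lookup (x ∷ xs) (p AllPairs.∷ ps) Fin.zero (Fin.suc j) e = ⊥-elim (All.lookup p (∈-lookup {xs = xs} j) e)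
 unique-lookup (x ∷ xs) (p AllPairs.∷ ps) (Fin.suc i) Fin.zero e = ⊥-elim (All.lookup p (∈-lookup {xs = xs} i) (sym e))
 unique-lookup (x ∷ xs) (p AllPairs.∷ ps) (Fin.suc i) (Fin.suc j) e = cong Fin.suc (unique-lookup xs ps i j e)

 unique-tabulate : ∀ {A : Set} {r} (f : Fin r → A) → AllPairs.AllPairs _≢_ (tabulate f) → ∀ {i j} → f i ≡ f j → i ≡ j
 unique-tabulate {r = suc r} f (p AllPairs.∷ ps) {Fin.zero} {Fin.zero} e = refl
 unique-tabulate {r = suc r} f (p AllPairs.∷ ps) {Fin.zero} {Fin.suc j} e = ⊥-elim (All.lookup p (∈-tabulate⁺ j) e)
 unique-tabulate {r = suc r} f (p AllPairs.∷ ps) {Fin.suc i} {Fin.zero} e = ⊥-elim (All.lookup p (∈-tabulate⁺ i) (sym e))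
 unique-tabulate {r = suc r} f (p AllPairs.∷ ps) {Fin.suc i} {Fin.suc j} e = cong Fin.suc (unique-tabulate (λ i → f (Fin.suc i)) ps e)

 fromTabulate : ∀ {n r} (T : Fin r → TArc) → IsTaggedTriangulation n (tabulate T) → Triang n T
 fromTabulate T IT = record
   { validT = λ q → All.lookup valid (∈-tabulate⁺ q)
   ; T-inj = unique-tabulate T distinct
   ; compat = λ q q′ → compatible (∈-tabulate⁺ q) (∈-tabulate⁺ q′)
   ; maximal = λ γ v h → let q , e = ∈-tabulate⁻ (maximal γ v λ {α} α∈ → let q , e = ∈-tabulate⁻ α∈ in subst (Compatible _ γ) (sym e) (h q)) in q , sym e }
   where open IsTaggedTriangulation IT

 fromList : ∀ {n} (T : List TArc) → IsTaggedTriangulation n T → Triang n (lookup T)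
 fromList T IT = record
   { validT = λ q → All.lookup valid (∈-lookup {xs = T} q)
   ; T-inj = λ {q} {q′} → unique-lookup T distinct q q′
   ; compat = λ q q′ → compatible (∈-lookup {xs = T} q) (∈-lookup {xs = T} q′)
   ; maximal = λ γ v h → let m = maximal γ v (λ {α} α∈ → subst (Compatible _ γ) (sym (AnyP.lookup-index α∈)) (h (Any.index α∈))) in Any.index m , sym (AnyP.lookup-index m) }
   where open IsTaggedTriangulation IT

 -- Either all radii carry the same tag, or they are the two versions of one radius.
 data Kind {r : ℕ} (T : Fin r → TArc) : Set where
   one : ∀ τ → (∀ {q i t} → T q ≡ trad i t → t ≡ τ) → Kind T
   two : ∀ i σ pρ pλ → T pρ ≡ trad i σ → T pλ ≡ trad i (opp σ) → Kind T

 -- Either of the two tagged radii may be the one turned into the loop. Flips use this freedom: a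
 -- radius that completes or breaks the pair should be the loop.
 idealOf : ∀ (n : ℕ) {r} {T : Fin r → TArc} → Kind T → Fin r → OArc
 idealOf n {T = T} (one _ _) q = und (T q)
 idealOf n {T = T} (two i _ _ pλ _ _) q with q Fin.≟ pλ
 ... | yes _ = iv i n
 ... | no _ = und (T q)

 labelArc : ∀ (n : ℕ) {r} → (Fin r → OArc) → Fin (r ℕ.+ n) → OArc
 labelArc n {r} f ℓ = [ f , (λ s → iv (toℕ s) 1) ]′ (splitAt r ℓ)

 labelArc-arc : ∀ n {r} (f : Fin r → OArc) q → labelArc n f (q ↑ˡ n) ≡ f q
 labelArc-arc n {r} f q = cong [ f , (λ s → iv (toℕ s) 1) ]′ (FinP.splitAt-↑ˡ r q n)

 labelArc-bdy : ∀ n {r} (f : Fin r → OArc) s → labelArc n f (r ↑ʳ s) ≡ iv (toℕ s) 1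
 labelArc-bdy n {r} f s = cong [ f , (λ s → iv (toℕ s) 1) ]′ (FinP.splitAt-↑ʳ r n s)

 module TaggedTriangulation (n : ℕ) (2≤n : 2 ℕ.≤ n) {r : ℕ} {T : Fin r → TArc} (FT : Triang n T) where
   open Cover n 2≤n
   open CrossingNumber n 2≤n
   open Triangulation n 2≤n
   open Triang FT

   kind? : Kind T
   kind? with FinP.any? (λ q → radius? (T q))
     where
     radius? : ∀ y → Dec (∃₂ λ i t → y ≡ trad i t)
     radius? (tiv _ _) = no λ { (_ , _ , ()) }
     radius? (trad i t) = yes (i , t , refl)
   ... | no nr = one plain λ {q} {i} {t} e → ⊥-elim (nr (q , i , t , e))
   ... | yes (q , i , t , e) with FinP.any? (λ q′ → T q′ ≟ᵗ trad i (opp t))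
   ...   | yes (q′ , e′) = two i t q q′ e e′
   ...   | no nopp = one t λ {q′} {j} {s} e′ → tagged q′ j s e′
     where
     tagged : ∀ q′ j s → T q′ ≡ trad j s → s ≡ t
     tagged q′ j s e′ with i ℕ.≟ j | tag-cases t s
     ... | _ | inj₁ h = h
     ... | yes refl | inj₂ refl = ⊥-elim (nopp (q′ , e′))
     ... | no ne | inj₂ refl = sym (proj₂ (subst₂ (Compatible n) e e′ (compat q q′)) ne)

   valid-small : ∀ {y} → ValidT n y → Small (und y)
   valid-small {tiv i k} (a , b , c) = a , ℕP.≤-trans (ℕ.s≤s ℕ.z≤n) b , ℕP.<⇒≤ c
   valid-small {trad i t} a = a

   noX-T : ∀ {q q′ u v u′ v′} → On (und (T q)) u v → On (und (T q′)) u′ v′ → ¬ Crosses u v u′ v′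
   noX-T {q} {q′} a b x = cross-lifts (valid-small {T q} (validT q)) (valid-small {T q′} (validT q′)) a b x (proj₁ (compat q q′))

   und-inj : ∀ {y y′} → und y ≡ und y′ → tagOf y ≡ tagOf y′ → y ≡ y′
   und-inj {tiv _ _} {tiv _ _} refl _ = refl
   und-inj {trad _ _} {trad _ _} refl refl = refl

   und-loop : ∀ {y i} → ValidT n y → und y ≢ iv i n
   und-loop {tiv i k} (_ , _ , k<n) refl = ℕP.<-irrefl refl k<n

   module _ (K : Kind T) where
     O : Fin (r ℕ.+ n) → OArc
     O = labelArc n (idealOf n K)

     data ArcView : OArc → Set where
       real : ∀ q → ArcView (und (T q))
       loop : ∀ {i σ} pρ → T pρ ≡ trad i σ → ∀ {pλ} → T pλ ≡ trad i (opp σ) → ArcView (iv i n)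
       edge : ∀ s → ArcView (iv (toℕ {n} s) 1)

   ideal-view : ∀ (K : Kind T) ℓ → ArcView K (O K ℓ)
   ideal-view K ℓ with splitAt r ℓ
   ... | inj₂ s = edge s
   ideal-view (one τ h) ℓ | inj₁ q = real q
   ideal-view (two i σ pρ pλ eρ eλ) ℓ | inj₁ q with q Fin.≟ pλ
   ... | yes _ = loop pρ eρ eλ
   ... | no _ = real q

   arc-view : ∀ (K : Kind T) q → (idealOf n K q ≡ und (T q)) ⊎ (∃ λ i → idealOf n K q ≡ iv i n × i ℕ.< n)
   arc-view (one _ _) q = inj₁ refl
   arc-view (two i σ pρ pλ eρ eλ) q with q Fin.≟ pλ
   ... | yes _ = inj₂ (i , refl , subst (ValidT n) eρ (validT pρ))
   ... | no _ = inj₁ refl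

   -- Radii at vertices other than i are incompatible with one of the two versions of the radius at i.
   pair-radius : ∀ {i σ pρ pλ q j t} → T pρ ≡ trad i σ → T pλ ≡ trad i (opp σ) → T q ≡ trad j t → j ≡ i
   pair-radius {i} {σ} {pρ} {pλ} {q} {j} {t} eρ eλ e with i ℕ.≟ j
   ... | yes h = sym h
   ... | no ne = ⊥-elim (opp-≢ σ (trans (proj₂ (subst₂ (Compatible n) eλ e (compat pλ q)) ne) (sym (proj₂ (subst₂ (Compatible n) eρ e (compat pρ q)) ne))))

   private
     edge₁ : ∀ {s : Fin n} {u v u′ v′} → On (iv (toℕ s) 1) u v → ¬ X u v u′ v′
     edge₁ {u = u} {u′ = u′} (on-iv _ _ refl) (p , q , _) = ar u u′ p q
       where
       ar : ∀ u u′ → u < u′ → u′ < u + 1ℤ → ⊥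
       ar u u′ p q = absurd≤ 0 (s≤ p ⊕ s≤ q) (solve (u ∷ u′ ∷ []))
     edge₂ : ∀ {s : Fin n} {u v u′ v′} → On (iv (toℕ s) 1) u′ v′ → ¬ X u v u′ v′
     edge₂ {v = ∞} (on-iv _ _ refl) (p , q , ())
     edge₂ {v = fin v} {u′ = u′} (on-iv _ _ refl) (p , q , h) = ar u′ v q h
       where
       ar : ∀ u v → u < v → v < u + 1ℤ → ⊥
       ar u u′ p q = absurd≤ 0 (s≤ p ⊕ s≤ q) (solve (u ∷ u′ ∷ []))

     rad-at : ∀ {i σ pρ u} → T pρ ≡ trad i σ → (∃ λ t → u ≡ + i + t * N) → On (und (T pρ)) u ∞
     rad-at e (t , h) = subst (λ y → On (und y) _ ∞) (sym e) (on-rad t h)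

     loop-end : ∀ {i u v} → On (iv i n) u (fin v) → ∃ λ t → v ≡ + i + t * N
     loop-end {i} (on-iv t refl refl) = t + 1ℤ , ar (+ i) t N
       where
       ar : ∀ i t N → i + t * N + N ≡ i + (t + 1ℤ) * N
       ar = solve-∀

     loop-start : ∀ {i k u v} → On (iv i k) u v → ∃ λ t → u ≡ + i + t * N
     loop-start (on-iv t e _) = t , e

     same-radius : ∀ {i q u u′ v′} → u < u′ → u′ < u + N → (∃ λ t → u ≡ + i + t * N) → On (und (T q)) u′ v′ → v′ ≡ ∞ → (∀ {j t} → T q ≡ trad j t → j ≡ i) → ⊥
     same-radius {i} {q} {u} {u′} p p′ (t , e) on refl h with T q in eq | on
     ... | trad j s | on-rad t′ e′ with h refl
     ...   | refl = ar-absurd (mult-small {n} (t′ ℤ.- t) ((t′ ℤ.- t) * N) refl (ar₁ (+ j) t t′ N u u′ e e′ p′) (ar₂ (+ j) t t′ N u u′ e e′ (<-≤-trans (ℤ.+<+ (ℕ.s≤s ℕ.z≤n)) 2≤N) p))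
       where
       ar₁ : ∀ i t t′ N u u′ → u ≡ i + t * N → u′ ≡ i + t′ * N → u′ < u + N → (t′ ℤ.- t) * N < N
       ar₁ i t t′ N u u′ e e′ h = by< λ k → absurd≤ 0 (s≤ h ⊕ k ⊕ ≡⇒≤ e ⊕ ≡⇒≤ (sym e′)) (solve (i ∷ t ∷ t′ ∷ N ∷ u ∷ u′ ∷ []))
       ar₂ : ∀ i t t′ N u u′ → u ≡ i + t * N → u′ ≡ i + t′ * N → 0ℤ < N → u < u′ → - N < (t′ ℤ.- t) * N
       ar₂ i t t′ N u u′ e e′ g h = by< λ k → absurd≤ 1 (s≤ h ⊕ k ⊕ s≤ g ⊕ ≡⇒≤ (sym e) ⊕ ≡⇒≤ e′) (solve (i ∷ t ∷ t′ ∷ N ∷ u ∷ u′ ∷ []))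
       ar-absurd : t′ ℤ.- t ≡ 0ℤ → ⊥
       ar-absurd z = <-irrefl (trans e (trans (cong (λ s → + j + s * N) (sym (i-j≡0⇒i≡j t′ t z))) (sym e′))) p

   -- A loop starts and ends at lifts of the same vertex. A finite arc crossing it crosses the
   -- radius over one of these two ends, and that radius belongs to `T`; a radius crossing it would
   -- start at another vertex, against `pair-radius`.
   ideal-noX : ∀ (K : Kind T) {y y′ u v u′ v′} → ArcView K y → ArcView K y′ → On y u v → On y′ u′ v′ → ¬ X u v u′ v′
   ideal-noX K (edge s) _ a b x = edge₁ {s} a x
   ideal-noX K (real _) (edge s) a b x = edge₂ {s} b x
   ideal-noX K (loop _ _ _) (edge s) a b x = edge₂ {s} b x
   ideal-noX K (real q) (real q′) a b x = noX-T {q} {q′} a b (inj₁ x)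
   ideal-noX K {v = ∞} (real q) (loop pρ eρ _) a b (_ , _ , ())
   ideal-noX K {v = fin v} (real q) (loop pρ eρ _) a b (p , h , _) = noX-T {q} {pρ} a (rad-at {pρ = pρ} eρ (loop-start b)) (inj₁ (p , h , tt))
   ideal-noX K {v′ = fin v′} (loop pρ eρ eλ) (real q) a@(on-iv _ _ refl) b (p , h , h′) = noX-T {q} {pρ} b (rad-at {pρ = pρ} eρ (loop-end a)) (inj₁ (h , h′ , tt))
   ideal-noX K {v′ = ∞} (loop pρ eρ eλ) (real q) a@(on-iv _ _ refl) b (p , h , h′) = same-radius {q = q} p h (loop-start a) b refl (pair-radius eρ eλ)
   ideal-noX K (loop pρ eρ eλ) (loop pρ′ eρ′ eλ′) a@(on-iv _ _ refl) b (p , h , h′) =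
     same-radius {q = pρ′} p h (loop-start a) (rad-at {pρ = pρ′} eρ′ (loop-start b)) refl (pair-radius eρ eλ)

   λ≢ρ : ∀ {i σ pρ pλ} → T pρ ≡ trad i σ → T pλ ≡ trad i (opp σ) → pρ ≢ pλ
   λ≢ρ {σ = σ} eρ eλ refl = opp-≢ σ (proj₂ (trad-injective (trans (sym eλ) eρ)))

   idealOf-λ : ∀ {i σ pρ pλ} (eρ : T pρ ≡ trad i σ) (eλ : T pλ ≡ trad i (opp σ)) → idealOf n (two i σ pρ pλ eρ eλ) pλ ≡ iv i n
   idealOf-λ {pλ = pλ} _ _ with pλ Fin.≟ pλ
   ... | yes _ = refl
   ... | no ne = ⊥-elim (ne refl)

   idealOf-real : ∀ {i σ pρ pλ} (eρ : T pρ ≡ trad i σ) (eλ : T pλ ≡ trad i (opp σ)) {q} → q ≢ pλ → idealOf n (two i σ pρ pλ eρ eλ) q ≡ und (T q)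
   idealOf-real {pλ = pλ} _ _ {q} ne with q Fin.≟ pλ
   ... | yes e = ⊥-elim (ne e)
   ... | no _ = refl

   idealOf-tiv : ∀ (K : Kind T) {q i k} → T q ≡ tiv i k → idealOf n K q ≡ iv i k
   idealOf-tiv (one _ _) e = cong und e
   idealOf-tiv (two i σ pρ pλ eρ eλ) {q} e = trans (idealOf-real eρ eλ λ { refl → clash (trans (sym e) eλ) }) (cong und e)
     where
     clash : ∀ {i k j t} → tiv i k ≢ trad j t
     clash ()

   und-label : ∀ (K : Kind T) q → ∃ λ ℓ → O K ℓ ≡ und (T q)
   und-label K@(one _ _) q = q ↑ˡ n , labelArc-arc n (idealOf n K) q
   und-label K@(two i σ pρ pλ eρ eλ) q with q Fin.≟ pλ
   ... | no ne = q ↑ˡ n , trans (labelArc-arc n (idealOf n K) q) (idealOf-real eρ eλ ne)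
   ... | yes refl = pρ ↑ˡ n , trans (labelArc-arc n (idealOf n K) pρ) (trans (idealOf-real eρ eλ (λ≢ρ eρ eλ)) (trans (cong und eρ) (sym (cong und eλ))))

   idealOf-inj : ∀ (K : Kind T) {q q′} → idealOf n K q ≡ idealOf n K q′ → q ≡ q′
   idealOf-inj (one τ h) {q} {q′} e = T-inj (und-inj e (tags (T q) refl (T q′) refl e))
     where
     tags : ∀ y → T q ≡ y → ∀ y′ → T q′ ≡ y′ → und y ≡ und y′ → tagOf y ≡ tagOf y′
     tags (tiv _ _) _ (tiv _ _) _ _ = refl
     tags (trad _ _) e (trad _ _) e′ _ = trans (h e) (sym (h e′))
   idealOf-inj (two i σ pρ pλ eρ eλ) {q} {q′} e with q Fin.≟ pλ | q′ Fin.≟ pλ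
   ... | yes refl | yes refl = refl
   ... | yes refl | no ne = ⊥-elim (und-loop {T q′} (validT q′) (sym e))
   ... | no ne | yes refl = ⊥-elim (und-loop {T q} (validT q) e)
   ... | no ne | no ne′ = T-inj (und-inj e (tags (T q) refl (T q′) refl e))
     where
     tag : ∀ {q j t} → q ≢ pλ → T q ≡ trad j t → t ≡ σ
     tag {q} {j} {t} ne e with pair-radius eρ eλ e | tag-cases σ t
     ... | refl | inj₁ h = h
     ... | refl | inj₂ refl = ⊥-elim (ne (T-inj (trans e (sym eλ))))
     tags : ∀ y → T q ≡ y → ∀ y′ → T q′ ≡ y′ → und y ≡ und y′ → tagOf y ≡ tagOf y′
     tags (tiv _ _) _ (tiv _ _) _ _ = refl
     tags (trad _ _) e (trad _ _) e′ _ = trans (tag ne e) (sym (tag ne′ e′))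

   ideal-shape : ∀ (K : Kind T) q → Shape (idealOf n K q)
   ideal-shape K q with arc-view K q
   ... | inj₁ e = subst Shape (sym e) (sh′ (T q) (validT q))
     where
     sh′ : ∀ y → ValidT n y → Shape (und y)
     sh′ (tiv i k) (a , b , c) = a , b , ℕP.<⇒≤ c
     sh′ (trad i t) a = a
   ... | inj₂ (i , e , i<) = subst Shape (sym e) (i< , 2≤n , ℕP.≤-refl)

   labelArc-inj : ∀ (K : Kind T) {ℓ ℓ′} → O K ℓ ≡ O K ℓ′ → ℓ ≡ ℓ′
   labelArc-inj K {ℓ} {ℓ′} e with splitAt r ℓ in p | splitAt r ℓ′ in p′
   ... | inj₁ q | inj₁ q′ = trans (sym (FinP.splitAt⁻¹-↑ˡ {m = r} p)) (trans (cong (_↑ˡ n) (idealOf-inj K e)) (FinP.splitAt⁻¹-↑ˡ {m = r} p′))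
   ... | inj₂ s | inj₂ s′ = trans (sym (FinP.splitAt⁻¹-↑ʳ {m = r} p)) (trans (cong (r ↑ʳ_) (FinP.toℕ-injective (fst e))) (FinP.splitAt⁻¹-↑ʳ {m = r} p′))
     where
     fst : ∀ {i j k} → iv i k ≡ iv j k → i ≡ j
     fst refl = refl
   ... | inj₁ q | inj₂ s = ⊥-elim (short (subst Shape e (ideal-shape K q)))
     where
     short : ∀ {i} → ¬ Shape (iv i 1)
     short (_ , ℕ.s≤s () , _)
   ... | inj₂ s | inj₁ q = ⊥-elim (short (subst Shape (sym e) (ideal-shape K q)))
     where
     short : ∀ {i} → ¬ Shape (iv i 1)
     short (_ , ℕ.s≤s () , _)

   private
     between : ∀ {i a u} → a ℕ.< n → i ℕ.< n → i ≢ a → (∃ λ t → u ≡ + i + t * N) → ∃ λ s → + a + s * N < u × u < + a + s * N + N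
     between {i} {a} {u} a< i< ne (t , e) with nearest (+ a) u
     ... | s , p , q = s , strict (<-cmp (+ a + s * N) u) , q
       where
       open import Relation.Binary.Definitions using (Tri; tri<; tri≈; tri>)
       strict : Tri (+ a + s * N < u) (+ a + s * N ≡ u) (u < + a + s * N) → + a + s * N < u
       strict (tri< h _ _) = h
       strict (tri≈ _ h _) = ⊥-elim (ne (sym (resid′ {t = s} {t} a< i< (trans h e))))
       strict (tri> _ _ h) = ⊥-elim (<⇒≱ h p)

     between′ : ∀ {i a u} → a ℕ.< n → i ℕ.< n → i ≢ a → (∃ λ t → u ≡ + i + t * N) → ∃ λ s → u < + a + s * N × + a + s * N < u + N
     between′ {i} {a} {u} a< i< ne h with between {i} {a} {u} a< i< ne h
     ... | s , p , q = s + 1ℤ , subst (u <_) (ar (+ a) s N) q , subst (_< u + N) (ar (+ a) s N) (+-monoˡ-< N p)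
       where
       ar : ∀ a s N → a + s * N + N ≡ a + (s + 1ℤ) * N
       ar = solve-∀

   ideal-maxi : ∀ (K : Kind T) y → Shape y → ∀ {u v} → On y u v →
     (∀ {ℓ u′ v′} → On (O K ℓ) u′ v′ → ¬ X u v u′ v′ × ¬ X u′ v′ u v) → ∃ λ q → idealOf n K q ≡ y
   ideal-maxi K y sy {u} {v} on free = go y sy on K refl
     where
     free-T : ∀ q {u′ v′} → On (und (T q)) u′ v′ → ¬ Crosses u v u′ v′
     free-T q on′ x with und-label K q
     ... | ℓ , e = let f = free {ℓ} (subst (λ y → On y _ _) (sym e) on′) in [ proj₁ f , proj₂ f ]′ x
     go : ∀ y → Shape y → On y u v → ∀ K′ → K ≡ K′ → ∃ λ q → idealOf n K q ≡ y
     go (iv i k) (i< , 2≤k , k≤) on K′ eK with ℕP.m≤n⇒m<n∨m≡n k≤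
     ... | inj₁ k< = let q , e = maximal (tiv i k) (i< , 2≤k , k<) (λ q → no-cross-lifts on (free-T q) , λ ()) in q , idealOf-tiv K e
     go (iv i k) (i< , 2≤k , k≤) on@(on-iv t eu refl) (two a σ pρ pλ eρ eλ) refl | inj₂ refl with i ℕ.≟ a
     ... | yes refl = pλ , idealOf-λ eρ eλ
     ... | no ne with between′ {i} {a} (subst (ValidT n) eρ (validT pρ)) i< ne (t , eu)
     ...   | s , p , q = ⊥-elim (free-T pρ (rad-at {pρ = pρ} eρ (s , refl)) (inj₁ (p , q , tt)))
     -- A loop that crosses nothing leaves both tagged radii at its base compatible with `T`. By
     -- maximality both would be present, although all radii carry the tag `τ`.
     go (iv i k) (i< , 2≤k , k≤) on@(on-iv t eu refl) (one τ h) refl | inj₂ refl = ⊥-elim (clash (h (proj₂ (both plain))) (h (proj₂ (both notched))))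
       where
       clash : plain ≡ τ → notched ≡ τ → ⊥
       clash refl ()
       radfree : ∀ q {u′ v′} → On (und (T q)) u′ v′ → ¬ Crosses u ∞ u′ v′
       radfree q on′ (inj₁ (_ , _ , ()))
       radfree q {v′ = ∞} on′ (inj₂ (_ , _ , ()))
       radfree q {u′} {fin v′} on′ (inj₂ (p , p′ , _)) = free-T q on′ (inj₂ (p , p′ , ends (T q) (validT q) on′))
         where
         ar : ∀ u u′ k N → u′ < u → k < N → u′ + k < u + N
         ar u u′ k N a b = by< λ g → absurd≤ 1 (s≤ a ⊕ s≤ b ⊕ g) (solve (u ∷ u′ ∷ k ∷ N ∷ []))
         ends : ∀ y → ValidT n y → On (und y) u′ (fin v′) → v′ < u + N
         ends (tiv j l) (_ , _ , l<) (on-iv _ _ refl) = ar u u′ (+ l) N p (ℤ.+<+ l<)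
       distinctfree : ∀ q tg → DistinctRadii (trad i tg) (T q) → ⊥
       distinctfree q tg d with T q in eq
       ... | trad j t′ with between′ {i} {j} (subst (ValidT n) eq (validT q)) i< (λ h → d h) (t , eu)
       ...   | s , p , p′ = free-T q (rad-at {pρ = q} eq (s , refl)) (inj₁ (p , p′ , tt))
       both : ∀ tg → ∃ λ q → T q ≡ trad i tg
       both tg = maximal (trad i tg) i< λ q → no-cross-lifts (on-rad t eu) (radfree q) , λ d → ⊥-elim (distinctfree q tg d)
     go (rad i) i< on@(on-rad t eu) (one τ h) refl = maximal (trad i τ) i< (λ q → no-cross-lifts on (free-T q) , tags q) ⟨und⟩
       where
       _⟨und⟩ : (∃ λ q → T q ≡ trad i τ) → ∃ λ q → und (T q) ≡ rad i
       (q , e) ⟨und⟩ = q , cong und e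
       tags : ∀ q → DistinctRadii (trad i τ) (T q) → τ ≡ tagOf (T q)
       tags q d with T q in eq
       ... | trad j t′ = sym (h eq)
     go (rad i) i< on@(on-rad t eu) (two a σ pρ pλ eρ eλ) refl with i ℕ.≟ a
     ... | yes refl = pρ , trans (idealOf-real eρ eλ (λ≢ρ eρ eλ)) (cong und eρ)
     -- A radius at a vertex other than `a` starts strictly under some lift of the loop at `a` and
     -- therefore crosses it.
     ... | no ne with between {i} {a} (subst (ValidT n) eρ (validT pρ)) i< ne (t , eu)
     ...   | s , p , q = ⊥-elim (proj₂ (free {pλ ↑ˡ n} (subst (λ y → On y (+ a + s * N) (fin (+ a + s * N + N))) (sym (trans (labelArc-arc n (idealOf n K) pλ) (idealOf-λ eρ eλ))) (on-iv s refl refl))) (p , q , tt))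

   ideal : ∀ (K : Kind T) → Ideal r (O K)
   ideal K = record
     { bnd = labelArc-bdy n (idealOf n K)
     ; shape = λ q → subst Shape (sym (labelArc-arc n (idealOf n K) q)) (ideal-shape K q)
     ; O-inj = labelArc-inj K
     ; noX = λ {ℓ} {ℓ′} a b → ideal-noX K (ideal-view K ℓ) (ideal-view K ℓ′) a b
     ; maxi = λ y sy on h → let q , e = ideal-maxi K y sy on (λ {ℓ} → h {ℓ}) in q , trans (labelArc-arc n (idealOf n K) q) e }

-- Flips as rotations of the tree of triangles

module Rotations where
 open IntegerInequalities
 open UniversalCover
 open IdealTriangulations
 open Crossings
 open import Data.Nat using (ℕ)
 open import Data.Integer using (ℤ; +_; _+_; _*_; -_; _≤_; _<_; 0ℤ; 1ℤ)
 open import Data.Integer.Properties hiding (_≟_)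
 open import Data.Integer.DivMod using (n%ℕd<d)
 open import Data.Integer.Tactic.RingSolver using (solve; solve-∀)
 open import Data.Fin using (Fin; _↑ˡ_)
 open import Data.List using ([]; _∷_)
 open import Relation.Binary.Definitions using (tri<; tri≈; tri>)

 module Sides (n : ℕ) (2≤n : 2 ℕ.≤ n) {r : ℕ} {O : Fin (r ℕ.+ n) → OArc} (I : Triangulation.Ideal n 2≤n r O) where
   open Cover n 2≤n
   open CrossingNumber n 2≤n
   open Triangulation n 2≤n hiding (Ideal)
   open Triangles I public

   lab : ∀ {u v} → Arc u v → Label
   lab = proj₁

   own : ∀ ℓ → Arc (lo (O ℓ)) (hi (O ℓ))
   own ℓ = ℓ , lo-on₀ (O ℓ)

   long : ∀ y → Shape y → fin (1ℤ + lo y) ≺ hi y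
   long (iv i k) (_ , 2≤k , _) = ℤ.+<+ (ℕP.≤-trans (ℕ.s≤s (ℕP.≤-reflexive (ℕP.+-comm 1 i))) (ℕP.≤-trans (ℕP.≤-reflexive (sym (ℕP.+-suc i 1))) (ℕP.+-monoʳ-≤ i 2≤k)))
   long (rad i) _ = tt

   abstract
     triOf : ∀ q → ∃ λ b → Tri (lo (O (q ↑ˡ n))) b (hi (O (q ↑ˡ n)))
     triOf q = inner (own (q ↑ˡ n)) (long (O (q ↑ˡ n)) (shape q))

   -- The tree in terms of labels: the children of `q` are the short sides of the triangle whose
   -- long side is `q`.
   L₁ L₂ : Fin r → Label
   L₁ q = lab (Tri.a₁ (proj₂ (triOf q)))
   L₂ q = lab (Tri.a₂ (proj₂ (triOf q)))

   label-≡ : ∀ {u v} (a a′ : Arc u v) → lab a ≡ lab a′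
   label-≡ a a′ = label-unique (proj₂ a) (proj₂ a′)

   ↑-inj : ∀ {q q′ : Fin r} → q ↑ˡ n ≡ q′ ↑ˡ n → q ≡ q′
   ↑-inj {q} {q′} = FinP.↑ˡ-injective n q q′

   L-unique : ∀ {a b c} q (T : Tri a b c) → lab (Tri.a₃ T) ≡ q ↑ˡ n → L₁ q ≡ lab (Tri.a₁ T) × L₂ q ≡ lab (Tri.a₂ T)
   L-unique {a} {b} {c} q T e = go (on-lo (subst (λ ℓ → On (O ℓ) a c) e (proj₂ (Tri.a₃ T)))) T
     where
     go : (∃ λ t → a ≡ lo (O (q ↑ˡ n)) + t * N × c ≡ sh t (hi (O (q ↑ˡ n)))) → (T : Tri a b c) → L₁ q ≡ lab (Tri.a₁ T) × L₂ q ≡ lab (Tri.a₂ T)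
     go (t , refl , refl) T with inner-unique (tri-sh t (proj₂ (triOf q))) T
     ... | refl = label-≡ (arc-sh t (Tri.a₁ (proj₂ (triOf q)))) (Tri.a₁ T) , label-≡ (arc-sh t (Tri.a₂ (proj₂ (triOf q)))) (Tri.a₂ T)

   own-lab : ∀ q → lab (Tri.a₃ (proj₂ (triOf q))) ≡ q ↑ˡ n
   own-lab q = label-≡ (Tri.a₃ (proj₂ (triOf q))) (own (q ↑ˡ n))

   first-label : ∀ {a b c a′ b′ c′} (T : Tri a b c) (T′ : Tri a′ b′ c′) → lab (Tri.a₁ T) ≡ lab (Tri.a₁ T′) → lab (Tri.a₃ T) ≡ lab (Tri.a₃ T′)
   first-label T T′ e with on-lift (subst (λ ℓ → On (O ℓ) _ _) e (proj₂ (Tri.a₁ T))) (proj₂ (Tri.a₁ T′))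
   ... | t , refl , refl with first-unique (tri-sh t T) T′
   ...   | refl = label-≡ (arc-sh t (Tri.a₃ T)) (Tri.a₃ T′)

   second-label : ∀ {a b c a′ b′ c′} (T : Tri a b c) (T′ : Tri a′ b′ c′) → lab (Tri.a₂ T) ≡ lab (Tri.a₂ T′) → lab (Tri.a₃ T) ≡ lab (Tri.a₃ T′)
   second-label T T′ e with on-lift (subst (λ ℓ → On (O ℓ) _ _) e (proj₂ (Tri.a₂ T))) (proj₂ (Tri.a₂ T′))
   ... | t , refl , refl with second-unique (tri-sh t T) T′
   ...   | refl = label-≡ (arc-sh t (Tri.a₃ T)) (Tri.a₃ T′)

   mixed-label : ∀ {a b c a′ b′ c′} (T : Tri a b c) (T′ : Tri a′ b′ c′) → lab (Tri.a₁ T) ≢ lab (Tri.a₂ T′)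
   mixed-label T T′ e with on-lift (subst (λ ℓ → On (O ℓ) _ _) e (proj₂ (Tri.a₁ T))) (proj₂ (Tri.a₂ T′))
   ... | t , refl , refl = first-second (tri-sh t T) T′

   L₁-inj : ∀ {q q′} → L₁ q ≡ L₁ q′ → q ≡ q′
   L₁-inj {q} {q′} e = ↑-inj (trans (sym (own-lab q)) (trans (first-label (proj₂ (triOf q)) (proj₂ (triOf q′)) e) (own-lab q′)))

   L₂-inj : ∀ {q q′} → L₂ q ≡ L₂ q′ → q ≡ q′
   L₂-inj {q} {q′} e = ↑-inj (trans (sym (own-lab q)) (trans (second-label (proj₂ (triOf q)) (proj₂ (triOf q′)) e) (own-lab q′)))

   L₁≢L₂ : ∀ {q q′} → L₁ q ≢ L₂ q′
   L₁≢L₂ {q} {q′} = mixed-label (proj₂ (triOf q)) (proj₂ (triOf q′))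

   long-label : ∀ {a b c} (T : Tri a b c) → ∃ λ q → lab (Tri.a₃ T) ≡ q ↑ˡ n
   long-label {a} {b} {c} T = go (lab (Tri.a₃ T)) (view (lab (Tri.a₃ T))) refl
     where
     ar : ∀ a b → a < b → b < a + 1ℤ → ⊥
     ar a b p q = absurd≤ 0 (s≤ p ⊕ s≤ q) (solve (a ∷ b ∷ []))
     short : ∀ {i} c → fin b ≺ c → On (iv i 1) a c → ⊥
     short (fin c) q (on-iv _ _ refl) = ar a b (Tri.e<u T) q
     go : ∀ ℓ → View ℓ → lab (Tri.a₃ T) ≡ ℓ → ∃ λ q → lab (Tri.a₃ T) ≡ q ↑ˡ n
     go _ (arcˡ q) e = q , e
     go _ (bdyˡ s) e = ⊥-elim (short c (Tri.u≺f T) (subst (λ y → On y a c) (trans (cong O e) (bnd s)) (proj₂ (Tri.a₃ T))))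

   -- The two triangles at an arc p; P is the long side of the outer one.
   data Quad (p : Fin r) : Set where
     quadL : ∀ {a b c d} (T : Tri a b (fin c)) (U : Tri a c d) P → lab (Tri.a₃ T) ≡ p ↑ˡ n → lab (Tri.a₁ U) ≡ p ↑ˡ n → lab (Tri.a₃ U) ≡ P ↑ˡ n → Quad p
     quadR : ∀ {a b c d} (T : Tri a b c) (U : Tri d a c) P → lab (Tri.a₃ T) ≡ p ↑ˡ n → lab (Tri.a₂ U) ≡ p ↑ˡ n → lab (Tri.a₃ U) ≡ P ↑ˡ n → Quad p

   quad : ∀ p → Quad p
   quad p = go (hi (O (p ↑ˡ n))) refl (parent (own (p ↑ˡ n)))
     where
     go : ∀ c → c ≡ hi (O (p ↑ˡ n)) → Parent (lo (O (p ↑ˡ n))) (hi (O (p ↑ˡ n))) → Quad p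
     go c ec (second U) = let P , e = long-label U in quadR (proj₂ (triOf p)) U P (own-lab p) (label-≡ (Tri.a₂ U) (own (p ↑ˡ n))) e
     go c ec (first {b′} eb U) = let P , e = long-label U in
       quadL (subst (Tri _ _) eb (proj₂ (triOf p))) U P
         (label-≡ (Tri.a₃ (subst (Tri _ _) eb (proj₂ (triOf p)))) ((p ↑ˡ n) , subst (On _ _) eb (lo-on₀ (O (p ↑ˡ n)))))
         (label-≡ (Tri.a₁ U) ((p ↑ˡ n) , subst (On _ _) eb (lo-on₀ (O (p ↑ˡ n))))) e

 record FlipIdeals : Set where
   constructor flip-ideals
   field
     n : ℕ
     2≤n : 2 ℕ.≤ n
     {r} : ℕ
     {O O′} : Fin (r ℕ.+ n) → OArc
     I : Triangulation.Ideal n 2≤n r O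
     I′ : Triangulation.Ideal n 2≤n r O′
     p : Fin r
     agree : ∀ ℓ → ℓ ≢ p ↑ˡ n → O′ ℓ ≡ O ℓ
     differ : O′ (p ↑ˡ n) ≢ O (p ↑ˡ n)

 module Flip (Ω : FlipIdeals) where
   open FlipIdeals Ω

   open Cover n 2≤n
   open CrossingNumber n 2≤n
   open Triangulation n 2≤n hiding (Ideal)
   module S = Sides n 2≤n I
   module S′ = Sides n 2≤n I′
   open S using (lab; Tri; Arc; Quad; quadL; quadR)

   p′ : OArc
   p′ = O′ (p ↑ˡ n)

   move : ∀ {u v} (a : Arc u v) → lab a ≢ p ↑ˡ n → S′.Arc u v
   move (ℓ , on) ne = ℓ , subst (λ y → On y _ _) (sym (agree ℓ ne)) on

   -- The new arc crosses p and no side of the quadrilateral around p, so it is the other diagonal.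
   new-arc : (α : OArc) → (∀ {u v a c} → On p′ u v → On (O (p ↑ˡ n)) a c → Crosses u v a c → p′ ≡ α) → p′ ≡ α
   new-arc α h with p′ ≟ᵒ α
   ... | yes e = e
   ... | no ne with Triangulation.Ideal.maxi I p′ (Triangulation.Ideal.shape I′ p) (lo-on₀ p′) (λ {ℓ} on → free ℓ on)
     where
     free : ∀ ℓ {u v} → On (O ℓ) u v → ¬ X (lo p′) (hi p′) u v × ¬ X u v (lo p′) (hi p′)
     free ℓ on with ℓ Fin.≟ p ↑ˡ n
     ... | yes refl = (λ x → ne (h (lo-on₀ p′) on (inj₁ x))) , λ x → ne (h (lo-on₀ p′) on (inj₂ x))
     ... | no nl = S′.noX (lo-on₀ p′) on′ , S′.noX on′ (lo-on₀ p′)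
       where
       on′ = subst (λ y → On y _ _) (sym (agree ℓ nl)) on
   ... | q , e with q Fin.≟ p
   ...   | yes refl = ⊥-elim (differ (sym e))
   ...   | no nq = ⊥-elim (nq (S.↑-inj (S′.O-inj (trans (agree (q ↑ˡ n) (λ x → nq (S.↑-inj x))) e))))

   -- It suffices to compare with one fixed lift of p.
   new-diagonal : ∀ {a c b d} → On (O (p ↑ˡ n)) a c → fin b ≺ d → Small (cls b d) →
     (∀ {u v} → S′.Arc u v → Crosses u v a c → u ≡ b × v ≡ d) → On p′ b d
   new-diagonal {a} {c} {b} {d} on b≺d sm h = subst (λ y → On y b d) (sym (new-arc (cls b d) diag)) (on-cls b≺d)
     where
     diag : ∀ {u v a′ c′} → On p′ u v → On (O (p ↑ˡ n)) a′ c′ → Crosses u v a′ c′ → p′ ≡ cls b d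
     diag {u} {v} {a′} {c′} op on′ x with on-lift on′ on
     ... | t , ea , ec with h ((p ↑ˡ n) , on-shift t op) (subst₂ (Crosses (u + t * N) (sh t v)) (sym ea) (sym ec) (Crosses-sh t x))
     ...   | eu , ev = on-unique (S′.small (p ↑ˡ n)) sm (subst₂ (On p′) eu ev (on-shift t op)) (on-cls b≺d)

   -- The quadrilateral is `a < b < c < d` with old diagonal `[a , c]`. An arc that crosses this
   -- diagonal without having the ends `b` and `d` crosses one of the four sides. `newR` is the
   -- mirror image, with `d < a < b < c`.
   newL : ∀ {a b c d} (T : Tri a b (fin c)) (U : Tri a c d) → lab (Tri.a₃ T) ≡ p ↑ˡ n → lab (Tri.a₁ T) ≢ p ↑ˡ n → lab (Tri.a₂ T) ≢ p ↑ˡ n →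
     lab (Tri.a₂ U) ≢ p ↑ˡ n → lab (Tri.a₃ U) ≢ p ↑ˡ n → On p′ b d
   newL {a} {b} {c} {d} T U ep n₁ n₂ n₃ n₄ =
     new-diagonal (subst (λ ℓ → On (O ℓ) a (fin c)) ep (proj₂ (Tri.a₃ T))) b≺d (sm d b≺d (Tri.a₃ U)) cmp
     where
     ab = move (Tri.a₁ T) n₁
     bc = move (Tri.a₂ T) n₂
     cd = move (Tri.a₂ U) n₃
     ad = move (Tri.a₃ U) n₄
     b≺d : fin b ≺ d
     b≺d = ≺-trans {fin b} {fin c} {d} (Tri.u≺f T) (Tri.u≺f U)
     sm : ∀ d → fin b ≺ d → Arc a d → Small (cls b d)
     sm (fin d) h ad = len-cls h (≤-trans (S.arc-len ad) (+-monoˡ-≤ N (<⇒≤ (Tri.e<u T))))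
     sm ∞ h ad = n%ℕd<d b n
     cmp : ∀ {u v} → S′.Arc u v → Crosses u v a (fin c) → u ≡ b × v ≡ d
     cmp {u} {v} uv (inj₁ (h₁ , h₂ , h₃)) = ⊥-elim (S′.nx uv ad (h₁ , h₂ , ≺-trans {v} {fin c} {d} h₃ (Tri.u≺f U)))
     cmp {u} {v} uv (inj₂ (h₁ , h₂ , h₃)) = left (<-cmp u b) , right (≺-cmp v d)
       where
       left : _ → u ≡ b
       left (tri< h _ _) = ⊥-elim (S′.nx ab uv (h₁ , h , ≺-trans {fin b} {fin c} {v} (Tri.u≺f T) h₃))
       left (tri≈ _ h _) = h
       left (tri> _ _ h) = ⊥-elim (S′.nx bc uv (h , h₂ , h₃))
       right : Cmp v d → v ≡ d
       right (lt h) = ⊥-elim (S′.nx uv cd (h₂ , h₃ , h))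
       right (eq h) = h
       right (gt h) = ⊥-elim (S′.nx ad uv (h₁ , ≺-trans {fin u} {fin c} {d} h₂ (Tri.u≺f U) , h))

   newR : ∀ {a b c d} (T : Tri a b c) (U : Tri d a c) → lab (Tri.a₃ T) ≡ p ↑ˡ n → lab (Tri.a₁ T) ≢ p ↑ˡ n → lab (Tri.a₂ T) ≢ p ↑ˡ n →
     lab (Tri.a₁ U) ≢ p ↑ˡ n → lab (Tri.a₃ U) ≢ p ↑ˡ n → b ≤ d + N → On p′ d (fin b)
   newR {a} {b} {c} {d} T U ep n₁ n₂ n₃ n₄ b≤ =
     new-diagonal (subst (λ ℓ → On (O ℓ) a c) ep (proj₂ (Tri.a₃ T))) (<-trans (Tri.e<u U) (Tri.e<u T)) (len-cls (<-trans (Tri.e<u U) (Tri.e<u T)) b≤) cmp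
     where
     ab = move (Tri.a₁ T) n₁
     bc = move (Tri.a₂ T) n₂
     da = move (Tri.a₁ U) n₃
     dc = move (Tri.a₃ U) n₄
     cmp : ∀ {u v} → S′.Arc u v → Crosses u v a c → u ≡ d × v ≡ fin b
     cmp {u} {v} uv (inj₂ (h₁ , h₂ , h₃)) = ⊥-elim (S′.nx dc uv (<-trans (Tri.e<u U) h₁ , h₂ , h₃))
     cmp {u} {v} uv (inj₁ (h₁ , h₂ , h₃)) = left (<-cmp u d) , right (≺-cmp v (fin b))
       where
       left : _ → u ≡ d
       left (tri< h _ _) = ⊥-elim (S′.nx uv dc (h , ≺-trans {fin d} {fin a} {v} (Tri.e<u U) h₂ , h₃))
       left (tri≈ _ h _) = h
       left (tri> _ _ h) = ⊥-elim (S′.nx da uv (h , h₁ , h₂))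
       right : Cmp v (fin b) → v ≡ fin b
       right (lt h) = ⊥-elim (S′.nx uv ab (h₁ , h₂ , h))
       right (eq h) = h
       right (gt h) = ⊥-elim (S′.nx uv bc (<-trans h₁ (Tri.e<u T) , h , h₃))

   private
     shorter : ∀ {u v u′ v′ t} → u′ ≡ u + t * N → v′ ≡ v + t * N → v ℤ.- u < v′ ℤ.- u′ → ⊥
     shorter {u} {v} {t = t} refl refl h = <-irrefl (ar u v (t * N)) h
       where
       ar : ∀ u v x → v ℤ.- u ≡ v + x ℤ.- (u + x)
       ar = solve-∀

   -- A label cannot be carried by two arcs one of which is finite and strictly shorter.
   nested-≢ : ∀ {u v u′ v′} (a : Arc u (fin v)) (b : Arc u′ v′) → u′ ≤ u → fin v ≺ v′ → lab a ≢ lab b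
   nested-≢ {u} {v} {u′} {fin v′} a b p q e with on-lift (subst (λ ℓ → On (O ℓ) u (fin v)) e (proj₂ a)) (proj₂ b)
   ... | t , eu , ev = shorter {u} {v} {t = t} eu (fin-injective ev) (ar u v u′ v′ p q)
     where
     ar : ∀ u v u′ v′ → u′ ≤ u → v < v′ → v ℤ.- u < v′ ℤ.- u′
     ar u v u′ v′ p q = by< λ k → absurd≤ 0 (p ⊕ s≤ q ⊕ k) (solve (u ∷ v ∷ u′ ∷ v′ ∷ []))
   nested-≢ {u} {v} {u′} {∞} a b p q e with on-lift (subst (λ ℓ → On (O ℓ) u (fin v)) e (proj₂ a)) (proj₂ b)
   ... | t , eu , ()

   nested-≢′ : ∀ {u v u′ v′} (a : Arc u (fin v)) (b : Arc u′ (fin v′)) → u′ < u → v ≤ v′ → lab a ≢ lab b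
   nested-≢′ {u} {v} {u′} {v′} a b p q e with on-lift (subst (λ ℓ → On (O ℓ) u (fin v)) e (proj₂ a)) (proj₂ b)
   ... | t , eu , ev = shorter {u} {v} {t = t} eu (fin-injective ev) (ar u v u′ v′ p q)
     where
     ar : ∀ u v u′ v′ → u′ < u → v ≤ v′ → v ℤ.- u < v′ ℤ.- u′
     ar u v u′ v′ p q = by< λ k → absurd≤ 0 (s≤ p ⊕ q ⊕ k) (solve (u ∷ v ∷ u′ ∷ v′ ∷ []))

   -- Recognises self-folded triangles: if the two radii of a triangle have the same label, they are
   -- exactly one period apart.
   wrap-around : ∀ {u w} (b : Arc u ∞) (b′ : Arc w ∞) → lab b ≡ lab b′ → u < w → w ≤ u + N → w ≡ u + N
   wrap-around {u} {w} b b′ e p q with on-lift (subst (λ ℓ → On (O ℓ) u ∞) e (proj₂ b)) (proj₂ b′)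
   ... | t , ew , _ with <-cmp w (u + N)
   ...   | tri≈ _ h _ = h
   ...   | tri> _ _ h = ⊥-elim (<⇒≱ h q)
   ...   | tri< h _ _ = ⊥-elim (<-irrefl (sym (trans ew (trans (cong (λ z → u + z * N) t≡0) (+-identityʳ u)))) p)
     where
     ar : ∀ u w x N → w ≡ u + x → w < u + N → x < N
     ar u w x N e h = by< λ k → absurd≤ 0 (s≤ h ⊕ k ⊕ ≡⇒≤ (sym e)) (solve (u ∷ w ∷ x ∷ N ∷ []))
     ar′ : ∀ u w x N → w ≡ u + x → u < w → 0ℤ < N → - N < x
     ar′ u w x N e h g = by< λ k → absurd≤ 1 (s≤ h ⊕ k ⊕ s≤ g ⊕ ≡⇒≤ e) (solve (u ∷ w ∷ x ∷ N ∷ []))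
     t≡0 : t ≡ 0ℤ
     t≡0 = mult-small {n} t (t * N) refl (ar u w (t * N) N ew h) (ar′ u w (t * N) N ew p (<-≤-trans (ℤ.+<+ (ℕ.s≤s ℕ.z≤n)) 2≤N))

   private
     -- Were p the radius inside a loop, the loop would force the same radius into the new triangulation.
     not-self-folded : ∀ {d a} (U : Tri d a ∞) → lab (Tri.a₂ U) ≡ p ↑ˡ n → lab (Tri.a₃ U) ≢ p ↑ˡ n
     not-self-folded {d} {a} U e₂ e₃ = clash (S′.radius)
       where
       ea : a ≡ d + N
       ea = wrap-around (Tri.a₃ U) (Tri.a₂ U) (trans e₃ (sym e₂)) (Tri.e<u U) (S.arc-len (Tri.a₁ U))
       loop : S′.Arc d (fin (d + N))
       loop = subst (λ a → S′.Arc d (fin a)) ea (move (Tri.a₁ U) λ e → mixed e)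
         where
         mixed : lab (Tri.a₁ U) ≢ p ↑ˡ n
         mixed e = nested-≢ (Tri.a₁ U) (Tri.a₃ U) ≤-refl tt (trans e (sym e₃))
       found : S′.Arc d ∞ → ⊥
       found (ℓ , on) with ℓ Fin.≟ p ↑ˡ n
       ... | yes refl = differ (on-unique (S′.small ℓ) (S.small ℓ) on (subst (λ ℓ → On (O ℓ) d ∞) e₃ (proj₂ (Tri.a₃ U))))
       ... | no ne = ne (S.label-unique (subst (λ y → On y d ∞) (agree ℓ ne) on) (subst (λ ℓ → On (O ℓ) d ∞) e₃ (proj₂ (Tri.a₃ U))))
       clash : ∃ S′.Base → ⊥
       clash (z , b) with nearest d z
       ... | t , lo′ , hi′ = go (<-cmp d (z + - t * N))
         where
         b′ : S′.Base (z + - t * N)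
         b′ = S′.arc-sh (- t) b
         ar₁ : ∀ d z x → d + x ≤ z → d ≤ z + - x
         ar₁ d z x h = by≤ λ k → absurd≤ 0 (h ⊕ s≤ k) (solve (d ∷ z ∷ x ∷ []))
         ar₂ : ∀ d z x N → z < d + x + N → z + - x < d + N
         ar₂ d z x N h = by< λ k → absurd≤ 0 (s≤ h ⊕ k) (solve (d ∷ z ∷ x ∷ N ∷ []))
         eqt : z + - t * N ≡ z + - (t * N)
         eqt = cong (λ x → z + x) (sym (neg-distribˡ-* t N))
         go : _ → ⊥
         go (tri≈ _ h _) = found (subst S′.Base (sym h) b′)
         go (tri< h _ _) = S′.not-under b′ loop h (subst (_< d + N) (sym eqt) (ar₂ d z (t * N) N hi′))
         go (tri> _ _ h) = <⇒≱ h (subst (d ≤_) (sym eqt) (ar₁ d z (t * N) lo′))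

   -- A tree rotation: with sides written as children, `((L₁ p , L₂ p) , L₂ P)` becomes
   -- `(L₁ p , (L₂ p , L₂ P))`, where the inner pair is `p` both times. `RotR` is the inverse shape.
   record RotL (P : Fin r) : Set where
     field
       {a b c} : ℤ
       {d} : Pt
       Δ : Tri a b (fin c)
       Γ : Tri a c d
       e₁ : lab (Tri.a₁ Δ) ≡ S.L₁ p
       e₂ : lab (Tri.a₂ Δ) ≡ S.L₂ p
       e₃ : lab (Tri.a₃ Δ) ≡ p ↑ˡ n
       f₂ : lab (Tri.a₂ Γ) ≡ S.L₂ P
       f₃ : lab (Tri.a₃ Γ) ≡ P ↑ˡ n
       p∈P : S.L₁ P ≡ p ↑ˡ n
       new : On p′ b d
       P₁ : S′.L₁ P ≡ S.L₁ p
       P₂ : S′.L₂ P ≡ p ↑ˡ n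
       p₁ : S′.L₁ p ≡ S.L₂ p
       p₂ : S′.L₂ p ≡ S.L₂ P

   record RotR (P : Fin r) : Set where
     field
       {a b d} : ℤ
       {c} : Pt
       Δ : Tri a b c
       Γ : Tri d a c
       e₁ : lab (Tri.a₁ Δ) ≡ S.L₁ p
       e₂ : lab (Tri.a₂ Δ) ≡ S.L₂ p
       e₃ : lab (Tri.a₃ Δ) ≡ p ↑ˡ n
       f₁ : lab (Tri.a₁ Γ) ≡ S.L₁ P
       f₃ : lab (Tri.a₃ Γ) ≡ P ↑ˡ n
       b≤d+N : b ≤ d + N
       p∈P : S.L₂ P ≡ p ↑ˡ n
       new : On p′ d (fin b)
       P₁ : S′.L₁ P ≡ p ↑ˡ n
       P₂ : S′.L₂ P ≡ S.L₂ p
       p₁ : S′.L₁ p ≡ S.L₁ P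
       p₂ : S′.L₂ p ≡ S.L₁ p

   record FlipShape : Set where
     field
       P      : Fin r
       P≢p    : P ≢ p
       rot    : RotL P ⊎ RotR P
       others : ∀ q → q ≢ p → q ≢ P → S′.L₁ q ≡ S.L₁ q × S′.L₂ q ≡ S.L₂ q
       only₁  : ∀ q → q ≢ P → S.L₁ q ≢ p ↑ˡ n
       only₂  : ∀ q → q ≢ P → S.L₂ q ≢ p ↑ˡ n

   private
     keep : ∀ {q P} → (∀ q → q ≢ P → S.L₁ q ≢ p ↑ˡ n) → (∀ q → q ≢ P → S.L₂ q ≢ p ↑ˡ n) → q ≢ p → q ≢ P →
       S′.L₁ q ≡ S.L₁ q × S′.L₂ q ≡ S.L₂ q
     keep {q} o₁ o₂ nq nP = S′.L-unique q (S′.mkTri (Tri.e<u T) (Tri.u≺f T) (move (Tri.a₁ T) (o₁ q nP)) (move (Tri.a₂ T) (o₂ q nP))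
         (move (Tri.a₃ T) λ e → nq (S.↑-inj (trans (sym (S.own-lab q)) e)))) (S.own-lab q)
       where
       T = proj₂ (S.triOf q)

     -- If `c` is the puncture and `b` exceeded `d + N`, the translated radius at `d + N` would
     -- start strictly under `[a , b]`. The boundary case `b = d + N` does occur: the new diagonal
     -- is then a loop.
     b≤ : ∀ {a b c d} (T : Tri a b c) (U : Tri d a c) → lab (Tri.a₂ U) ≡ p ↑ˡ n → lab (Tri.a₃ U) ≢ p ↑ˡ n → b ≤ d + N
     b≤ {c = fin c} T U _ _ = <⇒≤ (<-≤-trans (Tri.u≺f T) (S.arc-len (Tri.a₃ U)))
     b≤ {a} {b} {∞} {d} T U e ne = by≤ λ h → S.not-under base⁺ (Tri.a₁ T) (a<d+N (<-cmp a (d + N))) h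
       where
       base⁺ : S.Base (d + N)
       base⁺ = subst S.Base (cong (λ x → d + x) (*-identityˡ N)) (S.arc-sh 1ℤ (Tri.a₃ U))
       a<d+N : _ → a < d + N
       a<d+N (tri< h _ _) = h
       a<d+N (tri≈ _ h _) = ⊥-elim (ne (trans (S.label-≡ (subst S.Base (trans (cong (λ x → d + x) (*-identityˡ N)) (sym h)) (S.arc-sh 1ℤ (Tri.a₃ U))) (Tri.a₂ U) ⟨lab⟩) e))
         where
         _⟨lab⟩ : ∀ {ℓ} → proj₁ (subst S.Base (trans (cong (λ x → d + x) (*-identityˡ N)) (sym h)) (S.arc-sh 1ℤ (Tri.a₃ U))) ≡ ℓ → lab (Tri.a₃ U) ≡ ℓ
         _⟨lab⟩ = trans (sym (subst-lab (trans (cong (λ x → d + x) (*-identityˡ N)) (sym h)) (S.arc-sh 1ℤ (Tri.a₃ U))))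
           where
           subst-lab : ∀ {u w} (e : u ≡ w) (x : S.Base u) → proj₁ (subst S.Base e x) ≡ proj₁ x
           subst-lab refl x = refl
       a<d+N (tri> _ _ h) = ⊥-elim (<⇒≱ h (S.arc-len (Tri.a₁ U)))

   rotation : FlipShape
   rotation with S.quad p
   ... | quadL {a} {b} {c} {d} T U P e₃ f₁ f₃ = record
       { P = P ; P≢p = P≢p ; others = λ q nq nP → keep only₁ only₂ nq nP ; only₁ = only₁ ; only₂ = only₂
       ; rot = inj₁ (record { Δ = T ; Γ = U ; e₁ = sym (proj₁ Lp) ; e₂ = sym (proj₂ Lp) ; e₃ = e₃ ; f₂ = sym (proj₂ LP) ; f₃ = f₃ ; p∈P = L₁P ; new = nw
           ; P₁ = trans (proj₁ L′P) (sym (proj₁ Lp)) ; P₂ = proj₂ L′P ; p₁ = trans (proj₁ L′p) (sym (proj₂ Lp)) ; p₂ = trans (proj₂ L′p) (sym (proj₂ LP)) }) }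
     where
     Lp = S.L-unique p T e₃
     LP = S.L-unique P U f₃
     L₁P = trans (proj₁ LP) f₁
     P≢p : P ≢ p
     P≢p refl = nested-≢ (Tri.a₃ T) (Tri.a₃ U) ≤-refl (Tri.u≺f U) (trans e₃ (sym f₃))
     only₁ : ∀ q → q ≢ P → S.L₁ q ≢ p ↑ˡ n
     only₁ q nq e = nq (S.L₁-inj (trans e (sym L₁P)))
     only₂ : ∀ q → q ≢ P → S.L₂ q ≢ p ↑ˡ n
     only₂ q nq e = S.L₁≢L₂ {P} {q} (trans L₁P (sym e))
     n₁ : lab (Tri.a₁ T) ≢ p ↑ˡ n
     n₁ e = only₁ p (λ x → P≢p (sym x)) (trans (proj₁ Lp) e)
     n₂ : lab (Tri.a₂ T) ≢ p ↑ˡ n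
     n₂ e = only₂ p (λ x → P≢p (sym x)) (trans (proj₂ Lp) e)
     n₃ : lab (Tri.a₂ U) ≢ p ↑ˡ n
     n₃ e = S.L₁≢L₂ {P} {P} (trans L₁P (sym (trans (proj₂ LP) e)))
     n₄ : lab (Tri.a₃ U) ≢ p ↑ˡ n
     n₄ e = P≢p (S.↑-inj (trans (sym f₃) e))
     nw : On p′ b d
     nw = newL T U e₃ n₁ n₂ n₃ n₄
     L′P = S′.L-unique P (S′.mkTri (Tri.e<u T) (≺-trans {fin b} {fin c} {d} (Tri.u≺f T) (Tri.u≺f U)) (move (Tri.a₁ T) n₁) ((p ↑ˡ n) , nw) (move (Tri.a₃ U) n₄)) f₃
     L′p = S′.L-unique p (S′.mkTri (Tri.u≺f T) (Tri.u≺f U) (move (Tri.a₂ T) n₂) (move (Tri.a₂ U) n₃) ((p ↑ˡ n) , nw)) refl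
   ... | quadR {a} {b} {c} {d} T U P e₃ f₂ f₃ = record
       { P = P ; P≢p = P≢p ; others = λ q nq nP → keep only₁ only₂ nq nP ; only₁ = only₁ ; only₂ = only₂
       ; rot = inj₂ (record { Δ = T ; Γ = U ; e₁ = sym (proj₁ Lp) ; e₂ = sym (proj₂ Lp) ; e₃ = e₃ ; f₁ = sym (proj₁ LP) ; f₃ = f₃ ; b≤d+N = b≤ T U f₂ n₄ ; p∈P = L₂P ; new = nw
           ; P₁ = proj₁ L′P ; P₂ = trans (proj₂ L′P) (sym (proj₂ Lp)) ; p₁ = trans (proj₁ L′p) (sym (proj₁ LP)) ; p₂ = trans (proj₂ L′p) (sym (proj₁ Lp)) }) }
     where
     Lp = S.L-unique p T e₃
     LP = S.L-unique P U f₃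
     L₂P = trans (proj₂ LP) f₂
     notSelf : ∀ c → (U : Tri d a c) → lab (Tri.a₂ U) ≡ p ↑ˡ n → lab (Tri.a₃ U) ≢ p ↑ˡ n
     notSelf ∞ U e = not-self-folded U e
     notSelf (fin c) U e e′ = nested-≢′ (Tri.a₂ U) (Tri.a₃ U) (Tri.e<u U) ≤-refl (trans e (sym e′))
     n₄ : lab (Tri.a₃ U) ≢ p ↑ˡ n
     n₄ = notSelf c U f₂
     P≢p : P ≢ p
     P≢p refl = n₄ f₃
     only₂ : ∀ q → q ≢ P → S.L₂ q ≢ p ↑ˡ n
     only₂ q nq e = nq (S.L₂-inj (trans e (sym L₂P)))
     only₁ : ∀ q → q ≢ P → S.L₁ q ≢ p ↑ˡ n
     only₁ q nq e = S.L₁≢L₂ {q} {P} (trans e (sym L₂P))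
     n₁ : lab (Tri.a₁ T) ≢ p ↑ˡ n
     n₁ e = only₁ p (λ x → P≢p (sym x)) (trans (proj₁ Lp) e)
     n₂ : lab (Tri.a₂ T) ≢ p ↑ˡ n
     n₂ e = only₂ p (λ x → P≢p (sym x)) (trans (proj₂ Lp) e)
     n₃ : lab (Tri.a₁ U) ≢ p ↑ˡ n
     n₃ e = S.L₁≢L₂ {P} {P} (trans (trans (proj₁ LP) e) (sym L₂P))
     nw : On p′ d (fin b)
     nw = newR T U e₃ n₁ n₂ n₃ n₄ (b≤ T U f₂ n₄)
     L′P = S′.L-unique P (S′.mkTri (<-trans (Tri.e<u U) (Tri.e<u T)) (Tri.u≺f T) ((p ↑ˡ n) , nw) (move (Tri.a₂ T) n₂) (move (Tri.a₃ U) n₄)) f₃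
     L′p = S′.L-unique p (S′.mkTri (Tri.e<u U) (Tri.e<u T) (move (Tri.a₁ U) n₃) (move (Tri.a₁ T) n₁) ((p ↑ˡ n) , nw)) refl

-- Matrix mutation on a quadrilateral

module MatrixMutation where
 open import Data.Bool using (true; false; _∨_; if_then_else_)
 open import Data.Bool.Properties using (∧-zeroʳ)
 open import Data.Nat using (ℕ; zero; suc; _≡ᵇ_)
 open import Data.Integer using (ℤ; +_; _+_; _*_; -_; _-_; 0ℤ)
 import Data.Integer.Properties as ℤP
 open import Data.Integer.Tactic.RingSolver using (solve-∀)
 open import Data.Fin using (Fin; zero; suc; toℕ)
 open import Data.List using (List; []; _∷_; length; lookup)
 import Data.List.Relation.Unary.All as All
 import Data.List.Relation.Unary.AllPairs as AllPairs
 open import Data.List.Membership.Propositional.Properties using (∈-lookup)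
 open import Relation.Nullary.Decidable using (from-yes)

 Sum : ∀ {r} → (Fin r → ℤ) → ℤ
 Sum {zero} f = 0ℤ
 Sum {suc r} f = f zero + Sum (λ q → f (suc q))

 Sum-cong : ∀ {r} {f g : Fin r → ℤ} → (∀ q → f q ≡ g q) → Sum f ≡ Sum g
 Sum-cong {zero} h = refl
 Sum-cong {suc r} h = cong₂ _+_ (h zero) (Sum-cong λ q → h (suc q))

 Sum-0 : ∀ {r} {f : Fin r → ℤ} → (∀ q → f q ≡ 0ℤ) → Sum f ≡ 0ℤ
 Sum-0 {zero} h = refl
 Sum-0 {suc r} h = cong₂ _+_ (h zero) (Sum-0 λ q → h (suc q))

 Sum-+ : ∀ {r} (f g : Fin r → ℤ) → Sum (λ q → f q + g q) ≡ Sum f + Sum g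
 Sum-+ {zero} f g = refl
 Sum-+ {suc r} f g = trans (cong (λ z → f zero + g zero + z) (Sum-+ (λ q → f (suc q)) (λ q → g (suc q)))) (ar (f zero) (g zero) _ _)
   where
   ar : ∀ a b x y → a + b + (x + y) ≡ a + x + (b + y)
   ar = solve-∀

 only : ∀ {r} → Fin r → (Fin r → ℤ) → Fin r → ℤ
 only p f q = if does (p Fin.≟ q) then f q else 0ℤ

 except : ∀ {r} → Fin r → (Fin r → ℤ) → Fin r → ℤ
 except p f q = if does (p Fin.≟ q) then 0ℤ else f q

 Sum-only : ∀ {r} (p : Fin r) f → Sum (only p f) ≡ f p
 Sum-only zero f = trans (cong (λ z → f zero + z) (Sum-0 {f = λ q → only zero f (suc q)} λ q → refl)) (ℤP.+-identityʳ (f zero))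
 Sum-only (suc p) f = trans (ℤP.+-identityˡ _) (Sum-only p λ q → f (suc q))

 Sum-except : ∀ {r} (p : Fin r) f → Sum f ≡ f p + Sum (except p f)
 Sum-except p f = trans (Sum-cong split) (trans (Sum-+ (only p f) (except p f)) (cong (_+ Sum (except p f)) (Sum-only p f)))
   where
   split : ∀ q → f q ≡ only p f q + except p f q
   split q with does (p Fin.≟ q)
   ... | true = sym (ℤP.+-identityʳ (f q))
   ... | false = sym (ℤP.+-identityˡ (f q))

 except-≡ : ∀ {r} (p : Fin r) f → except p f p ≡ 0ℤ
 except-≡ p f = cong (λ b → if b then 0ℤ else f p) (dec-true (p Fin.≟ p) refl)

 except-≢ : ∀ {r} {p q : Fin r} f → q ≢ p → except p f q ≡ f q
 except-≢ {p = p} {q} f h = cong (λ b → if b then 0ℤ else f q) (dec-false (p Fin.≟ q) λ e → h (sym e))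

 except-cong : ∀ {r} (p : Fin r) {f g : Fin r → ℤ} → (∀ q → q ≢ p → f q ≡ g q) → ∀ q → except p f q ≡ except p g q
 except-cong p h q with p Fin.≟ q
 ... | yes _ = refl
 ... | no ne = h q λ e → ne (sym e)

 Sum-except₂ : ∀ {r} {p P : Fin r} f → P ≢ p → Sum f ≡ Sum (except P (except p f)) + (f p + f P)
 Sum-except₂ {p = p} {P} f h = trans (Sum-except p f) (trans (cong (λ z → f p + z) (trans (Sum-except P (except p f)) (cong (_+ Sum (except P (except p f))) (except-≢ f h))))
   (ar (f p) (f P) _))
   where
   ar : ∀ a b x → a + (b + x) ≡ x + (a + b)
   ar = solve-∀

 adj-cong : ∀ {s₁ s₂ s₃ t₁ t₂ t₃ x y x′ y′} → oEq s₁ x ≡ oEq t₁ x′ → oEq s₂ x ≡ oEq t₂ x′ → oEq s₃ x ≡ oEq t₃ x′ →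
   oEq s₁ y ≡ oEq t₁ y′ → oEq s₂ y ≡ oEq t₂ y′ → oEq s₃ y ≡ oEq t₃ y′ → adj (s₁ , s₂ , s₃) x y ≡ adj (t₁ , t₂ , t₃) x′ y′
 adj-cong h₁ h₂ h₃ h₄ h₅ h₆ rewrite h₁ | h₂ | h₃ | h₄ | h₅ | h₆ = refl

 adj-zeroʳ : ∀ {s₁ s₂ s₃ x y} → oEq s₁ y ≡ false → oEq s₂ y ≡ false → oEq s₃ y ≡ false → adj (s₁ , s₂ , s₃) x y ≡ 0ℤ
 adj-zeroʳ {s₁} {s₂} {s₃} {x} {y} h₁ h₂ h₃ rewrite h₁ | h₂ | h₃ | ∧-zeroʳ (oEq s₁ x) | ∧-zeroʳ (oEq s₂ x) | ∧-zeroʳ (oEq s₃ x) = refl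

 adj-zeroˡ : ∀ {s₁ s₂ s₃ x y} → oEq s₁ x ≡ false → oEq s₂ x ≡ false → oEq s₃ x ≡ false → adj (s₁ , s₂ , s₃) x y ≡ 0ℤ
 adj-zeroˡ {s₁} {s₂} {s₃} {x} {y} h₁ h₂ h₃ rewrite h₁ | h₂ | h₃ | ∧-zeroʳ (oEq s₁ y) | ∧-zeroʳ (oEq s₂ y) | ∧-zeroʳ (oEq s₃ y) = refl

 ≡ᵇ-refl : ∀ k → (k ≡ᵇ k) ≡ true
 ≡ᵇ-refl zero = refl
 ≡ᵇ-refl (suc k) = ≡ᵇ-refl k

 ≡ᵇ-≢ : ∀ {k l} → k ≢ l → (k ≡ᵇ l) ≡ false
 ≡ᵇ-≢ {zero} {zero} h = ⊥-elim (h refl)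
 ≡ᵇ-≢ {zero} {suc l} h = refl
 ≡ᵇ-≢ {suc k} {zero} h = refl
 ≡ᵇ-≢ {suc k} {suc l} h = ≡ᵇ-≢ {k} {l} λ e → h (cong suc e)

 -- `adj` uses its arguments only through `oEq`, so radii with distinct indices can stand for
 -- arbitrary labels.
 code : ∀ {m} → Fin m → OArc
 code x = rad (toℕ x)

 Triple : ℕ → Set
 Triple m = Fin m × Fin m × Fin m

 adjF : ∀ {m} → Triple m → Fin m → Fin m → ℤ
 adjF (x , y , z) i j = adj (code x , code y , code z) (code i) (code j)

 oEq-code-refl : ∀ {m} (x : Fin m) → oEq (code x) (code x) ≡ true
 oEq-code-refl x = ≡ᵇ-refl (toℕ x)

 oEq-code-≢ : ∀ {m} {x y : Fin m} → x ≢ y → oEq (code x) (code y) ≡ false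
 oEq-code-≢ h = ≡ᵇ-≢ λ e → h (FinP.toℕ-injective e)

 adjF-zeroʳ : ∀ {m} {x y z : Fin m} i {j} → x ≢ j → y ≢ j → z ≢ j → adjF (x , y , z) i j ≡ 0ℤ
 adjF-zeroʳ {x = x} {y} {z} i {j} p q s = adj-zeroʳ {code x} {code y} {code z} {code i} {code j} (oEq-code-≢ p) (oEq-code-≢ q) (oEq-code-≢ s)

 adjF-zeroˡ : ∀ {m} {x y z : Fin m} {i} j → x ≢ i → y ≢ i → z ≢ i → adjF (x , y , z) i j ≡ 0ℤ
 adjF-zeroˡ {x = x} {y} {z} {i} j p q s = adj-zeroˡ {code x} {code y} {code z} {code i} {code j} (oEq-code-≢ p) (oEq-code-≢ q) (oEq-code-≢ s)

 -- Position of a label in a list of distinguished labels; all other labels share the last value.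
 idx : ∀ {m} (xs : List (Fin m)) → Fin m → Fin (suc (length xs))
 idx [] i = zero
 idx (x ∷ xs) i = if does (x Fin.≟ i) then zero else suc (idx xs i)

 idx-spec : ∀ {m} (xs : List (Fin m)) → AllPairs.AllPairs _≢_ xs → ∀ k i → (toℕ (lookup xs k) ≡ᵇ toℕ i) ≡ (toℕ k ≡ᵇ toℕ (idx xs i))
 idx-spec (x ∷ xs) (p AllPairs.∷ ps) k i with x Fin.≟ i
 idx-spec (x ∷ xs) (p AllPairs.∷ ps) zero i | yes refl = ≡ᵇ-refl (toℕ x)
 idx-spec (x ∷ xs) (p AllPairs.∷ ps) (suc k) i | yes refl = ≡ᵇ-≢ λ e → All.lookup p (∈-lookup {xs = xs} k) (sym (FinP.toℕ-injective e))
 idx-spec (x ∷ xs) (p AllPairs.∷ ps) zero i | no ne = ≡ᵇ-≢ λ e → ne (FinP.toℕ-injective e)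
 idx-spec (x ∷ xs) (p AllPairs.∷ ps) (suc k) i | no ne = idx-spec xs ps k i

 ≡ᵇ⇒≡ : ∀ {k l} → (k ≡ᵇ l) ≡ true → k ≡ l
 ≡ᵇ⇒≡ {zero} {zero} _ = refl
 ≡ᵇ⇒≡ {suc k} {suc l} h = cong suc (≡ᵇ⇒≡ h)

 mutB : ∀ {m} → (Fin m → Fin m → ℤ) → Fin m → Fin m → Fin m → ℤ
 mutB B p i j = if does (i Fin.≟ p) ∨ does (j Fin.≟ p) then - B i j
   else B i j + (+ pos (B i p) * + pos (B p j)) - (+ pos (- B i p) * + pos (- B p j))

 -- Mutation only sees the quadrilateral: it may be checked on the finitely many positions of i and j in it.
 module LocalMutation {m k : ℕ} (κ : Fin m → Fin k) (p : Fin m) (κ-p : ∀ i → does (i Fin.≟ p) ≡ does (κ i Fin.≟ κ p))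
   (rest : Fin m → Fin m → ℤ) (rest-p : ∀ i → rest i p ≡ 0ℤ) (p-rest : ∀ j → rest p j ≡ 0ℤ)
   (w w′ : Fin k → Fin k → ℤ) (check : ∀ x y → w′ x y ≡ mutB w (κ p) x y)
   (B B′ : Fin m → Fin m → ℤ) (B-w : ∀ i j → B i j ≡ rest i j + w (κ i) (κ j)) (B′-w : ∀ i j → B′ i j ≡ rest i j + w′ (κ i) (κ j)) where

   B-col : ∀ i → B i p ≡ w (κ i) (κ p)
   B-col i = trans (B-w i p) (trans (cong (_+ w (κ i) (κ p)) (rest-p i)) (ℤP.+-identityˡ _))

   B-row : ∀ j → B p j ≡ w (κ p) (κ j)
   B-row j = trans (B-w p j) (trans (cong (_+ w (κ p) (κ j)) (p-rest j)) (ℤP.+-identityˡ _))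

   local : ∀ i j → B′ i j ≡ mutB B p i j
   local i j = trans (B′-w i j) (trans (cong (λ z → rest i j + z) (check (κ i) (κ j))) (go (i Fin.≟ p) (j Fin.≟ p)))
     where
     body : ℤ → ℤ → ℤ → ℤ
     body a b c = a + (+ pos b * + pos c) - (+ pos (- b) * + pos (- c))
     ar : ∀ x y u v → x + (y + u - v) ≡ x + y + u - v
     ar = solve-∀
     neg : ∀ {x y z} → x ≡ 0ℤ → y ≡ x + z → x + - z ≡ - y
     neg {z = z} refl refl = trans (ℤP.+-identityˡ (- z)) (cong -_ (sym (ℤP.+-identityˡ z)))
     go : Dec (i ≡ p) → Dec (j ≡ p) → rest i j + mutB w (κ p) (κ i) (κ j) ≡ mutB B p i j
     go (yes refl) _ rewrite dec-true (i Fin.≟ i) refl | dec-true (κ i Fin.≟ κ i) refl = neg (p-rest j) (B-w i j)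
     go (no ni) (yes refl) rewrite sym (κ-p i) | dec-false (i Fin.≟ j) ni | dec-true (j Fin.≟ j) refl | dec-true (κ j Fin.≟ κ j) refl = neg (rest-p i) (B-w i j)
     go (no ni) (no nj) rewrite sym (κ-p i) | sym (κ-p j) | dec-false (i Fin.≟ p) ni | dec-false (j Fin.≟ p) nj =
       trans (ar (rest i j) (w (κ i) (κ j)) (+ pos (w (κ i) (κ p)) * + pos (w (κ p) (κ j))) (+ pos (- w (κ i) (κ p)) * + pos (- w (κ p) (κ j))))
         (sym (trans (cong₂ (body (B i j)) (B-col i) (B-row j)) (cong (λ a → body a (w (κ i) (κ p)) (w (κ p) (κ j))) (B-w i j))))

 idx-p : ∀ {m} (p : Fin m) xs i → does (i Fin.≟ p) ≡ does (idx (p ∷ xs) i Fin.≟ idx (p ∷ xs) p)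
 idx-p p xs i rewrite dec-true (p Fin.≟ p) refl with p Fin.≟ i
 ... | yes refl = dec-true (i Fin.≟ i) refl
 ... | no ne = dec-false (i Fin.≟ p) λ e → ne (sym e)

 adjF-idx : ∀ {m} (xs : List (Fin m)) → AllPairs.AllPairs _≢_ xs → ∀ a b c i j →
   adjF (lookup xs a , lookup xs b , lookup xs c) i j ≡ adjF (Fin.inject₁ a , Fin.inject₁ b , Fin.inject₁ c) (idx xs i) (idx xs j)
 adjF-idx xs d a b c i j = adj-cong {code (lookup xs a)} {code (lookup xs b)} {code (lookup xs c)} {code (Fin.inject₁ a)} {code (Fin.inject₁ b)} {code (Fin.inject₁ c)}
     {code i} {code j} {code (idx xs i)} {code (idx xs j)} (sp a i) (sp b i) (sp c i) (sp a j) (sp b j) (sp c j)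
   where
   sp : ∀ k i → (toℕ (lookup xs k) ≡ᵇ toℕ i) ≡ (toℕ (Fin.inject₁ k) ≡ᵇ toℕ (idx xs i))
   sp k i = trans (idx-spec xs d k i) (cong (_≡ᵇ toℕ (idx xs i)) (sym (FinP.toℕ-inject₁ k)))

 pattern f0 = zero
 pattern f1 = suc zero
 pattern f2 = suc (suc zero)
 pattern f3 = suc (suc (suc zero))
 pattern f4 = suc (suc (suc (suc zero)))

 -- Positions 0, …, 4 are p, L₁ p, L₂ p, the remaining short side of the outer triangle, and P.
 wL wL′ wR wR′ : Fin 6 → Fin 6 → ℤ
 wL x y = adjF (f1 , f2 , f0) x y + adjF (f0 , f3 , f4) x y
 wL′ x y = adjF (f2 , f3 , f0) x y + adjF (f1 , f0 , f4) x y
 wR x y = adjF (f1 , f2 , f0) x y + adjF (f3 , f0 , f4) x y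
 wR′ x y = adjF (f3 , f1 , f0) x y + adjF (f0 , f2 , f4) x y

 -- A finite table, decided by evaluation: five labels of the quadrilateral and one further position
 -- that represents all other labels.
 checkL : ∀ x y → wL′ x y ≡ mutB wL zero x y
 checkL = from-yes (FinP.all? λ x → FinP.all? λ y → wL′ x y ℤ.≟ mutB wL zero x y)

 checkR : ∀ x y → wR′ x y ≡ mutB wR zero x y
 checkR = from-yes (FinP.all? λ x → FinP.all? λ y → wR′ x y ℤ.≟ mutB wR zero x y)

 -- Digon flips: positions 0, …, 3 are p, P and two sides; ζ identifies a radius with the loop around it.
 ζ : Fin 5 → Fin 5
 ζ f1 = f0
 ζ x = x

 wD wD′ wE wE′ : Fin 5 → Fin 5 → ℤ
 wD x y = adjF (f2 , f1 , f0) x y + adjF (f3 , f0 , f1) x y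
 wD′ x y = adjF (f3 , f2 , f0) (ζ x) (ζ y) + adjF (f0 , f1 , f1) (ζ x) (ζ y)
 wE x y = adjF (f2 , f3 , f0) (ζ x) (ζ y) + adjF (f0 , f1 , f1) (ζ x) (ζ y)
 wE′ x y = adjF (f3 , f1 , f0) x y + adjF (f2 , f0 , f1) x y

 checkD : ∀ x y → wD′ x y ≡ mutB wD zero x y
 checkD = from-yes (FinP.all? λ x → FinP.all? λ y → wD′ x y ℤ.≟ mutB wD zero x y)

 checkE : ∀ x y → wE′ x y ≡ mutB wE zero x y
 checkE = from-yes (FinP.all? λ x → FinP.all? λ y → wE′ x y ℤ.≟ mutB wE zero x y)

 δᶠ : ∀ {k} → Fin k → Fin k → ℕ
 δᶠ x y = if does (x Fin.≟ y) then 1 else 0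

 -- The positive and the negative entries in the column of the diagonal are the two pairs of
 -- opposite sides, which are the two products in the Ptolemy relation.
 columnL : ∀ x → (pos (wL x zero) ≡ δᶠ f2 x ℕ.+ δᶠ f4 x) × (pos (- wL x zero) ≡ δᶠ f1 x ℕ.+ δᶠ f3 x)
 columnL x = from-yes (FinP.all? λ x → pos (wL x zero) ℕ.≟ δᶠ f2 x ℕ.+ δᶠ f4 x) x , from-yes (FinP.all? λ x → pos (- wL x zero) ℕ.≟ δᶠ f1 x ℕ.+ δᶠ f3 x) x

 columnR : ∀ x → (pos (wR x zero) ≡ δᶠ f2 x ℕ.+ δᶠ f3 x) × (pos (- wR x zero) ≡ δᶠ f1 x ℕ.+ δᶠ f4 x)
 columnR x = from-yes (FinP.all? λ x → pos (wR x zero) ℕ.≟ δᶠ f2 x ℕ.+ δᶠ f3 x) x , from-yes (FinP.all? λ x → pos (- wR x zero) ℕ.≟ δᶠ f1 x ℕ.+ δᶠ f4 x) x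

 columnD : ∀ x → (pos (wD x zero) ≡ δᶠ f3 x) × (pos (- wD x zero) ≡ δᶠ f2 x)
 columnD x = from-yes (FinP.all? λ x → pos (wD x zero) ℕ.≟ δᶠ f3 x) x , from-yes (FinP.all? λ x → pos (- wD x zero) ℕ.≟ δᶠ f2 x) x

 columnE : ∀ x → (pos (wE x zero) ≡ δᶠ f3 x) × (pos (- wE x zero) ≡ δᶠ f2 x)
 columnE x = from-yes (FinP.all? λ x → pos (wE x zero) ℕ.≟ δᶠ f3 x) x , from-yes (FinP.all? λ x → pos (- wE x zero) ℕ.≟ δᶠ f2 x) x

 δ-idx : ∀ {m} (xs : List (Fin m)) → AllPairs.AllPairs _≢_ xs → ∀ k i → δᶠ (Fin.inject₁ k) (idx xs i) ≡ δᶠ (lookup xs k) i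
 δ-idx xs d k i with lookup xs k Fin.≟ i | Fin.inject₁ k Fin.≟ idx xs i
 ... | yes _ | yes _ = refl
 ... | no _ | no _ = refl
 ... | yes refl | no ne = ⊥-elim (ne (FinP.toℕ-injective (trans (FinP.toℕ-inject₁ k) (≡ᵇ⇒≡ (trans (sym (idx-spec xs d k (lookup xs k))) (≡ᵇ-refl (toℕ (lookup xs k))))))))
 ... | no ne | yes e = ⊥-elim (ne (FinP.toℕ-injective (≡ᵇ⇒≡ (trans (idx-spec xs d k i) (trans (cong (toℕ k ≡ᵇ_) (trans (cong toℕ (sym e)) (FinP.toℕ-inject₁ k))) (≡ᵇ-refl (toℕ k)))))))

-- Exchange matrices before and after a flip

module ExchangeMatrices where
 open IntegerInequalities
 open UniversalCover hiding (lt; gt; eq)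
 open IdealTriangulations
 open Crossings
 open TaggedTriangulations
 open Rotations
 open MatrixMutation
 open import Data.Bool using (if_then_else_)
 open import Data.Nat using (ℕ; zero; suc)
 open import Data.Integer using (ℤ; +_; _+_; _*_; -_; _≤_; _<_; 0ℤ; 1ℤ)
 open import Data.Integer.Properties hiding (_≟_)
 open import Data.Integer.Tactic.RingSolver using (solve-∀)
 open import Data.Fin using (Fin; _↑ˡ_)
 open import Data.List as List using (List; []; _∷_; lookup)
 import Data.List.Relation.Unary.All as All
 import Data.List.Relation.Unary.AllPairs as AllPairs

 distinct₅ : ∀ {A : Set} {a b c d e : A} → a ≢ b → a ≢ c → a ≢ d → a ≢ e → b ≢ c → b ≢ d → b ≢ e → c ≢ d → c ≢ e → d ≢ e →
   AllPairs.AllPairs _≢_ (a ∷ b ∷ c ∷ d ∷ e ∷ [])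
 distinct₅ ab ac ad ae bc bd be cd ce de = (ab All.∷ ac All.∷ ad All.∷ ae All.∷ All.[]) AllPairs.∷ (bc All.∷ bd All.∷ be All.∷ All.[])
   AllPairs.∷ (cd All.∷ ce All.∷ All.[]) AllPairs.∷ (de All.∷ All.[]) AllPairs.∷ All.[] AllPairs.∷ AllPairs.[]

 distinct₄ : ∀ {A : Set} {a b c d : A} → a ≢ b → a ≢ c → a ≢ d → b ≢ c → b ≢ d → c ≢ d → AllPairs.AllPairs _≢_ (a ∷ b ∷ c ∷ d ∷ [])
 distinct₄ ab ac ad bc bd cd = (ab All.∷ ac All.∷ ad All.∷ All.[]) AllPairs.∷ (bc All.∷ bd All.∷ All.[])
   AllPairs.∷ (cd All.∷ All.[]) AllPairs.∷ All.[] AllPairs.∷ AllPairs.[]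

 -- The radius inside a loop is identified with the loop.
 fold : ∀ {n r} {T : Fin r → TArc} → Kind T → Fin (r ℕ.+ n) → Fin (r ℕ.+ n)
 fold (one _ _) ℓ = ℓ
 fold {n} (two _ _ pρ pλ _ _) ℓ = if does ((pρ ↑ˡ n) Fin.≟ ℓ) then pλ ↑ˡ n else ℓ

 fold-ρ : ∀ {n r} {T : Fin r → TArc} {i σ pρ pλ} (eρ : T pρ ≡ trad i σ) (eλ : T pλ ≡ trad i (opp σ)) →
   fold {n} {T = T} (two i σ pρ pλ eρ eλ) (pρ ↑ˡ n) ≡ pλ ↑ˡ n
 fold-ρ {n} {pρ = pρ} {pλ} eρ eλ = cong (λ b → if b then pλ ↑ˡ n else (pρ ↑ˡ n)) (dec-true ((pρ ↑ˡ n) Fin.≟ (pρ ↑ˡ n)) refl)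

 fold-≢ : ∀ {n r} {T : Fin r → TArc} {i σ pρ pλ} (eρ : T pρ ≡ trad i σ) (eλ : T pλ ≡ trad i (opp σ)) {ℓ} → ℓ ≢ pρ ↑ˡ n →
   fold {n} {T = T} (two i σ pρ pλ eρ eλ) ℓ ≡ ℓ
 fold-≢ {n} {pρ = pρ} {pλ} eρ eλ {ℓ} ne = cong (λ b → if b then pλ ↑ˡ n else ℓ) (dec-false ((pρ ↑ˡ n) Fin.≟ ℓ) λ e → ne (sym e))

 module Quiver (n : ℕ) (2≤n : 2 ℕ.≤ n) {r : ℕ} {T : Fin r → TArc} (FT : Triang n T) (K : Kind T) where
   open TaggedTriangulation n 2≤n FT public using (O; ideal; idealOf-λ; idealOf-real; λ≢ρ; pair-radius; und-loop)
   open Sides n 2≤n (ideal K) public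
   open Cover n 2≤n

   sides : Fin r → Triple (r ℕ.+ n)
   sides q = L₁ q , L₂ q , q ↑ˡ n

   term : Label → Label → Fin r → ℤ
   term i j q = adjF (sides q) (fold K i) (fold K j)

   -- Each triangle is counted at its long side. The self-folded triangle is counted too but adds
   -- zero, because `fold` never yields the radius that forms two of its sides.
   Bg : Label → Label → ℤ
   Bg i j = Sum (term i j)

 -- In the cover the triangle below the radius at `i` has the vertices `i`, `i + n` and the
 -- puncture; its side at `i + n` is a lift of the same radius.
 self-folded : ∀ (n : ℕ) (2≤n : 2 ℕ.≤ n) {r : ℕ} {T : Fin r → TArc} (FT : Triang n T) {i σ pρ pλ} (eρ : T pρ ≡ trad i σ) (eλ : T pλ ≡ trad i (opp σ)) →
   let module Q = Quiver n 2≤n FT (two i σ pρ pλ eρ eλ) in Q.L₁ pρ ≡ pλ ↑ˡ n × Q.L₂ pρ ≡ pρ ↑ˡ n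
 self-folded n 2≤n FT {i} {σ} {pρ} {pλ} eρ eλ = Q.L-unique pρ (Q.mkTri i<i+n tt (pλ ↑ˡ n , onλ) (pρ ↑ˡ n , onρ′) (pρ ↑ˡ n , onρ)) refl
   where
   K = two i σ pρ pλ eρ eλ
   module Q = Quiver n 2≤n FT K
   open Cover n 2≤n
   Oλ : Q.O K (pλ ↑ˡ n) ≡ iv i n
   Oλ = trans (labelArc-arc n _ pλ) (Q.idealOf-λ eρ eλ)
   Oρ : Q.O K (pρ ↑ˡ n) ≡ rad i
   Oρ = trans (labelArc-arc n _ pρ) (trans (Q.idealOf-real eρ eλ (Q.λ≢ρ eρ eλ)) (cong und eρ))
   ar : ∀ i N → i + N ≡ i + 1ℤ * N
   ar = solve-∀
   onλ : On (Q.O K (pλ ↑ˡ n)) (+ i) (fin (+ i + N))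
   onλ = subst (λ y → On y (+ i) (fin (+ i + N))) (sym Oλ) (on-iv 0ℤ (sym (+-identityʳ (+ i))) refl)
   onρ : On (Q.O K (pρ ↑ˡ n)) (+ i) ∞
   onρ = subst (λ y → On y (+ i) ∞) (sym Oρ) (on-rad 0ℤ (sym (+-identityʳ (+ i))))
   onρ′ : On (Q.O K (pρ ↑ˡ n)) (+ i + N) ∞
   onρ′ = subst (λ y → On y (+ i + N) ∞) (sym Oρ) (on-rad 1ℤ (ar (+ i) N))
   i<i+n : + i < + i + N
   i<i+n = Q.arc-≺ (pλ ↑ˡ n , onλ)

 record Matching : Set where
   constructor matching
   field
     n : ℕ
     2≤n : 2 ℕ.≤ n
     {r} : ℕ
     {T T′} : Fin r → TArc
     FT : Triang n T
     FT′ : Triang n T′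
     p : Fin r
     K : Kind T
     K′ : Kind T′
     agree : ∀ ℓ → ℓ ≢ p ↑ˡ n → TaggedTriangulation.O n 2≤n FT′ K′ ℓ ≡ TaggedTriangulation.O n 2≤n FT K ℓ
     differ : TaggedTriangulation.O n 2≤n FT′ K′ (p ↑ˡ n) ≢ TaggedTriangulation.O n 2≤n FT K (p ↑ˡ n)

 module MatchedFlip (Ω : Matching) where
   open Matching Ω


   open Cover n 2≤n
   module Q = Quiver n 2≤n FT K
   module Q′ = Quiver n 2≤n FT′ K′
   open Flip (flip-ideals n 2≤n (Q.ideal K) (Q′.ideal K′) p agree differ) public
   open Q using (L₁; L₂; term; Bg; Label)
   open FlipShape rotation public
   open RotL using (new)

   pˡ Pˡ : Label
   pˡ = p ↑ˡ n
   Pˡ = P ↑ˡ n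

   p≢P : p ≢ P
   p≢P e = P≢p (sym e)

   pˡ≢Pˡ : pˡ ≢ Pˡ
   pˡ≢Pˡ e = p≢P (Q.↑-inj e)

   rest : Label → Label → ℤ
   rest i j = Sum (except P (except p (term i j)))

   sum-parts : ∀ i j → Bg i j ≡ rest i j + (term i j p + term i j P)
   sum-parts i j = Sum-except₂ (term i j) P≢p

   -- p is a side of no triangle other than those at p and P.
   rest-p : ∀ i j → fold K j ≡ pˡ → rest i j ≡ 0ℤ
   rest-p i j e = Sum-0 λ q → case q (P Fin.≟ q) (p Fin.≟ q)
     where
     case : ∀ q → Dec (P ≡ q) → Dec (p ≡ q) → except P (except p (term i j)) q ≡ 0ℤ
     case q (yes refl) _ = except-≡ P (except p (term i j))
     case q (no nP) (yes refl) = trans (except-≢ (except p (term i j)) λ x → nP (sym x)) (except-≡ p (term i j))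
     case q (no nP) (no np) = trans (except-≢ (except p (term i j)) λ x → nP (sym x)) (trans (except-≢ (term i j) λ x → np (sym x))
       (subst (λ z → adjF (Q.sides q) (fold K i) z ≡ 0ℤ) (sym e) (adjF-zeroʳ {x = L₁ q} {L₂ q} {q ↑ˡ n} (fold K i) (only₁ q λ x → nP (sym x)) (only₂ q λ x → nP (sym x)) λ x → np (sym (Q.↑-inj x)))))

   p-rest : ∀ i j → fold K i ≡ pˡ → rest i j ≡ 0ℤ
   p-rest i j e = Sum-0 λ q → case q (P Fin.≟ q) (p Fin.≟ q)
     where
     case : ∀ q → Dec (P ≡ q) → Dec (p ≡ q) → except P (except p (term i j)) q ≡ 0ℤ
     case q (yes refl) _ = except-≡ P (except p (term i j))
     case q (no nP) (yes refl) = trans (except-≢ (except p (term i j)) λ x → nP (sym x)) (except-≡ p (term i j))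
     case q (no nP) (no np) = trans (except-≢ (except p (term i j)) λ x → nP (sym x)) (trans (except-≢ (term i j) λ x → np (sym x))
       (subst (λ z → adjF (Q.sides q) z (fold K j) ≡ 0ℤ) (sym e) (adjF-zeroˡ {x = L₁ q} {L₂ q} {q ↑ˡ n} (fold K j) (only₁ q λ x → nP (sym x)) (only₂ q λ x → nP (sym x)) λ x → np (sym (Q.↑-inj x)))))

   rest-same : ∀ i j → (∀ q → q ≢ p → q ≢ P → adjF (Q.sides q) (fold K′ i) (fold K′ j) ≡ term i j q) →
     Sum (except P (except p (Q′.term i j))) ≡ rest i j
   rest-same i j h = Sum-cong λ q → case q (P Fin.≟ q) (p Fin.≟ q)
     where
     case : ∀ q → Dec (P ≡ q) → Dec (p ≡ q) → except P (except p (Q′.term i j)) q ≡ except P (except p (term i j)) q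
     case q (yes refl) _ = trans (except-≡ P (except p (Q′.term i j))) (sym (except-≡ P (except p (term i j))))
     case q (no nP) (yes refl) = trans (except-≢ (except p (Q′.term i j)) nP′) (trans (except-≡ p (Q′.term i j)) (sym (trans (except-≢ (except p (term i j)) nP′) (except-≡ p (term i j)))))
       where
       nP′ : p ≢ P
       nP′ x = nP (sym x)
     case q (no nP) (no np) = trans (out (Q′.term i j)) (trans (trans (cong₂ (λ a b → adjF (a , b , q ↑ˡ n) (fold K′ i) (fold K′ j)) (proj₁ ot) (proj₂ ot)) (h q np′ nP′)) (sym (out (term i j))))
       where
       nP′ : q ≢ P
       nP′ x = nP (sym x)
       np′ : q ≢ p
       np′ x = np (sym x)
       ot = others q np′ nP′
       out : ∀ f → except P (except p f) q ≡ f q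
       out f = trans (except-≢ (except p f) nP′) (except-≢ f np′)

   sum-parts′ : ∀ i j → Q′.Bg i j ≡ Sum (except P (except p (Q′.term i j))) + (Q′.term i j p + Q′.term i j P)
   sum-parts′ i j = Sum-except₂ (Q′.term i j) P≢p

   -- `g` chooses the labels whose positions are compared: `fold K` if no loop appears or
   -- disappears, and the identity if one does, where the identification is built into `w` or `w′`
   -- by `ζ`.
   module AtPositions (g : Label → Label) (g-p : g pˡ ≡ pˡ) (g-p⁻ : ∀ {i} → g i ≡ pˡ → i ≡ pˡ) (fold-p : fold K pˡ ≡ pˡ)
     (ys : List Label) (w w′ : Fin (suc (List.length (pˡ ∷ ys))) → Fin (suc (List.length (pˡ ∷ ys))) → ℤ)
     (check₀ : ∀ x y → w′ x y ≡ mutB w Fin.zero x y)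
     (terms : ∀ i j → term i j p + term i j P ≡ w (idx (pˡ ∷ ys) (g i)) (idx (pˡ ∷ ys) (g j)))
     (terms′ : ∀ i j → Q′.term i j p + Q′.term i j P ≡ w′ (idx (pˡ ∷ ys) (g i)) (idx (pˡ ∷ ys) (g j)))
     (same : ∀ i j q → q ≢ p → q ≢ P → adjF (Q.sides q) (fold K′ i) (fold K′ j) ≡ term i j q) where

     κ : Label → Fin (suc (List.length (pˡ ∷ ys)))
     κ i = idx (pˡ ∷ ys) (g i)

     κ-zero : κ pˡ ≡ Fin.zero
     κ-zero rewrite g-p | dec-true (pˡ Fin.≟ pˡ) refl = refl

     private
       κ-p : ∀ i → does (i Fin.≟ pˡ) ≡ does (κ i Fin.≟ κ pˡ)
       κ-p i = trans (same-does (i Fin.≟ pˡ) (g i Fin.≟ pˡ)) (trans (idx-p pˡ ys (g i)) (cong (λ z → does (idx (pˡ ∷ ys) (g i) Fin.≟ idx (pˡ ∷ ys) z)) (sym g-p)))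
         where
         same-does : Dec (i ≡ pˡ) → Dec (g i ≡ pˡ) → does (i Fin.≟ pˡ) ≡ does (g i Fin.≟ pˡ)
         same-does (yes refl) _ = trans (dec-true (i Fin.≟ i) refl) (sym (dec-true (g i Fin.≟ i) g-p))
         same-does (no ne) _ = trans (dec-false (i Fin.≟ pˡ) ne) (sym (dec-false (g i Fin.≟ pˡ) λ e → ne (g-p⁻ e)))

       module LM = LocalMutation κ pˡ κ-p rest (λ i → rest-p i pˡ fold-p) (λ j → p-rest pˡ j fold-p) w w′
         (λ x y → trans (check₀ x y) (cong (λ z → mutB w z x y) (sym κ-zero))) Bg Q′.Bg
         (λ i j → trans (sum-parts i j) (cong (λ z → rest i j + z) (terms i j)))
         (λ i j → trans (sum-parts′ i j) (cong₂ _+_ (rest-same i j (same i j)) (terms′ i j)))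

     mutation : ∀ i j → Q′.Bg i j ≡ mutB Bg pˡ i j
     mutation = LM.local

     column : ∀ i → Bg i pˡ ≡ w (κ i) Fin.zero
     column i = trans (LM.B-col i) (cong (w (κ i)) κ-zero)

   -- Flips in which no loop appears or disappears.
   module Generic (fold-same : ∀ ℓ → fold K′ ℓ ≡ fold {n} K ℓ) (fold-p : fold K pˡ ≡ pˡ) (fold-p⁻ : ∀ {i} → fold K i ≡ pˡ → i ≡ pˡ)
     (no-loop : ∀ u → ¬ On (Q.O K pˡ) u (fin (u + N))) (no-loop′ : ∀ u → ¬ On p′ u (fin (u + N))) where

     private
       same : ∀ i j q → q ≢ p → q ≢ P → adjF (Q.sides q) (fold K′ i) (fold K′ j) ≡ term i j q
       same i j q _ _ = cong₂ (adjF (Q.sides q)) (fold-same i) (fold-same j)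

     module CaseL (R : RotL P) where
       open RotL R
       xs : List Label
       xs = pˡ ∷ L₁ p ∷ L₂ p ∷ L₂ P ∷ Pˡ ∷ []
       dist : AllPairs.AllPairs _≢_ xs
       dist = distinct₅ (λ e → only₁ p p≢P (sym e)) (λ e → only₂ p p≢P (sym e)) (λ e → Q.L₁≢L₂ {P} {P} (trans p∈P e)) pˡ≢Pˡ
         (Q.L₁≢L₂ {p} {p}) (Q.L₁≢L₂ {p} {P}) (λ e → nested-≢ (Q.Tri.a₁ Δ) (Q.Tri.a₃ Γ) ≤-refl (≺-trans {fin b} {fin c} {d} (Q.Tri.u≺f Δ) (Q.Tri.u≺f Γ)) (trans e₁ (trans e (sym f₃))))
         (λ e → p≢P (Q.L₂-inj e)) (λ e → nested-≢ (Q.Tri.a₂ Δ) (Q.Tri.a₃ Γ) (<⇒≤ (Q.Tri.e<u Δ)) (Q.Tri.u≺f Γ) (trans e₂ (trans e (sym f₃))))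
         (λ e → last d Γ (trans f₂ (trans e (sym f₃))))
         where
         last : ∀ d (Γ : Q.Tri a c d) → Q.lab (Q.Tri.a₂ Γ) ≢ Q.lab (Q.Tri.a₃ Γ)
         last (fin d) Γ e = nested-≢′ (Q.Tri.a₂ Γ) (Q.Tri.a₃ Γ) (Q.Tri.e<u Γ) ≤-refl e
         -- Equal labels would make `P` the radius inside the loop `p`; such digons are treated
         -- separately.
         last ∞ Γ e = no-loop a (subst (λ z → On (Q.O K pˡ) a (fin z)) (wrap-around (Q.Tri.a₃ Γ) (Q.Tri.a₂ Γ) (sym e) (Q.Tri.e<u Γ) (Q.arc-len (Q.Tri.a₃ Δ)))
           (subst (λ ℓ → On (Q.O K ℓ) a (fin c)) e₃ (proj₂ (Q.Tri.a₃ Δ))))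

       terms : ∀ i j → term i j p + term i j P ≡ wL (idx xs (fold K i)) (idx xs (fold K j))
       terms i j = cong₂ _+_ (adjF-idx xs dist f1 f2 f0 (fold K i) (fold K j))
         (trans (cong (λ z → adjF (z , L₂ P , Pˡ) (fold K i) (fold K j)) p∈P) (adjF-idx xs dist f0 f3 f4 (fold K i) (fold K j)))

       terms′ : ∀ i j → Q′.term i j p + Q′.term i j P ≡ wL′ (idx xs (fold K i)) (idx xs (fold K j))
       terms′ i j = trans (cong₂ _+_ (cong₂ (adjF (Q′.sides p)) (fold-same i) (fold-same j)) (cong₂ (adjF (Q′.sides P)) (fold-same i) (fold-same j)))
         (cong₂ _+_ (trans (cong₂ (λ x y → adjF (x , y , pˡ) (fold K i) (fold K j)) p₁ p₂) (adjF-idx xs dist f2 f3 f0 (fold K i) (fold K j)))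
           (trans (cong₂ (λ x y → adjF (x , y , Pˡ) (fold K i) (fold K j)) P₁ P₂) (adjF-idx xs dist f1 f0 f4 (fold K i) (fold K j))))

       open AtPositions (fold K) fold-p fold-p⁻ fold-p (L₁ p ∷ L₂ p ∷ L₂ P ∷ Pˡ ∷ []) wL wL′ checkL terms terms′ same public

       pos-col : ∀ i → pos (Bg i pˡ) ≡ δᶠ (L₂ p) (fold K i) ℕ.+ δᶠ Pˡ (fold K i)
       pos-col i = trans (cong pos (column i)) (trans (proj₁ (columnL (κ i))) (cong₂ ℕ._+_ (δ-idx xs dist f2 (fold K i)) (δ-idx xs dist f4 (fold K i))))

       neg-col : ∀ i → pos (- Bg i pˡ) ≡ δᶠ (L₁ p) (fold K i) ℕ.+ δᶠ (L₂ P) (fold K i)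
       neg-col i = trans (cong (λ z → pos (- z)) (column i)) (trans (proj₂ (columnL (κ i))) (cong₂ ℕ._+_ (δ-idx xs dist f1 (fold K i)) (δ-idx xs dist f3 (fold K i))))

     module CaseR (R : RotR P) where
       open RotR R
       xs : List Label
       xs = pˡ ∷ L₁ p ∷ L₂ p ∷ L₁ P ∷ Pˡ ∷ []
       dist : AllPairs.AllPairs _≢_ xs
       dist = distinct₅ (λ e → only₁ p p≢P (sym e)) (λ e → only₂ p p≢P (sym e)) (λ e → Q.L₁≢L₂ {P} {P} (sym (trans p∈P e))) pˡ≢Pˡ
         (Q.L₁≢L₂ {p} {p}) (λ e → p≢P (Q.L₁-inj e)) (λ e → nested-≢ (Q.Tri.a₁ Δ) (Q.Tri.a₃ Γ) (<⇒≤ (Q.Tri.e<u Γ)) (Q.Tri.u≺f Δ) (trans e₁ (trans e (sym f₃))))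
         (λ e → Q.L₁≢L₂ {P} {p} (sym e)) (λ e → last c Δ Γ (trans e₂ (trans e (sym f₃))))
         (λ e → nested-≢ (Q.Tri.a₁ Γ) (Q.Tri.a₃ Γ) ≤-refl (Q.Tri.u≺f Γ) (trans f₁ (trans e (sym f₃))))
         where
         last : ∀ c (Δ : Q.Tri a b c) (Γ : Q.Tri d a c) → Q.lab (Q.Tri.a₂ Δ) ≢ Q.lab (Q.Tri.a₃ Γ)
         last (fin c) Δ Γ e = nested-≢′ (Q.Tri.a₂ Δ) (Q.Tri.a₃ Γ) (<-trans (Q.Tri.e<u Γ) (Q.Tri.e<u Δ)) ≤-refl e
         last ∞ Δ Γ e = no-loop′ d (subst (λ z → On p′ d (fin z)) (wrap-around (Q.Tri.a₃ Γ) (Q.Tri.a₂ Δ) (sym e) (<-trans (Q.Tri.e<u Γ) (Q.Tri.e<u Δ)) b≤d+N) (RotR.new R))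

       terms : ∀ i j → term i j p + term i j P ≡ wR (idx xs (fold K i)) (idx xs (fold K j))
       terms i j = cong₂ _+_ (adjF-idx xs dist f1 f2 f0 (fold K i) (fold K j))
         (trans (cong (λ z → adjF (L₁ P , z , Pˡ) (fold K i) (fold K j)) p∈P) (adjF-idx xs dist f3 f0 f4 (fold K i) (fold K j)))

       terms′ : ∀ i j → Q′.term i j p + Q′.term i j P ≡ wR′ (idx xs (fold K i)) (idx xs (fold K j))
       terms′ i j = trans (cong₂ _+_ (cong₂ (adjF (Q′.sides p)) (fold-same i) (fold-same j)) (cong₂ (adjF (Q′.sides P)) (fold-same i) (fold-same j)))
         (cong₂ _+_ (trans (cong₂ (λ x y → adjF (x , y , pˡ) (fold K i) (fold K j)) p₁ p₂) (adjF-idx xs dist f3 f1 f0 (fold K i) (fold K j)))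
           (trans (cong₂ (λ x y → adjF (x , y , Pˡ) (fold K i) (fold K j)) P₁ P₂) (adjF-idx xs dist f0 f2 f4 (fold K i) (fold K j))))

       open AtPositions (fold K) fold-p fold-p⁻ fold-p (L₁ p ∷ L₂ p ∷ L₁ P ∷ Pˡ ∷ []) wR wR′ checkR terms terms′ same public

       pos-col : ∀ i → pos (Bg i pˡ) ≡ δᶠ (L₂ p) (fold K i) ℕ.+ δᶠ (L₁ P) (fold K i)
       pos-col i = trans (cong pos (column i)) (trans (proj₁ (columnR (κ i))) (cong₂ ℕ._+_ (δ-idx xs dist f2 (fold K i)) (δ-idx xs dist f3 (fold K i))))

       neg-col : ∀ i → pos (- Bg i pˡ) ≡ δᶠ (L₁ p) (fold K i) ℕ.+ δᶠ Pˡ (fold K i)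
       neg-col i = trans (cong (λ z → pos (- z)) (column i)) (trans (proj₂ (columnR (κ i))) (cong₂ ℕ._+_ (δ-idx xs dist f1 (fold K i)) (δ-idx xs dist f4 (fold K i))))

 ζ-idx : ∀ {m} (a b : Fin m) (x y : Fin m) (f : Fin m → Fin m) → a ≢ b → f b ≡ a → (∀ {i} → i ≢ b → f i ≡ i) →
   ∀ i → idx (a ∷ b ∷ x ∷ y ∷ []) (f i) ≡ ζ (idx (a ∷ b ∷ x ∷ y ∷ []) i)
 ζ-idx a b x y f ne fb fi i with b Fin.≟ i
 ... | yes refl rewrite fb | dec-true (a Fin.≟ a) refl | dec-false (a Fin.≟ b) ne = refl
 ... | no nb rewrite fi {i} (λ e → nb (sym e)) with a Fin.≟ i
 ...   | yes _ = refl
 ...   | no _ rewrite dec-false (b Fin.≟ i) nb = refl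

 adjF-fold : ∀ {m} {s₁ s₂ s₃ a b : Fin m} (f : Fin m → Fin m) → f b ≡ a → (∀ {i} → i ≢ b → f i ≡ i) →
   s₁ ≢ a → s₂ ≢ a → s₃ ≢ a → s₁ ≢ b → s₂ ≢ b → s₃ ≢ b → ∀ i j → adjF (s₁ , s₂ , s₃) (f i) (f j) ≡ adjF (s₁ , s₂ , s₃) i j
 adjF-fold {s₁ = s₁} {s₂} {s₃} {a} {b} f fb fi a₁ a₂ a₃ b₁ b₂ b₃ i j =
   adj-cong {code s₁} {code s₂} {code s₃} {code s₁} {code s₂} {code s₃} {code (f i)} {code (f j)} {code i} {code j}
     (e a₁ b₁ i) (e a₂ b₂ i) (e a₃ b₃ i) (e a₁ b₁ j) (e a₂ b₂ j) (e a₃ b₃ j)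
   where
   e : ∀ {s} → s ≢ a → s ≢ b → ∀ i → oEq (code s) (code (f i)) ≡ oEq (code s) (code i)
   e {s} na nb i with i Fin.≟ b
   ... | yes refl = trans (cong (λ z → oEq (code s) (code z)) fb) (trans (oEq-code-≢ na) (sym (oEq-code-≢ nb)))
   ... | no ne = cong (λ z → oEq (code s) (code z)) (fi ne)

 record Appearance : Set where
   constructor appearance
   field
     n : ℕ
     2≤n : 2 ℕ.≤ n
     {r} : ℕ
     {T T′} : Fin r → TArc
     FT : Triang n T
     FT′ : Triang n T′
     p : Fin r
     τ : Tag
     hτ : ∀ {q i t} → T q ≡ trad i t → t ≡ τ
     i₀ : ℕ
     σ : Tag
     pρ : Fin r
     eρ : T′ pρ ≡ trad i₀ σ
     eλ : T′ p ≡ trad i₀ (opp σ)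
     agree : ∀ ℓ → ℓ ≢ p ↑ˡ n → TaggedTriangulation.O n 2≤n FT′ (two i₀ σ pρ p eρ eλ) ℓ ≡ TaggedTriangulation.O n 2≤n FT (one τ hτ) ℓ
     differ : TaggedTriangulation.O n 2≤n FT′ (two i₀ σ pρ p eρ eλ) (p ↑ˡ n) ≢ TaggedTriangulation.O n 2≤n FT (one τ hτ) (p ↑ˡ n)

 module LoopAppears (Ω : Appearance) where
   open Appearance Ω


   open Cover n 2≤n
   open MatchedFlip (matching n 2≤n FT FT′ p (one τ hτ) (two i₀ σ pρ p eρ eλ) agree differ) public
   open Q using (L₁; L₂; term; Bg; Label)

   private
     p′-loop : p′ ≡ iv i₀ n
     p′-loop = trans (labelArc-arc n _ p) (Q′.idealOf-λ eρ eλ)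

     is-loop : ∀ {u v} → On p′ u v → (∃ λ t → u ≡ + i₀ + t * N) × v ≡ fin (u + N)
     is-loop on with p′ | p′-loop | on
     ... | _ | refl | on-iv t e refl = (t , e) , refl

   -- After a left rotation the new arc `[b , d]` lies properly inside an arc `[a , d]` of length at
   -- most `n` if `d` is finite, and is a radius otherwise; it is never a loop.
   rotR : RotR P
   rotR with rot
   ... | inj₂ R = R
   ... | inj₁ R = ⊥-elim (go (RotL.d R) (RotL.Γ R) (proj₂ (is-loop (RotL.new R))))
     where
     go : ∀ d → Q.Tri (RotL.a R) (RotL.c R) d → d ≡ fin (RotL.b R + N) → ⊥
     go (fin d) Γ refl = <⇒≱ (+-monoˡ-< N (Q.Tri.e<u (RotL.Δ R))) (Q.arc-len (Q.Tri.a₃ Γ))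

   open RotR rotR

   b≡d+N : b ≡ d + N
   b≡d+N = fin-injective (proj₂ (is-loop new))

   c≡∞ : c ≡ ∞
   c≡∞ = go c (Q.Tri.u≺f Δ) (Q.Tri.a₃ Γ)
     where
     go : ∀ c → fin b ≺ c → Q.Arc d c → c ≡ ∞
     go ∞ _ _ = refl
     go (fin c) h dc = ⊥-elim (<⇒≱ (subst (_< c) b≡d+N h) (Q.arc-len dc))

   d-i₀ : ∃ λ t → d ≡ + i₀ + t * N
   d-i₀ = proj₁ (is-loop new)

   P≡pρ : P ≡ pρ
   P≡pρ = Q.↑-inj (trans (sym f₃) (Q′.label-unique (proj₂ (move (Q.Tri.a₃ Γ) λ e → P≢p (Q.↑-inj (trans (sym f₃) e))))
     (subst (λ y → On y d c) (sym (trans (labelArc-arc n _ pρ) (trans (Q′.idealOf-real eρ eλ (Q′.λ≢ρ eρ eλ)) (cong und eρ)))) (subst (On (rad i₀) d) (sym c≡∞) (on-rad (proj₁ d-i₀) (proj₂ d-i₀))))))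

   -- The new loop runs from `d` to `b = d + N`, so the radii at these ends are lifts of one radius:
   -- the quadrilateral closes up to a digon around the puncture.
   L₂p : L₂ p ≡ Pˡ
   L₂p = trans (sym e₂) (trans (go c≡∞ (Q.Tri.a₂ Δ) (Q.Tri.a₃ Γ)) f₃)
     where
     go : ∀ {c} → c ≡ ∞ → (x : Q.Arc b c) (y : Q.Arc d c) → Q.lab x ≡ Q.lab y
     go refl x y = Q.label-unique (proj₂ x) (subst (λ z → On (Q.O (one τ hτ) (Q.lab y)) z ∞) (trans (cong (λ x → d + x) (*-identityˡ N)) (sym b≡d+N)) (on-shift 1ℤ (proj₂ y)))

   private
     xs : List Label
     xs = pˡ ∷ Pˡ ∷ L₁ p ∷ L₁ P ∷ []
     dist : AllPairs.AllPairs _≢_ xs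
     dist = distinct₄ pˡ≢Pˡ (λ e → only₁ p p≢P (sym e)) (λ e → Q.L₁≢L₂ {P} {P} (sym (trans p∈P e)))
       (λ e → Q.L₁≢L₂ {p} {p} (sym (trans L₂p e))) (λ e → Q.L₁≢L₂ {P} {p} (sym (trans L₂p e))) (λ e → p≢P (Q.L₁-inj e))

     f : Label → Label
     f = fold {n} {T = T′} (two i₀ σ pρ p eρ eλ)
     fP : f Pˡ ≡ pˡ
     fP = trans (cong (λ q → f (q ↑ˡ n)) P≡pρ) (fold-ρ {n} {T = T′} {pρ = pρ} eρ eλ)
     f≢ : ∀ {i} → i ≢ Pˡ → f i ≡ i
     f≢ ne = fold-≢ {n} {T = T′} {pρ = pρ} eρ eλ λ e → ne (trans e (cong (_↑ˡ n) (sym P≡pρ)))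

     terms : ∀ i j → term i j p + term i j P ≡ wD (idx xs i) (idx xs j)
     terms i j = cong₂ _+_ (trans (cong (λ z → adjF (L₁ p , z , pˡ) i j) L₂p) (adjF-idx xs dist f2 f1 f0 i j))
       (trans (cong (λ z → adjF (L₁ P , z , Pˡ) i j) p∈P) (adjF-idx xs dist f3 f0 f1 i j))

     terms′ : ∀ i j → Q′.term i j p + Q′.term i j P ≡ wD′ (idx xs i) (idx xs j)
     terms′ i j = cong₂ _+_ (trans (cong₂ (λ x y → adjF (x , y , pˡ) (f i) (f j)) p₁ p₂) (fz f3 f2 f0))
       (trans (cong₂ (λ x y → adjF (x , y , Pˡ) (f i) (f j)) P₁ (trans P₂ L₂p)) (fz f0 f1 f1))
       where
       fz : ∀ x y z → adjF (lookup xs x , lookup xs y , lookup xs z) (f i) (f j) ≡ adjF (Fin.inject₁ x , Fin.inject₁ y , Fin.inject₁ z) (ζ (idx xs i)) (ζ (idx xs j))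
       fz x y z = trans (adjF-idx xs dist x y z (f i) (f j)) (cong₂ (adjF (Fin.inject₁ x , Fin.inject₁ y , Fin.inject₁ z)) (ζ-idx pˡ Pˡ (L₁ p) (L₁ P) f pˡ≢Pˡ fP f≢ i) (ζ-idx pˡ Pˡ (L₁ p) (L₁ P) f pˡ≢Pˡ fP f≢ j))

     same : ∀ i j q → q ≢ p → q ≢ P → adjF (Q.sides q) (f i) (f j) ≡ term i j q
     same i j q np nP = adjF-fold {s₁ = L₁ q} {L₂ q} {q ↑ˡ n} f fP f≢ (only₁ q nP) (only₂ q nP) (λ e → np (Q.↑-inj e))
       (λ e → Q.L₁≢L₂ {q} {p} (trans e (sym L₂p))) (λ e → np (Q.L₂-inj (trans e (sym L₂p)))) (λ e → nP (Q.↑-inj e)) i j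

   open AtPositions (λ ℓ → ℓ) refl (λ e → e) refl (Pˡ ∷ L₁ p ∷ L₁ P ∷ []) wD wD′ checkD terms terms′ same public

   pos-col : ∀ i → pos (Bg i pˡ) ≡ δᶠ (L₁ P) i
   pos-col i = trans (cong pos (column i)) (trans (proj₁ (columnD (κ i))) (δ-idx xs dist f3 i))

   neg-col : ∀ i → pos (- Bg i pˡ) ≡ δᶠ (L₁ p) i
   neg-col i = trans (cong (λ z → pos (- z)) (column i)) (trans (proj₂ (columnD (κ i))) (δ-idx xs dist f2 i))

 record Disappearance : Set where
   constructor disappearance
   field
     n : ℕ
     2≤n : 2 ℕ.≤ n
     {r} : ℕ
     {T T′} : Fin r → TArc
     FT : Triang n T
     FT′ : Triang n T′
     p : Fin r
     i₀ : ℕ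
     σ : Tag
     pρ : Fin r
     eρ : T pρ ≡ trad i₀ σ
     eλ : T p ≡ trad i₀ (opp σ)
     τ : Tag
     hτ : ∀ {q i t} → T′ q ≡ trad i t → t ≡ τ
     agree : ∀ ℓ → ℓ ≢ p ↑ˡ n → TaggedTriangulation.O n 2≤n FT′ (one τ hτ) ℓ ≡ TaggedTriangulation.O n 2≤n FT (two i₀ σ pρ p eρ eλ) ℓ
     differ : TaggedTriangulation.O n 2≤n FT′ (one τ hτ) (p ↑ˡ n) ≢ TaggedTriangulation.O n 2≤n FT (two i₀ σ pρ p eρ eλ) (p ↑ˡ n)

 module LoopDisappears (Ω : Disappearance) where
   open Disappearance Ω


   open Cover n 2≤n
   open MatchedFlip (matching n 2≤n FT FT′ p (two i₀ σ pρ p eρ eλ) (one τ hτ) agree differ) public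
   open Q using (L₁; L₂; term; Bg; Label)

   private
     sf = self-folded n 2≤n FT eρ eλ

   -- The loop is the first side of the triangle below the radius that it encloses, and a label
   -- cannot be a first and a second side.
   rotL : RotL P
   rotL with rot
   ... | inj₁ R = R
   ... | inj₂ R = ⊥-elim (Q.L₁≢L₂ {pρ} {P} (trans (proj₁ sf) (sym (RotR.p∈P R))))

   open RotL rotL

   P≡pρ : P ≡ pρ
   P≡pρ = Q.L₁-inj (trans p∈P (sym (proj₁ sf)))

   L₂P : L₂ P ≡ Pˡ
   L₂P = trans (cong L₂ P≡pρ) (trans (proj₂ sf) (cong (_↑ˡ n) (sym P≡pρ)))

   private
     p-loop : Q.O (two i₀ σ pρ p eρ eλ) pˡ ≡ iv i₀ n
     p-loop = trans (labelArc-arc n _ p) (Q.idealOf-λ eρ eλ)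

     is-loop : ∀ {u v} → On (Q.O (two i₀ σ pρ p eρ eλ) pˡ) u (fin v) → (∃ λ t → u ≡ + i₀ + t * N) × v ≡ u + N
     is-loop on with Q.O (two i₀ σ pρ p eρ eλ) pˡ | p-loop | on
     ... | _ | refl | on-iv t e refl = (t , e) , refl

     on-p : On (Q.O (two i₀ σ pρ p eρ eλ) pˡ) a (fin c)
     on-p = subst (λ ℓ → On (Q.O (two i₀ σ pρ p eρ eλ) ℓ) a (fin c)) e₃ (proj₂ (Q.Tri.a₃ Δ))

   c≡a+N : c ≡ a + N
   c≡a+N = proj₂ (is-loop on-p)

   a-i₀ : ∃ λ t → a ≡ + i₀ + t * N
   a-i₀ = proj₁ (is-loop on-p)

   d≡∞ : d ≡ ∞
   d≡∞ = go d (Q.Tri.u≺f Γ) (Q.Tri.a₃ Γ)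
     where
     go : ∀ d → fin c ≺ d → Q.Arc a d → d ≡ ∞
     go ∞ _ _ = refl
     go (fin d) h ad = ⊥-elim (<⇒≱ (subst (_< d) c≡a+N h) (Q.arc-len ad))

   private
     xs : List Label
     xs = pˡ ∷ Pˡ ∷ L₁ p ∷ L₂ p ∷ []
     dist : AllPairs.AllPairs _≢_ xs
     dist = distinct₄ pˡ≢Pˡ (λ e → only₁ p p≢P (sym e)) (λ e → only₂ p p≢P (sym e))
       (λ e → Q.L₁≢L₂ {p} {P} (sym (trans L₂P e))) (λ e → P≢p (Q.L₂-inj (trans L₂P e))) (Q.L₁≢L₂ {p} {p})

     f : Label → Label
     f = fold {n} {T = T} (two i₀ σ pρ p eρ eλ)
     fP : f Pˡ ≡ pˡ
     fP = trans (cong (λ q → f (q ↑ˡ n)) P≡pρ) (fold-ρ {n} {T = T} {pρ = pρ} eρ eλ)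
     f≢ : ∀ {i} → i ≢ Pˡ → f i ≡ i
     f≢ ne = fold-≢ {n} {T = T} {pρ = pρ} eρ eλ λ e → ne (trans e (cong (_↑ˡ n) (sym P≡pρ)))

     terms : ∀ i j → term i j p + term i j P ≡ wE (idx xs i) (idx xs j)
     terms i j = cong₂ _+_ (fz f2 f3 f0) (trans (cong₂ (λ x y → adjF (x , y , Pˡ) (f i) (f j)) p∈P L₂P) (fz f0 f1 f1))
       where
       fz : ∀ x y z → adjF (lookup xs x , lookup xs y , lookup xs z) (f i) (f j) ≡ adjF (Fin.inject₁ x , Fin.inject₁ y , Fin.inject₁ z) (ζ (idx xs i)) (ζ (idx xs j))
       fz x y z = trans (adjF-idx xs dist x y z (f i) (f j)) (cong₂ (adjF (Fin.inject₁ x , Fin.inject₁ y , Fin.inject₁ z)) (ζ-idx pˡ Pˡ (L₁ p) (L₂ p) f pˡ≢Pˡ fP f≢ i) (ζ-idx pˡ Pˡ (L₁ p) (L₂ p) f pˡ≢Pˡ fP f≢ j))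

     terms′ : ∀ i j → Q′.term i j p + Q′.term i j P ≡ wE′ (idx xs i) (idx xs j)
     terms′ i j = cong₂ _+_ (trans (cong₂ (λ x y → adjF (x , y , pˡ) i j) p₁ (trans p₂ L₂P)) (adjF-idx xs dist f3 f1 f0 i j))
       (trans (cong₂ (λ x y → adjF (x , y , Pˡ) i j) P₁ P₂) (adjF-idx xs dist f2 f0 f1 i j))

     same : ∀ i j q → q ≢ p → q ≢ P → adjF (Q.sides q) i j ≡ term i j q
     same i j q np nP = sym (adjF-fold {s₁ = L₁ q} {L₂ q} {q ↑ˡ n} f fP f≢ (only₁ q nP) (only₂ q nP) (λ e → np (Q.↑-inj e))
       (λ e → Q.L₁≢L₂ {q} {P} (trans e (sym L₂P))) (λ e → nP (Q.L₂-inj (trans e (sym L₂P)))) (λ e → nP (Q.↑-inj e)) i j)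

   open AtPositions (λ ℓ → ℓ) refl (λ e → e) (f≢ pˡ≢Pˡ) (Pˡ ∷ L₁ p ∷ L₂ p ∷ []) wE wE′ checkE terms terms′ same public

   pos-col : ∀ i → pos (Bg i pˡ) ≡ δᶠ (L₂ p) i
   pos-col i = trans (cong pos (column i)) (trans (proj₁ (columnE (κ i))) (δ-idx xs dist f3 i))

   neg-col : ∀ i → pos (- Bg i pˡ) ≡ δᶠ (L₁ p) i
   neg-col i = trans (cong (λ z → pos (- z)) (column i)) (trans (proj₂ (columnE (κ i))) (δ-idx xs dist f2 i))

-- Values of unreduced fractions

module RationalExpressions where
 open LaurentPolynomials
 open LaurentNewtonPolytopes
 open RingIdentities
 open MatrixMutation using (δᶠ)
 open import Level using (0ℓ)
 open import Data.Nat using (ℕ; zero; suc)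
 open import Data.Fin using (Fin; zero; suc)
 open import Data.List using (map; foldr; allFin; tabulate)
 import Data.List.Properties as ListP

 module RingProducts (R : CommutativeRing 0ℓ 0ℓ) where
   open CommutativeRing R hiding (zero) renaming (refl to ≈-refl; sym to ≈-sym; trans to ≈-trans)
   open import Relation.Binary.Reasoning.Setoid setoid
   open import Algebra.Properties.CommutativeSemigroup *-commutativeSemigroup using (interchange)

   pow : Carrier → ℕ → Carrier
   pow x zero = 1#
   pow x (suc k) = x * pow x k

   pow-+ : ∀ x k l → pow x (k ℕ.+ l) ≈ pow x k * pow x l
   pow-+ x zero l = ≈-sym (*-identityˡ _)
   pow-+ x (suc k) l = ≈-trans (*-cong ≈-refl (pow-+ x k l)) (≈-sym (*-assoc x (pow x k) (pow x l)))

   Prod : ∀ {m} → (Fin m → Carrier) → (Fin m → ℕ) → Carrier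
   Prod {zero} v e = 1#
   Prod {suc m} v e = pow (v zero) (e zero) * Prod (λ i → v (suc i)) (λ i → e (suc i))

   Prod-cong : ∀ {m} (v : Fin m → Carrier) {e e′ : Fin m → ℕ} → (∀ i → e i ≡ e′ i) → Prod v e ≈ Prod v e′
   Prod-cong {zero} v h = ≈-refl
   Prod-cong {suc m} v h = *-cong (reflexive (cong (pow (v zero)) (h zero))) (Prod-cong (λ i → v (suc i)) (λ i → h (suc i)))

   Prod-+ : ∀ {m} (v : Fin m → Carrier) (e e′ : Fin m → ℕ) → Prod v (λ i → e i ℕ.+ e′ i) ≈ Prod v e * Prod v e′
   Prod-+ {zero} v e e′ = ≈-sym (*-identityˡ 1#)
   Prod-+ {suc m} v e e′ = ≈-trans (*-cong (pow-+ (v zero) (e zero) (e′ zero)) (Prod-+ (λ i → v (suc i)) (λ i → e (suc i)) (λ i → e′ (suc i)))) (interchange _ _ _ _)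

   Prod-0 : ∀ {m} (v : Fin m → Carrier) → Prod v (λ _ → 0) ≈ 1#
   Prod-0 {zero} v = ≈-refl
   Prod-0 {suc m} v = ≈-trans (*-identityˡ _) (Prod-0 λ i → v (suc i))

   Prod-δ : ∀ {m} (v : Fin m → Carrier) s → Prod v (δᶠ s) ≈ v s
   Prod-δ {suc m} v zero = ≈-trans (*-cong (*-identityʳ (v zero)) (Prod-0 λ i → v (suc i))) (*-identityʳ (v zero))
   Prod-δ {suc m} v (suc s) = ≈-trans (*-identityˡ _) (≈-trans (Prod-cong (λ i → v (suc i)) shift) (Prod-δ (λ i → v (suc i)) s))
     where
     shift : ∀ i → δᶠ (suc s) (suc i) ≡ δᶠ s i
     shift i with s Fin.≟ i
     ... | yes _ = refl
     ... | no _ = refl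

   frac-* : ∀ {n v d n′ v′ d′} → n ≈ v * d → n′ ≈ v′ * d′ → n * n′ ≈ (v * v′) * (d * d′)
   frac-* h h′ = ≈-trans (*-cong h h′) (interchange _ _ _ _)

   frac-+ : ∀ {n v d n′ v′ d′} → n ≈ v * d → n′ ≈ v′ * d′ → n * d′ + n′ * d ≈ (v + v′) * (d * d′)
   frac-+ {n} {v} {d} {n′} {v′} {d′} h h′ = begin
     n * d′ + n′ * d                  ≈⟨ +-cong (*-cong h ≈-refl) (*-cong h′ ≈-refl) ⟩
     v * d * d′ + v′ * d′ * d         ≈⟨ +-cong (*-assoc v d d′) (≈-trans (*-assoc v′ d′ d) (*-cong ≈-refl (*-comm d′ d))) ⟩
     v * (d * d′) + v′ * (d * d′)     ≈⟨ distribʳ (d * d′) v v′ ⟨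
     (v + v′) * (d * d′)              ∎

   frac-/ : ∀ {n v d n′ v′ d′ e} → n ≈ v * d → n′ ≈ v′ * d′ → v ≈ e * v′ → n * d′ ≈ e * (d * n′)
   frac-/ {n} {v} {d} {n′} {v′} {d′} {e} h h′ q = begin
     n * d′            ≈⟨ *-cong (≈-trans h (*-cong q ≈-refl)) ≈-refl ⟩
     e * v′ * d * d′   ≈⟨ *-cong (≈-trans (*-assoc e v′ d) (*-cong ≈-refl (*-comm v′ d))) ≈-refl ⟩
     e * (d * v′) * d′ ≈⟨ *-assoc e (d * v′) d′ ⟩
     e * (d * v′ * d′) ≈⟨ *-cong ≈-refl (*-assoc d v′ d′) ⟩
     e * (d * (v′ * d′)) ≈⟨ *-cong ≈-refl (*-cong ≈-refl h′) ⟨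
     e * (d * n′)      ∎

 module _ {m : ℕ} where
   open RingProducts (LRing m)

   -- Positivity is required of numerator and denominator because mutation inverts the old variable
   -- and exchanges the two. The quotient itself is not computed: `repr-/` receives it from an
   -- exchange relation.
   record Repr (F : Frac m) (v : LPoly m) : Set where
     constructor repr
     field
       frac : proj₁ F ≃ (v *L proj₂ F)
       num  : PosL (proj₁ F)
       den  : PosL (proj₂ F)

   repr-one : Repr fone oneL
   repr-one = repr (λ e → sym (*L-identityˡ oneL e)) (PosL-mono _) (PosL-mono _)

   repr-mono : ∀ e → Repr (mono e , oneL) (mono e)
   repr-mono e = repr (λ x → sym (CommutativeRing.*-identityʳ (LRing m) (mono e) x)) (PosL-mono e) (PosL-mono _)

   repr-≃ : ∀ {F v w} → v ≃ w → Repr F v → Repr F w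
   repr-≃ {F} {v} {w} h (repr f p q) = repr (≃-trans {P = proj₁ F} {v *L proj₂ F} {w *L proj₂ F} f (*L-cong {P = v} {w} {proj₂ F} {proj₂ F} h (≃-refl {P = proj₂ F}))) p q

   repr-* : ∀ {F G v w} → Repr F v → Repr G w → Repr (fmul F G) (v *L w)
   repr-* {F} {G} {v} {w} (repr f p q) (repr g p′ q′) = repr (frac-* {proj₁ F} {v} {proj₂ F} {proj₁ G} {w} {proj₂ G} f g)
     (PosL-* {P = proj₁ F} {proj₁ G} p p′) (PosL-* {P = proj₂ F} {proj₂ G} q q′)

   repr-+ : ∀ {F G v w} → Repr F v → Repr G w → Repr (fadd F G) (v +L w)
   repr-+ {F} {G} {v} {w} (repr f p q) (repr g p′ q′) = repr (frac-+ {proj₁ F} {v} {proj₂ F} {proj₁ G} {w} {proj₂ G} f g)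
     (PosL-+ {P = proj₁ F *L proj₂ G} {proj₁ G *L proj₂ F} (PosL-* {P = proj₁ F} {proj₂ G} p q′) (proj₁ (PosL-* {P = proj₁ G} {proj₂ F} p′ q))) (PosL-* {P = proj₂ F} {proj₂ G} q q′)

   repr-/ : ∀ {F G v w e} → Repr F v → Repr G w → v ≃ (e *L w) → Repr (fmul F (finv G)) e
   repr-/ {F} {G} {v} {w} {e} (repr f p q) (repr g p′ q′) h = repr (frac-/ {proj₁ F} {v} {proj₂ F} {proj₁ G} {w} {proj₂ G} {e} f g h)
     (PosL-* {P = proj₁ F} {proj₂ G} p q′) (PosL-* {P = proj₂ F} {proj₁ G} q p′)

   repr-pow : ∀ {F v} → Repr F v → ∀ k → Repr (fpow F k) (pow v k)
   repr-pow h zero = repr-one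
   repr-pow h (suc k) = repr-* h (repr-pow h k)

   repr-tab : ∀ {l} (Y : Fin l → Frac m) (v : Fin l → LPoly m) → (∀ i → Repr (Y i) (v i)) → ∀ e →
     Repr (foldr fmul fone (tabulate (λ i → fpow (Y i) (e i)))) (Prod v e)
   repr-tab {zero} Y v h e = repr-one
   repr-tab {suc l} Y v h e = repr-* (repr-pow (h zero) (e zero)) (repr-tab (λ i → Y (suc i)) (λ i → v (suc i)) (λ i → h (suc i)) (λ i → e (suc i)))

   repr-prod : ∀ {l} (Y : Fin l → Frac m) (v : Fin l → LPoly m) → (∀ i → Repr (Y i) (v i)) → ∀ e →
     Repr (foldr fmul fone (map (λ i → fpow (Y i) (e i)) (allFin l))) (Prod v e)
   repr-prod Y v h e = subst (λ z → Repr (foldr fmul fone z) (Prod v e)) (sym (ListP.map-tabulate (λ i → i) (λ i → fpow (Y i) (e i)))) (repr-tab Y v h e)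

-- Exchange relations between λ-lengths

module ArcValues where
 open IntegerInequalities
 open UniversalCover hiding (lt; gt; eq)
 open IdealTriangulations
 open Crossings
 open TaggedTriangulations
 open Rotations
 open MatrixMutation using (δᶠ; mutB)
 open ExchangeMatrices
 open RingIdentities
 open DecoratedVectors
 open RationalExpressions
 open import Level using (0ℓ)
 open import Data.Nat using (ℕ)
 open import Data.Integer using (ℤ; +_; _+_; _*_; -_; _≤_; 1ℤ)
 open import Data.Integer.Properties hiding (_≟_)
 open import Data.Integer.Tactic.RingSolver using (solve-∀)
 open import Data.Fin using (Fin; _↑ˡ_; toℕ; splitAt)

 -- `κ τ` scales the vector at the puncture for radii tagged `τ`. Condition `κκ` expresses that the
 -- horocycles of the two tags are conjugate.
 record Setup : Set₁ where
   constructor setup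
   field
     n     : ℕ
     2≤n   : 2 ℕ.≤ n
     {r}   : ℕ
     {O₀}  : Fin (r ℕ.+ n) → OArc
     I₀    : Triangulation.Ideal n 2≤n r O₀
     R     : CommutativeRing 0ℓ 0ℓ
     hom   : IntHom R
     M M⁻  : Fin (r ℕ.+ n) → CommutativeRing.Carrier R
     M-inv : ∀ ℓ → CommutativeRing._≈_ R (CommutativeRing._*_ R (M ℓ) (M⁻ ℓ)) (CommutativeRing.1# R)
     κ     : Tag → CommutativeRing.Carrier R
     κκ    : ∀ τ → CommutativeRing._≈_ R (CommutativeRing._*_ R (κ τ) (κ (opp τ))) (LambdaLengths.c (lengths n 2≤n I₀ R hom M M⁻ M-inv))

 module ClusterValues (S : Setup) where
   open Setup S

   private
     lengthData : LengthData
     lengthData = lengths n 2≤n I₀ R hom M M⁻ M-inv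

   open Cover n 2≤n
   open CrossingNumber n 2≤n using (on-lo)
   private module R = CommutativeRing R
   open R using (Carrier; _≈_; 0#; 1#) renaming (_+_ to infixl 6 _⊹_; _*_ to infixl 7 _⋆_)
   open LambdaLengths lengthData renaming (c to cc)
   open RingProducts R
   open import Relation.Binary.Reasoning.Setoid R.setoid
   open import Algebra.Properties.CommutativeSemigroup R.*-commutativeSemigroup using (interchange)

   E : TArc → Carrier
   E (tiv i k) = P 1# (+ i) (fin (+ (i ℕ.+ k)))
   E (trad i t) = κ t ⋆ xV (+ i)

   Bd : Fin n → Carrier
   Bd s = P 1# (+ toℕ s) (fin (+ (toℕ s ℕ.+ 1)))

   V : (Fin r → TArc) → Fin (r ℕ.+ n) → Carrier
   V T ℓ = [ (λ q → E (T q)) , Bd ]′ (splitAt r ℓ)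

   V-arc : ∀ T q → V T (q ↑ˡ n) ≡ E (T q)
   V-arc T q = cong [ (λ q → E (T q)) , Bd ]′ (FinP.splitAt-↑ˡ r q n)

   κof : ∀ {T : Fin r → TArc} → Kind T → Carrier
   κof (one τ _) = κ τ
   κof (two _ σ _ _ _ _) = κ σ

   P-at : ∀ k {y u v} → On y u v → P k (lo y) (hi y) ≈ P k u v
   P-at k {y} on with on-lo on
   ... | t , refl , refl = R.sym (P-per k t (lo y) (hi y))

   xV-at : ∀ {i u} t → u ≡ + i + t * N → xV u ≈ xV (+ i)
   xV-at {i} t refl = begin
     xV (+ i + t * N)       ≈⟨ R.*-identityˡ _ ⟨
     1# ⋆ xV (+ i + t * N)  ≈⟨ P-∞ 1# _ ⟨
     P 1# (+ i + t * N) ∞   ≈⟨ P-per 1# t (+ i) ∞ ⟩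
     P 1# (+ i) ∞           ≈⟨ P-∞ 1# _ ⟩
     1# ⋆ xV (+ i)          ≈⟨ R.*-identityˡ _ ⟩
     xV (+ i)               ∎

   real-value : ∀ k y → (∀ {i t} → y ≡ trad i t → κ t ≡ k) → E y ≈ P k (lo (und y)) (hi (und y))
   real-value k (tiv i l) h = R.refl
   real-value k (trad i t) h = R.trans (R.*-cong (R.reflexive (h refl)) R.refl) (R.sym (P-∞ k (+ i)))

   bdry-value : ∀ k s → Bd s ≈ P k (lo (iv (toℕ s) 1)) (hi (iv (toℕ s) 1))
   bdry-value k s = R.refl

   -- The digon relation with both corners at `i`: one side is zero, the other is the loop, and the
   -- scales of the two tags multiply to `c`.
   loop-value : ∀ k i σ → E (trad i (opp σ)) ⋆ E (trad i σ) ≈ P k (lo (iv i n)) (hi (iv i n))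
   loop-value k i σ = begin
     (κ (opp σ) ⋆ x) ⋆ (κ σ ⋆ x)   ≈⟨ interchange _ _ _ _ ⟩
     (κ (opp σ) ⋆ κ σ) ⋆ (x ⋆ x)   ≈⟨ R.*-cong (R.trans (R.*-comm _ _) (κκ σ)) R.refl ⟩
     cc ⋆ (x ⋆ x)                   ≈⟨ R.*-assoc _ _ _ ⟨
     cc ⋆ x ⋆ x                     ≈⟨ P-digon k (+ i) (+ i) ⟨
     P k (+ i) (fin (+ i)) ⊹ P k (+ i) (fin (+ i + 1ℤ * N)) ≈⟨ R.+-cong (P-self k (+ i)) R.refl ⟩
     0# ⊹ P k (+ i) (fin (+ i + 1ℤ * N))  ≈⟨ R.+-identityˡ _ ⟩
     P k (+ i) (fin (+ i + 1ℤ * N))  ≡⟨ cong (λ z → P k (+ i) (fin (+ i + z))) (*-identityˡ N) ⟩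
     P k (+ i) (fin (+ (i ℕ.+ n)))   ∎
     where
     x = xV (+ i)

   module AtTriangulation {T : Fin r → TArc} (FT : Triang n T) where
     open TaggedTriangulation n 2≤n FT

     -- λ-lengths of the ideal arcs, as opposed to the values `V` of the tagged arcs. They differ at
     -- the label of the loop, which in `T` belongs to a radius.
     Val : Kind T → Fin (r ℕ.+ n) → Carrier
     Val (one _ _) ℓ = V T ℓ
     Val (two i σ pρ pλ _ _) ℓ with ℓ Fin.≟ (pλ ↑ˡ n)
     ... | yes _ = V T (pλ ↑ˡ n) ⋆ V T (pρ ↑ˡ n)
     ... | no _ = V T ℓ

     Val-λ : ∀ {i σ pρ pλ} (eρ : T pρ ≡ trad i σ) (eλ : T pλ ≡ trad i (opp σ)) → Val (two i σ pρ pλ eρ eλ) (pλ ↑ˡ n) ≡ V T (pλ ↑ˡ n) ⋆ V T (pρ ↑ˡ n)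
     Val-λ {pλ = pλ} eρ eλ with (pλ ↑ˡ n) Fin.≟ (pλ ↑ˡ n)
     ... | yes _ = refl
     ... | no ne = ⊥-elim (ne refl)

     Val-≢ : ∀ {i σ pρ pλ} (eρ : T pρ ≡ trad i σ) (eλ : T pλ ≡ trad i (opp σ)) {ℓ} → ℓ ≢ pλ ↑ˡ n → Val (two i σ pρ pλ eρ eλ) ℓ ≡ V T ℓ
     Val-≢ {pλ = pλ} eρ eλ {ℓ} ne with ℓ Fin.≟ (pλ ↑ˡ n)
     ... | yes e = ⊥-elim (ne e)
     ... | no _ = refl

     Plain : Kind T → Fin (r ℕ.+ n) → Set
     Plain (one _ _) ℓ = ⊤
     Plain (two i σ pρ pλ _ _) ℓ = ℓ ≢ pρ ↑ˡ n

     -- Both tagged radii fold to the loop, so an entry at the loop in the ideal picture occurs in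
     -- the rows of both; the product of their values is the loop. `Plain` excludes the radius
     -- inside it, a label that `fold` never takes.
     prod-δ : ∀ K s → Plain K s → Prod (V T) (λ ℓ → δᶠ s (fold K ℓ)) ≈ Val K s
     prod-δ (one _ _) s _ = Prod-δ (V T) s
     prod-δ K@(two i σ pρ pλ eρ eλ) s ns with s Fin.≟ (pλ ↑ˡ n)
     ... | no ne = R.trans (Prod-cong (V T) e) (Prod-δ (V T) s)
       where
       e : ∀ ℓ → δᶠ s (fold K ℓ) ≡ δᶠ s ℓ
       e ℓ with ℓ Fin.≟ (pρ ↑ˡ n)
       ... | no nρ = cong (δᶠ s) (fold-≢ {n} {T = T} {pρ = pρ} eρ eλ nρ)
       ... | yes refl = trans (cong (δᶠ s) (fold-ρ {n} {T = T} {pρ = pρ} eρ eλ)) (trans (δ-no ne) (sym (δ-no ns)))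
         where
         δ-no : ∀ {x y : Fin (r ℕ.+ n)} → x ≢ y → δᶠ x y ≡ 0
         δ-no {x} {y} h = cong (λ b → Data.Bool.if b then 1 else 0) (dec-false (x Fin.≟ y) h)
           where import Data.Bool
     ... | yes refl = R.trans (Prod-cong (V T) e) (R.trans (Prod-+ (V T) (δᶠ (pλ ↑ˡ n)) (δᶠ (pρ ↑ˡ n))) (R.*-cong (Prod-δ (V T) (pλ ↑ˡ n)) (Prod-δ (V T) (pρ ↑ˡ n))))
       where
       import Data.Bool
       δ-no : ∀ {x y : Fin (r ℕ.+ n)} → x ≢ y → δᶠ x y ≡ 0
       δ-no {x} {y} h = cong (λ b → Data.Bool.if b then 1 else 0) (dec-false (x Fin.≟ y) h)
       δ-yes : ∀ (x : Fin (r ℕ.+ n)) → δᶠ x x ≡ 1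
       δ-yes x = cong (λ b → Data.Bool.if b then 1 else 0) (dec-true (x Fin.≟ x) refl)
       e : ∀ ℓ → δᶠ (pλ ↑ˡ n) (fold K ℓ) ≡ δᶠ (pλ ↑ˡ n) ℓ ℕ.+ δᶠ (pρ ↑ˡ n) ℓ
       e ℓ with ℓ Fin.≟ (pρ ↑ˡ n)
       ... | yes refl = trans (cong (δᶠ (pλ ↑ˡ n)) (fold-ρ {n} {T = T} {pρ = pρ} eρ eλ)) (trans (δ-yes (pλ ↑ˡ n)) (sym (cong₂ ℕ._+_ (δ-no ns) (δ-yes (pρ ↑ˡ n)))))
       ... | no nρ = trans (cong (δᶠ (pλ ↑ˡ n)) (fold-≢ {n} {T = T} {pρ = pρ} eρ eλ nρ)) (sym (trans (cong (λ z → δᶠ (pλ ↑ˡ n) ℓ ℕ.+ z) (δ-no λ x → nρ (sym x))) (ℕP.+-identityʳ _)))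
         where import Data.Nat.Properties as ℕP

     val-P : ∀ K ℓ {u v} → On (O K ℓ) u v → Val K ℓ ≈ P (κof K) u v
     val-P K ℓ on = R.trans (own K) (P-at (κof K) on)
       where
       own : ∀ K → Val K ℓ ≈ P (κof K) (lo (O K ℓ)) (hi (O K ℓ))
       own K@(one τ h) with splitAt r ℓ
       ... | inj₁ q = real-value (κ τ) (T q) (λ e → cong κ (h e))
       ... | inj₂ s = bdry-value (κ τ) s
       own K@(two i σ pρ pλ eρ eλ) with ℓ Fin.≟ (pλ ↑ˡ n)
       ... | yes refl = R.trans (R.*-cong (R.reflexive (trans (V-arc T pλ) (cong E eλ))) (R.reflexive (trans (V-arc T pρ) (cong E eρ))))
             (R.trans (loop-value (κ σ) i σ) (R.reflexive (cong (λ y → P (κ σ) (lo y) (hi y)) (sym (trans (labelArc-arc n (idealOf n K) pλ) (idealOf-λ eρ eλ))))))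
       ... | no ne with splitAt r ℓ in es
       ...   | inj₂ s = bdry-value (κ σ) s
       ...   | inj₁ q = R.trans (real-value (κ σ) (T q) tags) (R.reflexive (cong (λ y → P (κ σ) (lo y) (hi y)) (sym (idealOf-real eρ eλ q≢))))
         where
         q≢ : q ≢ pλ
         q≢ refl = ne (sym (FinP.splitAt⁻¹-↑ˡ {m = r} es))
         tags : ∀ {j t} → T q ≡ trad j t → κ t ≡ κ σ
         tags {j} {t} e with pair-radius eρ eλ e | tag-cases σ t
         ... | refl | inj₁ refl = refl
         ... | refl | inj₂ refl = ⊥-elim (q≢ (Triang.T-inj FT (trans e (sym eλ))))

     val-real : ∀ K q → (∀ {i σ pρ pλ eρ eλ} → K ≡ two i σ pρ pλ eρ eλ → q ≢ pλ) → Val K (q ↑ˡ n) ≈ E (T q)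
     val-real (one _ _) q _ = R.reflexive (V-arc T q)
     val-real (two i σ pρ pλ eρ eλ) q h with (q ↑ˡ n) Fin.≟ (pλ ↑ˡ n)
     ... | yes e = ⊥-elim (h refl (FinP.↑ˡ-injective n q pλ e))
     ... | no _ = R.reflexive (V-arc T q)

   record FlipData : Set where
     constructor flip-data
     field
       {T T′}  : Fin r → TArc
       FT      : Triang n T
       FT′     : Triang n T′
       p       : Fin r
       changed : T′ p ≢ T p
       others  : ∀ q → q ≢ p → T′ q ≡ T q

   module FlipRelation (F : FlipData) where
     open FlipData F

     private
       module A = AtTriangulation FT
       module A′ = AtTriangulation FT′
       module TT = TaggedTriangulation n 2≤n FT
       module TT′ = TaggedTriangulation n 2≤n FT′
       open Triang

     pˡ : Fin (r ℕ.+ n)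
     pˡ = p ↑ˡ n

     module Qv (K : Kind T) = Quiver n 2≤n FT K
     module Qv′ (K : Kind T′) = Quiver n 2≤n FT′ K

     record Step (K : Kind T) (K′ : Kind T′) : Set where
       constructor mkStep
       field
         mutates   : ∀ i j → Qv′.Bg K′ i j ≡ mutB (Qv.Bg K) pˡ i j
         exchanges : E (T′ p) ⋆ E (T p) ≈ Prod (V T) (λ i → pos (Qv.Bg K i pˡ)) ⊹ Prod (V T) (λ i → pos (- Qv.Bg K i pˡ))

     private
       agree-labels : ∀ {K : Kind T} {K′ : Kind T′} → (∀ q → q ≢ p → idealOf n K′ q ≡ idealOf n K q) → ∀ ℓ → ℓ ≢ pˡ → TT′.O K′ ℓ ≡ TT.O K ℓ
       agree-labels h ℓ ne with splitAt r ℓ in e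
       ... | inj₂ s = refl
       ... | inj₁ q = h q λ { refl → ne (sym (FinP.splitAt⁻¹-↑ˡ {m = r} e)) }

       differ-label : ∀ {K : Kind T} {K′ : Kind T′} → idealOf n K′ p ≢ idealOf n K p → TT′.O K′ pˡ ≢ TT.O K pˡ
       differ-label {K} {K′} h e = h (trans (sym (labelArc-arc n (idealOf n K′) p)) (trans e (labelArc-arc n (idealOf n K) p)))

       no-loop-valid : ∀ {y u} → ValidT n y → ¬ On (und y) u (fin (u + N))
       no-loop-valid {tiv i k} {u} (_ , _ , k<n) (on-iv _ _ e) = <-irrefl (lin≡ (sym e) (ar u (+ k) N)) (ℤ.+<+ k<n)
         where
         ar : ∀ u k N → k + (u + N) ≡ N + (u + k)
         ar = solve-∀

       E-value : ∀ K q {u v} → (∀ {i σ pρ pλ eρ eλ} → K ≡ two i σ pρ pλ eρ eλ → q ≢ pλ) → On (TT.O K (q ↑ˡ n)) u v → E (T q) ≈ P (κof K) u v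
       E-value K q h on = R.trans (R.sym (A.val-real K q h)) (A.val-P K (q ↑ˡ n) on)

       E-value′ : ∀ K q {u v} → (∀ {i σ pρ pλ eρ eλ} → K ≡ two i σ pρ pλ eρ eλ → q ≢ pλ) → On (TT′.O K (q ↑ˡ n)) u v → E (T′ q) ≈ P (κof K) u v
       E-value′ K q h on = R.trans (R.sym (A′.val-real K q h)) (A′.val-P K (q ↑ˡ n) on)

       radius-tag : ∀ {K : Kind T} q {u} → On (TT.O K (q ↑ˡ n)) u ∞ → ∃₂ λ j t → T q ≡ trad j t
       radius-tag {K} q on = go (TT.arc-view K q) (subst (λ y → On y _ ∞) (labelArc-arc n (idealOf n K) q) on)
         where
         rad-of : ∀ y {u} → On (und y) u ∞ → ∃₂ λ j t → y ≡ trad j t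
         rad-of (trad j t) _ = j , t , refl
         go : _ → On (idealOf n K q) _ ∞ → ∃₂ λ j t → T q ≡ trad j t
         go (inj₁ e) on = rad-of (T q) (subst (λ y → On y _ ∞) e on)
         go (inj₂ (_ , e , _)) on with subst (λ y → On y _ ∞) e on
         ... | ()

     record GenericData : Set where
       constructor generic-data
       field
         K : Kind T
         K′ : Kind T′
         agree : ∀ ℓ → ℓ ≢ pˡ → TT′.O K′ ℓ ≡ TT.O K ℓ
         differ : TT′.O K′ pˡ ≢ TT.O K pˡ
         fold-same : ∀ ℓ → fold K′ ℓ ≡ fold {n} K ℓ
         fold-p : fold K pˡ ≡ pˡ
         fold-p⁻ : ∀ {i} → fold K i ≡ pˡ → i ≡ pˡ
         real : idealOf n K p ≡ und (T p)
         real′ : idealOf n K′ p ≡ und (T′ p)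
         notλ : ∀ {i σ pρ pλ eρ eλ} → K ≡ two i σ pρ pλ eρ eλ → p ≢ pλ
         notλ′ : ∀ {i σ pρ pλ eρ eλ} → K′ ≡ two i σ pρ pλ eρ eλ → p ≢ pλ
         κ-same : ∀ q {u} → q ≢ p → On (TT.O K (q ↑ˡ n)) u ∞ → κof K′ ≡ κof K
         plainL : ∀ P → P ≢ p → Qv.L₁ K P ≡ pˡ → A.Plain K (Qv.L₁ K p) × A.Plain K (Qv.L₂ K p) × A.Plain K (Qv.L₂ K P) × A.Plain K (P ↑ˡ n)
         plainR : ∀ P → P ≢ p → Qv.L₂ K P ≡ pˡ → A.Plain K (Qv.L₁ K p) × A.Plain K (Qv.L₂ K p) × A.Plain K (Qv.L₁ K P) × A.Plain K (P ↑ˡ n)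

     module GenericStep (Ω : GenericData) where
       open GenericData Ω


       private
         module MF = MatchedFlip (matching n 2≤n FT FT′ p K K′ agree differ)
         open MF using (module RotL; module RotR; rot; P≢p) renaming (P to Pq)
         module G = MF.Generic fold-same fold-p fold-p⁻
           (λ u on → no-loop-valid {T p} (validT FT p) (subst (λ y → On y u (fin (u + N))) (trans (labelArc-arc n (idealOf n K) p) real) on))
           (λ u on → no-loop-valid {T′ p} (validT FT′ p) (subst (λ y → On y u (fin (u + N))) (trans (labelArc-arc n (idealOf n K′) p) real′) on))
         module Q = Qv K

         two-factors : ∀ {s t u v u′ v′} → A.Plain K s → A.Plain K t → On (TT.O K s) u v → On (TT.O K t) u′ v′ → ∀ e → (∀ i → e i ≡ δᶠ s (fold K i) ℕ.+ δᶠ t (fold K i)) →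
           Prod (V T) e ≈ P (κof K) u v ⋆ P (κof K) u′ v′
         two-factors {s} {t} ps pt os ot e h = R.trans (Prod-cong (V T) h) (R.trans (Prod-+ (V T) (λ i → δᶠ s (fold K i)) (λ i → δᶠ t (fold K i)))
           (R.*-cong (R.trans (A.prod-δ K s ps) (A.val-P K s os)) (R.trans (A.prod-δ K t pt) (A.val-P K t ot))))

         lab-on : ∀ {u v ℓ} (x : Q.Arc u v) → Q.lab x ≡ ℓ → On (TT.O K ℓ) u v
         lab-on x refl = proj₂ x

       result : Step K K′
       result with rot
       ... | inj₁ RL = mkStep C.mutation (begin
           E (T′ p) ⋆ E (T p)                       ≈⟨ R.*-cong Ep′ (E-value K p notλ (lab-on (Q.Tri.a₃ Δ) e₃)) ⟩
           P k b d ⋆ P k a (fin c)                  ≈⟨ R.*-comm _ _ ⟩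
           P k a (fin c) ⋆ P k b d                  ≈⟨ ptolemy k a b c d ⟩
           P k a (fin b) ⋆ P k c d ⊹ P k a d ⋆ P k b (fin c)  ≈⟨ R.+-comm _ _ ⟩
           P k a d ⋆ P k b (fin c) ⊹ P k a (fin b) ⋆ P k c d  ≈⟨ R.+-cong (R.*-comm _ _) R.refl ⟩
           P k b (fin c) ⋆ P k a d ⊹ P k a (fin b) ⋆ P k c d
             ≈⟨ R.+-cong (two-factors pl₂ plP (lab-on (Q.Tri.a₂ Δ) e₂) (lab-on (Q.Tri.a₃ Γ) f₃) _ C.pos-col)
                         (two-factors pl₁ pl₃ (lab-on (Q.Tri.a₁ Δ) e₁) (lab-on (Q.Tri.a₂ Γ) f₂) _ C.neg-col) ⟨
           Prod (V T) (λ i → pos (Q.Bg i pˡ)) ⊹ Prod (V T) (λ i → pos (- Q.Bg i pˡ)) ∎)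
         where
         module C = G.CaseL RL
         open RotL RL
         k = κof K
         pl = plainL Pq P≢p p∈P
         pl₁ = proj₁ pl
         pl₂ = proj₁ (proj₂ pl)
         pl₃ = proj₁ (proj₂ (proj₂ pl))
         plP = proj₂ (proj₂ (proj₂ pl))
         -- The scale matters only if `d` is the puncture. Then `P` is a radius which the flip
         -- keeps, and it ties the tags of both triangulations together.
         κ-at : ∀ d → Q.Arc a d → On (TT.O K (Pq ↑ˡ n)) a d → P (κof K′) b d ≈ P k b d
         κ-at (fin _) _ _ = R.refl
         κ-at ∞ _ on = R.reflexive (cong (λ z → P z b ∞) (κ-same Pq P≢p on))
         Ep′ : E (T′ p) ≈ P k b d
         Ep′ = R.trans (E-value′ K′ p notλ′ new) (κ-at d (Q.Tri.a₃ Γ) (lab-on (Q.Tri.a₃ Γ) f₃))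
       ... | inj₂ RR = mkStep C.mutation (begin
           E (T′ p) ⋆ E (T p)                       ≈⟨ R.*-cong (E-value′ K′ p notλ′ new) (E-value K p notλ (lab-on (Q.Tri.a₃ Δ) e₃)) ⟩
           P k d (fin b) ⋆ P k a c                  ≈⟨ ptolemy k d a b c ⟩
           P k d (fin a) ⋆ P k b c ⊹ P k d c ⋆ P k a (fin b)  ≈⟨ R.+-cong (R.*-comm _ _) (R.*-comm _ _) ⟩
           P k b c ⋆ P k d (fin a) ⊹ P k a (fin b) ⋆ P k d c
             ≈⟨ R.+-cong (two-factors pl₂ pl₃ (lab-on (Q.Tri.a₂ Δ) e₂) (lab-on (Q.Tri.a₁ Γ) f₁) _ C.pos-col)
                         (two-factors pl₁ plP (lab-on (Q.Tri.a₁ Δ) e₁) (lab-on (Q.Tri.a₃ Γ) f₃) _ C.neg-col) ⟨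
           Prod (V T) (λ i → pos (Q.Bg i pˡ)) ⊹ Prod (V T) (λ i → pos (- Q.Bg i pˡ)) ∎)
         where
         module C = G.CaseR RR
         open RotR RR
         k = κof K
         pl = plainR Pq P≢p p∈P
         pl₁ = proj₁ pl
         pl₂ = proj₁ (proj₂ pl)
         pl₃ = proj₁ (proj₂ (proj₂ pl))
         plP = proj₂ (proj₂ (proj₂ pl))

     private
       und-eq : ∀ q → q ≢ p → und (T′ q) ≡ und (T q)
       und-eq q ne = cong und (others q ne)

       same-und : ∀ {y y′} → und y ≡ und y′ → y ≢ y′ → ∃ λ i → ∃₂ λ s t → y ≡ trad i s × y′ ≡ trad i t
       same-und {tiv _ _} {tiv _ _} refl ne = ⊥-elim (ne refl)
       same-und {trad i s} {trad _ t} refl ne = i , s , t , refl , refl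

     -- If the flip only changed the tag of the radius at i, no other radius exists and both versions of it lie in T.
     step₁₁ : ∀ τ (h : ∀ {q i t} → T q ≡ trad i t → t ≡ τ) τ′ (h′ : ∀ {q i t} → T′ q ≡ trad i t → t ≡ τ′) → Step (one τ h) (one τ′ h′)
     step₁₁ τ h τ′ h′ = GenericStep.result (generic-data (one τ h) (one τ′ h′) (agree-labels {one τ h} {one τ′ h′} und-eq) (differ-label {one τ h} {one τ′ h′} dif) (λ _ → refl) refl (λ e → e) refl refl
         (λ ()) (λ ()) (λ q nq on → let j , t , e = radius-tag {one τ h} q on in cong κ (trans (sym (h′ (trans (others q nq) e))) (h e)))
         (λ _ _ _ → tt , tt , tt , tt) (λ _ _ _ → tt , tt , tt , tt))
       where
       dif : und (T′ p) ≢ und (T p)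
       dif e with same-und e changed
       ... | i , s , t , e₁ , e₂ = opp-≢ τ (h (proj₂ both))
         where
         s≢t : s ≢ t
         s≢t refl = changed (trans e₁ (sym e₂))
         alone : ∀ q tg → DistinctRadii (trad i tg) (T q) → ⊥
         alone q tg d with T q in eq
         ... | trad j u = s≢t (trans (trans (h′ e₁) (sym (h′ (trans (others q q≢p) eq)))) (trans (h eq) (sym (h e₂))))
           where
           q≢p : q ≢ p
           q≢p refl = d (proj₁ (trad-injective (trans (sym e₂) eq)))
         both : ∃ λ q → T q ≡ trad i (opp τ)
         both = maximal FT (trad i (opp τ)) (subst (ValidT n) e₂ (validT FT p)) λ q →
           subst (λ y → crossO n (und y) (und (T q)) ≡ 0) e₂ (proj₁ (compat FT p q)) , λ d → ⊥-elim (alone q (opp τ) d)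

     step₂₂ : ∀ {i i′ σ σ′ pρ pλ} (eρ : T pρ ≡ trad i σ) (eλ : T pλ ≡ trad i (opp σ)) (eρ′ : T′ pρ ≡ trad i′ σ′) (eλ′ : T′ pλ ≡ trad i′ (opp σ′)) →
       p ≢ pρ → p ≢ pλ → Step (two i σ pρ pλ eρ eλ) (two i′ σ′ pρ pλ eρ′ eλ′)
     step₂₂ {i} {i′} {σ} {σ′} {pρ} {pλ} eρ eλ eρ′ eλ′ nρ nλ with trad-injective (trans (sym eρ′) (trans (others pρ (λ e → nρ (sym e))) eρ))
     ... | refl , refl = GenericStep.result (generic-data K K′ (agree-labels {K} {K′} ag) (differ-label {K} {K′} dif) (λ _ → refl) fp fp⁻ (TT.idealOf-real eρ eλ nλ) (TT′.idealOf-real eρ′ eλ′ nλ)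
         (λ { refl → nλ }) (λ { refl → nλ }) (λ _ _ _ → refl) plL plR)
       where
       K = two i σ pρ pλ eρ eλ
       K′ = two i σ pρ pλ eρ′ eλ′
       module Q = Qv K
       sf = self-folded n 2≤n FT eρ eλ
       ag : ∀ q → q ≢ p → idealOf n K′ q ≡ idealOf n K q
       ag q nq with q Fin.≟ pλ
       ... | yes _ = refl
       ... | no _ = und-eq q nq
       dif : idealOf n K′ p ≢ idealOf n K p
       dif e with same-und (trans (sym (TT′.idealOf-real eρ′ eλ′ nλ)) (trans e (TT.idealOf-real eρ eλ nλ))) changed
       ... | j , s , t , _ , e₂ with TT.pair-radius eρ eλ e₂ | tag-cases σ t
       ...   | refl | inj₁ refl = nρ (T-inj FT (trans e₂ (sym eρ)))
       ...   | refl | inj₂ refl = nλ (T-inj FT (trans e₂ (sym eλ)))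
       fp : fold {n} K pˡ ≡ pˡ
       fp = fold-≢ {n} {T = T} {pρ = pρ} eρ eλ λ e → nρ (FinP.↑ˡ-injective n p pρ e)
       fp⁻ : ∀ {j} → fold {n} K j ≡ pˡ → j ≡ pˡ
       fp⁻ {j} e with j Fin.≟ (pρ ↑ˡ n)
       ... | yes refl = ⊥-elim (nλ (FinP.↑ˡ-injective n p pλ (sym (trans (sym (fold-ρ {n} {T = T} {pρ = pρ} eρ eλ)) e))))
       ... | no ne = trans (sym (fold-≢ {n} {T = T} {pρ = pρ} eρ eλ ne)) e
       n₁ : Q.L₁ p ≢ pρ ↑ˡ n
       n₁ e = Q.L₁≢L₂ {p} {pρ} (trans e (sym (proj₂ sf)))
       n₂ : Q.L₂ p ≢ pρ ↑ˡ n
       n₂ e = nρ (Q.L₂-inj (trans e (sym (proj₂ sf))))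
       plL : ∀ P → P ≢ p → Q.L₁ P ≡ pˡ → A.Plain K (Q.L₁ p) × A.Plain K (Q.L₂ p) × A.Plain K (Q.L₂ P) × A.Plain K (P ↑ˡ n)
       plL P _ e = n₁ , n₂ , (λ x → P≢ (Q.L₂-inj (trans x (sym (proj₂ sf))))) , λ x → P≢ (FinP.↑ˡ-injective n P pρ x)
         where
         P≢ : P ≢ pρ
         P≢ refl = nλ (FinP.↑ˡ-injective n p pλ (trans (sym e) (proj₁ sf)))
       plR : ∀ P → P ≢ p → Q.L₂ P ≡ pˡ → A.Plain K (Q.L₁ p) × A.Plain K (Q.L₂ p) × A.Plain K (Q.L₁ P) × A.Plain K (P ↑ˡ n)
       plR P _ e = n₁ , n₂ , (λ x → Q.L₁≢L₂ {P} {pρ} (trans x (sym (proj₂ sf)))) , λ x → P≢ (FinP.↑ˡ-injective n P pρ x)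
         where
         P≢ : P ≢ pρ
         P≢ refl = nρ (FinP.↑ˡ-injective n p pρ (trans (sym e) (proj₂ sf)))

     -- The old radius at `a` and the new one at `d` carry opposite tags, so their scales multiply
     -- to `c` and the digon relation produces the two sides of the digon.
     step₁₂ : ∀ τ (h : ∀ {q i t} → T q ≡ trad i t → t ≡ τ) {i σ pρ} (eρ : T′ pρ ≡ trad i σ) (eλ : T′ p ≡ trad i (opp σ)) → Step (one τ h) (two i σ pρ p eρ eλ)
     step₁₂ τ h {i} {σ} {pρ} eρ eλ = mkStep LA.mutation (begin
         E (T′ p) ⋆ E (T p)                          ≈⟨ R.*-cong Ep′ Ep ⟩
         (κ (opp τ) ⋆ xV d) ⋆ (κ τ ⋆ xV a)           ≈⟨ interchange _ _ _ _ ⟩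
         (κ (opp τ) ⋆ κ τ) ⋆ (xV d ⋆ xV a)           ≈⟨ R.*-cong (R.trans (R.*-comm _ _) (κκ τ)) R.refl ⟩
         cc ⋆ (xV d ⋆ xV a)  ≈⟨ R.*-assoc _ _ _ ⟨
         cc ⋆ xV d ⋆ xV a    ≈⟨ P-digon 1# d a ⟨
         P 1# d (fin a) ⊹ P 1# a (fin (d + 1ℤ * N))
           ≡⟨ cong (λ z → P 1# d (fin a) ⊹ P 1# a (fin z)) (trans (cong (λ z → d + z) (*-identityˡ N)) (sym LA.b≡d+N)) ⟩
         P 1# d (fin a) ⊹ P 1# a (fin b)
           ≈⟨ R.+-cong (single (lab-on (LA.Q.Tri.a₁ Γ) f₁) LA.pos-col) (single (lab-on (LA.Q.Tri.a₁ Δ) e₁) LA.neg-col) ⟨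
         Prod (V T) (λ i → pos (LA.Q.Bg i pˡ)) ⊹ Prod (V T) (λ i → pos (- LA.Q.Bg i pˡ)) ∎)
       where
       K = one τ h
       K′ = two i σ pρ p eρ eλ
       module LA = LoopAppears (appearance n 2≤n FT FT′ p τ h i σ pρ eρ eλ
         (agree-labels {K} {K′} (λ q ne → trans (TT′.idealOf-real eρ eλ ne) (und-eq q ne)))
         (differ-label {K} {K′} λ e → TT.und-loop {T p} (validT FT p) (trans (sym e) (TT′.idealOf-λ eρ eλ))))
       open LA using (module RotR)
       open RotR LA.rotR
       lab-on : ∀ {u v ℓ} (x : LA.Q.Arc u v) → LA.Q.lab x ≡ ℓ → On (TT.O K ℓ) u v
       lab-on x refl = proj₂ x
       single : ∀ {s u v e} → On (TT.O K s) u (fin v) → (∀ i → e i ≡ δᶠ s i) → Prod (V T) e ≈ P 1# u (fin v)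
       single {s} on he = R.trans (Prod-cong (V T) he) (R.trans (Prod-δ (V T) s) (A.val-P K s on))
       pρ≢p : pρ ≢ p
       pρ≢p = TT′.λ≢ρ eρ eλ
       σ≡τ : σ ≡ τ
       σ≡τ = h (trans (sym (others pρ pρ≢p)) eρ)
       Ep′ : E (T′ p) ≈ κ (opp τ) ⋆ xV d
       Ep′ = R.trans (R.reflexive (cong E eλ)) (R.*-cong (R.reflexive (cong (λ z → κ (opp z)) σ≡τ)) (R.sym (xV-at (proj₁ LA.d-i₀) (proj₂ LA.d-i₀))))
       Ep : E (T p) ≈ κ τ ⋆ xV a
       Ep = R.trans (E-value K p (λ ()) (subst (On (TT.O K pˡ) a) LA.c≡∞ (lab-on (LA.Q.Tri.a₃ Δ) e₃))) (P-∞ (κ τ) a)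

     step₂₁ : ∀ {i σ pρ} (eρ : T pρ ≡ trad i σ) (eλ : T p ≡ trad i (opp σ)) τ (h : ∀ {q i t} → T′ q ≡ trad i t → t ≡ τ) → Step (two i σ pρ p eρ eλ) (one τ h)
     step₂₁ {i} {σ} {pρ} eρ eλ τ h = mkStep LD.mutation (begin
         E (T′ p) ⋆ E (T p)                          ≈⟨ R.*-cong Ep′ Ep ⟩
         (κ τ ⋆ xV b) ⋆ (κ (opp τ) ⋆ xV a)           ≈⟨ interchange _ _ _ _ ⟩
         (κ τ ⋆ κ (opp τ)) ⋆ (xV b ⋆ xV a)           ≈⟨ R.*-cong (κκ τ) (R.*-comm _ _) ⟩
         cc ⋆ (xV a ⋆ xV b)  ≈⟨ R.*-assoc _ _ _ ⟨
         cc ⋆ xV a ⋆ xV b    ≈⟨ P-digon 1# a b ⟨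
         P 1# a (fin b) ⊹ P 1# b (fin (a + 1ℤ * N))  ≈⟨ R.+-comm _ _ ⟩
         P 1# b (fin (a + 1ℤ * N)) ⊹ P 1# a (fin b)
           ≡⟨ cong (λ z → P 1# b (fin z) ⊹ P 1# a (fin b)) (trans (cong (λ z → a + z) (*-identityˡ N)) (sym LD.c≡a+N)) ⟩
         P 1# b (fin c) ⊹ P 1# a (fin b)
           ≈⟨ R.+-cong (single (lab-on (LD.Q.Tri.a₂ Δ) e₂) (LD.only₂ p LD.p≢P) LD.pos-col) (single (lab-on (LD.Q.Tri.a₁ Δ) e₁) (LD.only₁ p LD.p≢P) LD.neg-col) ⟨
         Prod (V T) (λ i → pos (LD.Q.Bg i pˡ)) ⊹ Prod (V T) (λ i → pos (- LD.Q.Bg i pˡ)) ∎)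
       where
       K = two i σ pρ p eρ eλ
       K′ = one τ h
       pρ≢p : pρ ≢ p
       pρ≢p = TT.λ≢ρ eρ eλ
       module LD = LoopDisappears (disappearance n 2≤n FT FT′ p i σ pρ eρ eλ τ h
         (agree-labels {K} {K′} (λ q ne → trans (und-eq q ne) (sym (TT.idealOf-real eρ eλ ne))))
         (differ-label {K} {K′} λ e → TT′.und-loop {T′ p} (validT FT′ p) (trans e (TT.idealOf-λ eρ eλ))))
       open LD using (module RotL)
       open RotL LD.rotL
       lab-on : ∀ {u v ℓ} (x : LD.Q.Arc u v) → LD.Q.lab x ≡ ℓ → On (TT.O K ℓ) u v
       lab-on x refl = proj₂ x
       val-V : ∀ {s} → s ≢ pˡ → A.Val K s ≡ V T s
       val-V {s} ne with s Fin.≟ pˡ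
       ... | yes e = ⊥-elim (ne e)
       ... | no _ = refl
       single : ∀ {s u v e} → On (TT.O K s) u (fin v) → s ≢ pˡ → (∀ i → e i ≡ δᶠ s i) → Prod (V T) e ≈ P 1# u (fin v)
       single {s} on ne he = R.trans (Prod-cong (V T) he) (R.trans (Prod-δ (V T) s) (R.trans (R.reflexive (sym (val-V ne))) (A.val-P K s on)))
       σ≡τ : σ ≡ τ
       σ≡τ = h (trans (others pρ pρ≢p) eρ)
       Ep : E (T p) ≈ κ (opp τ) ⋆ xV a
       Ep = R.trans (R.reflexive (cong E eλ)) (R.*-cong (R.reflexive (cong (λ z → κ (opp z)) σ≡τ)) (R.sym (xV-at (proj₁ LD.a-i₀) (proj₂ LD.a-i₀))))
       Ep′ : E (T′ p) ≈ κ τ ⋆ xV b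
       Ep′ = R.trans (E-value′ K′ p (λ ()) (subst (On (TT′.O K′ pˡ) b) LD.d≡∞ new)) (P-∞ (κ τ) b)

-- The invariant along a path of flips

module SeedMutation where
 open IntegerInequalities
 open UniversalCover hiding (lt; gt; eq; X)
 open IdealTriangulations
 open Crossings
 open TaggedTriangulations
 open Rotations
 open MatrixMutation
 open ExchangeMatrices
 open RingIdentities
 open LaurentPolynomials
 open LaurentNewtonPolytopes
 open DecoratedVectors
 open RationalExpressions
 open ArcValues
 open import Data.Bool using (if_then_else_; _∨_)
 open import Data.Nat using (ℕ)
 open import Data.Integer using (ℤ; +_; _+_; _*_; -_; _-_)
 open import Data.Fin using (Fin; _↑ˡ_; _↑ʳ_; toℕ; splitAt)
 open import Data.List using (foldr; map; allFin)

 exchange : ∀ {m} → Fin m → Fin m → Fin m → Fin m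
 exchange a b x = if does (a Fin.≟ x) then b else if does (b Fin.≟ x) then a else x

 data ExchangeView {m} (a b x : Fin m) : Set where
   left  : x ≡ a → exchange a b x ≡ b → ExchangeView a b x
   right : x ≡ b → exchange a b x ≡ a → ExchangeView a b x
   fixed : x ≢ a → x ≢ b → exchange a b x ≡ x → ExchangeView a b x

 exchange-view : ∀ {m} (a b x : Fin m) → ExchangeView a b x
 exchange-view a b x with a Fin.≟ x | b Fin.≟ x in eqb
 ... | yes refl | _ = left refl (cong (λ z → if z then b else if does (b Fin.≟ a) then a else a) (dec-true (a Fin.≟ a) refl))
 ... | no ne | yes refl = right refl (trans (cong (λ z → if z then b else if does (b Fin.≟ b) then a else b) (dec-false (a Fin.≟ b) ne)) (cong (λ z → if z then a else b) (dec-true (b Fin.≟ b) refl)))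
 ... | no ne | no ne′ = fixed (λ e → ne (sym e)) (λ e → ne′ (sym e)) (trans (cong (λ z → if z then b else if does (b Fin.≟ x) then a else x) (dec-false (a Fin.≟ x) ne)) (cong (λ z → if z then a else x) (dec-false (b Fin.≟ x) ne′)))

 exchange-involutive : ∀ {m} (a b x : Fin m) → exchange a b (exchange a b x) ≡ x
 exchange-involutive a b x with exchange-view a b x
 ... | fixed _ _ e = trans (cong (exchange a b) e) e
 ... | left refl e with exchange-view x b b
 ...   | left e′ e″ = trans (cong (exchange x b) e) (trans e″ e′)
 ...   | right _ e″ = trans (cong (exchange x b) e) e″
 ...   | fixed _ ne _ = ⊥-elim (ne refl)
 exchange-involutive a b x | right refl e with exchange-view a x a
 ...   | left _ e″ = trans (cong (exchange a x) e) e″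
 ...   | right e′ e″ = trans (cong (exchange a x) e) (trans e″ e′)
 ...   | fixed ne _ _ = ⊥-elim (ne refl)

 exchange-injective : ∀ {m} (a b : Fin m) {x y} → exchange a b x ≡ exchange a b y → x ≡ y
 exchange-injective a b {x} {y} e = trans (sym (exchange-involutive a b x)) (trans (cong (exchange a b) e) (exchange-involutive a b y))

 Sum-exchange : ∀ {r} {a b : Fin r} → b ≢ a → ∀ f → Sum (λ q → f (exchange a b q)) ≡ Sum f
 Sum-exchange {a = a} {b} ne f = trans (Sum-except₂ (λ q → f (exchange a b q)) ne) (trans (cong₂ _+_ (Sum-cong rest) (trans (cong₂ _+_ at-a at-b) (ar (f b) (f a)))) (sym (Sum-except₂ f ne)))
   where
   import Data.Integer.Properties as ℤP
   ar : ∀ x y → x + y ≡ y + x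
   ar = ℤP.+-comm
   at-a : f (exchange a b a) ≡ f b
   at-a with exchange-view a b a
   ... | left _ e = cong f e
   ... | right e e′ = ⊥-elim (ne (sym e))
   ... | fixed h _ _ = ⊥-elim (h refl)
   at-b : f (exchange a b b) ≡ f a
   at-b with exchange-view a b b
   ... | left e _ = ⊥-elim (ne e)
   ... | right _ e = cong f e
   ... | fixed _ h _ = ⊥-elim (h refl)
   rest : ∀ q → except b (except a (λ q → f (exchange a b q))) q ≡ except b (except a f) q
   rest = except-cong b at
     where
     at : ∀ q → q ≢ b → except a (λ q → f (exchange a b q)) q ≡ except a f q
     at q nb with exchange-view a b q
     ... | left refl _ = trans (except-≡ q (λ x → f (exchange q b x))) (sym (except-≡ q f))
     ... | right e _ = ⊥-elim (nb e)
     ... | fixed na _ e = trans (except-≢ (λ q → f (exchange a b q)) na) (trans (cong f e) (sym (except-≢ f na)))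

 adjF-injective : ∀ {m} {s : Fin m → Fin m} → (∀ {x y} → s x ≡ s y → x ≡ y) → ∀ x y z i j → adjF (s x , s y , s z) (s i) (s j) ≡ adjF (x , y , z) i j
 adjF-injective {s = s} inj x y z i j = adj-cong {code (s x)} {code (s y)} {code (s z)} {code x} {code y} {code z} {code (s i)} {code (s j)} {code i} {code j} (at x i) (at y i) (at z i) (at x j) (at y j) (at z j)
   where
   at : ∀ a b → oEq (code (s a)) (code (s b)) ≡ oEq (code a) (code b)
   at a b with a Fin.≟ b
   ... | yes refl = trans (oEq-code-refl (s a)) (sym (oEq-code-refl a))
   ... | no ne = trans (oEq-code-≢ λ e → ne (inj e)) (sym (oEq-code-≢ ne))

 module Relabelling (n : ℕ) (2≤n : 2 ℕ.≤ n) {r : ℕ} {T : Fin r → TArc} (FT : Triang n T) where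
   open Cover n 2≤n
   open TaggedTriangulation n 2≤n FT
   open Triang FT

   private
     module Qv (K : Kind T) = Quiver n 2≤n FT K

   relabel : ∀ (K K′ : Kind T) (π : Fin r → Fin r) (s : Fin (r ℕ.+ n) → Fin (r ℕ.+ n)) → (∀ f → Sum (λ q → f (π q)) ≡ Sum f) →
     (∀ {x y} → s x ≡ s y → x ≡ y) → (∀ q → s (q ↑ˡ n) ≡ π q ↑ˡ n) → (∀ ℓ → O K′ (s ℓ) ≡ O K ℓ) → (∀ ℓ → fold {n} K′ ℓ ≡ s (fold K ℓ)) →
     ∀ i j → Qv.Bg K′ i j ≡ Qv.Bg K i j
   relabel K K′ π s π-sum s-inj s-arc O-s fold-s i j = trans (sym (π-sum (Q′.term i j))) (Sum-cong λ q → trans (cong₂ (adjF (Q′.sides (π q))) (fold-s i) (fold-s j)) (at q))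
     where
     module Q = Qv K
     module Q′ = Qv K′
     move : ∀ {u v} → Q.Arc u v → Q′.Arc u v
     move {u} {v} (ℓ , on) = s ℓ , subst (λ y → On y u v) (sym (O-s ℓ)) on
     at : ∀ q → adjF (Q′.sides (π q)) (s (fold K i)) (s (fold K j)) ≡ Q.term i j q
     at q = trans (cong (λ z → adjF z (s (fold K i)) (s (fold K j))) (cong₂ _,_ (proj₁ L) (cong₂ _,_ (proj₂ L) (sym (s-arc q))))) (adjF-injective {s = s} s-inj (Q.L₁ q) (Q.L₂ q) (q ↑ˡ n) (fold K i) (fold K j))
       where
       Δ = proj₂ (Q.triOf q)
       L : Q′.L₁ (π q) ≡ s (Q.L₁ q) × Q′.L₂ (π q) ≡ s (Q.L₂ q)
       L = Q′.L-unique (π q) (Q′.mkTri (Q.Tri.e<u Δ) (Q.Tri.u≺f Δ) (move (Q.Tri.a₁ Δ)) (move (Q.Tri.a₂ Δ)) (move (Q.Tri.a₃ Δ))) (trans (cong s (Q.own-lab q)) (s-arc q))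

   Bg-swap : ∀ {i₀ σ pρ pλ} (eρ : T pρ ≡ trad i₀ σ) (eλ : T pλ ≡ trad i₀ (opp σ)) eλ′ eρ′ i j →
     Qv.Bg (two i₀ (opp σ) pλ pρ eλ′ eρ′) i j ≡ Qv.Bg (two i₀ σ pρ pλ eρ eλ) i j
   Bg-swap {i₀} {σ} {pρ} {pλ} eρ eλ eλ′ eρ′ = relabel K K′ (exchange pρ pλ) (exchange ρˡ λˡ) (Sum-exchange λ e → λ≢ρ eρ eλ (sym e)) (exchange-injective ρˡ λˡ) s-arc O-s fold-s
     where
     K = two i₀ σ pρ pλ eρ eλ
     K′ = two i₀ (opp σ) pλ pρ eλ′ eρ′
     ρˡ λˡ : Fin (r ℕ.+ n)
     ρˡ = pρ ↑ˡ n
     λˡ = pλ ↑ˡ n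
     ↑-≢ : ∀ {a b : Fin r} → a ≢ b → a ↑ˡ n ≢ b ↑ˡ n
     ↑-≢ {a} {b} ne e = ne (FinP.↑ˡ-injective n a b e)
     s-arc : ∀ q → exchange ρˡ λˡ (q ↑ˡ n) ≡ exchange pρ pλ q ↑ˡ n
     s-arc q with exchange-view pρ pλ q | exchange-view ρˡ λˡ (q ↑ˡ n)
     ... | left _ e | left _ e′ = trans e′ (cong (_↑ˡ n) (sym e))
     ... | right _ e | right _ e′ = trans e′ (cong (_↑ˡ n) (sym e))
     ... | fixed _ _ e | fixed _ _ e′ = trans e′ (cong (_↑ˡ n) (sym e))
     ... | left refl _ | right h _ = ⊥-elim (↑-≢ (λ≢ρ eρ eλ) h)
     ... | left refl _ | fixed h _ _ = ⊥-elim (h refl)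
     ... | right refl _ | left h _ = ⊥-elim (↑-≢ (λ≢ρ eρ eλ) (sym h))
     ... | right refl _ | fixed _ h _ = ⊥-elim (h refl)
     ... | fixed h _ _ | left h′ _ = ⊥-elim (↑-≢ h h′)
     ... | fixed _ h _ | right h′ _ = ⊥-elim (↑-≢ h h′)
     O-s : ∀ ℓ → O K′ (exchange ρˡ λˡ ℓ) ≡ O K ℓ
     O-s ℓ with exchange-view ρˡ λˡ ℓ
     ... | left refl e = trans (cong (O K′) e) (trans (labelArc-arc n (idealOf n K′) pλ) (trans (trans (idealOf-real eλ′ eρ′ (λ≢ρ eλ′ eρ′)) (trans (cong und eλ) (sym (cong und eρ))))
           (sym (trans (labelArc-arc n (idealOf n K) pρ) (idealOf-real eρ eλ (λ≢ρ eρ eλ))))))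
     ... | right refl e = trans (cong (O K′) e) (trans (labelArc-arc n (idealOf n K′) pρ) (trans (trans (idealOf-λ eλ′ eρ′) (sym (idealOf-λ eρ eλ))) (sym (labelArc-arc n (idealOf n K) pλ))))
     ... | fixed nρ nλ e = trans (cong (O K′) e) (go (splitAt r ℓ) refl)
       where
       go : ∀ x → splitAt r ℓ ≡ x → O K′ ℓ ≡ O K ℓ
       go (inj₂ s) h = trans (cong [ idealOf n K′ , (λ s → iv (toℕ s) 1) ]′ h) (sym (cong [ idealOf n K , (λ s → iv (toℕ s) 1) ]′ h))
       go (inj₁ q) h = trans (cong [ idealOf n K′ , (λ s → iv (toℕ s) 1) ]′ h) (trans (trans (idealOf-real eλ′ eρ′ {q} λ { refl → nρ (sym (FinP.splitAt⁻¹-↑ˡ {m = r} h)) })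
         (sym (idealOf-real eρ eλ {q} λ { refl → nλ (sym (FinP.splitAt⁻¹-↑ˡ {m = r} h)) }))) (sym (cong [ idealOf n K , (λ s → iv (toℕ s) 1) ]′ h)))
     fold-s : ∀ ℓ → fold {n} K′ ℓ ≡ exchange ρˡ λˡ (fold {n} K ℓ)
     fold-s ℓ with exchange-view ρˡ λˡ ℓ
     ... | left refl e = trans (fold-≢ {n} {T = T} {pρ = pλ} eλ′ eρ′ (↑-≢ (λ≢ρ eρ eλ))) (sym (trans (cong (exchange ρˡ λˡ) (trans (fold-ρ {n} {T = T} {pρ = pρ} eρ eλ) (sym e))) (exchange-involutive ρˡ λˡ ρˡ)))
     ... | right refl e = trans (fold-ρ {n} {T = T} {pρ = pλ} eλ′ eρ′) (sym (trans (cong (exchange ρˡ λˡ) (fold-≢ {n} {T = T} {pρ = pρ} eρ eλ (↑-≢ λ h → λ≢ρ eρ eλ (sym h)))) e))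
     ... | fixed nρ nλ e = trans (fold-≢ {n} {T = T} {pρ = pλ} eλ′ eρ′ nλ) (sym (trans (cong (exchange ρˡ λˡ) (fold-≢ {n} {T = T} {pρ = pρ} eρ eλ nρ)) e))

   private
     not-both : ∀ {i σ pρ pλ} (τ : Tag) → (∀ {q i t} → T q ≡ trad i t → t ≡ τ) → T pρ ≡ trad i σ → T pλ ≡ trad i (opp σ) → ⊥
     not-both {σ = σ} τ h eρ eλ = opp-≢ σ (trans (h eλ) (sym (h eρ)))

   -- The only ambiguity is which tagged radius of a pair names the loop. Interchanging the two
   -- relabels the ideal triangulation, and since both fold to the loop the matrix stays the same.
   Bg-kind : ∀ (K K′ : Kind T) i j → Qv.Bg K′ i j ≡ Qv.Bg K i j
   Bg-kind K@(one _ _) K′@(one _ _) = relabel K K′ (λ q → q) (λ ℓ → ℓ) (λ _ → refl) (λ e → e) (λ _ → refl) (λ _ → refl) (λ _ → refl)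
   Bg-kind (one τ h) (two i σ pρ pλ eρ eλ) = ⊥-elim (not-both τ h eρ eλ)
   Bg-kind (two i σ pρ pλ eρ eλ) (one τ h) = ⊥-elim (not-both τ h eρ eλ)
   Bg-kind (two i σ pρ pλ eρ eλ) (two i′ σ′ pρ′ pλ′ eρ′ eλ′) with pair-radius eρ eλ eρ′ | tag-cases σ σ′
   ... | refl | inj₁ refl with T-inj (trans eρ (sym eρ′)) | T-inj (trans eλ (sym eλ′))
   ...   | refl | refl = relabel (two i σ pρ pλ eρ eλ) (two i σ pρ pλ eρ′ eλ′) (λ q → q) (λ ℓ → ℓ) (λ _ → refl) (λ e → e) (λ _ → refl) (λ _ → refl) (λ _ → refl)
   Bg-kind (two i σ pρ pλ eρ eλ) (two i′ σ′ pρ′ pλ′ eρ′ eλ′) | refl | inj₂ refl with T-inj (trans eλ (sym eρ′)) | T-inj (trans eρ (sym (trans eλ′ (cong (trad i) (opp-opp σ)))))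
   ...   | refl | refl = Bg-swap eρ eλ eρ′ eλ′

 record SeedSetup : Set where
   constructor seed-setup
   field
     n : ℕ
     2≤n : 2 ℕ.≤ n
     {r} : ℕ
     {O₀} : Fin (r ℕ.+ n) → OArc
     I₀ : Triangulation.Ideal n 2≤n r O₀
     hom : IntHom (LRing (r ℕ.+ n))
     M M⁻ : Fin (r ℕ.+ n) → LPoly (r ℕ.+ n)
     M-inv : ∀ ℓ → (M ℓ *L M⁻ ℓ) ≃ oneL
     κ : Tag → LPoly (r ℕ.+ n)
     κκ : ∀ τ → (κ τ *L κ (opp τ)) ≃ LambdaLengths.c (lengths n 2≤n I₀ (LRing (r ℕ.+ n)) hom M M⁻ M-inv)

 module SeedValues (Ω : SeedSetup) where
   open SeedSetup Ω


   private
     values : Setup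
     values = setup n 2≤n I₀ (LRing (r ℕ.+ n)) hom M M⁻ M-inv κ κκ

   open ClusterValues values
   open RingProducts (LRing (r ℕ.+ n))

   module _ {T T′ : Fin r → TArc} (FT : Triang n T) (FT′ : Triang n T′) (p : Fin r) (changed : T′ p ≢ T p) (others : ∀ q → q ≢ p → T′ q ≡ T q) where
     open FlipRelation (flip-data FT FT′ p changed others)
     private
       module TT = TaggedTriangulation n 2≤n FT
       module TT′ = TaggedTriangulation n 2≤n FT′
       open Triang

       swapped : ∀ {T : Fin r → TArc} {i σ pρ} → T pρ ≡ trad i σ → T pρ ≡ trad i (opp (opp σ))
       swapped {i = i} {σ} e = trans e (cong (trad i) (sym (opp-opp σ)))

       -- A pair of radii cannot be broken and restored by a single flip.
       no-pair : ∀ {i σ pρ i′ σ′ pρ′ pλ′} → T pρ ≡ trad i σ → T p ≡ trad i (opp σ) → T′ pρ′ ≡ trad i′ σ′ → T′ pλ′ ≡ trad i′ (opp σ′) → ⊥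
       no-pair {i} {σ} {pρ} {i′} {σ′} {pρ′} {pλ′} eρ eλ eρ′ eλ′ = go (tag-cases σ′ (opp σ)) (TT′.pair-radius eρ′ eλ′ (trans (others pρ (TT.λ≢ρ eρ eλ)) eρ))
         where
         at : ∀ q → T′ q ≡ trad i (opp σ) → ⊥
         at q e with q Fin.≟ p
         ... | yes refl = changed (trans e (sym eλ))
         ... | no ne = ne (T-inj FT (trans (sym (others q ne)) (trans e (sym eλ))))
         go : opp σ ≡ σ′ ⊎ opp σ ≡ opp σ′ → i ≡ i′ → ⊥
         go (inj₁ h) refl = at pρ′ (trans eρ′ (cong (trad i) (sym h)))
         go (inj₂ h) refl = at pλ′ (trans eλ′ (cong (trad i) (sym h)))

     -- If the flip completes or breaks a pair of radii, the kind is chosen so that position `p` is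
     -- the loop; the two ideal triangulations then differ at `p` alone.
     flip-step : ∃₂ λ K K′ → Step K K′
     flip-step = go TT.kind? TT′.kind?
       where
       go : Kind T → Kind T′ → ∃₂ λ K K′ → Step K K′
       go (one τ h) (one τ′ h′) = _ , _ , step₁₁ τ h τ′ h′
       go (one τ h) (two i σ pρ pλ eρ eλ) with p Fin.≟ pλ | p Fin.≟ pρ
       ... | yes refl | _ = _ , _ , step₁₂ τ h eρ eλ
       ... | no _ | yes refl = _ , _ , step₁₂ τ h eλ (swapped {T′} eρ)
       ... | no nλ | no nρ = ⊥-elim (opp-≢ σ (trans (h (trans (sym (others pλ λ e → nλ (sym e))) eλ)) (sym (h (trans (sym (others pρ λ e → nρ (sym e))) eρ)))))
       go (two i σ pρ pλ eρ eλ) (one τ h) with p Fin.≟ pλ | p Fin.≟ pρ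
       ... | yes refl | _ = _ , _ , step₂₁ eρ eλ τ h
       ... | no _ | yes refl = _ , _ , step₂₁ eλ (swapped {T} eρ) τ h
       ... | no nλ | no nρ = ⊥-elim (opp-≢ σ (trans (h (trans (others pλ λ e → nλ (sym e)) eλ)) (sym (h (trans (others pρ λ e → nρ (sym e)) eρ)))))
       go (two i σ pρ pλ eρ eλ) (two i′ σ′ pρ′ pλ′ eρ′ eλ′) with p Fin.≟ pλ | p Fin.≟ pρ
       ... | yes refl | _ = ⊥-elim (no-pair eρ eλ eρ′ eλ′)
       ... | no _ | yes refl = ⊥-elim (no-pair eλ (swapped {T} eρ) eρ′ eλ′)
       ... | no nλ | no nρ = _ , _ , step₂₂ eρ eλ (trans (others pρ λ e → nρ (sym e)) eρ) (trans (others pλ λ e → nλ (sym e)) eλ) nρ nλ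

   -- The matrix is controlled for every kind, because consecutive flips may call for different
   -- choices of the loop.
   record Inv (S : Seed r n) (T : Fin r → TArc) : Set where
     field
       FT  : Triang n T
       B-ok : ∀ K i j → Seed.B S i j ≡ Quiver.Bg n 2≤n FT K i (j ↑ˡ n)
       X-ok : ∀ q → Repr (Seed.X S q) (E (T q))

   module _ (bd : ∀ s → Bd s ≃ varL (r ↑ʳ s)) where

     inv-step : ∀ {S T p T′} → Inv S T → FlipStep n T p T′ → Inv (mutate S p) T′
     inv-step {S} {T} {p} {T′} I F = record { FT = FT′ ; B-ok = B-ok′ ; X-ok = X-ok′ }
       where
       open Inv I
       open FlipStep F
       open Seed S
       FT′ : Triang n T′
       FT′ = fromTabulate T′ triang
       fs = flip-step FT FT′ p changed others
       K = proj₁ fs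
       K′ = proj₁ (proj₂ fs)
       module St = FlipRelation.Step (proj₂ (proj₂ fs))
       pˡ : Fin (r ℕ.+ n)
       pˡ = p ↑ˡ n
       module Q = Quiver n 2≤n FT K
       module Q′ = Quiver n 2≤n FT′ K′
       body : ℤ → ℤ → ℤ → ℤ
       body a b c = a + (+ pos b * + pos c) - (+ pos (- b) * + pos (- c))
       does-↑ : ∀ j → does (j Fin.≟ p) ≡ does ((j ↑ˡ n) Fin.≟ pˡ)
       does-↑ j with j Fin.≟ p
       ... | yes refl = sym (dec-true (pˡ Fin.≟ pˡ) refl)
       ... | no ne = sym (dec-false ((j ↑ˡ n) Fin.≟ pˡ) λ e → ne (FinP.↑ˡ-injective n j p e))
       B-mut : ∀ i j → Seed.B (mutate S p) i j ≡ mutB Q.Bg pˡ i (j ↑ˡ n)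
       B-mut i j = trans (cong₂ (λ b x → if b then - x else body (B i j) (B i p) (B pˡ j)) (cong (does (i Fin.≟ pˡ) ∨_) (does-↑ j)) (B-ok K i j))
         (cong (λ x → if does (i Fin.≟ pˡ) ∨ does ((j ↑ˡ n) Fin.≟ pˡ) then - Q.Bg i (j ↑ˡ n) else x)
           (trans (cong (λ a → body a (B i p) (B pˡ j)) (B-ok K i j)) (cong₂ (body (Q.Bg i (j ↑ˡ n))) (B-ok K i p) (B-ok K pˡ j))))
       B-ok′ : ∀ K″ i j → Seed.B (mutate S p) i j ≡ Quiver.Bg n 2≤n FT′ K″ i (j ↑ˡ n)
       B-ok′ K″ i j = trans (B-mut i j) (trans (sym (St.mutates i (j ↑ˡ n))) (Relabelling.Bg-kind n 2≤n FT′ K″ K′ i (j ↑ˡ n)))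
       Y : Fin (r ℕ.+ n) → Frac (r ℕ.+ n)
       Y i = [ X , (λ j → (varL (r ↑ʳ j) , oneL)) ]′ (splitAt r i)
       Y-ok : ∀ i → Repr (Y i) (V T i)
       Y-ok i with splitAt r i
       ... | inj₁ q = X-ok q
       ... | inj₂ s = repr-≃ {v = varL (r ↑ʳ s)} {w = Bd s} (≃-sym {P = Bd s} {varL (r ↑ʳ s)} (bd s)) (repr-mono (unit (r ↑ʳ s)))
       P₊ P₋ : Frac (r ℕ.+ n)
       P₊ = foldr fmul fone (map (λ i → fpow (Y i) (pos (B i p))) (allFin _))
       P₋ = foldr fmul fone (map (λ i → fpow (Y i) (pos (- B i p))) (allFin _))
       new-ok : Repr (fmul (fadd P₊ P₋) (finv (X p))) (E (T′ p))
       new-ok = repr-/ {F = fadd P₊ P₋} {G = X p} {e = E (T′ p)} (repr-+ {F = P₊} {G = P₋} (side (λ i → pos (B i p)) (λ i → pos (Q.Bg i pˡ)) (λ i → cong pos (B-ok K i p))) (side (λ i → pos (- B i p)) (λ i → pos (- Q.Bg i pˡ)) (λ i → cong (λ z → pos (- z)) (B-ok K i p)))) (X-ok p)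
           (≃-sym {P = E (T′ p) *L E (T p)} {Prod (V T) (λ i → pos (Q.Bg i pˡ)) +L Prod (V T) (λ i → pos (- Q.Bg i pˡ))} St.exchanges)
         where
         side : ∀ e e′ → (∀ i → e i ≡ e′ i) → Repr (foldr fmul fone (map (λ i → fpow (Y i) (e i)) (allFin _))) (Prod (V T) e′)
         side e e′ h = repr-≃ {v = Prod (V T) e} (Prod-cong (V T) h) (repr-prod Y (V T) Y-ok e)
       X-ok′ : ∀ q → Repr (Seed.X (mutate S p) q) (E (T′ q))
       X-ok′ q with q Fin.≟ p
       ... | yes refl = new-ok
       ... | no ne = subst (λ y → Repr (X q) (E y)) (sym (others q ne)) (X-ok q)

     inv-path : ∀ {S T ps T′} → Inv S T → FlipPath n T ps T′ → Inv (mutateAlong S ps) T′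
     inv-path I done = I
     inv-path I (step F path) = inv-path (inv-step I F) path

-- The initial exchange matrix

module InitialSeed where
 open IntegerInequalities
 open UniversalCover hiding (lt; gt; eq; X)
 open IdealTriangulations
 open Crossings
 open TaggedTriangulations
 open Rotations
 open MatrixMutation
 open ExchangeMatrices
 open import Data.Bool using (Bool; T; true; false; if_then_else_; _∧_; _∨_)
 import Data.Bool.Properties as BoolP
 open import Data.Bool.ListAction using (any)
 open import Data.Nat using (ℕ; zero; suc; _<ᵇ_; _≤ᵇ_; _≡ᵇ_)
 open import Data.Integer using (ℤ; +_; _+_; _*_; _≤_; _<_; 0ℤ; 1ℤ)
 open import Data.Integer.Properties hiding (_≟_)
 open import Data.Integer.Tactic.RingSolver using (solve-∀)
 open import Data.Fin using (Fin; zero; suc; _↑ˡ_; _↑ʳ_; toℕ; splitAt; fromℕ<)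
 open import Data.List using (List; []; _∷_; _++_; map; foldr; concatMap; upTo; applyUpTo; length; lookup)
 import Data.Product.Properties as ProductP
 import Data.Sum.Properties as SumP
 open import Function.Bundles using (Equivalence)
 open import Relation.Binary.Definitions using (DecidableEquality)

 Sum-point : ∀ {r} (x : Fin r) f → (∀ q → q ≢ x → f q ≡ 0ℤ) → Sum f ≡ f x
 Sum-point x f h = trans (Sum-except x f) (trans (cong (λ z → f x + z) (Sum-0 away)) (+-identityʳ (f x)))
   where
   away : ∀ q → except x f q ≡ 0ℤ
   away q with x Fin.≟ q
   ... | yes _ = refl
   ... | no ne = h q λ e → ne (sym e)

 Sum-swap : ∀ {r m} (F : Fin r → Fin m → ℤ) → Sum (λ a → Sum (λ q → F q a)) ≡ Sum (λ q → Sum (F q))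
 Sum-swap {zero} {m} F = Sum-0 {m} {λ _ → 0ℤ} λ _ → refl
 Sum-swap {suc r} F = trans (Sum-+ (F zero) (λ a → Sum (λ q → F (suc q) a))) (cong (λ z → Sum (F zero) + z) (Sum-swap λ q → F (suc q)))

 record Summation (A : Set) : Set where
   field
     _≟ᴬ_    : DecidableEquality A
     total   : (A → ℤ) → ℤ
     t-cong  : ∀ {f g} → (∀ a → f a ≡ g a) → total f ≡ total g
     t-swap  : ∀ {r} (F : Fin r → A → ℤ) → total (λ a → Sum (λ q → F q a)) ≡ Sum (λ q → total (F q))
     t-point : ∀ x f → (∀ a → a ≢ x → f a ≡ 0ℤ) → total f ≡ f x

   -- Summing a function supported on the image of an injective family t is summing over the family.
   reindex : ∀ {r} (t : Fin r → A) → (∀ {q q′} → t q ≡ t q′ → q ≡ q′) → ∀ f → (∀ a → (∃ λ q → t q ≡ a) ⊎ f a ≡ 0ℤ) →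
     total f ≡ Sum (λ q → f (t q))
   reindex {r} t t-inj f h = trans (t-cong λ a → sym (spread a (h a))) (trans (t-swap F) (Sum-cong λ q → trans (t-point (t q) (F q) (off q)) (on q)))
     where
     F : Fin r → A → ℤ
     F q a = if does (t q ≟ᴬ a) then f a else 0ℤ
     off : ∀ q a → a ≢ t q → F q a ≡ 0ℤ
     off q a ne = cong (λ b → if b then f a else 0ℤ) (dec-false (t q ≟ᴬ a) λ e → ne (sym e))
     on : ∀ q → F q (t q) ≡ f (t q)
     on q = cong (λ b → if b then f (t q) else 0ℤ) (dec-true (t q ≟ᴬ t q) refl)
     spread : ∀ a → (∃ λ q → t q ≡ a) ⊎ f a ≡ 0ℤ → Sum (λ q → F q a) ≡ f a
     spread a (inj₁ (q , refl)) = trans (Sum-point q (λ q′ → F q′ (t q)) λ q′ ne → off q′ (t q) λ e → ne (t-inj (sym e))) (on q)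
     spread a (inj₂ e) = trans (Sum-0 zeroes) (sym e)
       where
       zeroes : ∀ q → F q a ≡ 0ℤ
       zeroes q with does (t q ≟ᴬ a)
       ... | true = e
       ... | false = refl

 open Summation

 sum-Fin : ∀ m → Summation (Fin m)
 sum-Fin m = record { _≟ᴬ_ = Fin._≟_ ; total = Sum ; t-cong = Sum-cong ; t-swap = Sum-swap ; t-point = Sum-point }

 sum-× : ∀ {A B} → Summation A → Summation B → Summation (A × B)
 sum-× S U = record
   { _≟ᴬ_ = ProductP.≡-dec (_≟ᴬ_ S) (_≟ᴬ_ U)
   ; total = λ f → total S λ a → total U λ b → f (a , b)
   ; t-cong = λ h → t-cong S λ a → t-cong U λ b → h (a , b)
   ; t-swap = λ F → trans (t-cong S λ a → t-swap U λ q b → F q (a , b)) (t-swap S λ q a → total U λ b → F q (a , b))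
   ; t-point = λ { (x , y) f h → trans (t-point S x _ λ a ne → trans (t-point U y _ λ b _ → h (a , b) λ { refl → ne refl }) (h (a , y) λ { refl → ne refl }))
                                       (t-point U y _ λ b ne → h (x , b) λ { refl → ne refl }) } }

 sum-⊎ : ∀ {A B} → Summation A → Summation B → Summation (A ⊎ B)
 sum-⊎ S U = record
   { _≟ᴬ_ = SumP.≡-dec (_≟ᴬ_ S) (_≟ᴬ_ U)
   ; total = tot
   ; t-cong = λ h → cong₂ _+_ (t-cong S λ a → h (inj₁ a)) (t-cong U λ b → h (inj₂ b))
   ; t-swap = λ F → trans (cong₂ _+_ (t-swap S λ q a → F q (inj₁ a)) (t-swap U λ q b → F q (inj₂ b))) (sym (Sum-+ (λ q → total S λ a → F q (inj₁ a)) (λ q → total U λ b → F q (inj₂ b))))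
   ; t-point = point }
   where
   tot : (_ ⊎ _ → ℤ) → ℤ
   tot f = total S (λ a → f (inj₁ a)) + total U (λ b → f (inj₂ b))
   zeroS : ∀ {f} → (∀ a → f a ≡ 0ℤ) → total S f ≡ 0ℤ
   zeroS {f} h = trans (t-cong S h) (t-swap S {0} λ ())
   zeroU : ∀ {f} → (∀ a → f a ≡ 0ℤ) → total U f ≡ 0ℤ
   zeroU {f} h = trans (t-cong U h) (t-swap U {0} λ ())
   point : ∀ x f → (∀ a → a ≢ x → f a ≡ 0ℤ) → tot f ≡ f x
   point (inj₁ x) f h = trans (cong₂ _+_ (t-point S x _ λ a ne → h (inj₁ a) λ { refl → ne refl }) (zeroU λ b → h (inj₂ b) λ ())) (+-identityʳ _)
   point (inj₂ y) f h = trans (cong₂ _+_ (zeroS λ a → h (inj₁ a) λ ()) (t-point U y _ λ b ne → h (inj₂ b) λ { refl → ne refl })) (+-identityˡ _)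

 module _ {A : Set} (φ : A → ℤ) where
   sumOver : List A → ℤ
   sumOver xs = foldr _+_ 0ℤ (map φ xs)

   sumOver-++ : ∀ xs ys → sumOver (xs ++ ys) ≡ sumOver xs + sumOver ys
   sumOver-++ [] ys = sym (+-identityˡ _)
   sumOver-++ (x ∷ xs) ys = trans (cong (λ z → φ x + z) (sumOver-++ xs ys)) (sym (+-assoc (φ x) (sumOver xs) (sumOver ys)))

   sumOver-concatMap : ∀ m (k : ℕ → List A) (h : ℕ → ℕ) → sumOver (concatMap k (applyUpTo h m)) ≡ Sum {m} (λ x → sumOver (k (h (toℕ x))))
   sumOver-concatMap zero k h = refl
   sumOver-concatMap (suc m) k h = trans (sumOver-++ (k (h 0)) (concatMap k (applyUpTo (λ x → h (suc x)) m))) (cong (λ z → sumOver (k (h 0)) + z) (sumOver-concatMap m k λ x → h (suc x)))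

 ≡true⇒T : ∀ {b} → b ≡ true → T b
 ≡true⇒T = Equivalence.from BoolP.T-≡

 T⇒≡true : ∀ {b} → T b → b ≡ true
 T⇒≡true = Equivalence.to BoolP.T-≡

 ∧-true : ∀ {a b} → a ∧ b ≡ true → a ≡ true × b ≡ true
 ∧-true {true} e = refl , e

 any-sound : ∀ {A : Set} (p : A → Bool) xs → any p xs ≡ true → ∃ λ q → p (lookup xs q) ≡ true
 any-sound p (x ∷ xs) e with p x in px
 ... | true = zero , px
 ... | false = let q , h = any-sound p xs e in suc q , h

 any-complete : ∀ {A : Set} (p : A → Bool) xs q {y} → lookup xs q ≡ y → p y ≡ true → any p xs ≡ true
 any-complete p (x ∷ xs) zero refl h rewrite h = refl
 any-complete p (x ∷ xs) (suc q) e h with p x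
 ... | true = refl
 ... | false = any-complete p xs q e h

 any-map : ∀ {A B : Set} (p : B → Bool) (g : A → B) xs → any p (map g xs) ≡ any (λ x → p (g x)) xs
 any-map p g [] = refl
 any-map p g (x ∷ xs) = cong (p (g x) ∨_) (any-map p g xs)

 oEq-refl : ∀ y → oEq y y ≡ true
 oEq-refl (iv i k) = cong₂ _∧_ (≡ᵇ-refl i) (≡ᵇ-refl k)
 oEq-refl (rad i) = ≡ᵇ-refl i

 oEq-sound : ∀ y y′ → oEq y y′ ≡ true → y ≡ y′
 oEq-sound (iv i k) (iv j l) e = cong₂ iv (≡ᵇ⇒≡ (proj₁ (∧-true e))) (≡ᵇ⇒≡ (proj₂ (∧-true {i ≡ᵇ j} e)))
 oEq-sound (rad i) (rad j) e = cong rad (≡ᵇ⇒≡ e)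

 oEq-≢ : ∀ {y y′} → y ≢ y′ → oEq y y′ ≡ false
 oEq-≢ {y} {y′} ne = BoolP.¬-not λ e → ne (oEq-sound y y′ e)

 tEq-refl : ∀ y → tEq y y ≡ true
 tEq-refl (tiv i k) = cong₂ _∧_ (≡ᵇ-refl i) (≡ᵇ-refl k)
 tEq-refl (trad i plain) = cong₂ _∧_ (≡ᵇ-refl i) refl
 tEq-refl (trad i notched) = cong₂ _∧_ (≡ᵇ-refl i) refl

 tEq-sound : ∀ y y′ → tEq y y′ ≡ true → y ≡ y′
 tEq-sound (tiv i k) (tiv j l) e = cong₂ tiv (≡ᵇ⇒≡ (proj₁ (∧-true e))) (≡ᵇ⇒≡ (proj₂ (∧-true {i ≡ᵇ j} e)))
 tEq-sound (trad i s) (trad j t) e = cong₂ trad (≡ᵇ⇒≡ (proj₁ (∧-true e))) (tags s t (proj₂ (∧-true {i ≡ᵇ j} e)))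
   where
   tags : ∀ s t → tagEq s t ≡ true → s ≡ t
   tags plain plain _ = refl
   tags notched notched _ = refl

 module InitialKind (n : ℕ) (2≤n : 2 ℕ.≤ n) (T : List TArc) (FT : Triang n (lookup T)) where
   open TaggedTriangulation n 2≤n FT
   open Triang FT

   hasBoth-sound : hasBoth T ≡ true → ∃ λ i → (∃ λ q → lookup T q ≡ trad i plain) × (∃ λ q → lookup T q ≡ trad i notched)
   hasBoth-sound e with any-sound _ T e
   ... | q , h with lookup T q in eq
   ...   | trad i notched = let q′ , h′ = any-sound _ T h in i , (q′ , sym (tEq-sound _ _ h′)) , q , eq

   hasBoth-complete : ∀ {i q q′} → lookup T q ≡ trad i plain → lookup T q′ ≡ trad i notched → hasBoth T ≡ true
   hasBoth-complete {i} {q} {q′} e e′ = any-complete _ T q′ e′ (any-complete _ T q e (tEq-refl (trad i plain)))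

   -- `circArc` turns the notched radius into the loop, so the initial kind has to keep the plain
   -- one as the enclosed radius.
   data Plainly : Kind (lookup T) → Set where
     one : ∀ τ (h : ∀ {q i t} → lookup T q ≡ trad i t → t ≡ τ) → Plainly (one τ h)
     two : ∀ {i pρ pλ eρ eλ} → Plainly (two i plain pρ pλ eρ eλ)

   plain-kind : ∃ Plainly
   plain-kind with kind?
   ... | one τ h = one τ h , one τ h
   ... | two i plain pρ pλ eρ eλ = two i plain pρ pλ eρ eλ , two
   ... | two i notched pρ pλ eρ eλ = two i plain pλ pρ eλ eρ , two

   idealArc-≡ : ∀ {K} → Plainly K → ∀ q → idealArc n T (lookup T q) ≡ idealOf n K q
   idealArc-≡ (one τ h) q = cong (λ b → if b then circArc n (lookup T q) else und (lookup T q)) (BoolP.¬-not λ e → clash (hasBoth-sound e))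
     where
     clash : ¬ (∃ λ i → (∃ λ q → lookup T q ≡ trad i plain) × (∃ λ q → lookup T q ≡ trad i notched))
     clash (i , (q , e) , q′ , e′) with trans (h e) (sym (h e′))
     ... | ()
   idealArc-≡ (two {i} {pρ} {pλ} {eρ} {eλ}) q = trans (cong (λ b → if b then circArc n (lookup T q) else und (lookup T q)) (hasBoth-complete eρ eλ)) (go (q Fin.≟ pλ))
     where
     go : Dec (q ≡ pλ) → circArc n (lookup T q) ≡ idealOf n (two i plain pρ pλ eρ eλ) q
     go (yes refl) = trans (cong (circArc n) eλ) (sym (idealOf-λ eρ eλ))
     go (no ne) = trans (same (lookup T q) refl) (sym (idealOf-real eρ eλ ne))
       where
       same : ∀ y → lookup T q ≡ y → circArc n (lookup T q) ≡ und (lookup T q)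
       same (tiv j k) e = trans (cong (circArc n) e) (sym (cong und e))
       same (trad j plain) e = trans (cong (circArc n) e) (sym (cong und e))
       same (trad j notched) e with pair-radius eρ eλ e
       ... | refl = ⊥-elim (ne (T-inj (trans e (sym eλ))))

 module InitialMatrix (n : ℕ) (2≤n : 2 ℕ.≤ n) (T : List TArc) (FT : Triang n (lookup T)) (K : Kind (lookup T))
   (ideal-≡ : ∀ q → idealArc n T (lookup T q) ≡ idealOf n K q) where

   open Cover n 2≤n
   open CrossingNumber n 2≤n using (lo-on₀)
   open TaggedTriangulation n 2≤n FT using (ideal-view; edge; loop) renaming (real to realᵛ)
   open Quiver n 2≤n FT K
   open Triang FT

   private
     r : ℕ
     r = length T
     I : List OArc
     I = map (idealArc n T) T

     mem-sound : ∀ y → memO y I ≡ true → ∃ λ q → O K (q ↑ˡ n) ≡ y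
     mem-sound y e with any-sound (λ x → oEq y (idealArc n T x)) T (trans (sym (any-map (oEq y) (idealArc n T) T)) e)
     ... | q , h = q , trans (labelArc-arc n (idealOf n K) q) (trans (sym (ideal-≡ q)) (sym (oEq-sound y _ h)))

     mem-complete : ∀ {y} q → O K (q ↑ˡ n) ≡ y → memO y I ≡ true
     mem-complete {y} q e = trans (any-map (oEq y) (idealArc n T) T) (any-complete _ T q refl
       (trans (cong (oEq y) (trans (ideal-≡ q) (trans (sym (labelArc-arc n (idealOf n K) q)) e))) (oEq-refl y)))

     red : ℕ → ℕ
     red u = if u <ᵇ n then u else u ℕ.∸ n

     side : ℕ → ℕ → OArc
     side u v = iv (red u) (v ℕ.∸ u)

     present′ : OArc → Bool
     present′ (iv i k) = (k ≡ᵇ 1) ∨ memO (iv i k) I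
     present′ (rad i) = memO (rad i) I

     red-spec : ∀ u → u ℕ.< n ℕ.+ n → red u ℕ.< n × (∃ λ t → + u ≡ + red u + t * N)
     red-spec u h with u <ᵇ n in e
     ... | true = ℕP.<ᵇ⇒< u n (≡true⇒T e) , 0ℤ , sym (+-identityʳ (+ u))
     ... | false = ℕP.+-cancelʳ-< n (u ℕ.∸ n) n (subst (ℕ._< n ℕ.+ n) (sym (ℕP.m∸n+n≡m n≤u)) h) , 1ℤ ,
         trans (cong +_ (sym (ℕP.m∸n+n≡m n≤u))) (trans (pos-+ (u ℕ.∸ n) n) (cong (λ z → + (u ℕ.∸ n) + z) (sym (*-identityˡ N))))
       where
       n≤u : n ℕ.≤ u
       n≤u = ℕP.≮⇒≥ λ lt → BoolP.not-¬ e (T⇒≡true (ℕP.<⇒<ᵇ lt))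

     side-on : ∀ {u v} → u ℕ.< n ℕ.+ n → u ℕ.≤ v → On (side u v) (+ u) (fin (+ v))
     side-on {u} {v} h le = let _ , t , e = red-spec u h in on-iv t e (cong +_ (sym (ℕP.m+[n∸m]≡n le)))

     rad-on : ∀ {u} → u ℕ.< n ℕ.+ n → On (rad (red u)) (+ u) ∞
     rad-on {u} h = let _ , t , e = red-spec u h in on-rad t e

     side-small : ∀ {u v} → u ℕ.< n ℕ.+ n → u ℕ.< v → v ℕ.≤ u ℕ.+ n → Small (side u v)
     side-small {u} {v} h lt le = proj₁ (red-spec u h) , ℕP.m<n⇒0<n∸m lt , ℕP.m≤n+o⇒m∸n≤o v u le

     label-eq : ∀ {y u v} (x : Arc u v) → Small y → On y u v → O K (lab x) ≡ y
     label-eq x sm on = on-unique (small (lab x)) sm (proj₂ x) on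

     present-sound : ∀ y → Small y → present′ y ≡ true → ∃ λ ℓ → O K ℓ ≡ y
     present-sound (rad i) _ e = let q , h = mem-sound (rad i) e in q ↑ˡ n , h
     present-sound (iv i k) (i<n , _) e with k ≡ᵇ 1 in ek
     ... | true = r ↑ʳ fromℕ< i<n , trans (labelArc-bdy n (idealOf n K) (fromℕ< i<n)) (cong₂ iv (FinP.toℕ-fromℕ< i<n) (sym (≡ᵇ⇒≡ ek)))
     ... | false = let q , h = mem-sound (iv i k) e in q ↑ˡ n , h

     present-complete : ∀ ℓ {y} → O K ℓ ≡ y → present′ y ≡ true
     present-complete ℓ e with view ℓ
     present-complete _ {iv i k} e | arcˡ q = trans (cong ((k ≡ᵇ 1) ∨_) (mem-complete q e)) (BoolP.∨-zeroʳ (k ≡ᵇ 1))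
     present-complete _ {rad i} e | arcˡ q = mem-complete q e
     present-complete _ e | bdyˡ s with trans (sym (labelArc-bdy n (idealOf n K) s)) e
     ... | refl = refl

     Index : Set
     Index = (Fin n × Fin (n ℕ.+ n) × Fin (n ℕ.+ n)) ⊎ (Fin n × Fin (n ℕ.+ n))

     indices : Summation Index
     indices = sum-⊎ (sum-× (sum-Fin n) (sum-× (sum-Fin (n ℕ.+ n)) (sum-Fin (n ℕ.+ n)))) (sum-× (sum-Fin n) (sum-Fin (n ℕ.+ n)))

     condF : ℕ → ℕ → ℕ → Bool
     condF a b c = (a <ᵇ b) ∧ (b <ᵇ c) ∧ (c ≤ᵇ a ℕ.+ n) ∧ (present′ (side a b) ∧ present′ (side b c) ∧ present′ (side a c) ∧ true)

     cond∞ : ℕ → ℕ → Bool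
     cond∞ a b = (a <ᵇ b) ∧ (b <ᵇ a ℕ.+ n) ∧ (present′ (side a b) ∧ present′ (rad (red b)) ∧ present′ (rad a) ∧ true)

     finite : ℕ → ℕ → ℕ → List (OArc × OArc × OArc)
     finite a b c = if condF a b c then (side a b , side b c , side a c) ∷ [] else []

     infinite : ℕ → ℕ → List (OArc × OArc × OArc)
     infinite a b = if cond∞ a b then (side a b , rad (red b) , rad a) ∷ [] else []

     Δs : Index → List (OArc × OArc × OArc)
     Δs (inj₁ (x , y , z)) = finite (toℕ x) (toℕ y) (toℕ z)
     Δs (inj₂ (x , y)) = infinite (toℕ x) (toℕ y)

     triangle-sum : ∀ φ → sumOver φ (triangles n I) ≡ total indices (λ a → sumOver φ (Δs a))
     triangle-sum φ = trans (sumOver-++ φ (concatMap finite₁ (upTo n)) (concatMap infinite₁ (upTo n))) (cong₂ _+_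
         (trans (sumOver-concatMap φ n finite₁ λ x → x) (Sum-cong {n} λ a → trans (sumOver-concatMap φ (n ℕ.+ n) (finite₂ (toℕ a)) λ x → x)
           (Sum-cong {n ℕ.+ n} λ b → sumOver-concatMap φ (n ℕ.+ n) (finite (toℕ a) (toℕ b)) λ x → x)))
         (trans (sumOver-concatMap φ n infinite₁ λ x → x) (Sum-cong {n} λ a → sumOver-concatMap φ (n ℕ.+ n) (infinite (toℕ a)) λ x → x)))
       where
       finite₂ : ℕ → ℕ → List (OArc × OArc × OArc)
       finite₂ a b = concatMap (finite a b) (upTo (n ℕ.+ n))
       finite₁ infinite₁ : ℕ → List (OArc × OArc × OArc)
       finite₁ a = concatMap (finite₂ a) (upTo (n ℕ.+ n))
       infinite₁ a = concatMap (infinite a) (upTo (n ℕ.+ n))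

     point : Index → ℤ × ℤ × Pt
     point (inj₁ (x , y , z)) = + toℕ x , + toℕ y , fin (+ toℕ z)
     point (inj₂ (x , y)) = + toℕ x , + toℕ y , ∞

     same-Fin : ∀ {m} {x y : Fin m} → + toℕ x ≡ + toℕ y → x ≡ y
     same-Fin e = FinP.toℕ-injective (+-injective e)

     point-injective : ∀ a a′ → point a ≡ point a′ → a ≡ a′
     point-injective (inj₁ (x , y , z)) (inj₁ (x′ , y′ , z′)) e = cong inj₁ (cong₂ _,_ (same-Fin (cong proj₁ e))
       (cong₂ _,_ (same-Fin (cong (λ p → proj₁ (proj₂ p)) e)) (same-Fin (fin-injective (cong (λ p → proj₂ (proj₂ p)) e)))))
     point-injective (inj₁ _) (inj₂ _) e with cong (λ p → proj₂ (proj₂ p)) e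
     ... | ()
     point-injective (inj₂ _) (inj₁ _) e with cong (λ p → proj₂ (proj₂ p)) e
     ... | ()
     point-injective (inj₂ (x , y)) (inj₂ (x′ , y′)) e = cong inj₂ (cong₂ _,_ (same-Fin (cong proj₁ e)) (same-Fin (cong (λ p → proj₁ (proj₂ p)) e)))

     -- The left end is less than `n` and arcs have length at most `n`, so the other vertices are
     -- less than `n + n`, the bound of the search.
     locate : ∀ y b → Shape y → lo y < b → fin b ≺ hi y → b ≤ lo y + N → ∃ λ a → point a ≡ (lo y , b , hi y)
     locate (iv i k) (+ b) (i<n , _ , k≤n) _ (ℤ.+<+ b<) _ = inj₁ (fromℕ< i<n , fromℕ< (ℕP.<-trans b< c<) , fromℕ< c<) ,
         cong₂ _,_ (cong +_ (FinP.toℕ-fromℕ< i<n)) (cong₂ _,_ (cong +_ (FinP.toℕ-fromℕ< (ℕP.<-trans b< c<))) (cong (λ z → fin (+ z)) (FinP.toℕ-fromℕ< c<)))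
       where
       c< : i ℕ.+ k ℕ.< n ℕ.+ n
       c< = ℕP.+-mono-<-≤ i<n k≤n
     locate (rad i) (+ b) i<n _ _ (ℤ.+≤+ b≤) = inj₂ (fromℕ< i<n , fromℕ< b<) , cong₂ _,_ (cong +_ (FinP.toℕ-fromℕ< i<n)) (cong (λ z → (+ z , ∞)) (FinP.toℕ-fromℕ< b<))
       where
       b< : b ℕ.< n ℕ.+ n
       b< = ℕP.≤-<-trans b≤ (ℕP.+-monoˡ-< n i<n)

     located : ∀ q → ∃ λ a → point a ≡ (lo (O K (q ↑ˡ n)) , proj₁ (triOf q) , hi (O K (q ↑ˡ n)))
     located q = locate (O K (q ↑ˡ n)) (proj₁ (triOf q)) (shapeᵢ q) (Tri.e<u Δ) (Tri.u≺f Δ) (arc-len (Tri.a₁ Δ))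
       where
       Δ = proj₂ (triOf q)
       shapeᵢ = Triangulation.Ideal.shape (ideal K)

     t : Fin r → Index
     t q = proj₁ (located q)

     t-injective : ∀ {q q′} → t q ≡ t q′ → q ≡ q′
     t-injective {q} {q′} e = ↑-inj (label-unique (lo-on₀ (O K (q ↑ˡ n))) (subst₂ (On (O K (q′ ↑ˡ n))) (sym (cong proj₁ h)) (sym (cong (λ p → proj₂ (proj₂ p)) h)) (lo-on₀ (O K (q′ ↑ˡ n)))))
       where
       h = trans (sym (proj₂ (located q))) (trans (cong point e) (proj₂ (located q′)))

     found : ∀ q {u b w} → Tri u b w → lo (O K (q ↑ˡ n)) ≡ u → hi (O K (q ↑ˡ n)) ≡ w → ∀ a → point a ≡ (u , b , w) → t q ≡ a
     found q Δ refl refl a e = point-injective (t q) a (trans (proj₂ (located q)) (trans (cong (λ b → _ , b , _) (inner-unique (proj₂ (triOf q)) Δ)) (sym e)))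

     cond-true : ∀ {a b c d} → a ≡ true → b ≡ true → c ≡ true → d ≡ true → a ∧ b ∧ c ∧ d ≡ true
     cond-true refl refl refl refl = refl

     cond-true₃ : ∀ {a b c} → a ≡ true → b ≡ true → c ≡ true → a ∧ b ∧ c ≡ true
     cond-true₃ refl refl refl = refl

     -- At the puncture the search demands `b < a + n`. The excluded case `b = a + n` is the
     -- self-folded triangle.
     Δs-at : ∀ a {u b w} (Δ : Tri u b w) → point a ≡ (u , b , w) →
       Δs a ≡ (O K (lab (Tri.a₁ Δ)) , O K (lab (Tri.a₂ Δ)) , O K (lab (Tri.a₃ Δ))) ∷ [] ⊎ (Δs a ≡ [] × w ≡ ∞ × b ≡ u + N)
     Δs-at (inj₁ (x , y , z)) Δ refl = inj₁ (trans (cong (λ h → if h then (side a b , side b c , side a c) ∷ [] else [])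
           (cond-true (T⇒≡true (ℕP.<⇒<ᵇ a<b)) (T⇒≡true (ℕP.<⇒<ᵇ b<c)) (T⇒≡true (ℕP.≤⇒≤ᵇ c≤)) (cond-true (pr (Tri.a₁ Δ) s₁) (pr (Tri.a₂ Δ) s₂) (pr (Tri.a₃ Δ) s₃) refl)))
         (cong (_∷ []) (cong₂ _,_ (sym s₁) (cong₂ _,_ (sym s₂) (sym s₃)))))
       where
       a = toℕ x
       b = toℕ y
       c = toℕ z
       a<b : a ℕ.< b
       a<b = drop‿+<+ (Tri.e<u Δ)
       b<c : b ℕ.< c
       b<c = drop‿+<+ (Tri.u≺f Δ)
       c≤ : c ℕ.≤ a ℕ.+ n
       c≤ = drop‿+≤+ (arc-len (Tri.a₃ Δ))
       b< = FinP.toℕ<n y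
       a< = ℕP.<-trans a<b b<
       s₁ = label-eq (Tri.a₁ Δ) (side-small a< a<b (ℕP.≤-trans (ℕP.<⇒≤ b<c) c≤)) (side-on a< (ℕP.<⇒≤ a<b))
       s₂ = label-eq (Tri.a₂ Δ) (side-small b< b<c (ℕP.≤-trans c≤ (ℕP.+-monoˡ-≤ n (ℕP.<⇒≤ a<b)))) (side-on b< (ℕP.<⇒≤ b<c))
       s₃ = label-eq (Tri.a₃ Δ) (side-small a< (ℕP.<-trans a<b b<c) c≤) (side-on a< (ℕP.<⇒≤ (ℕP.<-trans a<b b<c)))
       pr : ∀ {u v y} (x : Arc u v) → O K (lab x) ≡ y → present′ y ≡ true
       pr x = present-complete (lab x)
     Δs-at (inj₂ (x , y)) Δ refl = go (ℕP.m≤n⇒m<n∨m≡n b≤)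
       where
       a = toℕ x
       b = toℕ y
       a<b : a ℕ.< b
       a<b = drop‿+<+ (Tri.e<u Δ)
       b≤ : b ℕ.≤ a ℕ.+ n
       b≤ = drop‿+≤+ (arc-len (Tri.a₁ Δ))
       b< = FinP.toℕ<n y
       a< = ℕP.<-trans a<b b<
       s₁ = label-eq (Tri.a₁ Δ) (side-small a< a<b b≤) (side-on a< (ℕP.<⇒≤ a<b))
       s₂ = label-eq (Tri.a₂ Δ) (proj₁ (red-spec b b<)) (rad-on b<)
       s₃ = label-eq {rad a} (Tri.a₃ Δ) (FinP.toℕ<n x) (on-rad 0ℤ (sym (+-identityʳ (+ a))))
       go : b ℕ.< a ℕ.+ n ⊎ b ≡ a ℕ.+ n → _
       go (inj₁ h) = inj₁ (trans (cong (λ h → if h then (side a b , rad (red b) , rad a) ∷ [] else [])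
           (cond-true₃ (T⇒≡true (ℕP.<⇒<ᵇ a<b)) (T⇒≡true (ℕP.<⇒<ᵇ h)) (cond-true (present-complete _ s₁) (present-complete _ s₂) (present-complete _ s₃) refl)))
         (cong (_∷ []) (cong₂ _,_ (sym s₁) (cong₂ _,_ (sym s₂) (sym s₃)))))
       go (inj₂ h) = inj₂ (cong (λ h → if h then (side a b , rad (red b) , rad a) ∷ [] else [])
           (trans (cong (λ v → (a <ᵇ b) ∧ (v ∧ (present′ (side a b) ∧ present′ (rad (red b)) ∧ present′ (rad a) ∧ true))) (BoolP.¬-not λ e → ℕP.<-irrefl h (ℕP.<ᵇ⇒< b (a ℕ.+ n) (≡true⇒T e)))) (BoolP.∧-zeroʳ (a <ᵇ b)))
         , refl , cong +_ h)

     -- A tuple that passes the tests bounds a triangle, and the long side of a triangle is never a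
     -- boundary segment; its position is the required `q`.
     onto : ∀ φ a → (∃ λ q → t q ≡ a) ⊎ sumOver φ (Δs a) ≡ 0ℤ
     onto φ (inj₁ (x , y , z)) with condF (toℕ x) (toℕ y) (toℕ z) in e
     ... | false = inj₂ refl
     ... | true = inj₁ (go (view (proj₁ p₃)) (proj₂ p₃))
       where
       a = toℕ x
       b = toℕ y
       c = toℕ z
       e₂ = proj₂ (∧-true {a <ᵇ b} e)
       e₃ = proj₂ (∧-true {b <ᵇ c} e₂)
       e₄ = proj₂ (∧-true {c ≤ᵇ a ℕ.+ n} e₃)
       e₅ = proj₂ (∧-true {present′ (side a b)} e₄)
       e₆ = proj₂ (∧-true {present′ (side b c)} e₅)
       a<b : a ℕ.< b
       a<b = ℕP.<ᵇ⇒< a b (≡true⇒T (proj₁ (∧-true e)))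
       b<c : b ℕ.< c
       b<c = ℕP.<ᵇ⇒< b c (≡true⇒T (proj₁ (∧-true e₂)))
       c≤ : c ℕ.≤ a ℕ.+ n
       c≤ = ℕP.≤ᵇ⇒≤ c (a ℕ.+ n) (≡true⇒T (proj₁ (∧-true e₃)))
       b< = FinP.toℕ<n y
       a< = ℕP.<-trans a<b b<
       a<c = ℕP.<-trans a<b b<c
       p₁ = present-sound (side a b) (side-small a< a<b (ℕP.≤-trans (ℕP.<⇒≤ b<c) c≤)) (proj₁ (∧-true e₄))
       p₂ = present-sound (side b c) (side-small b< b<c (ℕP.≤-trans c≤ (ℕP.+-monoˡ-≤ n (ℕP.<⇒≤ a<b)))) (proj₁ (∧-true e₅))
       p₃ = present-sound (side a c) (side-small a< a<c c≤) (proj₁ (∧-true e₆))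
       arc : ∀ {y u v} → (∃ λ ℓ → O K ℓ ≡ y) → On y u v → Arc u v
       arc {u = u} {v} (ℓ , h) on = ℓ , subst (λ y → On y u v) (sym h) on
       Δ : Tri (+ a) (+ b) (fin (+ c))
       Δ = mkTri (ℤ.+<+ a<b) (ℤ.+<+ b<c) (arc p₁ (side-on a< (ℕP.<⇒≤ a<b))) (arc p₂ (side-on b< (ℕP.<⇒≤ b<c))) (arc p₃ (side-on a< (ℕP.<⇒≤ a<c)))
       red-a : red a ≡ a
       red-a = cong (λ h → if h then a else a ℕ.∸ n) (T⇒≡true (ℕP.<⇒<ᵇ (FinP.toℕ<n x)))
       go : ∀ {ℓ} → View ℓ → O K ℓ ≡ side a c → ∃ λ q → t q ≡ inj₁ (x , y , z)
       go (arcˡ q) h = q , found q Δ (trans (cong lo h) (cong +_ red-a)) (trans (cong hi h) (cong (λ z → fin (+ z)) (trans (cong (ℕ._+ (c ℕ.∸ a)) red-a) (ℕP.m+[n∸m]≡n (ℕP.<⇒≤ a<c))))) (inj₁ (x , y , z)) refl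
       go (bdyˡ s) h = ⊥-elim (ℕP.<-irrefl (trans (len (trans (sym (labelArc-bdy n (idealOf n K) s)) h)) refl) (ℕP.≤-trans (ℕ.s≤s (ℕP.m<n⇒0<n∸m a<b)) (ℕP.∸-monoˡ-< b<c (ℕP.<⇒≤ a<b))))
         where
         len : ∀ {i j k l} → iv i k ≡ iv j l → k ≡ l
         len refl = refl
     onto φ (inj₂ (x , y)) with cond∞ (toℕ x) (toℕ y) in e
     ... | false = inj₂ refl
     ... | true = inj₁ (go (view (proj₁ p₃)) (proj₂ p₃))
       where
       a = toℕ x
       b = toℕ y
       e₂ = proj₂ (∧-true {a <ᵇ b} e)
       e₃ = proj₂ (∧-true {b <ᵇ a ℕ.+ n} e₂)
       e₄ = proj₂ (∧-true {present′ (side a b)} e₃)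
       e₅ = proj₂ (∧-true {present′ (rad (red b))} e₄)
       a<b : a ℕ.< b
       a<b = ℕP.<ᵇ⇒< a b (≡true⇒T (proj₁ (∧-true e)))
       b≤ : b ℕ.≤ a ℕ.+ n
       b≤ = ℕP.<⇒≤ (ℕP.<ᵇ⇒< b (a ℕ.+ n) (≡true⇒T (proj₁ (∧-true e₂))))
       b< = FinP.toℕ<n y
       a< = ℕP.<-trans a<b b<
       p₁ = present-sound (side a b) (side-small a< a<b b≤) (proj₁ (∧-true e₃))
       p₂ = present-sound (rad (red b)) (proj₁ (red-spec b b<)) (proj₁ (∧-true e₄))
       p₃ = present-sound (rad a) (FinP.toℕ<n x) (proj₁ (∧-true e₅))
       arc : ∀ {y u v} → (∃ λ ℓ → O K ℓ ≡ y) → On y u v → Arc u v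
       arc {u = u} {v} (ℓ , h) on = ℓ , subst (λ y → On y u v) (sym h) on
       Δ : Tri (+ a) (+ b) ∞
       Δ = mkTri (ℤ.+<+ a<b) tt (arc p₁ (side-on a< (ℕP.<⇒≤ a<b))) (arc p₂ (rad-on b<)) (arc p₃ (on-rad 0ℤ (sym (+-identityʳ (+ a)))))
       go : ∀ {ℓ} → View ℓ → O K ℓ ≡ rad a → ∃ λ q → t q ≡ inj₂ (x , y)
       go (arcˡ q) h = q , found q Δ (cong lo h) (cong hi h) (inj₂ (x , y)) refl
       go (bdyˡ s) h with trans (sym (labelArc-bdy n (idealOf n K) s)) h
       ... | ()

     oEq-label : ∀ ℓ ℓ′ → oEq (O K ℓ) (O K ℓ′) ≡ oEq (code ℓ) (code ℓ′)
     oEq-label ℓ ℓ′ with ℓ Fin.≟ ℓ′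
     ... | yes refl = trans (oEq-refl (O K ℓ)) (sym (oEq-code-refl ℓ))
     ... | no ne = trans (oEq-≢ λ e → ne (Triangulation.Ideal.O-inj (ideal K) e)) (sym (oEq-code-≢ ne))

     adj-labels : ∀ a b c x y → adj (O K a , O K b , O K c) (O K x) (O K y) ≡ adjF (a , b , c) x y
     adj-labels a b c x y = adj-cong {O K a} {O K b} {O K c} {code a} {code b} {code c} {O K x} {O K y} {code x} {code y}
       (oEq-label a x) (oEq-label b x) (oEq-label c x) (oEq-label a y) (oEq-label b y) (oEq-label c y)

     adj-folded : ∀ {s₁ s₂ x y} → oEq s₂ x ≡ false → oEq s₂ y ≡ false → adj (s₁ , s₂ , s₂) x y ≡ 0ℤ
     adj-folded {s₁} {s₂} {x} {y} h h′ rewrite h | h′ | BoolP.∧-zeroʳ (oEq s₁ x) | BoolP.∧-zeroʳ (oEq s₁ y) = refl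

     radius-ρ : ∀ {i σ pρ pλ} (eρ : lookup T pρ ≡ trad i σ) (eλ : lookup T pλ ≡ trad i (opp σ)) {q j} → q ≢ pλ → und (lookup T q) ≡ rad j → q ≡ pρ
     radius-ρ {i} {σ} {pρ} {pλ} eρ eλ {q} {j} ne e with lookup T q in eq
     ... | trad _ t with pair-radius eρ eλ eq | tag-cases σ t
     ...   | refl | inj₁ refl = T-inj (trans eq (sym eρ))
     ...   | refl | inj₂ refl = ⊥-elim (ne (T-inj (trans eq (sym eλ))))

     no-loop : ∀ {y u} → ValidT n y → ¬ On (und y) u (fin (u + N))
     no-loop {tiv i k} {u} (_ , _ , k<n) (on-iv _ _ e) = <-irrefl (lin≡ (sym e) (ar u (+ k) N)) (ℤ.+<+ k<n)
       where
       ar : ∀ u k N → k + (u + N) ≡ N + (u + k)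
       ar = solve-∀

     -- The radius inside a loop is never in the image of fold.
     folded : ∀ {q u} → Arc u (fin (u + N)) → On (O K (q ↑ˡ n)) u ∞ → ∀ i → fold K i ≢ q ↑ˡ n
     folded {q} {u} (ℓ , on) onq i = go K refl
       where
       go : ∀ K′ → K ≡ K′ → fold K i ≢ q ↑ˡ n
       go (one τ h) refl = ⊥-elim (loopless (ideal-view (one τ h) ℓ) on)
         where
         loopless : ∀ {y} → TaggedTriangulation.ArcView n 2≤n FT (one τ h) y → ¬ On y u (fin (u + N))
         loopless (realᵛ q′) x = no-loop {lookup T q′} (validT q′) x
         loopless (loop {i} {σ} _ eρ eλ) _ = opp-≢ σ (trans (h eλ) (sym (h eρ)))
         loopless (edge s) (on-iv _ _ e) = <-irrefl (lin≡ (sym e) (ar u 1ℤ N)) (<-≤-trans (ℤ.+<+ (ℕ.s≤s (ℕ.s≤s ℕ.z≤n))) 2≤N)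
           where
           ar : ∀ u k N → k + (u + N) ≡ N + (u + k)
           ar = solve-∀
       go (two i₀ σ pρ pλ eρ eλ) refl e = at (q Fin.≟ pλ)
         where
         at : Dec (q ≡ pλ) → ⊥
         at (yes refl) with subst (λ y → On y u ∞) (trans (labelArc-arc n (idealOf n K) pλ) (idealOf-λ eρ eλ)) onq
         ... | ()
         at (no ne) = avoid (i Fin.≟ (pρ ↑ˡ n))
           where
           rad-und : ∀ y → On y u ∞ → ∃ λ j → y ≡ rad j
           rad-und (rad j) _ = j , refl
           q≡ρ : q ≡ pρ
           q≡ρ = let j , h = rad-und (und (lookup T q)) (subst (λ y → On y u ∞) (trans (labelArc-arc n (idealOf n K) q) (idealOf-real eρ eλ ne)) onq) in radius-ρ eρ eλ ne h
           avoid : Dec (i ≡ pρ ↑ˡ n) → ⊥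
           avoid (yes refl) = ne (↑-inj (trans (sym e) (fold-ρ {n} {T = lookup T} {pρ = pρ} eρ eλ)))
           avoid (no ni) = ni (trans (sym (fold-≢ {n} {T = lookup T} {pρ = pρ} eρ eλ ni)) (trans e (cong (_↑ˡ n) q≡ρ)))

     -- At the self-folded triangle the search contributes an empty list. The term on the right is
     -- zero as well, since two of its three sides are the enclosed radius and no folded label
     -- equals it.
     value : ∀ i j q → sumOver (λ Δ → adj Δ (O K (fold K i)) (O K (fold K j))) (Δs (t q)) ≡ term i j q
     value i j q with Δs-at (t q) (proj₂ (triOf q)) (proj₂ (located q))
     ... | inj₁ e = trans (cong (sumOver φ) e) (trans (+-identityʳ _) (trans (cong (λ z → φ (O K (L₁ q) , O K (L₂ q) , O K z)) (own-lab q)) (adj-labels (L₁ q) (L₂ q) (q ↑ˡ n) (fold K i) (fold K j))))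
       where
       φ = λ Δ → adj Δ (O K (fold K i)) (O K (fold K j))
     ... | inj₂ (e , ew , eb) = trans (cong (sumOver (λ Δ → adj Δ (O K (fold K i)) (O K (fold K j)))) e) (sym (trans (cong (λ z → adjF (L₁ q , z , q ↑ˡ n) (fold K i) (fold K j)) L₂≡)
         (adj-folded {code (L₁ q)} {code (q ↑ˡ n)} {code (fold K i)} {code (fold K j)} (oEq-code-≢ λ h → avoid i (sym h)) (oEq-code-≢ λ h → avoid j (sym h)))))
       where
       u = lo (O K (q ↑ˡ n))
       onq : On (O K (q ↑ˡ n)) u ∞
       onq = subst (On (O K (q ↑ˡ n)) u) ew (lo-on₀ (O K (q ↑ˡ n)))
       avoid = folded {q} {u} (subst (λ b → Arc u (fin b)) eb (Tri.a₁ (proj₂ (triOf q)))) onq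
       L₂≡ : L₂ q ≡ q ↑ˡ n
       L₂≡ = label-unique (subst₂ (On (O K (L₂ q))) eb ew (proj₂ (Tri.a₂ (proj₂ (triOf q))))) (subst (λ z → On (O K (q ↑ˡ n)) z ∞) (cong (λ z → u + z) (*-identityˡ N)) (on-shift 1ℤ onq))

     πT-fold : ∀ ℓ → πT n I (O K ℓ) ≡ O K (fold K ℓ)
     πT-fold ℓ = go K refl
       where
       keep : ∀ y → (∀ {j} → y ≡ rad j → memO (iv j n) I ≢ true) → πT n I y ≡ y
       keep (iv _ _) _ = refl
       keep (rad j) h = cong (λ b → if b then iv j n else rad j) (BoolP.¬-not (h refl))
       go : ∀ K′ → K ≡ K′ → πT n I (O K ℓ) ≡ O K (fold K ℓ)
       go (one τ h) refl = keep (O K ℓ) λ {j} _ m → let q , e = mem-sound (iv j n) m in und-loop {lookup T q} (validT q) (trans (sym (labelArc-arc n (idealOf n K) q)) e)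
       go (two i σ pρ pλ eρ eλ) refl with ℓ Fin.≟ (pρ ↑ˡ n)
       ... | yes refl = trans (cong (πT n I) Oρ) (trans (cong (λ b → if b then iv i n else rad i) (mem-complete pλ Oλ)) (trans (sym Oλ) (cong (O K) (sym (fold-ρ {n} {T = lookup T} {pρ = pρ} eρ eλ)))))
         where
         Oλ : O K (pλ ↑ˡ n) ≡ iv i n
         Oλ = trans (labelArc-arc n (idealOf n K) pλ) (idealOf-λ eρ eλ)
         Oρ : O K (pρ ↑ˡ n) ≡ rad i
         Oρ = trans (labelArc-arc n (idealOf n K) pρ) (trans (idealOf-real eρ eλ (λ≢ρ eρ eλ)) (cong und eρ))
       ... | no ne = trans (keep (O K ℓ) λ e _ → other (view ℓ) ne e) (cong (O K) (sym (fold-≢ {n} {T = lookup T} {pρ = pρ} eρ eλ ne)))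
         where
         other : ∀ {ℓ j} → View ℓ → ℓ ≢ pρ ↑ˡ n → O K ℓ ≢ rad j
         other (bdyˡ s) _ e with trans (sym (labelArc-bdy n (idealOf n K) s)) e
         ... | ()
         other (arcˡ q) nq e with q Fin.≟ pλ
         ... | no nλ = nq (cong (_↑ˡ n) (radius-ρ eρ eλ nλ (trans (sym (trans (labelArc-arc n (idealOf n K) q) (idealOf-real eρ eλ nλ))) e)))
         ... | yes refl with trans (sym (trans (labelArc-arc n (idealOf n K) q) (idealOf-λ eρ eλ))) e
         ...   | ()

   matrix : ∀ i j → exchangeMatrix n T i j ≡ Bg i (j ↑ˡ n)
   matrix i j = trans (cong₂ (λ x y → sumOver (λ Δ → adj Δ (πT n I x) (πT n I y)) (triangles n I)) row (trans (ideal-≡ j) (sym (labelArc-arc n (idealOf n K) j))))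
       (trans (cong₂ (λ x y → sumOver (λ Δ → adj Δ x y) (triangles n I)) (πT-fold i) (πT-fold (j ↑ˡ n)))
       (trans (triangle-sum φ) (trans (reindex indices t t-injective (λ a → sumOver φ (Δs a)) (onto φ)) (Sum-cong (value i (j ↑ˡ n))))))
     where
     φ = λ Δ → adj Δ (O K (fold K i)) (O K (fold K (j ↑ˡ n)))
     row : [ (λ q → idealArc n T (lookup T q)) , (λ s → iv (toℕ s) 1) ]′ (splitAt r i) ≡ O K i
     row with splitAt r i
     ... | inj₁ q = ideal-≡ q
     ... | inj₂ s = refl

-- Emptiness against crossings

module Conclusion where
 open IntegerInequalities
 open UniversalCover hiding (lt; gt; eq)
 open IdealTriangulations
 open Crossings
 open TaggedTriangulations
 open Rotations
 open ExchangeMatrices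
 open RingIdentities
 open LaurentPolynomials
 open Cancellation
 open NewtonPolytopes
 open LaurentNewtonPolytopes
 open DecoratedVectors
 open LaurentExpansions
 open RationalExpressions
 open ArcValues
 open SeedMutation
 open InitialSeed
 open import Data.Bool using (if_then_else_)
 open import Data.Nat using (ℕ)
 open import Data.Integer using (ℤ; +_; _+_; _*_; -_; _≤_; _<_; 1ℤ)
 open import Data.Integer.Properties hiding (_≟_)
 open import Data.Integer.Tactic.RingSolver using (solve; solve-∀)
 open import Data.Fin using (Fin; _↑ˡ_; _↑ʳ_; splitAt)
 open import Data.List using (List; []; _∷_; length; lookup)
 open import Data.List.Membership.Propositional using (_∈_)
 open import Data.List.Membership.Propositional.Properties using (∈-lookup; ∈-map⁺; ∈-map⁻)
 import Data.List.Relation.Unary.Any as Any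
 import Data.List.Relation.Unary.Any.Properties as AnyP
 open import Data.Vec as V using (Vec)
 import Data.Vec.Properties as VecP
 open import Function.Bundles using (_⇔_; mk⇔)

 NewtonEmpty-≃ : ∀ {m} {P Q : LPoly m} → P ≃ Q → NewtonEmpty P → NewtonEmpty Q
 NewtonEmpty-≃ {P = P} {Q} h empty p hull = InHull-mono to (proj₁ v) ,
     λ { (y , z , t , hy , hz , rest) → proj₂ v (y , z , t , InHull-mono from hy , InHull-mono from hz , rest) }
   where
   to : ∀ {e} → Supp P e → Supp Q e
   to {e} s = subst (_≢ + 0) (h e) s
   from : ∀ {e} → Supp Q e → Supp P e
   from {e} s = subst (_≢ + 0) (sym (h e)) s
   v = empty p (InHull-mono from hull)

 module Criterion (n : ℕ) (2≤n : 2 ℕ.≤ n) {r : ℕ} {O : Fin (r ℕ.+ n) → OArc} (I : Triangulation.Ideal n 2≤n r O)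
   (mon : Fin (r ℕ.+ n) → Mon (r ℕ.+ n)) (W : ℕ → Vec ℤ (r ℕ.+ n)) (dot-W : ∀ i ℓ → dot (W i) (mon ℓ) ≡ leftDeg i (O ℓ)) where

   open Cover n 2≤n
   open CrossingNumber n 2≤n
   open Triangulation n 2≤n hiding (Ideal)
   open Triangles I
   open LaurentExpansion (grading n 2≤n I mon W dot-W)

   private
     shift-unique : ∀ z x s t → z ≤ x + s * N → x + s * N < z + N → z ≤ x + t * N → x + t * N < z + N → s ≡ t
     shift-unique z x s t a b c d = i-j≡0⇒i≡j s t (mult-small {n} (s ℤ.- t) ((s ℤ.- t) * N) refl (ar₁ z x s t N b c) (ar₂ z x s t N a d))
       where
       ar₁ : ∀ z x s t N → x + s * N < z + N → z ≤ x + t * N → (s ℤ.- t) * N < N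
       ar₁ z x s t N b c = by< λ k → absurd≤ 0 (s≤ b ⊕ c ⊕ k) (solve (z ∷ x ∷ s ∷ t ∷ N ∷ []))
       ar₂ : ∀ z x s t N → z ≤ x + s * N → x + t * N < z + N → - N < (s ℤ.- t) * N
       ar₂ z x s t N a d = by< λ k → absurd≤ 0 (a ⊕ s≤ d ⊕ k) (solve (z ∷ x ∷ s ∷ t ∷ N ∷ []))

   -- A lift meeting a good arc stays between two consecutive lifts of a radius.
   good-once : ∀ {i k} → Good (+ i) (+ (i ℕ.+ k)) → ∀ ℓ → crossO n (iv i k) (O ℓ) ℕ.≤ 1
   good-once {i} {k} (z , bz , w≤ , z≤) ℓ = crossO-≤1 λ s t ne x y → ne (unique (at s x) (at t y))
     where
     Inside : ℤ → Set
     Inside t = z ≤ lo (O ℓ) + t * N × lo (O ℓ) + t * N < z + N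
     at : ∀ t → CrossL (iv i k) (O ℓ) t → Inside t
     at t x = go (sh t (hi (O ℓ))) (ℓ , lo-on (O ℓ) t) x
       where
       go : ∀ b → Arc (lo (O ℓ) + t * N) b → Crosses (+ i) (fin (+ (i ℕ.+ k))) (lo (O ℓ) + t * N) b → Inside t
       go b ab (inj₁ (u<a , a<w , _)) = ≤-trans z≤ (<⇒≤ u<a) , <-≤-trans a<w w≤
       go (fin b) ab (inj₂ (a<u , u<b , b<w)) = by≤ (λ a<z → not-under bz ab a<z (≤-<-trans z≤ u<b)) , <-trans a<u (<-≤-trans (<-trans u<b b<w) w≤)
     unique : ∀ {s t} → Inside s → Inside t → s ≡ t
     unique {s} {t} (a , b) (c , d) = shift-unique z (lo (O ℓ)) s t a b c d

   radius-once : ∀ {i j k} → k ℕ.≤ n → crossO n (iv j k) (rad i) ℕ.≤ 1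
   radius-once {i} {j} {k} k≤n = crossO-≤1 {j} {k} {rad i} λ { s t ne (inj₁ (a , b , _)) (inj₁ (c , d , _)) → ne (shift-unique (+ j) (+ i) s t (<⇒≤ a) (lift b) (<⇒≤ c) (lift d)) }
     where
     lift : ∀ {x} → x < + (j ℕ.+ k) → x < + j + N
     lift h = <-≤-trans h (ℤ.+≤+ (ℕP.+-monoʳ-≤ j k≤n))

   radius-all : ∀ i y → Small y → crossO n (rad i) y ℕ.≤ 1
   radius-all i (iv j k) (_ , _ , k≤n) = radius-once k≤n
   radius-all i (rad j) _ = ℕ.z≤n

   data Verdict (i k : ℕ) : Set where
     good : Good (+ i) (+ (i ℕ.+ k)) → Verdict i k
     bad  : ¬ NewtonEmpty (P oneL (+ i) (fin (+ (i ℕ.+ k)))) → (∃ λ q → ¬ (crossO n (iv i k) (O (q ↑ˡ n)) ℕ.≤ 1)) → Verdict i k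

   verdict : ∀ {i k} → i ℕ.< n → 2 ℕ.≤ k → k ℕ.< n → Verdict i k
   verdict {i} {k} i<n 2≤k k<n with slot (+ i)
   ... | s , t , Δ , s≤u , u<t with (+ (i ℕ.+ k)) ≤? (s + N)
   ...   | yes w≤ = good (s , Tri.a₃ Δ , w≤ , s≤u)
   -- The arc extends beyond the translate `s + N`, so `w - N` falls strictly between `s` and `u`,
   -- as `Strip.nonempty` requires.
   ...   | no w≰ = bad (subst (λ z → ¬ NewtonEmpty (P oneL u (fin z))) (v+N w N) (Strip.nonempty Δ s<v v<u u<t)) (double (view ℓ) (proj₂ (Tri.a₁ Δ)))
     where
     u w : ℤ
     u = + i
     w = + (i ℕ.+ k)
     ℓ = proj₁ (Tri.a₁ Δ)
     s+N<w : s + N < w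
     s+N<w = ≰⇒> w≰
     w<u+N : w < u + N
     w<u+N = ℤ.+<+ (ℕP.+-monoʳ-< i k<n)
     v+N : ∀ w N → w ℤ.- N + 1ℤ * N ≡ w
     v+N = solve-∀
     s<v : s < w ℤ.- N
     s<v = ar s w N s+N<w
       where
       ar : ∀ s w N → s + N < w → s < w ℤ.- N
       ar s w N h = by< λ k → absurd≤ 0 (s≤ h ⊕ k) (solve (s ∷ w ∷ N ∷ []))
     v<u : w ℤ.- N < u
     v<u = ar u w N w<u+N
       where
       ar : ∀ u w N → w < u + N → w ℤ.- N < u
       ar u w N h = by< λ k → absurd≤ 0 (s≤ h ⊕ k) (solve (u ∷ w ∷ N ∷ []))
     s<u = <-trans s<v v<u
     t≤s+N = arc-len (Tri.a₁ Δ)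
     double : ∀ {ℓ} → View ℓ → On (O ℓ) s (fin t) → ∃ λ q → ¬ (crossO n (iv i k) (O (q ↑ˡ n)) ℕ.≤ 1)
     double (bdyˡ b) on = ⊥-elim (short (subst (λ y → On y s (fin t)) (Triangulation.Ideal.bnd I b) on))
       where
       short : ∀ {i} → On (iv i 1) s (fin t) → ⊥
       short (on-iv _ _ e) = ar s u t e s<u u<t
         where
         ar : ∀ s u t → t ≡ s + 1ℤ → s < u → u < t → ⊥
         ar s u t e a b = absurd≤ 0 (s≤ a ⊕ s≤ b ⊕ ≡⇒≤ e) (solve (s ∷ u ∷ t ∷ []))
     double (arcˡ q) on with on-lo on
     -- One crossing is with `[s , t]`, which passes over `u`; the other is with its translate by
     -- `N`, which passes over `w`.
     ... | m , refl , et = q , crossO-≥2 {s = m} {m + 1ℤ} (i<n , ℕP.≤-trans (ℕ.s≤s ℕ.z≤n) 2≤k , ℕP.<⇒≤ k<n) (small (q ↑ˡ n)) (m≢1+m m)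
         (subst (Crosses u (fin w) s) et (inj₂ (s<u , u<t , ≤-<-trans t≤s+N s+N<w)))
         (subst₂ (Crosses u (fin w)) (ar s₀ m N) (trans (cong (λ z → fin z) (ar′ t N)) (trans (cong (sh 1ℤ) et) (shsh (hi (O (q ↑ˡ n)))))) (inj₁ (<-≤-trans u<t t≤s+N , s+N<w , <-trans w<u+N (+-monoˡ-< N u<t))))
       where
       s₀ = lo (O (q ↑ˡ n))
       m≢1+m : ∀ m → m ≢ m + 1ℤ
       m≢1+m m e = <-irrefl refl (subst (_< m + 1ℤ) e (<-ar m))
         where
         <-ar : ∀ m → m < m + 1ℤ
         <-ar m = by< λ k → absurd≤ 0 k (solve (m ∷ []))
       ar : ∀ s₀ m N → s₀ + m * N + N ≡ s₀ + (m + 1ℤ) * N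
       ar = solve-∀
       ar′ : ∀ t N → t + N ≡ t + 1ℤ * N
       ar′ = solve-∀
       shsh : ∀ v → sh 1ℤ (sh m v) ≡ sh (m + 1ℤ) v
       shsh ∞ = refl
       shsh (fin v) = cong fin (ar″ v m N)
         where
         ar″ : ∀ v m N → v + m * N + 1ℤ * N ≡ v + (m + 1ℤ) * N
         ar″ = solve-∀

   P-good : ∀ {i k} → k ℕ.≤ n → Good (+ i) (+ (i ℕ.+ k)) → SE (Supp (P oneL (+ i) (fin (+ (i ℕ.+ k)))))
   P-good {i} {k} k≤n g = SE-P (vert (+ i)) (vert (+ (i ℕ.+ k))) (ℤ.+≤+ (ℕP.m≤m+n i k)) (ℤ.+≤+ (ℕP.+-monoʳ-≤ i k≤n)) g

 tagᴷ : ∀ {r} {T : Fin r → TArc} → Kind T → Tag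
 tagᴷ (one τ _) = τ
 tagᴷ (two _ σ _ _ _ _) = σ

 -- The radii of the initial triangulation have λ-length x, those with the other tag c·x.
 weight : ∀ {m} → Tag → LPoly m → Tag → LPoly m
 weight plain c plain = oneL
 weight plain c notched = c
 weight notched c plain = c
 weight notched c notched = oneL

 weight-own : ∀ {m} τ (c : LPoly m) → weight τ c τ ≡ oneL
 weight-own plain c = refl
 weight-own notched c = refl

 weight-cases : ∀ {m} τ (c : LPoly m) σ → weight τ c σ ≡ oneL ⊎ weight τ c σ ≡ c
 weight-cases plain c plain = inj₁ refl
 weight-cases plain c notched = inj₂ refl
 weight-cases notched c plain = inj₂ refl
 weight-cases notched c notched = inj₁ refl

 weight-opp : ∀ {m} τ (c : LPoly m) σ → (weight τ c σ *L weight τ c (opp σ)) ≃ c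
 weight-opp {m} plain c plain = *L-identityˡ c
 weight-opp {m} plain c notched = CommutativeRing.*-identityʳ (LRing m) c
 weight-opp {m} notched c plain = CommutativeRing.*-identityʳ (LRing m) c
 weight-opp {m} notched c notched = *L-identityˡ c

 factor : ∀ {m} (A B : LPoly m) s t → (A *L B) ≃ mono (s ⊞ t) → B ≃ mono t → A ≃ mono s
 factor A B s t h hB = PosL-cancel (mono t) A (mono s) (PosL-mono t) (≃-trans {P = A *L mono t} {A *L B} {mono (s ⊞ t)}
   (*L-cong {P = A} {A} {mono t} {B} (≃-refl {P = A}) (≃-sym {P = B} {mono t} hB)) h)

 -- The loop of a self-folded triangle is the product of its two tagged radii.
 module Coordinates {r n : ℕ} {T : Fin r → TArc} (K : Kind T) (O : Fin (r ℕ.+ n) → OArc) where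
   Splits : Kind T → Fin (r ℕ.+ n) → Mon (r ℕ.+ n)
   Splits (one _ _) ℓ = unit ℓ
   Splits (two _ _ pρ pλ _ _) ℓ with ℓ Fin.≟ (pλ ↑ˡ n)
   ... | yes _ = unit ℓ ⊞ unit (pρ ↑ˡ n)
   ... | no _ = unit ℓ

   Splits-λ : ∀ {i σ pρ pλ} (eρ : T pρ ≡ trad i σ) (eλ : T pλ ≡ trad i (opp σ)) → Splits (two i σ pρ pλ eρ eλ) (pλ ↑ˡ n) ≡ unit (pλ ↑ˡ n) ⊞ unit (pρ ↑ˡ n)
   Splits-λ {pλ = pλ} eρ eλ with (pλ ↑ˡ n) Fin.≟ (pλ ↑ˡ n)
   ... | yes _ = refl
   ... | no ne = ⊥-elim (ne refl)

   Splits-≢ : ∀ {i σ pρ pλ} (eρ : T pρ ≡ trad i σ) (eλ : T pλ ≡ trad i (opp σ)) {ℓ} → ℓ ≢ pλ ↑ˡ n → Splits (two i σ pρ pλ eρ eλ) ℓ ≡ unit ℓ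
   Splits-≢ {pλ = pλ} eρ eλ {ℓ} ne with ℓ Fin.≟ (pλ ↑ˡ n)
   ... | yes e = ⊥-elim (ne e)
   ... | no _ = refl

   mon : Fin (r ℕ.+ n) → Mon (r ℕ.+ n)
   mon = Splits K

   -- The exponent of a loop is the sum of two coordinate vectors, so the weight of the enclosed
   -- radius is subtracted in advance at the coordinate of the loop.
   degree : Kind T → ℕ → Fin (r ℕ.+ n) → ℤ
   degree (one _ _) i ℓ = leftDeg i (O ℓ)
   degree (two _ _ pρ pλ _ _) i ℓ with ℓ Fin.≟ (pλ ↑ˡ n)
   ... | yes _ = leftDeg i (O ℓ) ℤ.- leftDeg i (O (pρ ↑ˡ n))
   ... | no _ = leftDeg i (O ℓ)

   W : ℕ → Vec ℤ (r ℕ.+ n)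
   W i = V.tabulate (degree K i)

   dot-W : (∀ {i σ pρ pλ eρ eλ} → K ≡ two i σ pρ pλ eρ eλ → pρ ≢ pλ) → ∀ i ℓ → dot (W i) (mon ℓ) ≡ leftDeg i (O ℓ)
   dot-W ne i ℓ = go K refl
     where
     at : ∀ ℓ → dot (W i) (unit ℓ) ≡ degree K i ℓ
     at ℓ = trans (dot-unit (W i) ℓ) (VecP.lookup∘tabulate (degree K i) ℓ)
     go : ∀ K′ → K ≡ K′ → dot (W i) (mon ℓ) ≡ leftDeg i (O ℓ)
     go (one _ _) refl = at ℓ
     go (two i₀ σ pρ pλ eρ eλ) refl with ℓ Fin.≟ (pλ ↑ˡ n) | at ℓ
     ... | no _ | h = h
     ... | yes _ | h = trans (dot-⊞ (W i) (unit ℓ) (unit (pρ ↑ˡ n))) (trans (cong₂ _+_ h ρ-degree) (cancel (leftDeg i (O ℓ)) (leftDeg i (O (pρ ↑ˡ n)))))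
       where
       cancel : ∀ x y → x ℤ.- y + y ≡ x
       cancel = solve-∀
       ρ-degree : dot (W i) (unit (pρ ↑ˡ n)) ≡ leftDeg i (O (pρ ↑ˡ n))
       ρ-degree with (pρ ↑ˡ n) Fin.≟ (pλ ↑ˡ n) | at (pρ ↑ˡ n)
       ... | yes e | _ = ⊥-elim (ne refl (FinP.↑ˡ-injective n pρ pλ e))
       ... | no _ | h = h

 switch-involutive : ∀ y → switch (switch y) ≡ y
 switch-involutive (tiv _ _) = refl
 switch-involutive (trad _ plain) = refl
 switch-involutive (trad _ notched) = refl

 switch-trad : ∀ i t → switch (trad i t) ≡ trad i (opp t)
 switch-trad i plain = refl
 switch-trad i notched = refl

 module Initially (n : ℕ) (2≤n : 2 ℕ.≤ n) (T : List TArc) (FT : Triang n (lookup T)) (K : Kind (lookup T))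
   (plainly : InitialKind.Plainly n 2≤n T FT K) where
   open Cover n 2≤n
   open TaggedTriangulation n 2≤n FT
   open InitialKind n 2≤n T FT

   open Coordinates {n = n} K (O K) using (Splits; Splits-λ; Splits-≢; mon; W) renaming (dot-W to dot-W′)

   dot-W : ∀ i ℓ → dot (W i) (mon ℓ) ≡ leftDeg i (O K ℓ)
   dot-W = dot-W′ λ { {eρ = eρ} {eλ} _ → λ≢ρ eρ eλ }

   module C = Criterion n 2≤n (ideal K) mon W dot-W
   open LaurentExpansion (grading n 2≤n (ideal K) mon W dot-W) using (c; P; P-∞; P-arc; xV; xV-base; mono-inv; SE-xV; SE-cxV)

   κ : Tag → LPoly (length T ℕ.+ n)
   κ = weight (tagᴷ K) c

   private
     M M⁻ : Fin (length T ℕ.+ n) → LPoly (length T ℕ.+ n)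
     M ℓ = mono (mon ℓ)
     M⁻ ℓ = mono (⊟ mon ℓ)

     values : Setup
     values = setup n 2≤n (ideal K) (LRing _) (LHom _) M M⁻ mono-inv κ (weight-opp (tagᴷ K) c)
     seeds : SeedSetup
     seeds = seed-setup n 2≤n (ideal K) (LHom _) M M⁻ mono-inv κ (weight-opp (tagᴷ K) c)

   open ClusterValues values
   open SeedValues seeds
   open AtTriangulation FT

   private
     κof-tag : ∀ (K′ : Kind (lookup T)) → κof K′ ≡ κ (tagᴷ K′)
     κof-tag (one _ _) = refl
     κof-tag (two _ _ _ _ _ _) = refl

     κof-K : κof K ≡ oneL
     κof-K = trans (κof-tag K) (weight-own (tagᴷ K) c)

     P-own : ∀ ℓ {u v} → On (O K ℓ) u v → P oneL u v ≃ M ℓ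
     P-own ℓ {u} {fin v} on = P-arc oneL (ℓ , on)
     P-own ℓ {u} {∞} on = ≃-trans {P = P oneL u ∞} {oneL *L xV u} {M ℓ} (P-∞ oneL u)
       (≃-trans {P = oneL *L xV u} {xV u} {M ℓ} (*L-identityˡ (xV u)) (≃-reflexive (xV-base (ℓ , on))))

     Val-own : ∀ ℓ → Val K ℓ ≃ M ℓ
     Val-own ℓ = ≃-trans {P = Val K ℓ} {P oneL (lo (O K ℓ)) (hi (O K ℓ))} {M ℓ}
       (subst (λ k → Val K ℓ ≃ P k (lo (O K ℓ)) (hi (O K ℓ))) κof-K (val-P K ℓ (lo-on₀ (O K ℓ)))) (P-own ℓ (lo-on₀ (O K ℓ)))
       where open CrossingNumber n 2≤n using (lo-on₀)

     -- For a pair of radii the λ-length of the loop only determines their product; cancelling the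
     -- variable of the enclosed radius leaves that of the other.
     V-from : ∀ K′ → (∀ {i σ pρ pλ eρ eλ} → K′ ≡ two i σ pρ pλ eρ eλ → pρ ≢ pλ) → (∀ ℓ → Val K′ ℓ ≃ mono (Splits K′ ℓ)) → ∀ ℓ → V (lookup T) ℓ ≃ varL ℓ
     V-from (one _ _) _ h ℓ = h ℓ
     V-from (two i σ pρ pλ eρ eλ) ne h = λ ℓ → go ℓ (ℓ Fin.≟ (pλ ↑ˡ n))
       where
       other : ∀ {ℓ} → ℓ ≢ pλ ↑ˡ n → V (lookup T) ℓ ≃ varL ℓ
       other {ℓ} nλ = subst₂ _≃_ (Val-≢ eρ eλ nλ) (cong mono (Splits-≢ eρ eλ nλ)) (h ℓ)
       go : ∀ ℓ → Dec (ℓ ≡ pλ ↑ˡ n) → V (lookup T) ℓ ≃ varL ℓ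
       go ℓ (no nλ) = other nλ
       go ℓ (yes refl) = factor (V (lookup T) (pλ ↑ˡ n)) (V (lookup T) (pρ ↑ˡ n)) (unit (pλ ↑ˡ n)) (unit (pρ ↑ˡ n))
         (subst₂ _≃_ (Val-λ eρ eλ) (cong mono (Splits-λ eρ eλ)) (h (pλ ↑ˡ n))) (other λ e → ne refl (FinP.↑ˡ-injective n pρ pλ e))

     V-var : ∀ ℓ → V (lookup T) ℓ ≃ varL ℓ
     V-var = V-from K (λ { {eρ = eρ} {eλ} _ → λ≢ρ eρ eλ }) Val-own

     boundary : ∀ s → Bd s ≃ varL (length T ↑ʳ s)
     boundary s = subst (_≃ varL (length T ↑ʳ s)) (cong [ (λ q → E (lookup T q)) , Bd ]′ (FinP.splitAt-↑ʳ (length T) n s)) (V-var (length T ↑ʳ s))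

     initially : Inv (initialSeed n T) (lookup T)
     initially = record
       { FT = FT
       ; B-ok = λ K′ i j → trans (InitialMatrix.matrix n 2≤n T FT K (idealArc-≡ plainly) i j) (Relabelling.Bg-kind n 2≤n FT K′ K i (j ↑ˡ n))
       ; X-ok = λ q → repr-≃ {v = varL (q ↑ˡ n)} {w = E (lookup T q)} (≃-sym {P = E (lookup T q)} {varL (q ↑ˡ n)} (subst (_≃ varL (q ↑ˡ n)) (V-arc (lookup T) q) (V-var (q ↑ˡ n)))) (repr-mono (unit (q ↑ˡ n))) }

   -- The given `L` and the λ-length agree after multiplication by the denominator, which is
   -- positive and can be cancelled.
   expansion : ∀ {ps T′} → FlipPath n (lookup T) ps T′ → ∀ p L → IsLaurentExpansion L (Seed.X (mutateAlong (initialSeed n T) ps) p) → L ≃ E (T′ p)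
   expansion {ps} {T′} path p L h = PosL-cancel (proj₂ F) L (E (T′ p)) den (≃-trans {P = L *L proj₂ F} {proj₁ F} {E (T′ p) *L proj₂ F} h frac)
     where
     F = Seed.X (mutateAlong (initialSeed n T) ps) p
     open Repr (Inv.X-ok (inv-path boundary initially path) p)

   radius-empty : ∀ i t L → L ≃ E (trad i t) → NewtonEmpty L
   radius-empty i t L h = SE⇒NewtonEmpty L (SE-≃ {P = L} {E (trad i t)} h (go (weight-cases (tagᴷ K) c t)))
     where
     go : κ t ≡ oneL ⊎ κ t ≡ c → SE (Supp (κ t *L xV (+ i)))
     go (inj₁ e) = subst (λ k → SE (Supp (k *L xV (+ i)))) (sym e) (SE-xV (+ i))
     go (inj₂ e) = subst (λ k → SE (Supp (k *L xV (+ i)))) (sym e) (SE-cxV (+ i))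

   notched-empty : ∀ γ L → L ≃ E γ → IsNotched γ → NewtonEmpty L
   notched-empty (trad i notched) L h _ = radius-empty i notched L h

   criterion : ∀ γ → ValidT n γ → ∀ L → L ≃ E γ → NewtonEmpty L ⇔ (∀ q → crossO n (und γ) (O K (q ↑ˡ n)) ℕ.≤ 1)
   -- For a radius both sides always hold: an arc spans at most one period and so crosses it at most
   -- once.
   criterion (trad i t) _ L h = mk⇔ (λ _ q → C.radius-all i (O K (q ↑ˡ n)) (Triangulation.Triangles.small n 2≤n (ideal K) (q ↑ˡ n))) (λ _ → radius-empty i t L h)
   criterion (tiv i k) (i<n , 2≤k , k<n) L h = go (C.verdict i<n 2≤k k<n)
     where
     go : C.Verdict i k → NewtonEmpty L ⇔ (∀ q → crossO n (iv i k) (O K (q ↑ˡ n)) ℕ.≤ 1)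
     go (C.good g) = mk⇔ (λ _ q → C.good-once g (q ↑ˡ n)) (λ _ → SE⇒NewtonEmpty L (SE-≃ {P = L} {E (tiv i k)} h (C.P-good (ℕP.<⇒≤ k<n) g)))
     go (C.bad ne (q , twice)) = mk⇔ (λ empty → ⊥-elim (ne (NewtonEmpty-≃ {P = L} {E (tiv i k)} h empty))) (λ once → ⊥-elim (twice (once q)))

   private
     index : ∀ {α} → α ∈ T → ∃ λ q → lookup T q ≡ α
     index α∈ = Any.index α∈ , sym (AnyP.lookup-index α∈)

     at-index : ∀ {α q} → lookup T q ≡ α → α ∈ T
     at-index {q = q} e = subst (_∈ T) e (∈-lookup {xs = T} q)

   two-selfdual : ∀ {i σ pρ pλ} → lookup T pρ ≡ trad i σ → lookup T pλ ≡ trad i (opp σ) → SelfDual T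
   two-selfdual {i} {σ} {pρ} {pλ} eρ eλ γ = mk⇔ (λ γ∈ → subst (_∈ (T ᵖ)) (switch-involutive γ) (∈-map⁺ switch (closed γ γ∈)))
       (λ γ∈ → let y , y∈ , e = ∈-map⁻ switch γ∈ in subst (_∈ T) (sym e) (closed y y∈))
     where
     closed : ∀ y → y ∈ T → switch y ∈ T
     closed (tiv _ _) y∈ = y∈
     closed (trad j t) y∈ with index y∈
     ... | q , e with pair-radius eρ eλ e | tag-cases σ t
     ...   | refl | inj₁ refl = subst (_∈ T) (sym (switch-trad i σ)) (at-index eλ)
     ...   | refl | inj₂ refl = subst (_∈ T) (sym (trans (switch-trad i (opp σ)) (cong (trad i) (opp-opp σ)))) (at-index eρ)

   -- Some vertex carries a radius, because the left end of a longest arc lies under no arc.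
   -- Self-duality would add its other tag.
   one-not-selfdual : ∀ {τ} → (∀ {q i t} → lookup T q ≡ trad i t → t ≡ τ) → ¬ SelfDual T
   one-not-selfdual {τ} h dual = clash (has-radius (Triangulation.Triangles.radius n 2≤n (ideal (one τ h))))
     where
     open import Function.Bundles using (Equivalence)
     has-radius : ∃ (Triangulation.Triangles.Base n 2≤n (ideal (one τ h))) → ∃ λ q → ∃₂ λ i t → lookup T q ≡ trad i t
     has-radius (z , ℓ , on) with splitAt (length T) ℓ | on
     ... | inj₁ q | on′ with lookup T q in e | on′
     ...   | trad i t | _ = q , i , t , e
     clash : (∃ λ q → ∃₂ λ i t → lookup T q ≡ trad i t) → ⊥
     clash (q , i , t , e) = opp-≢ t (trans (h (proj₂ other)) (sym (h e)))
       where
       other : ∃ λ q → lookup T q ≡ trad i (opp t)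
       other = index (Equivalence.from (dual (trad i (opp t))) (subst (_∈ (T ᵖ)) (switch-trad i t) (∈-map⁺ switch (at-index e))))

   arcs-in-T : ∀ {τ} {h : ∀ {q i t} → lookup T q ≡ trad i t → t ≡ τ} (Q : OArc → Set) → (∀ q → Q (O (one τ h) (q ↑ˡ n))) ⇔ (∀ α → α ∈ T → Q (und α))
   arcs-in-T {τ} {h} Q = mk⇔ (λ f α α∈ → let q , e = index α∈ in subst Q (trans (labelArc-arc n (idealOf n (one τ h)) q) (cong und e)) (f q))
     (λ g q → subst Q (sym (labelArc-arc n (idealOf n (one τ h)) q)) (g (lookup T q) (∈-lookup {xs = T} q)))

   arcs-in-Tcirc : ∀ {i pρ pλ eρ eλ} (Q : OArc → Set) → (∀ q → Q (O (two i plain pρ pλ eρ eλ) (q ↑ˡ n))) ⇔ (∀ α → α ∈ Tcirc n T → Q α)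
   arcs-in-Tcirc {i} {pρ} {pλ} {eρ} {eλ} Q = mk⇔ (λ f α α∈ → let y , y∈ , e = ∈-map⁻ (circArc n) α∈ ; q , e′ = index y∈ in subst Q (trans (circ q) (trans (cong (circArc n) e′) (sym e))) (f q))
       (λ g q → subst Q (sym (circ q)) (g (circArc n (lookup T q)) (∈-map⁺ (circArc n) (∈-lookup {xs = T} q))))
     where
     circ : ∀ q → O (two i plain pρ pλ eρ eλ) (q ↑ˡ n) ≡ circArc n (lookup T q)
     circ q = trans (labelArc-arc n (idealOf n (two i plain pρ pλ eρ eλ)) q) (trans (sym (idealArc-≡ (two {i} {pρ} {pλ} {eρ} {eλ}) q))
       (cong (λ b → if b then circArc n (lookup T q) else und (lookup T q)) (hasBoth-complete eρ eλ)))

   module _ {A : Set} (Q : OArc → Set) (h : A ⇔ (∀ q → Q (O K (q ↑ˡ n)))) where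
     open import Function.Construct.Composition using (_⇔-∘_)

     not-selfdual-case : ¬ SelfDual T → A ⇔ (∀ α → α ∈ T → Q (und α))
     not-selfdual-case nd = go plainly refl
       where
       go : ∀ {K′} → Plainly K′ → K ≡ K′ → A ⇔ (∀ α → α ∈ T → Q (und α))
       go (one τ h′) e = arcs-in-T {τ} {h′} Q ⇔-∘ subst (λ k → A ⇔ (∀ q → Q (O k (q ↑ˡ n)))) e h
       go (two {eρ = eρ} {eλ}) _ = ⊥-elim (nd (two-selfdual eρ eλ))

     selfdual-case : SelfDual T → A ⇔ (∀ α → α ∈ Tcirc n T → Q α)
     selfdual-case d = go plainly refl
       where
       go : ∀ {K′} → Plainly K′ → K ≡ K′ → A ⇔ (∀ α → α ∈ Tcirc n T → Q α)
       go (one τ h′) _ = ⊥-elim (one-not-selfdual h′ d)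
       go (two {eρ = eρ} {eλ}) e = arcs-in-Tcirc {eρ = eρ} {eλ} Q ⇔-∘ subst (λ k → A ⇔ (∀ q → Q (O k (q ↑ˡ n)))) e h

open import Data.Nat using (ℕ; _≤_; _+_)
open import Data.List using (List; length; lookup)
open import Data.List.Membership.Propositional using (_∈_)
open import Data.Fin using (Fin)
open import Data.Product using (_×_; _,_; proj₁; proj₂)
open import Relation.Nullary using (¬_)
open import Relation.Binary.PropositionalEquality using (_≡_; refl)
open import Function.Bundles using (_⇔_)

theorem5p15 : (n : ℕ) → 2 ≤ n →
    (T : List TArc) → IsTaggedTriangulation n T →
    (γ : TArc) → ValidT n γ →
    (ps : List (Fin (length T))) (T′ : Fin (length T) → TArc) → FlipPath n (lookup T) ps T′ →
    (p : Fin (length T)) → T′ p ≡ γ →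
    (L : LPoly (length T + n)) →
    IsLaurentExpansion L (Seed.X (mutateAlong (initialSeed n T) ps) p) →
    ((IsPlain γ → ¬ SelfDual T →
    (NewtonEmpty L ⇔ (∀ α → α ∈ T → crossO n (und γ) (und α) ≤ 1)))
    × (IsPlain γ → SelfDual T →
    (NewtonEmpty L ⇔ (∀ α → α ∈ Tcirc n T → crossO n (und γ) α ≤ 1)))
    × (IsNotched γ → NewtonEmpty L))
theorem5p15 n 2≤n T IT γ valid ps T′ path p refl L h =
    (λ _ nd → not-selfdual-case (λ y → crossO n (und γ) y ≤ 1) crit nd)
  , (λ _ d → selfdual-case (λ y → crossO n (und γ) y ≤ 1) crit d)
  , notched-empty γ L L≃
  where
  FT = TaggedTriangulations.fromList T IT
  kind = InitialSeed.InitialKind.plain-kind n 2≤n T FT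
  open Conclusion.Initially n 2≤n T FT (proj₁ kind) (proj₂ kind)
  L≃ = expansion path p L h
  crit = criterion γ valid L L≃
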